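{- Let $\mathrm{un}_4(n,e)$ denote the maximum number of edges of a $4$-graph $\mathcal{H}$ that is $(n,e)$-unavoidable. Then: \begin{enumerate} \item[(i)] For $1\le e\le n^2$ we have $\mathrm{un}_4(n,e)\approx 1$. \item[(ii)] For $n^2\le e\le n^3$ we have $\mathrm{un}_4(n,e)\approx \min\{(e/n^2)^{3/4},(e/n)^{1/3}\}$. \item[(iii)] For $n^3<e\ll \binom{n}{4}$ we have $\mathrm{un}_4(n,e)\approx \min\Big\{e^{4/3}/n^{10/3},\ \frac{e^{1/4}\log n}{\log\left(\binom{n}{4}/e\right)}\Big\}$. \end{enumerate}
   Context: An $r$-graph is an $r$-uniform hypergraph. An $r$-graph $\mathcal{H}$ is called $(n,e)$-unavoidable if every $r$-graph on $n$ vertices with $e$ edges contains a copy of $\mathcal{H}$ as a subhypergraph; $\mathrm{un}_r(n,e)$ is the maximum number of edges of an $(n,e)$-unavoidable $r$-graph. Asymptotic notation is as $n\to\infty$: $f\approx g$ means there are absolute constants $c,C>0$ with $cg\le f\le Cg$ (for all sufficiently large $n$ and all $e$ in the stated range); $f\ll g$ means $f\le c g$ for a sufficiently small absolute constant $c>0$ (so part (iii) asserts the estimate for all $e$ with $n^3<e\le c\binom{n}{4}$ for a suitable absolute constant $c>0$). -}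

module Defs where

open import Data.Nat using (ℕ; zero; suc; _/_; _≤_)
open import Data.Nat.Logarithm using (⌊log₂_⌋)
open import Data.Nat.Combinatorics using (_C_)
open import Data.Fin using (Fin; _≟_)
open import Data.Fin.Properties using (any?)
open import Data.Fin.Subset using (Subset; ∣_∣; _∈_)
open import Data.Fin.Subset.Properties using (_∈?_)
open import Data.Vec using (tabulate)
open import Data.List using (List; length)
open import Data.List.Relation.Unary.All using (All)
open import Data.List.Relation.Unary.Unique.Propositional using (Unique)
import Data.List.Membership.Propositional as LM
open import Data.Product using (Σ; _×_; ∃)
open import Relation.Nullary using (does)
open import Relation.Nullary.Decidable using (_×-dec_)
open import Relation.Binary.PropositionalEquality using (_≡_)
open import Function.Definitions using (Injective)

record Graph4 (V : ℕ) : Set where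
  field
    edges    : List (Subset V)
    distinct : Unique edges
    uniform  : All (λ s → ∣ s ∣ ≡ 4) edges
open Graph4 public

∥_∥ : ∀ {V} → Graph4 V → ℕ
∥ G ∥ = length (edges G)

record Hyper4 : Set where
  field
    verts : ℕ
    graph : Graph4 verts
open Hyper4 public

image : ∀ {k n} → (Fin k → Fin n) → Subset k → Subset n
image {k} f s = tabulate (λ j → does (any? (λ i → (i ∈? s) ×-dec (f i ≟ j))))

Contains : ∀ {n} → Graph4 n → Hyper4 → Set
Contains {n} G H =
  Σ (Fin (verts H) → Fin n) (λ f →
    Injective _≡_ _≡_ f × All (λ s → image f s LM.∈ edges G) (edges (graph H)))

Unavoidable : ℕ → ℕ → Hyper4 → Set
Unavoidable n e H = (G : Graph4 n) → ∥ G ∥ ≡ e → Contains G H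

IsUn4 : ℕ → ℕ → ℕ → Set
IsUn4 n e m =
  (∃ λ H → Unavoidable n e H × ∥ graph H ∥ ≡ m)
  × ((H : Hyper4) → Unavoidable n e H → ∥ graph H ∥ ≤ m)

-- integer substitute for log( binom(n,4) / e ):  ⌊log₂ ⌊binom(n,4)/e⌋⌋  (0 if e = 0)
logRatio : ℕ → ℕ → ℕ
logRatio n zero    = 0
logRatio n (suc k) = ⌊log₂ ((n C 4) / suc k) ⌋

-- Write d = e / n², z = e / n³, s = (e / n) ^ (1 / 3).
--
-- Upper bounds.  An unavoidable H embeds into every graph with e edges.  Complete 4-partite hosts give a hub set of size z and
-- small sets meeting every edge in two or more vertices; linear hosts such as (x , y , x + y , x + 2 y) bound the codegrees;
-- a transversal argument shows that a small vertex set W spans at most 2 |W| edges of H.  Counting the edges of H with these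
-- gives O(s) and O(d ^ (3 / 4)) up to n³ and O(z ^ 3 (n z) ^ (1 / 2) + s z) above; for large z the transversal bound for all
-- of H, which is O(e ^ (1 / 4) log n / log (n⁴ / e)), implies the other one.
--
-- Lower bounds.  A graph without a generalised star (hub, x children, y grandchildren each, z leaves each) is covered by few
-- quadruples, so a dense graph contains many disjoint ones.  When e is n ^ (4 - o(1)), copies of K(l , l , l , q) take over.
module Submission where

open import Defs
open import Data.Nat using (ℕ; _+_; _*_; _^_; _≤_; _<_)
open import Data.Nat.Logarithm using (⌊log₂_⌋)
open import Data.Nat.Combinatorics using (_C_)
open import Data.Product using (Σ; _×_)
open import Data.Sum using (_⊎_)
open import Data.Nat using (zero; suc; _∸_; z≤n; s≤s; _/_; _%_)
open import Data.Nat.Properties hiding (_≟_)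
open import Data.Nat.Tactic.RingSolver using (solve-∀)
open import Data.Fin using (Fin; zero; suc; toℕ)
import Data.Nat as N
import Data.Nat.Logarithm as Log
import Data.Nat.Combinatorics as Comb
import Data.Nat.DivMod as DM
import Data.Fin as F
import Data.Fin.Properties as FP
import Data.Fin.Subset as S
import Data.Fin.Subset.Properties as SP
open import Data.Bool using (Bool; true; false; T)
import Data.Bool.Properties as BP
open import Data.Vec using (Vec; []; _∷_)
import Data.Vec as Vec
import Data.Vec.Properties as VP
open import Data.List using (List; []; _∷_; _++_; map; concatMap; filter; length; allFin; take)
import Data.List as L
import Data.List.Properties as LP
open import Data.List.Membership.Propositional using (_∈_; _∉_)
open import Data.List.Membership.Propositional.Properties
open import Data.List.Relation.Unary.All using (All; []; _∷_)
import Data.List.Relation.Unary.All as All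
import Data.List.Relation.Unary.All.Properties as AllP
open import Data.List.Relation.Unary.Any using (Any; here; there)
import Data.List.Relation.Unary.Any as Any
open import Data.List.Relation.Unary.AllPairs using (AllPairs; []; _∷_)
import Data.List.Relation.Unary.AllPairs as AP
open import Data.List.Relation.Unary.Unique.Propositional using (Unique)
import Data.List.Relation.Unary.Unique.Propositional.Properties as Uniq
open import Data.Product using (_,_; proj₁; proj₂; ∃; ∃₂)
open import Data.Sum using (inj₁; inj₂; [_,_]′)
open import Data.Unit using (⊤; tt)
open import Data.Empty using (⊥; ⊥-elim)
open import Function using (_∘_; id; case_of_)
open import Function.Definitions using (Injective)
open import Relation.Nullary using (¬_; Dec; yes; no; does)
open import Relation.Nullary.Decidable using (_×-dec_; _⊎-dec_; ¬?; map′; decidable-stable)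
open import Relation.Nullary.Negation using (contradiction)
open import Relation.Unary using (Decidable)
open import Relation.Binary.PropositionalEquality
open import Relation.Binary.Definitions using (DecidableEquality)
import Data.List.Relation.Unary.AllPairs.Properties as APP
open import Data.List.Relation.Binary.Sublist.Propositional using (_⊆_; []; _∷_; _∷ʳ_; ⊆-refl; ⊆-trans)
import Data.List.Relation.Binary.Sublist.Propositional as Sub
import Data.List.Relation.Binary.Sublist.Propositional.Properties as SubP
import Data.Nat.Combinatorics.Specification as CombSpec

-- Stars cannot simply be deleted one after another: τ stars with w children, w grandchildren per
-- child and τ leaves per grandchild span about τ²w² vertices, which may meet up to τ²w²n³ edges,
-- whereas e may be only of order τn³. So a new hub avoids only old hubs, a child old hubs and
-- children, and so on; only leaves avoid everything. The old stars then cost only the edges with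
-- one vertex among the hubs, two in the top two levels, three in the top three, or all four in old
-- stars. Twice as many and larger stars are built, and the remaining collisions between levels are
-- pruned at the end. Forests of K(l,l,l,q) are treated in the same way. For the upper bound, the
-- exponent 3/4 comes from a host with about δ² groups of about δ vertices, δ = d^(1/4), in which
-- every edge has two vertices in a common group: all groups together have only order δ³ vertices.
-- In the transversal argument, blocks of order n^(1/2) give the factor 2 in 2|W|, and blocks of
-- order n⁴/e give the logarithms.

pattern in₁ x = inj₂ (inj₁ x)
pattern in₂ x = inj₂ (inj₂ (inj₁ x))
pattern in₃ x = inj₂ (inj₂ (inj₂ x))

private variable
 Elem Elem′ : Set

-- Counting by injections.

unique-⊆⇒length≤ : {xs ys : List Elem} → Unique xs → (∀ {x} → x ∈ xs → x ∈ ys) → length xs ≤ length ys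
unique-⊆⇒length≤ {xs = []} _ _ = z≤n
unique-⊆⇒length≤ {xs = x ∷ xs} {ys} (x≢ ∷ u) sub with ∈-∃++ (sub (here refl))
... | ls , rs , refl = ≤-trans (s≤s (unique-⊆⇒length≤ {ys = ls ++ rs} u sub′)) (≤-reflexive (sym eq))
 where
 sub′ : ∀ {y} → y ∈ xs → y ∈ ls ++ rs
 sub′ {y} y∈ with ∈-++⁻ ls (sub (there y∈))
 ... | inj₁ p = ∈-++⁺ˡ p
 ... | inj₂ (here refl) = ⊥-elim (All.lookup x≢ y∈ refl)
 ... | inj₂ (there p) = ∈-++⁺ʳ ls p
 eq : length (ls ++ x ∷ rs) ≡ suc (length (ls ++ rs))
 eq = trans (LP.length-++ ls) (trans (+-suc (length ls) (length rs)) (cong suc (sym (LP.length-++ ls))))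

-- A relation instead of a function, because the partner of an element is often known only through a
-- proof of existence; `pick` collects these partners.
injRel⇒length≤ : {xs : List Elem} {ys : List Elem′} (R : Elem → Elem′ → Set) → Unique xs
 → (∀ {x x′ y} → x ∈ xs → x′ ∈ xs → R x y → R x′ y → x ≡ x′)
 → (∀ {x} → x ∈ xs → ∃ λ y → y ∈ ys × R x y) → length xs ≤ length ys
injRel⇒length≤ {Elem = Elem} {Elem′ = Elem′} {xs = xs} {ys} R u inj tot = ≤-trans (≤-reflexive (sym (len xs λ p → p)))
 (unique-⊆⇒length≤ (uni xs (λ p → p) u) (⊆ys xs (λ p → p)))
 where
 pick : (zs : List Elem) → (∀ {x} → x ∈ zs → x ∈ xs) → List Elem′
 pick [] _ = []
 pick (z ∷ zs) s = proj₁ (tot (s (here refl))) ∷ pick zs (s ∘ there)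
 len : (zs : List Elem) (s : ∀ {x} → x ∈ zs → x ∈ xs) → length (pick zs s) ≡ length zs
 len [] s = refl
 len (z ∷ zs) s = cong suc (len zs (s ∘ there))
 src : (zs : List Elem) (s : ∀ {x} → x ∈ zs → x ∈ xs) → ∀ {y} → y ∈ pick zs s → ∃ λ x → x ∈ zs × R x y
 src (z ∷ zs) s (here refl) = z , here refl , proj₂ (proj₂ (tot (s (here refl))))
 src (z ∷ zs) s (there p) with src zs (s ∘ there) p
 ... | x , x∈ , r = x , there x∈ , r
 ⊆ys : (zs : List Elem) (s : ∀ {x} → x ∈ zs → x ∈ xs) → ∀ {y} → y ∈ pick zs s → y ∈ ys
 ⊆ys (z ∷ zs) s (here refl) = proj₁ (proj₂ (tot (s (here refl))))
 ⊆ys (z ∷ zs) s (there p) = ⊆ys zs (s ∘ there) p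
 uni : (zs : List Elem) (s : ∀ {x} → x ∈ zs → x ∈ xs) → Unique zs → Unique (pick zs s)
 uni [] s _ = []
 uni (z ∷ zs) s (z≢ ∷ uz) = All.tabulate (λ {y} y∈ eq → new y∈ eq) ∷ uni zs (s ∘ there) uz
  where
  new : ∀ {y} → y ∈ pick zs (s ∘ there) → proj₁ (tot (s (here refl))) ≡ y → ⊥
  new y∈ refl with src zs (s ∘ there) y∈
  ... | x , x∈ , r = All.lookup z≢ x∈ (inj (s (here refl)) (s (there x∈)) (proj₂ (proj₂ (tot (s (here refl))))) r)

inj⇒length≤ : {xs : List Elem} {ys : List Elem′} (f : Elem → Elem′) → Unique xs
 → (∀ {x x′} → x ∈ xs → x′ ∈ xs → f x ≡ f x′ → x ≡ x′)
 → (∀ {x} → x ∈ xs → f x ∈ ys) → length xs ≤ length ys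
inj⇒length≤ f u inj tot =
 injRel⇒length≤ (λ x y → f x ≡ y) u (λ p q r s → inj p q (trans r (sym s))) (λ {x} p → f x , tot p , refl)

length-concatMap≤ : (f : Elem → List Elem′) (k : ℕ) (xs : List Elem) → (∀ x → length (f x) ≤ k) →
 length (concatMap f xs) ≤ length xs * k
length-concatMap≤ f k [] h = z≤n
length-concatMap≤ f k (x ∷ xs) h =
 ≤-trans (≤-reflexive (LP.length-++ (f x))) (+-mono-≤ (h x) (length-concatMap≤ f k xs h))

∈-concatMap : (f : Elem → List Elem′) {xs : List Elem} {x : Elem} {y : Elem′} → x ∈ xs → y ∈ f x → y ∈ concatMap f xs
∈-concatMap f x∈ y∈ = ∈-concat⁺′ y∈ (∈-map⁺ f x∈)

∈-concatMap⁻′ : (f : Elem → List Elem′) (xs : List Elem) {y : Elem′} → y ∈ concatMap f xs → ∃ λ x → x ∈ xs × y ∈ f x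
∈-concatMap⁻′ f (x ∷ xs) y∈ with ∈-++⁻ (f x) y∈
... | inj₁ p = x , here refl , p
... | inj₂ p with ∈-concatMap⁻′ f xs p
... | x′ , m , q = x′ , there m , q

takeUpTo : (k : ℕ) {P : Elem → Set} {xs : List Elem} → Unique xs → All P xs → k ≤ length xs →
 ∃ λ ys → length ys ≡ k × Unique ys × All P ys × (∀ {x} → x ∈ ys → x ∈ xs)
takeUpTo k {xs = xs} u ps k≤ =
 take k xs , trans (LP.length-take k xs) (m≤n⇒m⊓n≡m k≤) , Uniq.take⁺ k u , AllP.take⁺ k ps , ⊆take k xs
 where
 ⊆take : ∀ {Elem : Set} (k : ℕ) (xs : List Elem) {x : Elem} → x ∈ take k xs → x ∈ xs
 ⊆take (suc k) (x ∷ xs) (here p) = here p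
 ⊆take (suc k) (x ∷ xs) (there p) = there (⊆take k xs p)

-- Quadruples of vertices standing for 4-element vertex sets

record Rep {n : ℕ} (s : S.Subset n) (a b c d : Fin n) : Set where
 constructor rep
 field
  ab : a ≢ b
  ac : a ≢ c
  ad : a ≢ d
  bc : b ≢ c
  bd : b ≢ d
  cd : c ≢ d
  ∈a : a S.∈ s
  ∈b : b S.∈ s
  ∈c : c S.∈ s
  ∈d : d S.∈ s
  only : ∀ {i} → i S.∈ s → i ≡ a ⊎ i ≡ b ⊎ i ≡ c ⊎ i ≡ d

module _ {n : ℕ} {s : S.Subset n} {a b c d : Fin n} where

 rep-swap₁ : Rep s a b c d → Rep s b a c d
 rep-swap₁ r = rep (≢-sym ab) bc bd ac ad cd ∈b ∈a ∈c ∈d λ p → case only p of λ where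
   (inj₁ e) → in₁ e
   (in₁ e) → inj₁ e
   (inj₂ (inj₂ e)) → inj₂ (inj₂ e)
  where open Rep r

 rep-swap₂ : Rep s a b c d → Rep s a c b d
 rep-swap₂ r = rep ac ab ad (≢-sym bc) cd bd ∈a ∈c ∈b ∈d λ p → case only p of λ where
   (inj₁ e) → inj₁ e
   (in₁ e) → in₂ e
   (in₂ e) → in₁ e
   (in₃ e) → in₃ e
  where open Rep r

 rep-swap₃ : Rep s a b c d → Rep s a b d c
 rep-swap₃ r = rep ab ad ac bd bc (≢-sym cd) ∈a ∈b ∈d ∈c λ p → case only p of λ where
   (inj₁ e) → inj₁ e
   (in₁ e) → in₁ e
   (in₂ e) → in₃ e
   (in₃ e) → in₂ e
  where open Rep r

subset-ext : ∀ {n} (s t : S.Subset n) → (∀ i → i S.∈ s → i S.∈ t) → (∀ i → i S.∈ t → i S.∈ s) → s ≡ t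
subset-ext s t p q = SP.⊆-antisym (λ {i} → p i) (λ {i} → q i)

rep-mem : ∀ {n} {s : S.Subset n} {a b c d} → Rep s a b c d → ∀ {i} → i ≡ a ⊎ i ≡ b ⊎ i ≡ c ⊎ i ≡ d → i S.∈ s
rep-mem r (inj₁ refl) = Rep.∈a r
rep-mem r (in₁ refl) = Rep.∈b r
rep-mem r (in₂ refl) = Rep.∈c r
rep-mem r (in₃ refl) = Rep.∈d r

rep-unique : ∀ {n} {s t : S.Subset n} {a b c d} → Rep s a b c d → Rep t a b c d → s ≡ t
rep-unique {s = s} {t} r r′ =
 subset-ext s t (λ i p → rep-mem r′ (Rep.only r p)) (λ i p → rep-mem r (Rep.only r′ p))

elems : ∀ {n} → S.Subset n → List (Fin n)
elems [] = []
elems (true ∷ s) = zero ∷ map suc (elems s)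
elems (false ∷ s) = map suc (elems s)

length-elems : ∀ {n} (s : S.Subset n) → length (elems s) ≡ S.∣ s ∣
length-elems [] = refl
length-elems (true ∷ s) = cong suc (trans (LP.length-map suc (elems s)) (length-elems s))
length-elems (false ∷ s) = trans (LP.length-map suc (elems s)) (length-elems s)

zero∉map-suc : ∀ {n} (xs : List (Fin n)) → All (λ x → _≢_ {A = Fin (suc n)} zero x) (map suc xs)
zero∉map-suc [] = []
zero∉map-suc (x ∷ xs) = (λ ()) ∷ zero∉map-suc xs

elems-unique : ∀ {n} (s : S.Subset n) → Unique (elems s)
elems-unique [] = []
elems-unique (true ∷ s) = zero∉map-suc (elems s) ∷ Uniq.map⁺ FP.suc-injective (elems-unique s)
elems-unique (false ∷ s) = Uniq.map⁺ FP.suc-injective (elems-unique s)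

∈-elems⁺ : ∀ {n} (s : S.Subset n) {i} → i S.∈ s → i ∈ elems s
∈-elems⁺ (true ∷ s) {zero} p = here refl
∈-elems⁺ (true ∷ s) {suc i} (Vec.there p) = there (∈-map⁺ suc (∈-elems⁺ s p))
∈-elems⁺ (false ∷ s) {suc i} (Vec.there p) = ∈-map⁺ suc (∈-elems⁺ s p)

∈-elems⁻ : ∀ {n} (s : S.Subset n) {i} → i ∈ elems s → i S.∈ s
∈-elems⁻ (true ∷ s) (here refl) = Vec.here
∈-elems⁻ (true ∷ s) (there p) with ∈-map⁻ suc p
... | j , j∈ , refl = Vec.there (∈-elems⁻ s j∈)
∈-elems⁻ (false ∷ s) p with ∈-map⁻ suc p
... | j , j∈ , refl = Vec.there (∈-elems⁻ s j∈)

∣∣≡4⇒rep : ∀ {n} (s : S.Subset n) → S.∣ s ∣ ≡ 4 →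
 ∃₂ λ a b → ∃₂ λ c d → Rep s a b c d
∣∣≡4⇒rep s eq with elems s | length-elems s | elems-unique s | (λ {i} → ∈-elems⁺ s {i}) | (λ {i} → ∈-elems⁻ s {i})
... | [] | l | u | f | g = contradiction (trans l eq) λ ()
... | _ ∷ [] | l | u | f | g = contradiction (trans l eq) λ ()
... | _ ∷ _ ∷ [] | l | u | f | g = contradiction (trans l eq) λ ()
... | _ ∷ _ ∷ _ ∷ [] | l | u | f | g = contradiction (trans l eq) λ ()
... | _ ∷ _ ∷ _ ∷ _ ∷ _ ∷ _ | l | u | f | g = contradiction (trans l eq) λ ()
... | a ∷ b ∷ c ∷ d ∷ [] | l | (ab ∷ ac ∷ ad ∷ []) ∷ (bc ∷ bd ∷ []) ∷ (cd ∷ []) ∷ [] ∷ [] | f | g =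
 a , b , c , d , rep ab ac ad bc bd cd (g (here refl)) (g (there (here refl)))
  (g (there (there (here refl)))) (g (there (there (there (here refl))))) λ p → case f p of λ where
   (here e) → inj₁ e
   (there (here e)) → in₁ e
   (there (there (here e))) → in₂ e
   (there (there (there (here e)))) → in₃ e

set4 : ∀ {n} (a b c d : Fin n) → S.Subset n
set4 a b c d = S.⁅ a ⁆ S.∪ (S.⁅ b ⁆ S.∪ (S.⁅ c ⁆ S.∪ S.⁅ d ⁆))

set4-rep : ∀ {n} {a b c d : Fin n} → a ≢ b → a ≢ c → a ≢ d → b ≢ c → b ≢ d → c ≢ d → Rep (set4 a b c d) a b c d
set4-rep {a = a} {b} {c} {d} ab ac ad bc bd cd = rep ab ac ad bc bd cd
 (∪ˡ (SP.x∈⁅x⁆ a)) (∪ʳ (∪ˡ (SP.x∈⁅x⁆ b))) (∪ʳ (∪ʳ (∪ˡ (SP.x∈⁅x⁆ c)))) (∪ʳ (∪ʳ (∪ʳ (SP.x∈⁅x⁆ d)))) split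
 where
 ∪ˡ : ∀ {n} {p q : S.Subset n} {x} → x S.∈ p → x S.∈ p S.∪ q
 ∪ˡ p = SP.x∈p∪q⁺ (inj₁ p)
 ∪ʳ : ∀ {n} {p q : S.Subset n} {x} → x S.∈ q → x S.∈ p S.∪ q
 ∪ʳ p = SP.x∈p∪q⁺ (inj₂ p)
 split : ∀ {i} → i S.∈ set4 a b c d → i ≡ a ⊎ i ≡ b ⊎ i ≡ c ⊎ i ≡ d
 split p with SP.x∈p∪q⁻ S.⁅ a ⁆ _ p
 ... | inj₁ q = inj₁ (SP.x∈⁅y⁆⇒x≡y a q)
 ... | inj₂ q with SP.x∈p∪q⁻ S.⁅ b ⁆ _ q
 ... | inj₁ r = in₁ (SP.x∈⁅y⁆⇒x≡y b r)
 ... | inj₂ r with SP.x∈p∪q⁻ S.⁅ c ⁆ _ r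
 ... | inj₁ t = in₂ (SP.x∈⁅y⁆⇒x≡y c t)
 ... | inj₂ t = in₃ (SP.x∈⁅y⁆⇒x≡y d t)

rep⇒∣∣≡4 : ∀ {n} {s : S.Subset n} {a b c d} → Rep s a b c d → S.∣ s ∣ ≡ 4
rep⇒∣∣≡4 {s = s} {a} {b} {c} {d} r = trans (sym (length-elems s)) (≤-antisym
 (unique-⊆⇒length≤ {ys = a ∷ b ∷ c ∷ d ∷ []} (elems-unique s) λ p → case only (∈-elems⁻ s p) of λ where
  (inj₁ e) → here e
  (in₁ e) → there (here e)
  (in₂ e) → there (there (here e))
  (in₃ e) → there (there (there (here e))))
 (unique-⊆⇒length≤ {xs = a ∷ b ∷ c ∷ d ∷ []}
  ((ab ∷ ac ∷ ad ∷ []) ∷ (bc ∷ bd ∷ []) ∷ (cd ∷ []) ∷ [] ∷ []) λ where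
   (here refl) → ∈-elems⁺ s ∈a
   (there (here refl)) → ∈-elems⁺ s ∈b
   (there (there (here refl))) → ∈-elems⁺ s ∈c
   (there (there (there (here refl)))) → ∈-elems⁺ s ∈d))
 where open Rep r

∈-image⁺ : ∀ {k n} (f : Fin k → Fin n) (s : S.Subset k) {i} → i S.∈ s → f i S.∈ image f s
∈-image⁺ f s {i} i∈ = VP.lookup⇒[]= (f i) (image f s) (trans (VP.lookup∘tabulate _ (f i)) val)
 where
 val : does (FP.any? (λ i′ → (i′ SP.∈? s) ×-dec (f i′ F.≟ f i))) ≡ true
 val with FP.any? (λ i′ → (i′ SP.∈? s) ×-dec (f i′ F.≟ f i))
 ... | yes _ = refl
 ... | no ¬p = ⊥-elim (¬p (i , i∈ , refl))

∈-image⁻ : ∀ {k n} (f : Fin k → Fin n) (s : S.Subset k) {j} → j S.∈ image f s → ∃ λ i → i S.∈ s × f i ≡ j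
∈-image⁻ f s {j} j∈ = go (trans (sym (VP.lookup∘tabulate _ j)) (VP.[]=⇒lookup j∈))
 where
 go : does (FP.any? (λ i → (i SP.∈? s) ×-dec (f i F.≟ j))) ≡ true → ∃ λ i → i S.∈ s × f i ≡ j
 go e with FP.any? (λ i → (i SP.∈? s) ×-dec (f i F.≟ j))
 go e | yes p = p
 go () | no _

rep-image : ∀ {k n} {f : Fin k → Fin n} → Injective _≡_ _≡_ f → ∀ {s a b c d} →
 Rep s a b c d → Rep (image f s) (f a) (f b) (f c) (f d)
rep-image {f = f} inj {s} {a} {b} {c} {d} r = rep (ab ∘ inj) (ac ∘ inj) (ad ∘ inj) (bc ∘ inj) (bd ∘ inj) (cd ∘ inj)
 (∈-image⁺ f s ∈a) (∈-image⁺ f s ∈b) (∈-image⁺ f s ∈c) (∈-image⁺ f s ∈d) λ p → back (∈-image⁻ f s p)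
 where
 open Rep r
 back : ∀ {j} → (∃ λ i → i S.∈ s × f i ≡ j) → j ≡ f a ⊎ j ≡ f b ⊎ j ≡ f c ⊎ j ≡ f d
 back (i , i∈ , refl) with only i∈
 ... | inj₁ refl = inj₁ refl
 ... | in₁ refl = in₁ refl
 ... | in₂ refl = in₂ refl
 ... | in₃ refl = in₃ refl

rep-image⁻ : ∀ {k n} {f : Fin k → Fin n} → Injective _≡_ _≡_ f → ∀ {s} {a b c d : Fin n} →
 Rep (image f s) a b c d →
 ∃₂ λ i j → ∃₂ λ l m → Rep s i j l m × f i ≡ a × f j ≡ b × f l ≡ c × f m ≡ d
rep-image⁻ {f = f} inj {s} r
 with ∈-image⁻ f s (Rep.∈a r) | ∈-image⁻ f s (Rep.∈b r) | ∈-image⁻ f s (Rep.∈c r) | ∈-image⁻ f s (Rep.∈d r)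
... | i , i∈ , refl | j , j∈ , refl | l , l∈ , refl | m , m∈ , refl =
 i , j , l , m , rep (ab ∘ cong f) (ac ∘ cong f) (ad ∘ cong f) (bc ∘ cong f) (bd ∘ cong f) (cd ∘ cong f) i∈ j∈ l∈ m∈
  (λ p → case only (∈-image⁺ f s p) of λ where
   (inj₁ e) → inj₁ (inj e)
   (in₁ e) → in₁ (inj e)
   (in₂ e) → in₂ (inj e)
   (in₃ e) → in₃ (inj e)) , refl , refl , refl , refl
 where open Rep r

-- Adjacent transpositions generate all reorderings of four arguments, so three conditions express
-- invariance under the whole symmetric group.
SymClosed : {V : Set} → (V → V → V → V → Set) → Set
SymClosed P = (∀ {a b c d} → P a b c d → P b a c d)
 × (∀ {a b c d} → P a b c d → P a c b d)
 × (∀ {a b c d} → P a b c d → P a b d c)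

Quad : Set → Set
Quad V = V × V × V × V

-- Elem list of quadruples that meets every permutation class of the edges bounds the number of edges.
count-edges : ∀ {n} (es : List (S.Subset n)) → Unique es → All (λ s → S.∣ s ∣ ≡ 4) es → (Q : List (Quad (Fin n)))
 → (∀ (P : Fin n → Fin n → Fin n → Fin n → Set) → SymClosed P → (∀ {a b c d} → (a , b , c , d) ∈ Q → P a b c d)
  → ∀ {s a b c d} → s ∈ es → Rep s a b c d → P a b c d)
 → length es ≤ length Q
count-edges {n} es u four Q cov = injRel⇒length≤ R u (λ _ _ → rep-unique) λ {s} s∈ →
 let (a , b , c , d , r) = ∣∣≡4⇒rep s (All.lookup four s∈) in
 cov Goal ((λ p t r → p t (rep-swap₁ r)) , (λ p t r → p t (rep-swap₂ r)) , (λ p t r → p t (rep-swap₃ r)))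
  (λ q∈ t r → _ , q∈ , r) s∈ r s r
 where
 R : S.Subset n → Quad (Fin n) → Set
 R s (a , b , c , d) = Rep s a b c d
 -- Being represented by a member of `Q` is invariant under reordering and holds on `Q`, so `cov`
 -- carries it to every edge.
 Goal : Fin n → Fin n → Fin n → Fin n → Set
 Goal a b c d = ∀ t → Rep t a b c d → ∃ λ q → q ∈ Q × R t q

-- Existence of the extremal number

-- Searchable types take the place of excluded middle: maps between finite sets and graphs are
-- vectors built from `Fin` and `Bool`, so containment and unavoidability are decided by exhaustive
-- search.
Omniscient : Set → Set₁
Omniscient A = ∀ {P : A → Set} → Decidable P → Dec (∃ P)

omni-Fin : ∀ {n} → Omniscient (Fin n)
omni-Fin P? = FP.any? P?

omni-Bool : Omniscient Bool
omni-Bool P? with P? true | P? false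
... | yes p | _ = yes (true , p)
... | no _ | yes p = yes (false , p)
... | no ¬p | no ¬q = no λ { (true , p) → ¬p p ; (false , q) → ¬q q }

omni-Vec : ∀ {A n} → Omniscient A → Omniscient (Vec A n)
omni-Vec {n = zero} om P? with P? []
... | yes p = yes ([] , p)
... | no ¬p = no λ { ([] , p) → ¬p p }
omni-Vec {n = suc n} om P? with om (λ a → omni-Vec {n = n} om (λ v → P? (a ∷ v)))
... | yes (a , v , p) = yes (a ∷ v , p)
... | no ¬p = no λ { (a ∷ v , p) → ¬p (a , v , p) }

omni-all : ∀ {A} → Omniscient A → {P : A → Set} → Decidable P → Dec (∀ a → P a)
omni-all om P? with om (λ a → ¬? (P? a))
... | yes (a , ¬p) = no λ h → ¬p (h a)
... | no ¬∃ = yes λ a → decidable-stable (P? a) (λ ¬p → ¬∃ (a , ¬p))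

image-cong : ∀ {k n} {f g : Fin k → Fin n} → (∀ i → f i ≡ g i) → ∀ s → image f s ≡ image g s
image-cong {f = f} {g} eq s = subset-ext _ _
 (λ i p → let (j , j∈ , e) = ∈-image⁻ f s p in subst (S._∈ image g s) (trans (sym (eq j)) e) (∈-image⁺ g s j∈))
 (λ i p → let (j , j∈ , e) = ∈-image⁻ g s p in subst (S._∈ image f s) (trans (eq j) e) (∈-image⁺ f s j∈))

image-injective : ∀ {k n} {f : Fin k → Fin n} → Injective _≡_ _≡_ f → ∀ {s t} → image f s ≡ image f t → s ≡ t
image-injective {f = f} inj {s} {t} eq = subset-ext _ _ (λ i → go eq i) (λ i → go (sym eq) i)
 where
 go : ∀ {s t} → image f s ≡ image f t → ∀ i → i S.∈ s → i S.∈ t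
 go {s} {t} eq i i∈ with ∈-image⁻ f t (subst (f i S.∈_) eq (∈-image⁺ f s i∈))
 ... | j , j∈ , e = subst (S._∈ t) (inj e) j∈

subset-≟ : ∀ {n} → DecidableEquality (S.Subset n)
subset-≟ = VP.≡-dec BP._≟_

-- The search runs over tables of values; a function agrees with its table only pointwise, and
-- `image-cong` shows that this is enough.
contains? : ∀ {n} (G : Graph4 n) (H : Hyper4) → Dec (Contains G H)
contains? {n} G H = map′ to from (omni-Vec omni-Fin test)
 where
 open import Data.List.Membership.DecPropositional (subset-≟ {n}) using (_∈?_)
 OK : (Fin (verts H) → Fin n) → Set
 OK f = Injective _≡_ _≡_ f × All (λ s → image f s ∈ edges G) (edges (graph H))
 test : Decidable (λ (v : Vec (Fin n) (verts H)) → OK (Vec.lookup v))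
 test v = map′ (λ h {i} {j} → h i j) (λ h i j → h {i} {j})
   (omni-all omni-Fin λ i → omni-all omni-Fin λ j → imp (Vec.lookup v i F.≟ Vec.lookup v j) (i F.≟ j))
  ×-dec All.all? (λ s → image (Vec.lookup v) s ∈? edges G) (edges (graph H))
  where
  imp : ∀ {X Y : Set} → Dec X → Dec Y → Dec (X → Y)
  imp (no ¬x) _ = yes λ x → ⊥-elim (¬x x)
  imp (yes x) (yes y) = yes λ _ → y
  imp (yes x) (no ¬y) = no λ f → ¬y (f x)
 to : ∃ (λ v → OK (Vec.lookup v)) → Contains G H
 to (v , ok) = Vec.lookup v , ok
 from : Contains G H → ∃ λ v → OK (Vec.lookup v)
 from (f , inj , all) = Vec.tabulate f , (λ {i} {j} e → inj (trans (sym (lk i)) (trans e (lk j))))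
  , All.map (λ {s} p → subst (_∈ edges G) (sym (image-cong lk s)) p) all
  where
  lk : ∀ i → Vec.lookup (Vec.tabulate f) i ≡ f i
  lk = VP.lookup∘tabulate f

ValidEdges : ∀ {n e} → Vec (S.Subset n) e → Set
ValidEdges v = Unique (Vec.toList v) × All (λ s → S.∣ s ∣ ≡ 4) (Vec.toList v)

validEdges? : ∀ {n e} (v : Vec (S.Subset n) e) → Dec (ValidEdges v)
validEdges? v = AP.allPairs? (λ x y → ¬? (subset-≟ x y)) (Vec.toList v) ×-dec All.all? (λ s → S.∣ s ∣ N.≟ 4) (Vec.toList v)

toGraph : ∀ {n e} (v : Vec (S.Subset n) e) → ValidEdges v → Graph4 n
toGraph v (u , f) = record { edges = Vec.toList v ; distinct = u ; uniform = f }

fromGraph : ∀ {n e} (G : Graph4 n) → ∥ G ∥ ≡ e → ∃ λ v → Σ (ValidEdges {n} {e} v) λ ok → edges (toGraph v ok) ≡ edges G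
fromGraph G refl = Vec.fromList (edges G) , (subst Unique (sym eq) (distinct G) , subst (All _) (sym eq) (uniform G)) , eq
 where
 eq : Vec.toList (Vec.fromList (edges G)) ≡ edges G
 eq = VP.toList∘fromList (edges G)

contains-cong : ∀ {n} {G G′ : Graph4 n} {H} → edges G ≡ edges G′ → Contains G H → Contains G′ H
contains-cong eq (f , inj , all) = f , inj , All.map (λ {s} p → subst (_ ∈_) eq p) all

unavoidable? : ∀ n e (H : Hyper4) → Dec (Unavoidable n e H)
unavoidable? n e H = map′ to from (omni-all (omni-Vec (omni-Vec omni-Bool)) test)
 where
 OK : Vec (S.Subset n) e → Set
 OK v = (ok : ValidEdges v) → Contains (toGraph v ok) H
 test : Decidable OK
 test v with validEdges? v
 ... | no ¬ok = yes λ ok → ⊥-elim (¬ok ok)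
 ... | yes ok = map′ (λ c ok′ → contains-cong {G = toGraph v ok} {toGraph v ok′} {H} refl c) (λ f → f ok) (contains? (toGraph v ok) H)
 to : (∀ v → OK v) → Unavoidable n e H
 to h G eq = let (v , ok , q) = fromGraph G eq in contains-cong {G = toGraph v ok} {G} {H} q (h v ok)
 from : Unavoidable n e H → ∀ v → OK v
 from h v ok = h (toGraph v ok) (VP.length-toList v)

contains-∥∥≤ : ∀ {n} {G : Graph4 n} {H} → Contains G H → ∥ graph H ∥ ≤ ∥ G ∥
contains-∥∥≤ {H = H} (f , inj , all) =
 inj⇒length≤ (image f) (distinct (graph H)) (λ _ _ → image-injective inj) (λ p → All.lookup all p)

bounded-max : {P : ℕ → Set} → Decidable P → P 0 → ∀ M → (∀ m → P m → m ≤ M) →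
 ∃ λ m → P m × (∀ m′ → P m′ → m′ ≤ m)
bounded-max P? p0 zero b = 0 , p0 , b
bounded-max P? p0 (suc M) b with P? (suc M)
... | yes p = suc M , p , b
... | no ¬p = bounded-max P? p0 M λ m p → ≤-pred (≤∧≢⇒< (b m p) λ { refl → ¬p p })

-- A single graph with `e` edges bounds both sizes: an unavoidable graph embeds into it, so it has
-- at most `e` edges and at most `n` vertices, and the maximum is found among finitely many
-- candidates.
un4-exists : ∀ {n e} (G : Graph4 n) → ∥ G ∥ ≡ e → ∃ λ m → IsUn4 n e m
un4-exists {n} {e} G ∥G∥ = let (m , p , max) = bounded-max P? P0 e bound in
 m , p , λ H un → max _ (H , un , refl)
 where
 P : ℕ → Set
 P m = ∃ λ H → Unavoidable n e H × ∥ graph H ∥ ≡ m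
 bound : ∀ m → P m → m ≤ e
 bound m (H , un , refl) = subst (_ ≤_) ∥G∥ (contains-∥∥≤ {G = G} {H} (un G ∥G∥))
 P0 : P 0
 P0 = record { verts = 0 ; graph = record { edges = [] ; distinct = [] ; uniform = [] } } ,
  (λ _ _ → (λ ()) , (λ {i} → ⊥-elim (case i of λ ())) , []) , refl
 P? : Decidable P
 P? m = map′ to from (omni-Fin {suc n} λ k → omni-Vec (omni-Vec omni-Bool) (test (toℕ k)))
  where
  H′ : ∀ k (v : Vec (S.Subset k) m) → ValidEdges v → Hyper4
  H′ k v ok = record { verts = k ; graph = toGraph v ok }
  OK : ∀ k → Vec (S.Subset k) m → Set
  OK k v = Σ (ValidEdges v) λ ok → Unavoidable n e (H′ k v ok)
  test : ∀ k → Decidable (OK k)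
  test k v with validEdges? v
  ... | no ¬ok = no (¬ok ∘ proj₁)
  ... | yes ok = map′ (ok ,_) (λ { (_ , un) G eq → un G eq }) (unavoidable? n e (H′ k v ok))
  to : (∃ λ (k : Fin (suc n)) → ∃ λ v → OK (toℕ k) v) → P m
  to (k , v , ok , un) = H′ (toℕ k) v ok , un , VP.length-toList v
  from : P m → ∃ λ (k : Fin (suc n)) → ∃ λ v → OK (toℕ k) v
  from (H , un , ∥H∥) = go (FP.toℕ-fromℕ< k<)
   where
   k< : verts H < suc n
   k< = s≤s (FP.injective⇒≤ {f = proj₁ (un G ∥G∥)} (proj₁ (proj₂ (un G ∥G∥))))
   go : toℕ (F.fromℕ< k<) ≡ verts H → ∃ λ (k : Fin (suc n)) → ∃ λ v → OK (toℕ k) v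
   go eq = F.fromℕ< k< , subst (λ k → ∃ λ v → OK k v) (sym eq)
    (let (v , ok , q) = fromGraph (graph H) ∥H∥ in v , ok , λ G eq →
     let (f , inj , all) = un G eq in f , inj , subst (All _) (sym q) all)

unavoidable-mono : ∀ {n e e′ H} → e ≤ e′ → Unavoidable n e H → Unavoidable n e′ H
unavoidable-mono {n} {e} {H = H} e≤ un G refl = let (f , inj , all) = un G′ len in
 f , inj , All.map (λ p → sub p) all
 where
 t = takeUpTo e (distinct G) (uniform G) e≤
 len = proj₁ (proj₂ t)
 G′ : Graph4 n
 G′ = record { edges = proj₁ t ; distinct = proj₁ (proj₂ (proj₂ t)) ; uniform = proj₁ (proj₂ (proj₂ (proj₂ t))) }
 sub : ∀ {x} → x ∈ edges G′ → x ∈ edges G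
 sub = proj₂ (proj₂ (proj₂ (proj₂ t)))

-- Reorderings, disjoint lists and greedy choice.

module Perm {V : Set} {R : V → V → V → V → Set} (sym : SymClosed R) where

 private variable
  a b c d : V

 -- The digits list the old positions in their new order.
 p1243 : R a b c d → R a b d c
 p1243 r = proj₂ (proj₂ sym) r
 p1324 : R a b c d → R a c b d
 p1324 r = proj₁ (proj₂ sym) r
 p1342 : R a b c d → R a c d b
 p1342 r = proj₂ (proj₂ sym) (proj₁ (proj₂ sym) r)
 p1423 : R a b c d → R a d b c
 p1423 r = proj₁ (proj₂ sym) (proj₂ (proj₂ sym) r)
 p1432 : R a b c d → R a d c b
 p1432 r = proj₁ (proj₂ sym) (proj₂ (proj₂ sym) (proj₁ (proj₂ sym) r))
 p2134 : R a b c d → R b a c d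
 p2134 r = proj₁ sym r
 p2314 : R a b c d → R b c a d
 p2314 r = proj₁ (proj₂ sym) (proj₁ sym r)
 p2341 : R a b c d → R b c d a
 p2341 r = proj₂ (proj₂ sym) (proj₁ (proj₂ sym) (proj₁ sym r))
 p2413 : R a b c d → R b d a c
 p2413 r = proj₁ (proj₂ sym) (proj₂ (proj₂ sym) (proj₁ sym r))
 p3124 : R a b c d → R c a b d
 p3124 r = proj₁ sym (proj₁ (proj₂ sym) r)
 p3142 : R a b c d → R c a d b
 p3142 r = proj₂ (proj₂ sym) (proj₁ sym (proj₁ (proj₂ sym) r))
 p3412 : R a b c d → R c d a b
 p3412 r = proj₁ (proj₂ sym) (proj₂ (proj₂ sym) (proj₁ sym (proj₁ (proj₂ sym) r)))
 p4123 : R a b c d → R d a b c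
 p4123 r = proj₁ sym (proj₁ (proj₂ sym) (proj₂ (proj₂ sym) r))
 p4312 : R a b c d → R d c a b
 p4312 r = proj₁ sym (proj₁ (proj₂ sym) (proj₂ (proj₂ sym) (proj₁ sym (proj₁ (proj₂ sym) r))))

Disj : {V : Set} → List V → List V → Set
Disj xs ys = ∀ v → v ∈ xs → v ∈ ys → ⊥

disj-++ʳ⁻ : {V : Set} {xs ys zs : List V} → Disj xs (ys ++ zs) → Disj xs ys × Disj xs zs
disj-++ʳ⁻ {ys = ys} h = (λ v p q → h v p (∈-++⁺ˡ q)) , (λ v p q → h v p (∈-++⁺ʳ ys q))

disj-sym : {V : Set} {xs ys : List V} → Disj xs ys → Disj ys xs
disj-sym h v p q = h v q p

Fin-dichotomy : ∀ {n} {A B : Fin n → Set} → (∀ i → A i ⊎ B i) → ∃ A ⊎ (∀ i → B i)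
Fin-dichotomy {zero} h = inj₂ λ ()
Fin-dichotomy {suc n} h with h zero | Fin-dichotomy (h ∘ suc)
... | inj₁ a | _ = inj₁ (zero , a)
... | inj₂ _ | inj₁ (i , a) = inj₁ (suc i , a)
... | inj₂ b | inj₂ bs = inj₂ λ { zero → b ; (suc i) → bs i }

module _ {V O : Set} (vs : O → List V) where

 -- Greedy choice: either k pairwise disjoint objects avoiding F, or a small set after whose deletion no object is left.
 greedy : (s : ℕ) (P : List V → Set) → (∀ o → length (vs o) ≤ s)
  → (∀ F → (∃ λ o → Disj (vs o) F) ⊎ P F) → ∀ k F
  → (∃ λ os → length os ≡ k × All (λ o → Disj (vs o) F) os × AllPairs (λ o o′ → Disj (vs o) (vs o′)) os)
   ⊎ (∃ λ U → length U ≤ k * s × P (U ++ F))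
 greedy s P len step zero F = inj₁ ([] , refl , [] , [])
 greedy s P len step (suc k) F with step F
 ... | inj₂ p = inj₂ ([] , z≤n , p)
 ... | inj₁ (o , o#F) with greedy s P len step k (vs o ++ F)
 ... | inj₂ (U , lU , p) = inj₂ (U ++ vs o
  , ≤-trans (≤-reflexive (LP.length-++ U)) (≤-trans (+-mono-≤ lU (len o)) (≤-reflexive (+-comm (k * s) s)))
  , subst P (sym (LP.++-assoc U (vs o) F)) p)
 ... | inj₁ (os , los , av , pw) = inj₁ (o ∷ os , cong suc los
  , o#F ∷ All.map (λ d → proj₂ (disj-++ʳ⁻ {ys = vs o} d)) av
  , All.map (λ d → disj-sym (proj₁ (disj-++ʳ⁻ {ys = vs o} d))) av ∷ pw)

module _ {V H : Set} {Body : H → Set} (vb : ∀ {h} → Body h → List V) where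

 -- Greedy choice with prescribed heads: a body has to avoid `F` and the bodies chosen before it,
 -- and `M` bounds the size of all of these together.
 attach : (s M : ℕ) → (∀ h F → length F ≤ M → Σ (Body h) λ b → length (vb b) ≤ s × Disj (vb b) F)
  → ∀ hs F → length F + length hs * s ≤ M
  → Σ (List (Σ H Body)) λ os → map proj₁ os ≡ hs × All (λ o → Disj (vb (proj₂ o)) F) os
   × AllPairs (λ o o′ → Disj (vb (proj₂ o)) (vb (proj₂ o′))) os
 attach s M get [] F le = [] , refl , [] , []
 attach s M get (h ∷ hs) F le with get h F (≤-trans (m≤m+n _ _) le)
 ... | b , lb , b#F with attach s M get hs (vb b ++ F) le′
  where
  le′ : length (vb b ++ F) + length hs * s ≤ M
  le′ = ≤-trans (+-monoˡ-≤ (length hs * s) (≤-trans (≤-reflexive (LP.length-++ (vb b))) (+-monoˡ-≤ (length F) lb)))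
   (≤-trans (≤-reflexive (trans (cong (_+ length hs * s) (+-comm s (length F))) (+-assoc (length F) s _))) le)
 ... | os , heads , av , pw = (h , b) ∷ os , cong (h ∷_) heads
  , b#F ∷ All.map (λ d → proj₂ (disj-++ʳ⁻ {ys = vb b} d)) av
  , All.map (λ d → disj-sym (proj₁ (disj-++ʳ⁻ {ys = vb b} d))) av ∷ pw

-- Lists of quadruples with prescribed branching

module _ {V : Set} where

 quads : List V → (V → List V) → (V → V → List V) → (V → V → V → List V) → List (Quad V)
 quads as f g h = concatMap (λ a → concatMap (λ b → concatMap (λ c → map (λ d → a , b , c , d) (h a b c)) (g a b)) (f a)) as

 ∈-quads : ∀ {as f g h a b c d} → a ∈ as → b ∈ f a → c ∈ g a b → d ∈ h a b c → (a , b , c , d) ∈ quads as f g h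
 ∈-quads a∈ b∈ c∈ d∈ = ∈-concatMap _ a∈ (∈-concatMap _ b∈ (∈-concatMap _ c∈ (∈-map⁺ _ d∈)))

 length-quads : ∀ {as f g h k₁ k₂ k₃ k₄} → length as ≤ k₁ → (∀ a → length (f a) ≤ k₂) → (∀ a b → length (g a b) ≤ k₃)
  → (∀ a b c → length (h a b c) ≤ k₄) → length (quads as f g h) ≤ k₁ * (k₂ * (k₃ * k₄))
 length-quads {as} {f} {g} {h} {k₁} {k₂} {k₃} {k₄} l₁ l₂ l₃ l₄ =
  ≤-trans (length-concatMap≤ _ (k₂ * (k₃ * k₄)) as λ a →
   ≤-trans (length-concatMap≤ _ (k₃ * k₄) (f a) λ b →
    ≤-trans (length-concatMap≤ _ k₄ (g a b) λ c → ≤-trans (≤-reflexive (LP.length-map _ (h a b c))) (l₄ a b c))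
     (*-monoˡ-≤ k₄ (l₃ a b)))
    (*-monoˡ-≤ (k₃ * k₄) (l₂ a)))
   (*-monoˡ-≤ (k₂ * (k₃ * k₄)) l₁)

 -- Insertion sort by `lev`; the symmetry of `P` undoes each exchange.
 sorted-wlog : (lev : V → ℕ) {P : V → V → V → V → Set} → SymClosed P
  → (∀ {a b c d} → lev a ≤ lev b → lev b ≤ lev c → lev c ≤ lev d → P a b c d)
  → ∀ a b c d → P a b c d
 sorted-wlog lev {P} symP h = sort₂
  where
  open Perm symP
  insert₁ : ∀ a b c d → lev b ≤ lev c → lev c ≤ lev d → P a b c d
  insert₁ a b c d bc cd with ≤-total (lev a) (lev b)
  ... | inj₁ ab = h ab bc cd
  ... | inj₂ ba with ≤-total (lev a) (lev c)
  ... | inj₁ ac = p2134 (h ba ac cd)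
  ... | inj₂ ca with ≤-total (lev a) (lev d)
  ... | inj₁ ad = p3124 (h bc ca ad)
  ... | inj₂ da = p4123 (h bc cd da)
  insert₂ : ∀ a b c d → lev c ≤ lev d → P a b c d
  insert₂ a b c d cd with ≤-total (lev b) (lev c)
  ... | inj₁ bc = insert₁ a b c d bc cd
  ... | inj₂ cb with ≤-total (lev b) (lev d)
  ... | inj₁ bd = p1324 (insert₁ a c b d cb bd)
  ... | inj₂ db = p1423 (insert₁ a c d b cd db)
  sort₂ : ∀ a b c d → P a b c d
  sort₂ a b c d with ≤-total (lev c) (lev d)
  ... | inj₁ cd = insert₂ a b c d cd
  ... | inj₂ dc = p1243 (insert₂ a b d c dc)

-- The star lemma

allPairs-All : {A : Set} {P : A → Set} {R : A → A → Set} {xs : List A} → All P xs → AllPairs R xs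
 → AllPairs (λ a b → P a × P b × R a b) xs
allPairs-All [] [] = []
allPairs-All (p ∷ ps) (r ∷ rs) = All.zipWith (λ { (q , s) → p , q , s }) (ps , r) ∷ allPairs-All ps rs

-- The four nested lists are the vertices forbidden to the hub, the children, the grandchildren and
-- the leaves of a new star: the lower the level, the more it has to avoid.
module Star {n : ℕ} (E : Fin n → Fin n → Fin n → Fin n → Set) (E? : ∀ a b c d → Dec (E a b c d))
 (E-sym : SymClosed E) (E-≢ : ∀ {a b c d} → E a b c d → a ≢ b)
 (B₁ B₂ B₃ B₄ : List (Fin n))
 (B₁⊆B₂ : ∀ {v} → v ∈ B₁ → v ∈ B₂) (B₂⊆B₃ : ∀ {v} → v ∈ B₂ → v ∈ B₃) (B₃⊆B₄ : ∀ {v} → v ∈ B₃ → v ∈ B₄)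
 (x y z₀ : ℕ) where

 open Perm E-sym
 open import Data.List.Membership.DecPropositional (F._≟_ {n}) using (_∈?_)

 V : Set
 V = Fin n

 z Y K K′ θ κ : ℕ
 z = suc z₀
 -- `Y` counts the vertices below one child, `K` those of a whole star with a little slack, and `κ`
 -- those of a star without its leaves; `θ` exceeds `K′` by the `z` leaves that are still wanted.
 Y = y * suc z
 K = x * suc Y + 2
 K′ = K + Y
 θ = K′ + z
 κ = x * suc y + 1

 E-≢₂₃ : ∀ {a b c d} → E a b c d → b ≢ c
 E-≢₂₃ e = E-≢ (p2314 e)

 E-≢₃₄ : ∀ {a b c d} → E a b c d → c ≢ d
 E-≢₃₄ e = E-≢ (p3412 e)

 E-≢₂₄ : ∀ {a b c d} → E a b c d → b ≢ d
 E-≢₂₄ e = E-≢ (p2413 e)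

 outs : V → V → V → List V → List V
 outs v w p F = filter (λ q → E? v w p q ×-dec ¬? (q ∈? B₄) ×-dec ¬? (q ∈? F)) (allFin n)

 outs-unique : ∀ v w p F → Unique (outs v w p F)
 outs-unique v w p F = Uniq.filter⁺ _ (Uniq.allFin⁺ n)

 ∈-outs⁺ : ∀ {v w p F q} → E v w p q → q ∉ B₄ → q ∉ F → q ∈ outs v w p F
 ∈-outs⁺ {q = q} e q∉ q∉F = ∈-filter⁺ (λ q → E? _ _ _ q ×-dec ¬? (q ∈? B₄) ×-dec ¬? (q ∈? _)) (∈-allFin q) (e , q∉ , q∉F)

 ∈-outs⁻ : ∀ {v w p F q} → q ∈ outs v w p F → E v w p q × q ∉ B₄ × q ∉ F
 ∈-outs⁻ {v} {w} {p} {F} q∈ =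
  proj₂ (∈-filter⁻ (λ q → E? v w p q ×-dec ¬? (q ∈? B₄) ×-dec ¬? (q ∈? F)) {xs = allFin n} q∈)

 outs-≤ : ∀ {v w p v′ w′ p′ F F′} → (∀ {q} → E v w p q → E v′ w′ p′ q) → (∀ {q} → q ∈ F′ → q ∈ F)
  → length (outs v w p F) ≤ length (outs v′ w′ p′ F′)
 outs-≤ f sub = unique-⊆⇒length≤ (outs-unique _ _ _ _) λ q∈ →
  let (e , b , c) = ∈-outs⁻ q∈ in ∈-outs⁺ (f e) b (c ∘ sub)

 outs-drop : ∀ v w p F → length (outs v w p []) ≤ length F + length (outs v w p F)
 outs-drop v w p F = ≤-trans (unique-⊆⇒length≤ {ys = F ++ outs v w p F} (outs-unique v w p []) go)
   (≤-reflexive (LP.length-++ F))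
  where
  go : ∀ {q} → q ∈ outs v w p [] → q ∈ F ++ outs v w p F
  go {q} q∈ with q ∈? F | ∈-outs⁻ {F = []} q∈
  ... | yes q∈F | _ = ∈-++⁺ˡ q∈F
  ... | no q∉F | e , b , _ = ∈-++⁺ʳ F (∈-outs⁺ e b q∉F)

 Leaves : V → V → V → Set
 Leaves v w p = Σ (List V) λ qs → length qs ≡ z × Unique qs × All (λ q → q ∉ B₄ × E v w p q) qs

 Petal : V → V → Set
 Petal v w = Σ V λ p → p ∉ B₃ × Leaves v w p

 petalVerts : ∀ {v w} → Petal v w → List V
 petalVerts (p , _ , qs , _) = p ∷ qs

 Petals : V → V → Set
 Petals v w = Σ (List (Petal v w)) λ os → length os ≡ y × AllPairs (λ o o′ → Disj (petalVerts o) (petalVerts o′)) os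

 petalsVerts : ∀ {v w} → Petals v w → List V
 petalsVerts (os , _) = concatMap petalVerts os

 Arm : V → Set
 Arm v = Σ V λ w → w ∉ B₂ × w ≢ v × Σ (Petals v w) λ os → w ∉ petalsVerts os

 armVerts : ∀ {v} → Arm v → List V
 armVerts (w , _ , _ , os , _) = w ∷ petalsVerts os

 FreeStar : Set
 FreeStar = Σ V λ v → v ∉ B₁ × Σ (List (Arm v)) λ as → length as ≡ x
  × All (λ a → v ∉ armVerts a) as × AllPairs (λ a a′ → Disj (armVerts a) (armVerts a′)) as

 takeLeaves : ∀ v w p F → z ≤ length (outs v w p F) → Σ (Leaves v w p) λ l → Disj (proj₁ l) F
 takeLeaves v w p F z≤ =
  let
   (qs , len , u , al , sub) = takeUpTo z {P = λ q → (q ∉ B₄ × E v w p q) × q ∉ F} (outs-unique v w p F)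
    (All.tabulate λ q∈ → let (e , b , c) = ∈-outs⁻ {F = F} q∈ in (b , e) , c) z≤
  in (qs , len , u , All.map proj₁ al) , λ q q∈ q∈F → proj₂ (All.lookup al q∈) q∈F

 -- After the deletion of `F` no petal is left at the pair `v`, `w`: every admissible third vertex
 -- has fewer than `z` leaves.
 P₁ : V → V → List V → Set
 P₁ v w F = ∀ p → p ∉ B₃ → p ∉ F → length (outs v w p F) ≤ z₀

 P₁? : ∀ v w F → Dec (P₁ v w F)
 P₁? v w F = omni-all omni-Fin λ p → imp (¬? (p ∈? B₃)) (imp (¬? (p ∈? F)) (length (outs v w p F) N.≤? z₀))
  where
  imp : ∀ {X Z : Set} → Dec X → Dec Z → Dec (X → Z)
  imp (no ¬x) _ = yes λ x → ⊥-elim (¬x x)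
  imp (yes x) (yes z) = yes λ _ → z
  imp (yes x) (no ¬z) = no λ f → ¬z (f x)

 P₁-mono : ∀ {v w F F′} → (∀ {q} → q ∈ F → q ∈ F′) → P₁ v w F → P₁ v w F′
 P₁-mono sub h p p∉ p∉F = ≤-trans (outs-≤ id sub) (h p p∉ (p∉F ∘ sub))

 P₁-sym : ∀ {v w F} → P₁ v w F → P₁ w v F
 P₁-sym h p p∉ p∉F = ≤-trans (outs-≤ p2134 id) (h p p∉ p∉F)

 petal-step : ∀ v w F → (Σ (Petal v w) λ o → Disj (petalVerts o) F) ⊎ P₁ v w F
 petal-step v w F with Fin-dichotomy dich
  where
  dich : ∀ p → (p ∉ B₃ × p ∉ F × z ≤ length (outs v w p F)) ⊎ (p ∉ B₃ → p ∉ F → length (outs v w p F) ≤ z₀)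
  dich p with p ∈? B₃ | p ∈? F | z N.≤? length (outs v w p F)
  ... | yes i | _ | _ = inj₂ λ n → ⊥-elim (n i)
  ... | no _ | yes i | _ = inj₂ λ _ n → ⊥-elim (n i)
  ... | no i | no j | yes le = inj₁ (i , j , le)
  ... | no _ | no _ | no nle = inj₂ λ _ _ → ≤-pred (≰⇒> nle)
 ... | inj₂ h = inj₂ h
 ... | inj₁ (p , p∉ , p∉F , le) = let (l , dj) = takeLeaves v w p F le in
  inj₁ ((p , p∉ , l) , λ { _ (here refl) q → p∉F q ; u (there q∈) q → dj u q∈ q })

 petals : ∀ v w F → (Σ (Petals v w) λ os → Disj (petalsVerts os) F) ⊎ (∃ λ U → length U ≤ Y × P₁ v w (U ++ F))
 petals v w F with greedy {O = Petal v w} petalVerts (suc z) (P₁ v w)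
  (λ { (p , _ , qs , len , _) → ≤-reflexive (cong suc len) }) (petal-step v w) y F
 ... | inj₂ r = inj₂ r
 ... | inj₁ (os , len , av , pw) = inj₁ ((os , len , pw) , λ u u∈ u∈F →
  let (o , o∈ , u∈o) = ∈-concatMap⁻′ petalVerts os u∈ in All.lookup av o∈ u u∈o u∈F)

 length-petalsVerts : ∀ {v w} (os : Petals v w) → length (petalsVerts os) ≤ Y
 length-petalsVerts (os , len , _) = ≤-trans
  (length-concatMap≤ petalVerts (suc z) os λ { (p , _ , qs , l , _) → ≤-reflexive (cong suc l) })
  (≤-reflexive (cong (_* suc z) len))

 -- After the deletion of `F` no arm is left at the hub `v`; for every candidate child this is
 -- witnessed by at most `Y` vertices that block its petals.
 P₂ : V → List V → Set
 P₂ v F = ∀ w → w ∉ B₂ → w ≢ v → w ∉ F → ∃ λ U → length U ≤ Y × P₁ v w (U ++ w ∷ F)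

 arm-step : ∀ v F → (Σ (Arm v) λ a → Disj (armVerts a) F) ⊎ P₂ v F
 arm-step v F with Fin-dichotomy dich
  where
  C D : V → Set
  C w = w ∉ B₂ × w ≢ v × w ∉ F × Σ (Petals v w) λ os → Disj (petalsVerts os) (w ∷ F)
  D w = w ∉ B₂ → w ≢ v → w ∉ F → ∃ λ U → length U ≤ Y × P₁ v w (U ++ w ∷ F)
  dich : ∀ w → C w ⊎ D w
  dich w with w ∈? B₂ | w F.≟ v | w ∈? F | petals v w (w ∷ F)
  ... | yes i | _ | _ | _ = inj₂ λ n → ⊥-elim (n i)
  ... | no i | yes j | _ | _ = inj₂ λ _ n → ⊥-elim (n j)
  ... | no i | no j | yes k | _ = inj₂ λ _ _ n → ⊥-elim (n k)
  ... | no i | no j | no k | inj₁ os = inj₁ (i , j , k , os)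
  ... | no i | no j | no k | inj₂ u = inj₂ λ _ _ _ → u
 ... | inj₂ h = inj₂ h
 ... | inj₁ (w , i , j , k , os , dj) = inj₁ ((w , i , j , os , λ w∈ → dj w w∈ (here refl))
  , λ { _ (here refl) q → k q ; u (there u∈) q → dj u u∈ (there q) })

 -- The greedy choice of arms at `v` can stop early only with a blocking set. It starts with `v`
 -- itself forbidden, so that the arms avoid the hub.
 hub-cover : ∀ v → v ∉ B₁ → FreeStar ⊎ (∃ λ U → length U ≤ K × P₂ v U)
 hub-cover v v∉ with greedy {O = Arm v} armVerts (suc Y) (P₂ v)
  (λ { (w , _ , _ , os , _) → s≤s (length-petalsVerts os) }) (arm-step v) x (v ∷ [])
 ... | inj₁ (as , len , av , pw) = inj₁ (v , v∉ , as , len , All.map (λ d v∈ → d v v∈ (here refl)) av , pw)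
 ... | inj₂ (U , lU , h) = inj₂ (U ++ v ∷ [] , ≤-trans (≤-reflexive (LP.length-++ U)) (+-mono-≤ lU (s≤s z≤n)) , h)

 -- Super pairs carry many petals however K vertices are deleted.
 NS : V → V → Set
 NS v w = ∃ λ (S : Vec V K′) → P₁ v w (Vec.toList S)

 NS? : ∀ v w → Dec (NS v w)
 NS? v w = omni-Vec omni-Fin λ S → P₁? v w (Vec.toList S)

 NS-sym : ∀ {v w} → NS v w → NS w v
 NS-sym (S , h) = S , P₁-sym h

 -- A fixed length makes `NS` decidable by search over vectors, and shorter lists have to be filled
 -- up to that length.
 pad : ∀ {k} (u : V) (F : List V) → length F ≤ k → Σ (Vec V k) λ S → ∀ {q} → q ∈ F → q ∈ Vec.toList S
 pad {k} u [] _ = Vec.replicate k u , λ ()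
 pad {suc k} u (a ∷ F) (s≤s le) = let (S , sub) = pad u F le in
  a ∷ S , λ { (here e) → here e ; (there p) → there (sub p) }

 super-petals : ∀ {v w} → ¬ NS v w → ∀ F → length F ≤ K → Σ (Petals v w) λ os → length (petalsVerts os) ≤ Y × Disj (petalsVerts os) F
 super-petals {v} {w} sup F le with petals v w F
 ... | inj₁ (os , dj) = os , length-petalsVerts os , dj
 ... | inj₂ (U , lU , h) = ⊥-elim (sup (proj₁ S , P₁-mono (proj₂ S) h))
  where
  S = pad v (U ++ F) (≤-trans (≤-reflexive (LP.length-++ U)) (≤-trans (≤-reflexive (+-comm (length U) _)) (+-mono-≤ le lU)))

 superNbr? : ∀ v w → Dec (¬ NS v w × w ∉ B₂ × w ≢ v)
 superNbr? v w = ¬? (NS? v w) ×-dec ¬? (w ∈? B₂) ×-dec ¬? (w F.≟ v)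

 superNbrs : V → List V
 superNbrs v = filter (superNbr? v) (allFin n)

 heads : ∀ {A : Set} {P : A → Set} {xs : List A} → All P xs → List (Σ A P)
 heads [] = []
 heads {xs = x ∷ _} (p ∷ ps) = (x , p) ∷ heads ps

 map-proj₁-heads : ∀ {A : Set} {P : A → Set} {xs : List A} (ps : All P xs) → map proj₁ (heads ps) ≡ xs
 map-proj₁-heads [] = refl
 map-proj₁-heads (p ∷ ps) = cong (_ ∷_) (map-proj₁-heads ps)

 length-heads : ∀ {A : Set} {P : A → Set} {xs : List A} (ps : All P xs) → length (heads ps) ≡ length xs
 length-heads [] = refl
 length-heads (p ∷ ps) = cong suc (length-heads ps)

 -- The children are fixed first. A super pair still has its petals after the deletion of any `K`
 -- vertices, so the petals of all children can then be chosen disjointly, one child at a time.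
 super-star : ∀ v → v ∉ B₁ → x ≤ length (superNbrs v) → FreeStar
 super-star v v∉ le = v , v∉ , map arm os
   , trans (LP.length-map arm os) (trans (sym (LP.length-map proj₁ os)) (trans (cong length hd) (trans (length-heads al) len)))
   , AllP.map⁺ (All.tabulate v∉arm) , arms-disjoint
  where
  tk = takeUpTo x {P = λ w → ¬ NS v w × w ∉ B₂ × w ≢ v} (Uniq.filter⁺ (superNbr? v) (Uniq.allFin⁺ n))
   (AllP.all-filter (superNbr? v) (allFin n)) le
  ws : List V
  ws = proj₁ tk
  len : length ws ≡ x
  len = proj₁ (proj₂ tk)
  u : Unique ws
  u = proj₁ (proj₂ (proj₂ tk))
  al : All (λ w → ¬ NS v w × w ∉ B₂ × w ≢ v) ws
  al = proj₁ (proj₂ (proj₂ (proj₂ tk)))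
  H : Set
  H = Σ V λ w → ¬ NS v w × w ∉ B₂ × w ≢ v
  Body : H → Set
  Body (w , _) = Σ (Petals v w) λ os → w ∉ petalsVerts os
  bodyVerts : ∀ {h} → Body h → List V
  bodyVerts (os , _) = petalsVerts os
  F₀ : List V
  F₀ = v ∷ ws
  size : length F₀ + length (heads al) * Y ≤ x * suc Y + 1
  size = ≤-reflexive (trans (cong₂ (λ a b → suc a + b * Y) len (trans (length-heads al) len)) (lem x Y))
   where
   lem : ∀ x Y → suc x + x * Y ≡ x * suc Y + 1
   lem = solve-∀
  get : ∀ h F → length F ≤ x * suc Y + 1 → Σ (Body h) λ b → length (bodyVerts {h} b) ≤ Y × Disj (bodyVerts {h} b) F
  get (w , sup , _) F le = let (os , l , dj) = super-petals sup (w ∷ F) (≤-trans (s≤s le) (≤-reflexive (sym (+-suc _ 1)))) in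
   (os , λ w∈ → dj w w∈ (here refl)) , l , λ u u∈ u∈F → dj u u∈ (there u∈F)
  at = attach {H = H} {Body = Body} (λ {h} → bodyVerts {h}) Y (x * suc Y + 1) get (heads al) F₀ size
  os : List (Σ H Body)
  os = proj₁ at
  hd : map proj₁ os ≡ heads al
  hd = proj₁ (proj₂ at)
  arm : Σ H Body → Arm v
  arm ((w , _ , w∉ , w≢) , (ps , w∉ps)) = w , w∉ , w≢ , ps , w∉ps
  hd′ : map (proj₁ ∘ proj₁) os ≡ ws
  hd′ = trans (LP.map-∘ os) (trans (cong (map proj₁) hd) (map-proj₁-heads al))
  head∈ : ∀ {o} → o ∈ os → proj₁ (proj₁ o) ∈ ws
  head∈ o∈ = subst (_ ∈_) hd′ (∈-map⁺ (proj₁ ∘ proj₁) o∈)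
  Fresh : Σ H Body → Set
  Fresh o = Disj (bodyVerts {proj₁ o} (proj₂ o)) F₀ × proj₁ (proj₁ o) ∈ ws
  fresh : All Fresh os
  fresh = All.tabulate λ o∈ → All.lookup (proj₁ (proj₂ (proj₂ at))) o∈ , head∈ o∈
  v∉arm : ∀ {o} → o ∈ os → v ∉ armVerts (arm o)
  v∉arm {(w , _ , w∉ , w≢) , b} o∈ (here e) = w≢ (sym e)
  v∉arm {(w , _ , w∉ , w≢) , b} o∈ (there p) = proj₁ (All.lookup fresh o∈) v p (here refl)
  arms-disjoint : AllPairs (λ a a′ → Disj (armVerts a) (armVerts a′)) (map arm os)
  arms-disjoint = APP.map⁺ (AP.map (λ {o} {o′} → sep {o} {o′}) (AP.zip (allPairs-All fresh (proj₂ (proj₂ (proj₂ at)))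
    , APP.map⁻ {f = proj₁ ∘ proj₁} (subst Unique (sym hd′) u))))
   where
   sep : ∀ {o o′} → (Fresh o × Fresh o′ × Disj (bodyVerts {proj₁ o} (proj₂ o)) (bodyVerts {proj₁ o′} (proj₂ o′)))
    × proj₁ (proj₁ o) ≢ proj₁ (proj₁ o′) → Disj (armVerts (arm o)) (armVerts (arm o′))
   sep (_ , ne) _ (here refl) (here e) = ne e
   sep (((_ , h) , (d′ , _) , _) , _) w (here refl) (there q) = d′ w q (there h)
   sep (((d , _) , (_ , h) , _) , _) w (there p) (here refl) = d w p (there h)
   sep ((_ , _ , d) , _) w (there p) (there q) = d w p q

 -- Robust triples have many neighbours outside B₄, so their leaves can be chosen last.
 T3 : V → V → V → Set
 T3 v w p = θ ≤ length (outs v w p [])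

 T3? : ∀ v w p → Dec (T3 v w p)
 T3? v w p = θ N.≤? length (outs v w p [])

 T3-sym₁ : ∀ {v w p} → T3 v w p → T3 w v p
 T3-sym₁ t = ≤-trans t (outs-≤ p2134 id)

 T3-sym₂ : ∀ {v w p} → T3 v w p → T3 v p w
 T3-sym₂ t = ≤-trans t (outs-≤ p1324 id)

 P₁ᵀ : V → V → List V → Set
 P₁ᵀ v w F = ∀ p → p ∉ B₃ → p ∉ F → ¬ T3 v w p

 Petal3 : V → V → Set
 Petal3 v w = Σ V λ p → p ∉ B₃ × T3 v w p

 petal3Verts : ∀ {v w} → Petal3 v w → List V
 petal3Verts (p , _) = p ∷ []

 Arm3 : V → Set
 Arm3 v = Σ V λ w → w ∉ B₂ × w ≢ v × Σ (List (Petal3 v w)) λ ps → length ps ≡ y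
  × AllPairs (λ o o′ → Disj (petal3Verts o) (petal3Verts o′)) ps × w ∉ concatMap petal3Verts ps

 arm3Verts : ∀ {v} → Arm3 v → List V
 arm3Verts (w , _ , _ , ps , _) = w ∷ concatMap petal3Verts ps

 length-arm3Verts : ∀ {v} (a : Arm3 v) → length (arm3Verts a) ≤ suc y
 length-arm3Verts (w , _ , _ , ps , len , _) = s≤s (≤-trans (length-concatMap≤ petal3Verts 1 ps λ _ → ≤-refl)
  (≤-reflexive (trans (*-identityʳ _) len)))

 petals3 : ∀ v w F → (Σ (List (Petal3 v w)) λ ps → length ps ≡ y × AllPairs (λ o o′ → Disj (petal3Verts o) (petal3Verts o′)) ps
  × Disj (concatMap petal3Verts ps) F) ⊎ (∃ λ U → length U ≤ y × P₁ᵀ v w (U ++ F))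
 petals3 v w F with greedy {O = Petal3 v w} petal3Verts 1 (P₁ᵀ v w) (λ _ → ≤-refl) step y F
  where
  step : ∀ F → (Σ (Petal3 v w) λ o → Disj (petal3Verts o) F) ⊎ P₁ᵀ v w F
  step F with Fin-dichotomy dich
   where
   dich : ∀ p → (p ∉ B₃ × p ∉ F × T3 v w p) ⊎ (p ∉ B₃ → p ∉ F → ¬ T3 v w p)
   dich p with p ∈? B₃ | p ∈? F | T3? v w p
   ... | yes i | _ | _ = inj₂ λ n → ⊥-elim (n i)
   ... | no _ | yes i | _ = inj₂ λ _ n → ⊥-elim (n i)
   ... | no i | no j | yes t = inj₁ (i , j , t)
   ... | no _ | no _ | no nt = inj₂ λ _ _ → nt
  ... | inj₂ h = inj₂ h
  ... | inj₁ (p , i , j , t) = inj₁ ((p , i , t) , λ { _ (here refl) q → j q })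
 ... | inj₂ (U , lU , h) = inj₂ (U , ≤-trans lU (≤-reflexive (*-identityʳ y)) , h)
 ... | inj₁ (os , len , av , pw) = inj₁ (os , len , pw , λ u u∈ u∈F →
  let (o , o∈ , u∈o) = ∈-concatMap⁻′ petal3Verts os u∈ in All.lookup av o∈ u u∈o u∈F)

 P₂ᵀ : V → List V → Set
 P₂ᵀ v F = ∀ w → w ∉ B₂ → w ≢ v → w ∉ F → ∃ λ U → length U ≤ y × P₁ᵀ v w (U ++ w ∷ F)

 arm3-step : ∀ v F → (Σ (Arm3 v) λ a → Disj (arm3Verts a) F) ⊎ P₂ᵀ v F
 arm3-step v F with Fin-dichotomy dich
  where
  C D : V → Set
  C w = w ∉ B₂ × w ≢ v × w ∉ F × Σ (List (Petal3 v w)) λ ps → length ps ≡ y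
   × AllPairs (λ o o′ → Disj (petal3Verts o) (petal3Verts o′)) ps × Disj (concatMap petal3Verts ps) (w ∷ F)
  D w = w ∉ B₂ → w ≢ v → w ∉ F → ∃ λ U → length U ≤ y × P₁ᵀ v w (U ++ w ∷ F)
  dich : ∀ w → C w ⊎ D w
  dich w with w ∈? B₂ | w F.≟ v | w ∈? F | petals3 v w (w ∷ F)
  ... | yes i | _ | _ | _ = inj₂ λ n → ⊥-elim (n i)
  ... | no i | yes j | _ | _ = inj₂ λ _ n → ⊥-elim (n j)
  ... | no i | no j | yes k | _ = inj₂ λ _ _ n → ⊥-elim (n k)
  ... | no i | no j | no k | inj₁ os = inj₁ (i , j , k , os)
  ... | no i | no j | no k | inj₂ u = inj₂ λ _ _ _ → u
 ... | inj₂ h = inj₂ h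
 ... | inj₁ (w , i , j , k , ps , len , pw , dj) = inj₁ ((w , i , j , ps , len , pw , λ w∈ → dj w w∈ (here refl))
  , λ { _ (here refl) q → k q ; u (there u∈) q → dj u u∈ (there q) })

 module Leafing (v : V) (F₀ : List V) where

  Leafy : V → Set
  Leafy w = Σ (Petal3 v w) λ p → Leaves v w (proj₁ p)

  leaves : ∀ {w p} → Leaves v w p → List V
  leaves (qs , _) = qs

  leafOf : ∀ {w} → Leafy w → List V
  leafOf o = leaves (proj₂ o)

  record Body (a : Arm3 v) : Set where
   field
    os : List (Leafy (proj₁ a))
    heads≡ : map proj₁ os ≡ proj₁ (proj₂ (proj₂ (proj₂ a)))
    avoid : All (λ o → Disj (leafOf o) F₀) os
    apart : AllPairs (λ o o′ → Disj (leafOf o) (leafOf o′)) os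

  bodyVerts : ∀ {a} → Body a → List V
  bodyVerts b = concatMap leafOf (Body.os b)

  H : Set
  H = Σ (Arm3 v) λ a → ∀ {u} → u ∈ arm3Verts a → u ∈ F₀

  petal : ∀ {w} → Leafy w → Petal v w
  petal ((p , p∉ , _) , l) = p , p∉ , l

  leaf∉ : ∀ {a} (b : Body a) → Disj (bodyVerts b) F₀
  leaf∉ b u u∈ u∈F = let (o , o∈ , u∈o) = ∈-concatMap⁻′ leafOf (Body.os b) u∈ in All.lookup (Body.avoid b) o∈ u u∈o u∈F

  split : ∀ {w} (os : List (Leafy w)) {u} → u ∈ concatMap petalVerts (map petal os)
   → u ∈ concatMap petal3Verts (map proj₁ os) ⊎ u ∈ concatMap leafOf os
  split (o ∷ os) (here e) = inj₁ (here e)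
  split (((p , _) , qs , _) ∷ os) (there u∈) with ∈-++⁻ qs u∈
  ... | inj₁ q = inj₂ (∈-++⁺ˡ q)
  ... | inj₂ q with split os q
  ... | inj₁ r = inj₁ (there r)
  ... | inj₂ r = inj₂ (∈-++⁺ʳ qs r)

  Q : ∀ {w} → Leafy w → Set
  Q o = Disj (leafOf o) F₀ × proj₁ (proj₁ o) ∈ F₀

  petal-sep : ∀ {w} {o o′ : Leafy w} → (Q o × Q o′ × Disj (leafOf o) (leafOf o′)) × Disj (petal3Verts (proj₁ o)) (petal3Verts (proj₁ o′))
   → Disj (petalVerts (petal o)) (petalVerts (petal o′))
  petal-sep (_ , ne) u (here refl) (here refl) = ne u (here refl) (here refl)
  petal-sep (((_ , h) , (d′ , _) , _) , _) u (here refl) (there q) = d′ u q h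
  petal-sep (((d , _) , (_ , h) , _) , _) u (there p) (here refl) = d u p h
  petal-sep ((_ , _ , d) , _) u (there p) (there q) = d u p q

  mkPetals : (h : H) → Body (proj₁ h) → Petals v (proj₁ (proj₁ h))
  mkPetals ((w , w∉ , w≢ , ps , lps , ps# , w∉ps) , sub) b = map petal os
   , trans (LP.length-map petal os) (trans (sym (LP.length-map proj₁ os)) (trans (cong length heads≡) lps))
   , APP.map⁺ (AP.map (λ {o} {o′} → petal-sep {o = o} {o′}) (AP.zip (allPairs-All both apart , APP.map⁻ {f = proj₁} (subst (AllPairs _) (sym heads≡) ps#))))
   where
   open Body b
   both : All Q os
   both = All.tabulate λ {o} o∈ → All.lookup avoid o∈
    , sub (there (∈-concatMap petal3Verts (subst (proj₁ o ∈_) heads≡ (∈-map⁺ proj₁ o∈)) (here refl)))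

  petals-split : (h : H) (b : Body (proj₁ h)) {u : V} → u ∈ petalsVerts (mkPetals h b)
   → u ∈ concatMap petal3Verts (proj₁ (proj₂ (proj₂ (proj₂ (proj₁ h))))) ⊎ u ∈ bodyVerts b
  petals-split h b {u} u∈ with split (Body.os b) u∈
  ... | inj₁ q = inj₁ (subst (λ ps → u ∈ concatMap petal3Verts ps) (Body.heads≡ b) q)
  ... | inj₂ q = inj₂ q

  arm : Σ H (λ h → Body (proj₁ h)) → Arm v
  arm (h@((w , w∉ , w≢ , ps , lps , ps# , w∉ps) , sub) , b) = w , w∉ , w≢ , mkPetals h b
   , λ w∈ → [ w∉ps , (λ q → leaf∉ b w q (sub (here refl))) ]′ (petals-split h b w∈)

  arm-split : ∀ o {u} → u ∈ armVerts (arm o) → u ∈ arm3Verts (proj₁ (proj₁ o)) ⊎ u ∈ bodyVerts (proj₂ o)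
  arm-split o (here e) = inj₁ (here e)
  arm-split (h , b) (there u∈) with petals-split h b u∈
  ... | inj₁ q = inj₁ (there q)
  ... | inj₂ q = inj₂ q

  hub∉arm : v ∈ F₀ → ∀ o → v ∉ arm3Verts (proj₁ (proj₁ o)) → v ∉ armVerts (arm o)
  hub∉arm v∈F o v∉a v∈ with arm-split o v∈
  ... | inj₁ q = v∉a q
  ... | inj₂ q = leaf∉ (proj₂ o) v q v∈F

  arm-sep : ∀ {o o′} → Disj (bodyVerts (proj₂ o)) (bodyVerts (proj₂ o′))
   × Disj (arm3Verts (proj₁ (proj₁ o))) (arm3Verts (proj₁ (proj₁ o′))) → Disj (armVerts (arm o)) (armVerts (arm o′))
  arm-sep {o} {o′} (d , d₃) u p q with arm-split o p | arm-split o′ q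
  ... | inj₁ p′ | inj₁ q′ = d₃ u p′ q′
  ... | inj₁ p′ | inj₂ q′ = leaf∉ (proj₂ o′) u q′ (proj₂ (proj₁ o) p′)
  ... | inj₂ p′ | inj₁ q′ = leaf∉ (proj₂ o) u p′ (proj₂ (proj₁ o′) q′)
  ... | inj₂ p′ | inj₂ q′ = d u p′ q′

  -- A robust triple has at least `K′ + z` leaves, while `F₀` and all leaves chosen so far have at
  -- most `K′` vertices, so `z` fresh leaves remain.
  pick-leaves : length F₀ ≤ 1 + x * suc y → ∀ w (p : Petal3 v w) F → length F ≤ x * (y * z) + y * z
   → Σ (Leaves v w (proj₁ p)) λ l → length (leaves l) ≤ z × Disj (leaves l) (F₀ ++ F)
  pick-leaves F₀≤ w (p , p∉ , t) F le = proj₁ tl , ≤-reflexive (proj₁ (proj₂ (proj₁ tl))) , proj₂ tl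
   where
   lem : ∀ x y z → 1 + x * suc y + (x * (y * z) + y * z) + (y + 1) ≡ x * suc (y * suc z) + 2 + y * suc z
   lem = solve-∀
   bound : length (F₀ ++ F) ≤ K′
   bound = ≤-trans (≤-reflexive (LP.length-++ F₀)) (≤-trans (+-mono-≤ F₀≤ le)
    (≤-trans (m≤m+n _ (y + 1)) (≤-reflexive (lem x y z))))
   tl = takeLeaves v w p (F₀ ++ F) (+-cancelˡ-≤ K′ z _ (≤-trans t
    (≤-trans (outs-drop v w p (F₀ ++ F)) (+-monoˡ-≤ _ bound))))

  Leafy′ : V → Set
  Leafy′ w = Σ (Petal3 v w) λ p → Σ (Leaves v w (proj₁ p)) λ l → Disj (leaves l) F₀

  forget : ∀ {w} → Leafy′ w → Leafy w
  forget (p , l , _) = p , l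

  mkBody : (a : Arm3 v) (F : List V) (os : List (Leafy′ (proj₁ a))) → map proj₁ os ≡ proj₁ (proj₂ (proj₂ (proj₂ a)))
   → All (λ o → Disj (leafOf (forget o)) F) os → AllPairs (λ o o′ → Disj (leafOf (forget o)) (leafOf (forget o′))) os
   → Σ (Body a) λ b → length (bodyVerts b) ≤ y * z × Disj (bodyVerts b) F
  mkBody a F os hd av pw = record { os = map forget os ; heads≡ = trans (sym (LP.map-∘ os)) hd
    ; avoid = AllP.map⁺ (All.tabulate λ {o} _ → proj₂ (proj₂ o)) ; apart = APP.map⁺ pw }
   , ≤-trans (length-concatMap≤ leafOf z (map forget os) λ { (_ , _ , l , _) → ≤-reflexive l })
    (≤-reflexive (cong (_* z) (trans (LP.length-map forget os) (trans (sym (LP.length-map proj₁ os))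
     (trans (cong length hd) (proj₁ (proj₂ (proj₂ (proj₂ (proj₂ a))))))))))
   , disj
   where
   disj : Disj (concatMap leafOf (map forget os)) F
   disj u u∈ u∈F with ∈-concatMap⁻′ leafOf (map forget os) u∈
   ... | o , o∈ , u∈o with ∈-map⁻ forget o∈
   ... | o₁ , o₁∈ , refl = All.lookup av o₁∈ u u∈o u∈F

  get-body : length F₀ ≤ 1 + x * suc y → (h : H) (F : List V) → length F ≤ x * (y * z)
   → Σ (Body (proj₁ h)) λ b → length (bodyVerts b) ≤ y * z × Disj (bodyVerts b) F
  get-body F₀≤ (a@(w , _ , _ , ps , lps , _) , _) F le
   with attach {H = Petal3 v w} {Body = λ p → Σ (Leaves v w (proj₁ p)) λ l → Disj (leaves l) F₀} (leaves ∘ proj₁) z (x * (y * z) + y * z)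
    (λ p F le → let (l , b , dj) = pick-leaves F₀≤ w p F le in (l , proj₁ (disj-++ʳ⁻ {ys = F₀} dj)) , b , proj₂ (disj-++ʳ⁻ {ys = F₀} dj)) ps F
    (+-mono-≤ le (≤-reflexive (cong (_* z) lps)))
  ... | os , hd , av , pw = mkBody a F os hd av pw

 robust-star : ∀ v → v ∉ B₁ → (as : List (Arm3 v)) → length as ≡ x → All (λ a → v ∉ arm3Verts a) as
  → AllPairs (λ a a′ → Disj (arm3Verts a) (arm3Verts a′)) as → FreeStar
 robust-star v v∉ as len v∉as as# =
   let
    (os , hd , _ , pw) = attach {H = H} {Body = Body ∘ proj₁} (λ {h} → bodyVerts {proj₁ h}) (y * z) (x * (y * z))
     (get-body F₀≤) (heads hs) [] (≤-reflexive (cong (_* (y * z)) (trans (length-heads hs) len)))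
   in assemble os (trans (LP.map-∘ os) (trans (cong (map proj₁) hd) (map-proj₁-heads hs))) pw
  where
  F₀ : List V
  F₀ = v ∷ concatMap arm3Verts as
  open Leafing v F₀
  F₀≤ : length F₀ ≤ 1 + x * suc y
  F₀≤ = s≤s (≤-trans (length-concatMap≤ arm3Verts (suc y) as length-arm3Verts) (≤-reflexive (cong (_* suc y) len)))
  hs : All (λ a → ∀ {u} → u ∈ arm3Verts a → u ∈ F₀) as
  hs = All.tabulate λ a∈ u∈ → there (∈-concatMap arm3Verts a∈ u∈)
  assemble : (os : List (Σ H (λ h → Body (proj₁ h)))) → map (proj₁ ∘ proj₁) os ≡ as
   → AllPairs (λ o o′ → Disj (bodyVerts (proj₂ o)) (bodyVerts (proj₂ o′))) os → FreeStar
  assemble os hd pw = v , v∉ , map arm os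
   , trans (LP.length-map arm os) (trans (sym (LP.length-map (proj₁ ∘ proj₁) os)) (trans (cong length hd) len))
   , AllP.map⁺ (All.tabulate λ {o} o∈ → hub∉arm (here refl) o (All.lookup v∉as (subst (_ ∈_) hd (∈-map⁺ (proj₁ ∘ proj₁) o∈))))
   , APP.map⁺ (AP.map (λ {o} {o′} → arm-sep {o} {o′}) (AP.zip (pw , APP.map⁻ {f = proj₁ ∘ proj₁} (subst (AllPairs _) (sym hd) as#))))

 -- In contrast to `K` and `Y`, the sizes `κ` and `y` of these blocking sets do not involve the
 -- number of leaves. For quadruples that start in `B₄`, the largest list, this gain of a factor `z`
 -- keeps the covering within its budget.
 robust-cover : ∀ v → v ∉ B₁ → FreeStar ⊎ (∃ λ U → length U ≤ κ × P₂ᵀ v U)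
 robust-cover v v∉ with greedy {O = Arm3 v} arm3Verts (suc y) (P₂ᵀ v) length-arm3Verts (arm3-step v) x (v ∷ [])
 ... | inj₁ (as , len , av , pw) = inj₁ (robust-star v v∉ as len (All.map (λ d v∈ → d v v∈ (here refl)) av) pw)
 ... | inj₂ (U , lU , h) = inj₂ (U ++ v ∷ [] , ≤-trans (≤-reflexive (LP.length-++ U)) (+-monoˡ-≤ 1 lU) , h)

-- The case analysis of the star lemma, with the covering lists and the exceptional lists kept abstract.

record StarCases : Set₁ where
 field
  V : Set
  E P : V → V → V → V → Set
  E-sym : SymClosed E
  P-sym : SymClosed P
  E-≢ : ∀ {a b c d} → E a b c d → a ≢ b
  lev : V → ℕ
  I₁ I₂ I₃ I₄ : V → Set
  I₁? : ∀ v → Dec (I₁ v)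
  I₂? : ∀ v → Dec (I₂ v)
  I₃? : ∀ v → Dec (I₃ v)
  I₄? : ∀ v → Dec (I₄ v)
  I₁⊆I₂ : ∀ {v} → I₁ v → I₂ v
  I₂⊆I₃ : ∀ {v} → I₂ v → I₃ v
  I₃⊆I₄ : ∀ {v} → I₃ v → I₄ v
  lev-down₂ : ∀ {a b} → lev a ≤ lev b → I₂ b → I₂ a
  lev-down₃ : ∀ {a b} → lev a ≤ lev b → I₃ b → I₃ a
  lev-down₄ : ∀ {a b} → lev a ≤ lev b → I₄ b → I₄ a
  U Uᵀ Qn : V → V → Set
  U? : ∀ v w → Dec (U v w)
  Uᵀ? : ∀ v w → Dec (Uᵀ v w)
  Yh Y′ Yᵀ : V → V → V → Set
  Yh? : ∀ v w p → Dec (Yh v w p)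
  Y′? : ∀ v w p → Dec (Y′ v w p)
  Yᵀ? : ∀ v w p → Dec (Yᵀ v w p)
  NS : V → V → Set
  NS? : ∀ v w → Dec (NS v w)
  NS-sym : ∀ {v w} → NS v w → NS w v
  T3 : V → V → V → Set
  T3? : ∀ v w p → Dec (T3 v w p)
  T3-sym₁ : ∀ {v w p} → T3 v w p → T3 w v p
  T3-sym₂ : ∀ {v w p} → T3 v w p → T3 v p w
  super⇒Qn : ∀ {v w} → ¬ I₁ v → ¬ NS v w → ¬ I₂ w → w ≢ v → Qn v w
  robust⇒Y′ : ∀ {v w p} → T3 v w p → NS v w → ¬ I₃ p → Y′ v w p
  robust⇒Yᵀ : ∀ {v w p} → T3 v w p → ¬ I₁ v → ¬ I₂ w → w ≢ v → ¬ Uᵀ v w → ¬ I₃ p → p ≢ w → ¬ Uᵀ v p → Yᵀ v w p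
  -- `low₁`, `low₂` and `few` dispose of triples with too few leaves. Together with `c0` to `c19`
  -- they correspond to the families of the covering, in which they have the numbers 4, 5 and 15.
  low₁ : ∀ {v w p q} → E v w p q → ¬ I₁ v → ¬ I₂ w → ¬ U v w → ¬ I₃ p → ¬ U v p → ¬ I₄ q → ¬ U v q
   → ¬ Yh v w p → ¬ Yh v w q → P v w p q
  low₂ : ∀ {v w p q} → E v w p q → NS v w → ¬ I₃ p → ¬ I₄ q → ¬ Y′ v w p → ¬ Y′ v w q → P v w p q
  few : ∀ {a u w r} → E a u w r → ¬ T3 a u w → ¬ I₄ r → U a u → Y′ a u w → P a u w r
  c0 : ∀ {a b c d} → I₁ a → P a b c d
  c1 : ∀ {a b c d} → I₂ a → I₂ b → P a b c d
  c2 : ∀ {a b c d} → I₃ a → I₃ b → I₃ c → P a b c d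
  c3 : ∀ {a b c d} → I₄ a → I₄ b → I₄ c → I₄ d → P a b c d
  c6 : ∀ {a b c d} → Qn a b → Qn c d → P a b c d
  c7 : ∀ {a b c d} → I₄ c ⊎ Y′ a b c → Qn c d → P a b c d
  c8 : ∀ {a b c d} → I₂ a → Qn a b → P a b c d
  c9 : ∀ {a b c d} → I₃ a → I₃ b → Yh a b c → P a b c d
  c10 : ∀ {a b c d} → I₄ a → I₄ b → Yh a b c → P a b c d
  c11 : ∀ {a b c d} → Yh a b c → Yh a c d → P a b c d
  c12 : ∀ {a b c d} → I₃ a → U a b → I₃ c → P a b c d
  c13 : ∀ {a b c d} → I₄ a → U a b → I₄ c → I₄ d → P a b c d
  c14 : ∀ {a b c d} → I₄ a → U a b → Y′ a b c → I₄ d → P a b c d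
  c16 : ∀ {a b c d} → I₃ a → U a b → Y′ a b c → P a b c d
  c17 : ∀ {a b c d} → I₄ a → Uᵀ a b → Y′ a b c → P a b c d
  c18 : ∀ {a b c d} → I₄ a → Yᵀ a b c → P a b c d
  c19 : ∀ {a b c d} → U a b → Y′ a b c → Y′ b c d → P a b c d

module StarCaseAnalysis (S : StarCases) where

 open StarCases S
 open Perm E-sym
 open Perm P-sym using () renaming (p1243 to q1243; p1324 to q1324; p1342 to q1342; p1423 to q1423; p1432 to q1432; p2134 to q2134; p2341 to q2341; p3124 to q3124; p3142 to q3142; p3412 to q3412; p4312 to q4312)

 E-≢₂₃ : ∀ {a b c d} → E a b c d → b ≢ c
 E-≢₂₃ e = E-≢ (p2314 e)

 E-≢₃₄ : ∀ {a b c d} → E a b c d → c ≢ d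
 E-≢₃₄ e = E-≢ (p3412 e)

 -- A vertex has at most `x` super neighbours. If the opposite pair is super as well, two vertices
 -- have only `x` choices each; otherwise `s` and `t` are compared with the list that blocks the
 -- petals of the opposite pair.
 super-case : ∀ {s t s′ t′} → E s t s′ t′ → ¬ NS s t → ¬ I₁ s → ¬ I₁ t → ¬ I₁ s′ → ¬ I₂ t → ¬ I₂ t′ → P s t s′ t′
 super-case {s} {t} {s′} {t′} e sup s₁ t₁ s′₁ t₂ t′₂ with NS? s′ t′
 ... | no sup′ = c6 (super⇒Qn s₁ sup t₂ (≢-sym (E-≢ e))) (super⇒Qn s′₁ sup′ t′₂ (≢-sym (E-≢₃₄ e)))
 ... | yes ns with I₂? s | I₄? s ⊎-dec Y′? s′ t′ s | I₄? t ⊎-dec Y′? s′ t′ t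
 ... | yes s₂ | _ | _ = c8 s₂ (super⇒Qn s₁ sup t₂ (≢-sym (E-≢ e)))
 ... | no _ | yes h | _ = q3412 (c7 h (super⇒Qn s₁ sup t₂ (≢-sym (E-≢ e))))
 ... | no s₂ | no _ | yes h = q4312 (c7 h (super⇒Qn t₁ (sup ∘ NS-sym) s₂ (E-≢ e)))
 ... | no _ | no s∉ | no t∉ = q3412 (low₂ (p3412 e) ns (s∉ ∘ inj₁ ∘ I₃⊆I₄) (t∉ ∘ inj₁) (s∉ ∘ inj₂) (t∉ ∘ inj₂))

 -- For the hub `v`, the petals at `w` are blocked by the short list `Yh v w`. Either it contains
 -- one of the other two vertices, to which `w` then points, or the triple has few leaves.
 pointer : ∀ {v w p q} → E v w p q → ¬ I₁ v → ¬ I₂ w → ¬ U v w → ¬ I₃ p → ¬ U v p → ¬ I₄ q → ¬ U v q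
  → Yh v w p ⊎ Yh v w q ⊎ P v w p q
 pointer {v} {w} {p} {q} e v₁ w₂ wU p₃ pU q₄ qU with Yh? v w p | Yh? v w q
 ... | yes h | _ = inj₁ h
 ... | no _ | yes h = in₁ h
 ... | no p∉ | no q∉ = inj₂ (inj₂ (low₁ e v₁ w₂ wU p₃ pU q₄ qU p∉ q∉))

 path : ∀ {v a b c} → Yh v a b → Yh v b c → P v a b c
 path = c11

 -- Each of `b`, `c`, `d` points to another one of them. Three such arrows always contain a directed
 -- path through all three vertices, which leaves only `Y` choices for each of its last two.
 three-pointers : ∀ {v b c d} → E v b c d → ¬ I₁ v → ¬ I₂ b → ¬ I₂ c → ¬ I₂ d → ¬ I₃ b → ¬ I₃ c → ¬ I₄ c → ¬ I₄ d
  → ¬ U v b → ¬ U v c → ¬ U v d → P v b c d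
 three-pointers e v∉ b₂ c₂ d₂ b₃ c₃ c₄ d₄ bU cU dU
  with pointer e v∉ b₂ bU c₃ cU d₄ dU | pointer (p1324 e) v∉ c₂ cU b₃ bU d₄ dU | pointer (p1423 e) v∉ d₂ dU b₃ bU c₄ cU
 ... | inj₂ (inj₂ r) | _ | _ = r
 ... | _ | inj₂ (inj₂ r) | _ = q1324 r
 ... | _ | _ | inj₂ (inj₂ r) = q1342 r
 ... | inj₁ b→c | inj₁ c→b | inj₁ d→b = q1342 (path d→b b→c)
 ... | inj₁ b→c | inj₁ c→b | in₁ d→c = q1432 (path d→c c→b)
 ... | inj₁ b→c | in₁ c→d | _ = path b→c c→d
 ... | in₁ b→d | inj₁ c→b | _ = q1324 (path c→b b→d)
 ... | in₁ b→d | in₁ c→d | inj₁ d→b = q1423 (path c→d d→b)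
 ... | in₁ b→d | in₁ c→d | in₁ d→c = q1243 (path b→d d→c)

 -- If `s` lies in `Y′ r v`, then `t` lies in `Y′ v s` because the triple is robust, and `v`, `s`,
 -- `t` are all reached from `r` through short lists. The same works with `s` and `t` exchanged.
 free-hub-arc : ∀ {r v s t} → E r v s t → U r v → NS r v → NS v s → NS v t → T3 v s t
  → ¬ I₃ s → ¬ I₃ t → ¬ I₄ t → P r v s t
 free-hub-arc {r} {v} {s} {t} e v∈ ns ns-s ns-t t3 s₃ t₃ t₄ with Y′? r v s | Y′? r v t
 ... | yes h | _ = c19 v∈ h (robust⇒Y′ t3 ns-s t₃)
 ... | no _ | yes h = q1243 (c19 v∈ h (robust⇒Y′ (T3-sym₂ t3) ns-t s₃))
 ... | no s∉ | no t∉ = low₂ e ns s₃ t₄ s∉ t∉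

 record NonSuper (a b c d : V) : Set where
  constructor nonSuper
  field
   ab : NS a b
   ac : NS a c
   ad : NS a d
   bc : NS b c
   bd : NS b d
   cd : NS c d

 -- The role of the hub passes to `r`, the vertex outside the robust triple. Either `r` is blocked
 -- by a vertex of the triple or all three of them point.
 free-triple : ∀ {r a u w} → E r a u w → T3 a u w → NonSuper r a u w → ¬ I₁ r
  → ¬ I₄ a → ¬ I₄ u → ¬ I₄ w → P r a u w
 free-triple {r} {a} {u} {w} e t (nonSuper ra ru rw au aw uw) r₁ a₄ u₄ w₄ with U? r a | U? r u | U? r w
 ... | yes h | _ | _ = free-hub-arc e h ra au aw t (u₄ ∘ I₃⊆I₄) (w₄ ∘ I₃⊆I₄) w₄
 ... | no _ | yes h | _ = q1324 (free-hub-arc (p1324 e) h ru (NS-sym au) uw (T3-sym₁ t) (a₄ ∘ I₃⊆I₄) (w₄ ∘ I₃⊆I₄) w₄)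
 ... | no _ | no _ | yes h = q1342 (free-hub-arc (p1423 e) h rw (NS-sym aw) (NS-sym uw) (T3-sym₁ (T3-sym₂ t)) (a₄ ∘ I₃⊆I₄) (u₄ ∘ I₃⊆I₄) u₄)
 ... | no aU | no uU | no wU = three-pointers e r₁ (a₄ ∘ I₃⊆I₄ ∘ I₂⊆I₃) (u₄ ∘ I₃⊆I₄ ∘ I₂⊆I₃) (w₄ ∘ I₃⊆I₄ ∘ I₂⊆I₃)
  (a₄ ∘ I₃⊆I₄) (u₄ ∘ I₃⊆I₄) u₄ w₄ aU uU wU

 -- Here `u` and `w` lie in short lists at `a`, so `r` is the only free vertex. A triple that is not
 -- robust leaves fewer than `θ` choices for it; a robust one is treated according to the position
 -- of `a` among the forbidden lists.
 two-arcs : ∀ {a u w r} → E a u w r → NonSuper a u w r → U a u → Y′ a u w → ¬ I₁ a → ¬ I₁ r → ¬ I₂ u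
  → (I₄ r → I₄ a) → (I₃ u → I₃ a) → (I₄ u → I₄ a) → (I₄ w → I₄ a) → ¬ I₂ w → ¬ I₃ w → P a u w r
 two-arcs {a} {u} {w} {r} e (nonSuper au aw ar uw ur wr) u∈ w∈ a₁ r₁ u₂ r→a u→a₃ u→a w→a w₂ w₃ with I₄? r
 ... | yes r₄ = c14 (r→a r₄) u∈ w∈ r₄
 ... | no r₄ with T3? a u w
 ... | no ¬t = few e ¬t r₄ u∈ w∈
 ... | yes t with I₃? a
 ... | yes a₃ = c16 a₃ u∈ w∈
 ... | no a₃ with I₄? a
 ... | no a₄ = q2341 (free-triple (p4123 e) t (nonSuper (NS-sym ar) (NS-sym ur) (NS-sym wr) au aw uw) r₁ a₄ (a₄ ∘ u→a) (a₄ ∘ w→a))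
 ... | yes a₄ with Uᵀ? a u | Uᵀ? a w
 ... | yes h | _ = c17 a₄ h w∈
 ... | no _ | yes h = q1324 (c17 a₄ h (robust⇒Y′ (T3-sym₂ t) aw (a₃ ∘ u→a₃)))
 ... | no uU | no wU = c18 a₄ (robust⇒Yᵀ t a₁ u₂ (≢-sym (E-≢ e)) uU w₃ (≢-sym (E-≢₂₃ e)) wU)

 -- Since `u` belongs to the blocking set of `a`, it has only `K` choices; the other two vertices
 -- are controlled by `B₃`, by `B₄` or by the list `Y′ a u`.
 arc-case : ∀ {a u s t} → E a u s t → NonSuper a u s t → U a u → ¬ I₁ a → ¬ I₂ u → ¬ I₂ s → ¬ I₂ t → ¬ I₃ t
  → (I₃ u → I₃ a) → (I₄ u → I₄ a) → (I₃ s → I₃ a) → (I₄ s → I₄ a) → (I₄ t → I₄ s) → P a u s t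
 arc-case {a} {u} {s} {t} e ns@(nonSuper au as at us ut st) u∈ a₁ u₂ s₂ t₂ t₃ u→a₃ u→a₄ s→a₃ s→a₄ t→s₄ with I₃? s | I₄? t
 ... | yes s₃ | _ = c12 (s→a₃ s₃) u∈ s₃
 ... | no _ | yes t₄ = c13 (s→a₄ (t→s₄ t₄)) u∈ (t→s₄ t₄) t₄
 ... | no s₃ | no t₄ with Y′? a u s | Y′? a u t
 ... | yes h | _ = two-arcs e ns u∈ h a₁ (t₂ ∘ I₁⊆I₂) u₂ (⊥-elim ∘ t₄) u→a₃ u→a₄ s→a₄ s₂ s₃
 ... | no _ | yes h = q1243 (two-arcs (p1243 e) (nonSuper au at as ut us (NS-sym st)) u∈ h a₁ (s₂ ∘ I₁⊆I₂) u₂ s→a₄ u→a₃ u→a₄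
  (⊥-elim ∘ t₄) t₂ t₃)
 ... | no s∉ | no t∉ = low₂ e au s₃ t₄ s∉ t∉

 -- If no vertex lies in the blocking set of `a`, three pointers are available unless `b` lies in
 -- `B₃` or `c` in `B₄`. In these cases one pointer suffices, as two vertices already lie in that
 -- list.
 nonsuper-case : ∀ {a b c d} → E a b c d → NonSuper a b c d → lev a ≤ lev b → lev b ≤ lev c → lev c ≤ lev d
  → ¬ I₁ a → ¬ I₂ b → ¬ I₃ c → ¬ I₄ d → P a b c d
 nonsuper-case {a} {b} {c} {d} e ns@(nonSuper ab ac ad bc bd cd) a≤b b≤c c≤d a₁ b₂ c₃ d₄ with U? a b | U? a c | U? a d
 ... | yes h | _ | _ = arc-case e ns h a₁ b₂ (c₃ ∘ I₂⊆I₃) (d₄ ∘ I₃⊆I₄ ∘ I₂⊆I₃) (d₄ ∘ I₃⊆I₄)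
  (lev-down₃ a≤b) (lev-down₄ a≤b) (⊥-elim ∘ c₃) (lev-down₄ (≤-trans a≤b b≤c)) (⊥-elim ∘ d₄)
 ... | no _ | yes h | _ = q1324 (arc-case (p1324 e) (nonSuper ac ab ad (NS-sym bc) cd bd) h a₁ (c₃ ∘ I₂⊆I₃) b₂ (d₄ ∘ I₃⊆I₄ ∘ I₂⊆I₃) (d₄ ∘ I₃⊆I₄)
  (⊥-elim ∘ c₃) (lev-down₄ (≤-trans a≤b b≤c)) (lev-down₃ a≤b) (lev-down₄ a≤b) (⊥-elim ∘ d₄))
 ... | no _ | no _ | yes h = q1342 (arc-case (p1423 e) (nonSuper ad ab ac (NS-sym bd) (NS-sym cd) bc) h a₁ (d₄ ∘ I₃⊆I₄ ∘ I₂⊆I₃) b₂ (c₃ ∘ I₂⊆I₃) c₃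
  (⊥-elim ∘ d₄ ∘ I₃⊆I₄) (⊥-elim ∘ d₄) (lev-down₃ a≤b) (lev-down₄ a≤b) (lev-down₄ b≤c))
 ... | no bU | no cU | no dU with I₃? b
 ... | yes b₃ with pointer e a₁ b₂ bU c₃ cU d₄ dU
 ... | inj₁ h = c9 (lev-down₃ a≤b b₃) b₃ h
 ... | in₁ h = q1243 (c9 (lev-down₃ a≤b b₃) b₃ h)
 ... | inj₂ (inj₂ r) = r
 nonsuper-case {a} {b} {c} {d} e ns a≤b b≤c c≤d a₁ b₂ c₃ d₄ | no bU | no cU | no dU | no b₃ with I₄? c
 ... | no c₄ = three-pointers e a₁ b₂ (c₃ ∘ I₂⊆I₃) (d₄ ∘ I₃⊆I₄ ∘ I₂⊆I₃) b₃ c₃ c₄ d₄ bU cU dU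
 ... | yes c₄ with pointer e a₁ b₂ bU c₃ cU d₄ dU
 ... | inj₁ h = c10 (lev-down₄ (≤-trans a≤b b≤c) c₄) (lev-down₄ b≤c c₄) h
 ... | in₁ h = q1243 (c10 (lev-down₄ (≤-trans a≤b b≤c) c₄) (lev-down₄ b≤c c₄) h)
 ... | inj₂ (inj₂ r) = r

 -- Vertices sorted by level fail to fit as hub, child, grandchild and leaf only if, for some i, the
 -- first i of them lie in the i-th list; these edges make up the first four families. In all other
 -- cases the pairs decide: one of them is super or none is.
 sorted-case : ∀ {a b c d} → lev a ≤ lev b → lev b ≤ lev c → lev c ≤ lev d → E a b c d → P a b c d
 sorted-case {a} {b} {c} {d} a≤b b≤c c≤d e with I₁? a | I₂? b | I₃? c | I₄? d
 ... | yes h | _ | _ | _ = c0 h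
 ... | no _ | yes h | _ | _ = c1 (lev-down₂ a≤b h) h
 ... | no _ | no _ | yes h | _ = c2 (lev-down₃ (≤-trans a≤b b≤c) h) (lev-down₃ b≤c h) h
 ... | no _ | no _ | no _ | yes h = c3 (lev-down₄ (≤-trans a≤b (≤-trans b≤c c≤d)) h) (lev-down₄ (≤-trans b≤c c≤d) h) (lev-down₄ c≤d h) h
 ... | no a₁ | no b₂ | no c₃ | no d₄ with NS? a b | NS? a c | NS? a d | NS? b c | NS? b d | NS? c d
 ... | yes ab | yes ac | yes ad | yes bc | yes bd | yes cd = nonsuper-case e (nonSuper ab ac ad bc bd cd) a≤b b≤c c≤d a₁ b₂ c₃ d₄
 ... | no s | _ | _ | _ | _ | _ = super-case e s a₁ (b₂ ∘ I₁⊆I₂) (c₃ ∘ I₂⊆I₃ ∘ I₁⊆I₂) b₂ (d₄ ∘ I₃⊆I₄ ∘ I₂⊆I₃)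
 ... | yes _ | no s | _ | _ | _ | _ = q1324 (super-case (p1324 e) s a₁ (c₃ ∘ I₂⊆I₃ ∘ I₁⊆I₂) (b₂ ∘ I₁⊆I₂) (c₃ ∘ I₂⊆I₃) (d₄ ∘ I₃⊆I₄ ∘ I₂⊆I₃))
 ... | yes _ | yes _ | no s | _ | _ | _ = q1342 (super-case (p1423 e) s a₁ (d₄ ∘ I₃⊆I₄ ∘ I₂⊆I₃ ∘ I₁⊆I₂) (b₂ ∘ I₁⊆I₂) (d₄ ∘ I₃⊆I₄ ∘ I₂⊆I₃) (c₃ ∘ I₂⊆I₃))
 ... | yes _ | yes _ | yes _ | no s | _ | _ = q3124 (super-case (p2314 e) s (b₂ ∘ I₁⊆I₂) (c₃ ∘ I₂⊆I₃ ∘ I₁⊆I₂) a₁ (c₃ ∘ I₂⊆I₃) (d₄ ∘ I₃⊆I₄ ∘ I₂⊆I₃))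
 ... | yes _ | yes _ | yes _ | yes _ | no s | _ = q3142 (super-case (p2413 e) s (b₂ ∘ I₁⊆I₂) (d₄ ∘ I₃⊆I₄ ∘ I₂⊆I₃ ∘ I₁⊆I₂) a₁ (d₄ ∘ I₃⊆I₄ ∘ I₂⊆I₃) (c₃ ∘ I₂⊆I₃))
 ... | yes _ | yes _ | yes _ | yes _ | yes _ | no s = q3412 (super-case (p3412 e) s (c₃ ∘ I₂⊆I₃ ∘ I₁⊆I₂) (d₄ ∘ I₃⊆I₄ ∘ I₂⊆I₃ ∘ I₁⊆I₂) a₁ (d₄ ∘ I₃⊆I₄ ∘ I₂⊆I₃) b₂)

 main : ∀ {a b c d} → E a b c d → P a b c d
 main {a} {b} {c} {d} = sorted-wlog lev {λ a b c d → E a b c d → P a b c d}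
  ((λ f e → q2134 (f (p2134 e))) , (λ f e → q1324 (f (p1324 e))) , (λ f e → q1243 (f (p1243 e)))) sorted-case a b c d

-- The covering lists and their sizes.

starBound : (n b₁ b₂ b₃ b₄ x y z₀ : ℕ) → ℕ
starBound n b₁ b₂ b₃ b₄ x y z₀ =
  -- Every product stands for one family of quadruples, with one factor per vertex; factors other
  -- than `n` and the `bᵢ` bound lists that depend on the vertices chosen before.
  b₁ * (n * (n * n))
  + (b₂ * (b₂ * (n * n))
  + (b₃ * (b₃ * (b₃ * n))
  + (b₄ * (b₄ * (b₄ * b₄))
  + (n * (n * (n * z₀))
  + (n * (n * (n * z₀))
  + (n * (x * (n * x))
  + (n * (n * ((b₄ + K′) * x))
  + (b₂ * (x * (n * n))
  + (b₃ * (b₃ * (Y * n))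
  + (b₄ * (b₄ * (Y * n))
  + (n * (n * (Y * Y))
  + (b₃ * (K * (b₃ * n))
  + (b₄ * (K * (b₄ * b₄))
  + (b₄ * (K * (K′ * b₄))
  + (n * (K * (K′ * θ))
  + (b₃ * (K * (K′ * n))
  + (b₄ * (κ * (K′ * n))
  + (b₄ * (n * (y * n))
  + (n * (K * (K′ * K′)))))))))))))))))))))
 where
 z Y K K′ θ κ : ℕ
 z = suc z₀
 Y = y * suc z
 K = x * suc Y + 2
 K′ = K + Y
 θ = K′ + z
 κ = x * suc y + 1

module StarBound {n : ℕ} (E : Fin n → Fin n → Fin n → Fin n → Set) (E? : ∀ a b c d → Dec (E a b c d))
 (E-sym : SymClosed E) (E-≢ : ∀ {a b c d} → E a b c d → a ≢ b)
 (B₁ B₂ B₃ B₄ : List (Fin n))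
 (B₁⊆B₂ : ∀ {v} → v ∈ B₁ → v ∈ B₂) (B₂⊆B₃ : ∀ {v} → v ∈ B₂ → v ∈ B₃) (B₃⊆B₄ : ∀ {v} → v ∈ B₃ → v ∈ B₄)
 (x y z₀ : ℕ) (noStar : ¬ Star.FreeStar E E? E-sym E-≢ B₁ B₂ B₃ B₄ B₁⊆B₂ B₂⊆B₃ B₃⊆B₄ x y z₀) where

 open Star E E? E-sym E-≢ B₁ B₂ B₃ B₄ B₁⊆B₂ B₂⊆B₃ B₃⊆B₄ x y z₀
 open import Data.List.Membership.DecPropositional (F._≟_ {n}) using (_∈?_)
 open Perm E-sym

 take≤ : ∀ {A : Set} k (xs : List A) → length (take k xs) ≤ k
 take≤ k xs = ≤-trans (≤-reflexive (LP.length-take k xs)) (m⊓n≤m k (length xs))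

 ∈-take : ∀ {A : Set} k (xs : List A) {a} → length xs ≤ k → a ∈ xs → a ∈ take k xs
 ∈-take k xs le a∈ = subst (_ ∈_) (sym (LP.take-all k xs le)) a∈

 abstract

  hubCover : ∀ v → v ∈ B₁ ⊎ (∃ λ U → length U ≤ K × P₂ v U)
  hubCover v with v ∈? B₁
  ... | yes v∈ = inj₁ v∈
  ... | no v∉ with hub-cover v v∉
  ... | inj₁ s = ⊥-elim (noStar s)
  ... | inj₂ u = inj₂ u

  U : V → List V
  -- Vertices of `B₁` are never hubs; they get the empty list so that the length bound holds for all
  -- `v`.
  U v = [ (λ _ → []) , proj₁ ]′ (hubCover v)

  U≤ : ∀ v → length (U v) ≤ K
  U≤ v with hubCover v
  ... | inj₁ _ = z≤n
  ... | inj₂ (_ , l , _) = l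

  U-cover : ∀ {v} → v ∉ B₁ → P₂ v (U v)
  U-cover {v} v∉ with hubCover v
  ... | inj₁ v∈ = ⊥-elim (v∉ v∈)
  ... | inj₂ (_ , _ , h) = h

  petalCover : ∀ v w → (v ∈ B₁ ⊎ w ∈ B₂ ⊎ w ≡ v ⊎ w ∈ U v) ⊎ (∃ λ Z → length Z ≤ Y × P₁ v w (Z ++ w ∷ U v))
  petalCover v w = go (v ∈? B₁) (w ∈? B₂) (w F.≟ v) (w ∈? U v)
   where
   go : Dec (v ∈ B₁) → Dec (w ∈ B₂) → Dec (w ≡ v) → Dec (w ∈ U v)
    → (v ∈ B₁ ⊎ w ∈ B₂ ⊎ w ≡ v ⊎ w ∈ U v) ⊎ (∃ λ Z → length Z ≤ Y × P₁ v w (Z ++ w ∷ U v))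
   go (yes h) _ _ _ = inj₁ (inj₁ h)
   go (no _) (yes h) _ _ = inj₁ (in₁ h)
   go (no _) (no _) (yes h) _ = inj₁ (in₂ h)
   go (no _) (no _) (no _) (yes h) = inj₁ (in₃ h)
   go (no v∉) (no w∉) (no w≢) (no w∉U) = inj₂ (U-cover v∉ w w∉ w≢ w∉U)

  Yh : V → V → List V
  Yh v w = [ (λ _ → []) , proj₁ ]′ (petalCover v w)

  Yh≤ : ∀ v w → length (Yh v w) ≤ Y
  Yh≤ v w with petalCover v w
  ... | inj₁ _ = z≤n
  ... | inj₂ (_ , l , _) = l

  Yh-cover : ∀ {v w} → v ∉ B₁ → w ∉ B₂ → w ≢ v → w ∉ U v → P₁ v w (Yh v w ++ w ∷ U v)
  Yh-cover {v} {w} v∉ w∉ w≢ w∉U with petalCover v w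
  ... | inj₁ (inj₁ h) = ⊥-elim (v∉ h)
  ... | inj₁ (in₁ h) = ⊥-elim (w∉ h)
  ... | inj₁ (in₂ h) = ⊥-elim (w≢ h)
  ... | inj₁ (in₃ h) = ⊥-elim (w∉U h)
  ... | inj₂ (_ , _ , h) = h

  Y′ : V → V → List V
  Y′ v w with NS? v w
  ... | yes (S , _) = Vec.toList S
  ... | no _ = []

  Y′≤ : ∀ v w → length (Y′ v w) ≤ K′
  Y′≤ v w with NS? v w
  ... | yes (S , _) = ≤-reflexive (VP.length-toList S)
  ... | no _ = z≤n

  Y′-cover : ∀ {v w} → NS v w → P₁ v w (Y′ v w)
  Y′-cover {v} {w} ns with NS? v w
  ... | yes (S , h) = h
  ... | no ¬ns = ⊥-elim (¬ns ns)

  Qn : V → List V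
  Qn v = take x (superNbrs v)

  Qn≤ : ∀ v → length (Qn v) ≤ x
  Qn≤ v = take≤ x (superNbrs v)

  -- Without a free star, `super-star` leaves at most `x` super neighbours, so the truncation to `x`
  -- entries loses none of them.
  ∈-Qn : ∀ {v w} → v ∉ B₁ → ¬ NS v w → w ∉ B₂ → w ≢ v → w ∈ Qn v
  ∈-Qn {v} {w} v∉ sup w∉ w≢ = ∈-take x (superNbrs v) (≰⇒≥ λ le → noStar (super-star v v∉ le))
   (∈-filter⁺ (superNbr? v) (∈-allFin w) (sup , w∉ , w≢))

  robustCover : ∀ v → v ∈ B₁ ⊎ (∃ λ U → length U ≤ κ × P₂ᵀ v U)
  robustCover v with v ∈? B₁
  ... | yes v∈ = inj₁ v∈
  ... | no v∉ with robust-cover v v∉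
  ... | inj₁ s = ⊥-elim (noStar s)
  ... | inj₂ u = inj₂ u

  Uᵀ : V → List V
  Uᵀ v = [ (λ _ → []) , proj₁ ]′ (robustCover v)

  Uᵀ≤ : ∀ v → length (Uᵀ v) ≤ κ
  Uᵀ≤ v with robustCover v
  ... | inj₁ _ = z≤n
  ... | inj₂ (_ , l , _) = l

  Uᵀ-cover : ∀ {v} → v ∉ B₁ → P₂ᵀ v (Uᵀ v)
  Uᵀ-cover {v} v∉ with robustCover v
  ... | inj₁ v∈ = ⊥-elim (v∉ v∈)
  ... | inj₂ (_ , _ , h) = h

  petalCoverᵀ : ∀ v w → (v ∈ B₁ ⊎ w ∈ B₂ ⊎ w ≡ v ⊎ w ∈ Uᵀ v) ⊎ (∃ λ Z → length Z ≤ y × P₁ᵀ v w (Z ++ w ∷ Uᵀ v))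
  petalCoverᵀ v w = go (v ∈? B₁) (w ∈? B₂) (w F.≟ v) (w ∈? Uᵀ v)
   where
   go : Dec (v ∈ B₁) → Dec (w ∈ B₂) → Dec (w ≡ v) → Dec (w ∈ Uᵀ v)
    → (v ∈ B₁ ⊎ w ∈ B₂ ⊎ w ≡ v ⊎ w ∈ Uᵀ v) ⊎ (∃ λ Z → length Z ≤ y × P₁ᵀ v w (Z ++ w ∷ Uᵀ v))
   go (yes h) _ _ _ = inj₁ (inj₁ h)
   go (no _) (yes h) _ _ = inj₁ (in₁ h)
   go (no _) (no _) (yes h) _ = inj₁ (in₂ h)
   go (no _) (no _) (no _) (yes h) = inj₁ (in₃ h)
   go (no v∉) (no w∉) (no w≢) (no w∉U) = inj₂ (Uᵀ-cover v∉ w w∉ w≢ w∉U)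

  Yᵀ : V → V → List V
  Yᵀ v w = [ (λ _ → []) , proj₁ ]′ (petalCoverᵀ v w)

  Yᵀ≤ : ∀ v w → length (Yᵀ v w) ≤ y
  Yᵀ≤ v w with petalCoverᵀ v w
  ... | inj₁ _ = z≤n
  ... | inj₂ (_ , l , _) = l

  Yᵀ-cover : ∀ {v w} → v ∉ B₁ → w ∉ B₂ → w ≢ v → w ∉ Uᵀ v → P₁ᵀ v w (Yᵀ v w ++ w ∷ Uᵀ v)
  Yᵀ-cover {v} {w} v∉ w∉ w≢ w∉U with petalCoverᵀ v w
  ... | inj₁ (inj₁ h) = ⊥-elim (v∉ h)
  ... | inj₁ (in₁ h) = ⊥-elim (w∉ h)
  ... | inj₁ (in₂ h) = ⊥-elim (w≢ h)
  ... | inj₁ (in₃ h) = ⊥-elim (w∉U h)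
  ... | inj₂ (_ , _ , h) = h

  -- Otherwise the triple would have at most `K′` leaves inside `Y′ v w` and `z₀` outside, one less
  -- than `θ` in total.
  robust⇒∈Y′ : ∀ {v w p} → T3 v w p → NS v w → p ∉ B₃ → p ∈ Y′ v w
  robust⇒∈Y′ {v} {w} {p} t ns p∉ with p ∈? Y′ v w
  ... | yes h = h
  ... | no p∉Y = ⊥-elim (<-irrefl refl (≤-trans (s≤s (≤-trans t (≤-trans (outs-drop v w p (Y′ v w))
   (+-mono-≤ (Y′≤ v w) (Y′-cover ns p p∉ p∉Y))))) (≤-reflexive (sym (+-suc K′ z₀)))))

  -- lev v is the number of the Bᵢ that do not contain v.
  lev : V → ℕ
  lev v with v ∈? B₁ | v ∈? B₂ | v ∈? B₃ | v ∈? B₄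
  ... | yes _ | _ | _ | _ = 0
  ... | no _ | yes _ | _ | _ = 1
  ... | no _ | no _ | yes _ | _ = 2
  ... | no _ | no _ | no _ | yes _ = 3
  ... | no _ | no _ | no _ | no _ = 4

  lev-down₂ : ∀ {a b} → lev a ≤ lev b → b ∈ B₂ → a ∈ B₂
  lev-down₂ {a} {b} le b∈ with a ∈? B₁ | a ∈? B₂ | a ∈? B₃ | a ∈? B₄ | b ∈? B₁ | b ∈? B₂ | b ∈? B₃ | b ∈? B₄
  ... | yes i | _ | _ | _ | _ | _ | _ | _ = B₁⊆B₂ i
  ... | no _ | yes i | _ | _ | _ | _ | _ | _ = i
  ... | no _ | no _ | _ | _ | _ | no j | _ | _ = ⊥-elim (j b∈)
  lev-down₂ () b∈ | no _ | no _ | yes _ | _ | yes _ | _ | _ | _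
  lev-down₂ () b∈ | no _ | no _ | no _ | yes _ | yes _ | _ | _ | _
  lev-down₂ () b∈ | no _ | no _ | no _ | no _ | yes _ | _ | _ | _
  lev-down₂ (s≤s ()) b∈ | no _ | no _ | yes _ | _ | no _ | yes _ | _ | _
  lev-down₂ (s≤s ()) b∈ | no _ | no _ | no _ | yes _ | no _ | yes _ | _ | _
  lev-down₂ (s≤s ()) b∈ | no _ | no _ | no _ | no _ | no _ | yes _ | _ | _

  lev≤2 : ∀ {b} → b ∈ B₃ → lev b ≤ 2
  lev≤2 {b} b∈ with b ∈? B₁ | b ∈? B₂ | b ∈? B₃ | b ∈? B₄
  ... | yes _ | _ | _ | _ = z≤n
  ... | no _ | yes _ | _ | _ = s≤s z≤n
  ... | no _ | no _ | yes _ | _ = ≤-refl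
  ... | no _ | no _ | no j | _ = ⊥-elim (j b∈)

  lev≤2⁻ : ∀ {a} → lev a ≤ 2 → a ∈ B₃
  lev≤2⁻ {a} le with a ∈? B₁ | a ∈? B₂ | a ∈? B₃ | a ∈? B₄
  ... | yes i | _ | _ | _ = B₂⊆B₃ (B₁⊆B₂ i)
  ... | no _ | yes i | _ | _ = B₂⊆B₃ i
  ... | no _ | no _ | yes i | _ = i
  lev≤2⁻ (s≤s (s≤s ())) | no _ | no _ | no _ | yes _
  lev≤2⁻ (s≤s (s≤s ())) | no _ | no _ | no _ | no _

  lev≤3 : ∀ {b} → b ∈ B₄ → lev b ≤ 3
  lev≤3 {b} b∈ with b ∈? B₁ | b ∈? B₂ | b ∈? B₃ | b ∈? B₄
  ... | yes _ | _ | _ | _ = z≤n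
  ... | no _ | yes _ | _ | _ = s≤s z≤n
  ... | no _ | no _ | yes _ | _ = s≤s (s≤s z≤n)
  ... | no _ | no _ | no _ | yes _ = ≤-refl
  ... | no _ | no _ | no _ | no j = ⊥-elim (j b∈)

  lev≤3⁻ : ∀ {a} → lev a ≤ 3 → a ∈ B₄
  lev≤3⁻ {a} le with a ∈? B₁ | a ∈? B₂ | a ∈? B₃ | a ∈? B₄
  ... | yes i | _ | _ | _ = B₃⊆B₄ (B₂⊆B₃ (B₁⊆B₂ i))
  ... | no _ | yes i | _ | _ = B₃⊆B₄ (B₂⊆B₃ i)
  ... | no _ | no _ | yes i | _ = B₃⊆B₄ i
  ... | no _ | no _ | no _ | yes i = i
  lev≤3⁻ (s≤s (s≤s (s≤s ()))) | no _ | no _ | no _ | no _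

  lev-down₃ : ∀ {a b} → lev a ≤ lev b → b ∈ B₃ → a ∈ B₃
  lev-down₃ le b∈ = lev≤2⁻ (≤-trans le (lev≤2 b∈))

  lev-down₄ : ∀ {a b} → lev a ≤ lev b → b ∈ B₄ → a ∈ B₄
  lev-down₄ le b∈ = lev≤3⁻ (≤-trans le (lev≤3 b∈))

 -- The truncation makes the length bound unconditional; wherever the covering property applies, it
 -- removes nothing.
 Low₁ : V → V → V → List V
 Low₁ v w p = take z₀ (outs v w p (Yh v w ++ w ∷ U v))

 Low₂ : V → V → V → List V
 Low₂ v w p = take z₀ (outs v w p (Y′ v w))

 NT : V → V → V → List V
 NT v u w = take θ (outs v u w [])

 avoid : ∀ {w Z F} {r : V} → r ∉ Z → r ≢ w → r ∉ F → r ∉ Z ++ w ∷ F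
 avoid {Z = Z} a b c r∈ with ∈-++⁻ Z r∈
 ... | inj₁ h = a h
 ... | inj₂ (here h) = b h
 ... | inj₂ (there h) = c h

 robust⇒∈Yᵀ : ∀ {v w p} → T3 v w p → v ∉ B₁ → w ∉ B₂ → w ≢ v → w ∉ Uᵀ v → p ∉ B₃ → p ≢ w → p ∉ Uᵀ v → p ∈ Yᵀ v w
 robust⇒∈Yᵀ {v} {w} {p} t v₁ w₂ w≢ wU p₃ p≢ pU with p ∈? Yᵀ v w
 ... | yes h = h
 ... | no p∉ = ⊥-elim (Yᵀ-cover v₁ w₂ w≢ wU p p₃ (avoid p∉ p≢ pU) t)

 vs : List V
 vs = allFin n

 vs≤ : length vs ≤ n
 vs≤ = ≤-reflexive (LP.length-tabulate id)

 record QuadSpec : Set where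
  constructor spec
  field
   as : List V
   f : V → List V
   g : V → V → List V
   h : V → V → V → List V
  list : List (Quad V)
  list = quads as f g h

 -- The k-th family has the size of the k-th summand of starBound.
 Qs : List QuadSpec
 Qs = spec B₁ (λ _ → vs) (λ _ _ → vs) (λ _ _ _ → vs)
  ∷ spec B₂ (λ _ → B₂) (λ _ _ → vs) (λ _ _ _ → vs)
  ∷ spec B₃ (λ _ → B₃) (λ _ _ → B₃) (λ _ _ _ → vs)
  ∷ spec B₄ (λ _ → B₄) (λ _ _ → B₄) (λ _ _ _ → B₄)
  ∷ spec vs (λ _ → vs) (λ _ _ → vs) Low₁
  ∷ spec vs (λ _ → vs) (λ _ _ → vs) Low₂
  ∷ spec vs Qn (λ _ _ → vs) (λ _ _ c → Qn c)
  ∷ spec vs (λ _ → vs) (λ a b → B₄ ++ Y′ a b) (λ _ _ c → Qn c)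
  ∷ spec B₂ Qn (λ _ _ → vs) (λ _ _ _ → vs)
  ∷ spec B₃ (λ _ → B₃) Yh (λ _ _ _ → vs)
  ∷ spec B₄ (λ _ → B₄) Yh (λ _ _ _ → vs)
  ∷ spec vs (λ _ → vs) Yh (λ a _ c → Yh a c)
  ∷ spec B₃ U (λ _ _ → B₃) (λ _ _ _ → vs)
  ∷ spec B₄ U (λ _ _ → B₄) (λ _ _ _ → B₄)
  ∷ spec B₄ U Y′ (λ _ _ _ → B₄)
  ∷ spec vs U Y′ NT
  ∷ spec B₃ U Y′ (λ _ _ _ → vs)
  ∷ spec B₄ Uᵀ Y′ (λ _ _ _ → vs)
  ∷ spec B₄ (λ _ → vs) Yᵀ (λ _ _ _ → vs)
  ∷ spec vs U Y′ (λ _ b c → Y′ b c)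
  ∷ []

 Q : List (Quad V)
 Q = concatMap QuadSpec.list Qs

 family : Fin 20 → QuadSpec
 family = L.lookup Qs

 ∈Q : ∀ k {a b c d} → a ∈ QuadSpec.as (family k) → b ∈ QuadSpec.f (family k) a → c ∈ QuadSpec.g (family k) a b → d ∈ QuadSpec.h (family k) a b c
  → (a , b , c , d) ∈ Q
 ∈Q k p q r t = ∈-concatMap QuadSpec.list {xs = Qs} (∈-lookup {xs = Qs} k) (∈-quads {as = as} {f = f} {g = g} {h = h} p q r t)
  where open QuadSpec (family k)

 open F using (#_)

 Q≤ : length Q ≤ starBound n (length B₁) (length B₂) (length B₃) (length B₄) x y z₀
 Q≤ = ⊞ (# 0) ≤-refl (λ _ → vs≤) (λ _ _ → vs≤) (λ _ _ _ → vs≤)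
  (⊞ (# 1) ≤-refl (λ _ → ≤-refl) (λ _ _ → vs≤) (λ _ _ _ → vs≤)
  (⊞ (# 2) ≤-refl (λ _ → ≤-refl) (λ _ _ → ≤-refl) (λ _ _ _ → vs≤)
  (⊞ (# 3) ≤-refl (λ _ → ≤-refl) (λ _ _ → ≤-refl) (λ _ _ _ → ≤-refl)
  (⊞ (# 4) vs≤ (λ _ → vs≤) (λ _ _ → vs≤) (λ _ _ _ → take≤ z₀ _)
  (⊞ (# 5) vs≤ (λ _ → vs≤) (λ _ _ → vs≤) (λ _ _ _ → take≤ z₀ _)
  (⊞ (# 6) vs≤ Qn≤ (λ _ _ → vs≤) (λ _ _ c → Qn≤ c)
  (⊞ (# 7) vs≤ (λ _ → vs≤) (λ a b → ≤-trans (≤-reflexive (LP.length-++ B₄)) (+-monoʳ-≤ (length B₄) (Y′≤ a b))) (λ _ _ c → Qn≤ c)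
  (⊞ (# 8) ≤-refl Qn≤ (λ _ _ → vs≤) (λ _ _ _ → vs≤)
  (⊞ (# 9) ≤-refl (λ _ → ≤-refl) Yh≤ (λ _ _ _ → vs≤)
  (⊞ (# 10) ≤-refl (λ _ → ≤-refl) Yh≤ (λ _ _ _ → vs≤)
  (⊞ (# 11) vs≤ (λ _ → vs≤) Yh≤ (λ a _ c → Yh≤ a c)
  (⊞ (# 12) ≤-refl U≤ (λ _ _ → ≤-refl) (λ _ _ _ → vs≤)
  (⊞ (# 13) ≤-refl U≤ (λ _ _ → ≤-refl) (λ _ _ _ → ≤-refl)
  (⊞ (# 14) ≤-refl U≤ Y′≤ (λ _ _ _ → ≤-refl)
  (⊞ (# 15) vs≤ U≤ Y′≤ (λ _ _ _ → take≤ θ _)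
  (⊞ (# 16) ≤-refl U≤ Y′≤ (λ _ _ _ → vs≤)
  (⊞ (# 17) ≤-refl Uᵀ≤ Y′≤ (λ _ _ _ → vs≤)
  (⊞ (# 18) ≤-refl (λ _ → vs≤) Yᵀ≤ (λ _ _ _ → vs≤)
  (≤-trans (⊞ (# 19) vs≤ U≤ Y′≤ (λ _ b c → Y′≤ b c) z≤n) (≤-reflexive (+-identityʳ _)))))))))))))))))))))
  where
  ⊞ : ∀ i {ys : List (Quad V)} {k₁ k₂ k₃ k₄ b} → let open QuadSpec (family i) in length as ≤ k₁ → (∀ a → length (f a) ≤ k₂) → (∀ a b → length (g a b) ≤ k₃)
   → (∀ a b c → length (h a b c) ≤ k₄) → length ys ≤ b → length (list ++ ys) ≤ k₁ * (k₂ * (k₃ * k₄)) + b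
  ⊞ i l₁ l₂ l₃ l₄ p = ≤-trans (≤-reflexive (LP.length-++ list)) (+-mono-≤ (length-quads {as = as} {f = f} {g = g} {h = h} l₁ l₂ l₃ l₄) p)
   where open QuadSpec (family i)

 all∈ : ∀ {v} → v ∈ vs
 all∈ {v} = ∈-allFin v

 cases : (P : V → V → V → V → Set) → SymClosed P → (∀ {a b c d} → (a , b , c , d) ∈ Q → P a b c d) → StarCases
 cases P P-sym hyp = record
  { V = V ; E = E ; P = P ; E-sym = E-sym ; P-sym = P-sym ; E-≢ = E-≢ ; lev = lev
  ; I₁ = _∈ B₁ ; I₂ = _∈ B₂ ; I₃ = _∈ B₃ ; I₄ = _∈ B₄
  ; I₁? = _∈? B₁ ; I₂? = _∈? B₂ ; I₃? = _∈? B₃ ; I₄? = _∈? B₄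
  ; I₁⊆I₂ = B₁⊆B₂ ; I₂⊆I₃ = B₂⊆B₃ ; I₃⊆I₄ = B₃⊆B₄
  ; lev-down₂ = lev-down₂ ; lev-down₃ = lev-down₃ ; lev-down₄ = lev-down₄
  ; U = λ v w → w ∈ U v ; Uᵀ = λ v w → w ∈ Uᵀ v ; Qn = λ v w → w ∈ Qn v
  ; U? = λ v w → w ∈? U v ; Uᵀ? = λ v w → w ∈? Uᵀ v
  ; Yh = λ v w p → p ∈ Yh v w ; Y′ = λ v w p → p ∈ Y′ v w ; Yᵀ = λ v w p → p ∈ Yᵀ v w
  ; Yh? = λ v w p → p ∈? Yh v w ; Y′? = λ v w p → p ∈? Y′ v w ; Yᵀ? = λ v w p → p ∈? Yᵀ v w
  ; NS = NS ; NS? = NS? ; NS-sym = NS-sym ; T3 = T3 ; T3? = T3? ; T3-sym₁ = T3-sym₁ ; T3-sym₂ = T3-sym₂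
  ; super⇒Qn = ∈-Qn
  ; robust⇒Y′ = robust⇒∈Y′
  ; robust⇒Yᵀ = robust⇒∈Yᵀ
  ; low₁ = λ e v₁ w₂ wU p₃ pU q₄ qU p∉ q∉ → hyp (∈Q (# 4) all∈ all∈ all∈ (∈-take z₀ _
   (Yh-cover v₁ w₂ (≢-sym (E-≢ e)) wU _ p₃ (avoid p∉ (≢-sym (E-≢₂₃ e)) pU))
   (∈-outs⁺ e q₄ (avoid q∉ (≢-sym (E-≢₂₄ e)) qU))))
  ; low₂ = λ e ns p₃ q₄ p∉ q∉ → hyp (∈Q (# 5) all∈ all∈ all∈ (∈-take z₀ _ (Y′-cover ns _ p₃ p∉) (∈-outs⁺ e q₄ q∉)))
  ; few = λ e ¬t r₄ u∈ w∈ → hyp (∈Q (# 15) all∈ u∈ w∈ (∈-take θ _ (<⇒≤ (≰⇒> ¬t)) (∈-outs⁺ e r₄ λ ())))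
  ; c0 = λ a → hyp (∈Q (# 0) a all∈ all∈ all∈)
  ; c1 = λ a b → hyp (∈Q (# 1) a b all∈ all∈)
  ; c2 = λ a b c → hyp (∈Q (# 2) a b c all∈)
  ; c3 = λ a b c d → hyp (∈Q (# 3) a b c d)
  ; c6 = λ b d → hyp (∈Q (# 6) all∈ b all∈ d)
  ; c7 = λ c d → hyp (∈Q (# 7) all∈ all∈ ([ ∈-++⁺ˡ , ∈-++⁺ʳ B₄ ]′ c) d)
  ; c8 = λ a b → hyp (∈Q (# 8) a b all∈ all∈)
  ; c9 = λ a b c → hyp (∈Q (# 9) a b c all∈)
  ; c10 = λ a b c → hyp (∈Q (# 10) a b c all∈)
  ; c11 = λ c d → hyp (∈Q (# 11) all∈ all∈ c d)
  ; c12 = λ a b c → hyp (∈Q (# 12) a b c all∈)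
  ; c13 = λ a b c d → hyp (∈Q (# 13) a b c d)
  ; c14 = λ a b c d → hyp (∈Q (# 14) a b c d)
  ; c16 = λ a b c → hyp (∈Q (# 16) a b c all∈)
  ; c17 = λ a b c → hyp (∈Q (# 17) a b c all∈)
  ; c18 = λ a c → hyp (∈Q (# 18) a all∈ c all∈)
  ; c19 = λ b c d → hyp (∈Q (# 19) all∈ b c d)
  }

 covered : (P : V → V → V → V → Set) → SymClosed P → (∀ {a b c d} → (a , b , c , d) ∈ Q → P a b c d)
  → ∀ {a b c d} → E a b c d → P a b c d
 covered P P-sym hyp = StarCaseAnalysis.main (cases P P-sym hyp)

-- Graphs and forbidden graphs given by 4-partite lists of tuples

Edge : ∀ {n} → Graph4 n → Fin n → Fin n → Fin n → Fin n → Set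
Edge G a b c d = ∃ λ s → s ∈ edges G × Rep s a b c d

Edge-sym : ∀ {n} (G : Graph4 n) → SymClosed (Edge G)
Edge-sym G = (λ (s , s∈ , r) → s , s∈ , rep-swap₁ r) , (λ (s , s∈ , r) → s , s∈ , rep-swap₂ r)
 , (λ (s , s∈ , r) → s , s∈ , rep-swap₃ r)

Edge? : ∀ {n} (G : Graph4 n) a b c d → Dec (Edge G a b c d)
Edge? {n} G a b c d = map′ to from (Any.any? rep? (edges G))
 where
 rep? : ∀ s → Dec (Rep s a b c d)
 rep? s with a F.≟ b | a F.≟ c | a F.≟ d | b F.≟ c | b F.≟ d | c F.≟ d | subset-≟ s (set4 a b c d)
 ... | yes e | _ | _ | _ | _ | _ | _ = no λ r → Rep.ab r e
 ... | _ | yes e | _ | _ | _ | _ | _ = no λ r → Rep.ac r e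
 ... | _ | _ | yes e | _ | _ | _ | _ = no λ r → Rep.ad r e
 ... | _ | _ | _ | yes e | _ | _ | _ = no λ r → Rep.bc r e
 ... | _ | _ | _ | _ | yes e | _ | _ = no λ r → Rep.bd r e
 ... | _ | _ | _ | _ | _ | yes e | _ = no λ r → Rep.cd r e
 ... | no ab | no ac | no ad | no bc | no bd | no cd | yes refl = yes (set4-rep ab ac ad bc bd cd)
 ... | no ab | no ac | no ad | no bc | no bd | no cd | no s≢ = no λ r → s≢ (rep-unique r (set4-rep ab ac ad bc bd cd))
 to : Any (λ s → Rep s a b c d) (edges G) → Edge G a b c d
 to p = let (s , s∈ , r) = find p in s , s∈ , r
  where open import Data.List.Membership.Propositional using (find)
 from : Edge G a b c d → Any (λ s → Rep s a b c d) (edges G)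
 from (s , s∈ , r) = lose s∈ r
  where open import Data.List.Membership.Propositional using (lose)

rep-cong : ∀ {n} {s : S.Subset n} {a b c d a′ b′ c′ d′} → a ≡ a′ → b ≡ b′ → c ≡ c′ → d ≡ d′ → Rep s a b c d → Rep s a′ b′ c′ d′
rep-cong refl refl refl refl r = r

Parts : (k₀ k₁ k₂ k₃ : ℕ) → Set
Parts k₀ k₁ k₂ k₃ = Fin k₀ ⊎ (Fin k₁ ⊎ (Fin k₂ ⊎ Fin k₃))

Tuple : (k₀ k₁ k₂ k₃ : ℕ) → Set
Tuple k₀ k₁ k₂ k₃ = Fin k₀ × Fin k₁ × Fin k₂ × Fin k₃

module Partite (k₀ k₁ k₂ k₃ : ℕ) where

 pattern at₀ a = inj₁ a
 pattern at₁ b = inj₂ (inj₁ b)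
 pattern at₂ c = inj₂ (inj₂ (inj₁ c))
 pattern at₃ d = inj₂ (inj₂ (inj₂ d))

 size : ℕ
 size = k₀ + (k₁ + (k₂ + k₃))

 split : Fin size → Parts k₀ k₁ k₂ k₃
 split i with F.splitAt k₀ i
 ... | inj₁ a = at₀ a
 ... | inj₂ j with F.splitAt k₁ j
 ... | inj₁ b = at₁ b
 ... | inj₂ l with F.splitAt k₂ l
 ... | inj₁ c = at₂ c
 ... | inj₂ d = at₃ d

 glue : Parts k₀ k₁ k₂ k₃ → Fin size
 glue (at₀ a) = a F.↑ˡ _
 glue (at₁ b) = k₀ F.↑ʳ (b F.↑ˡ _)
 glue (at₂ c) = k₀ F.↑ʳ (k₁ F.↑ʳ (c F.↑ˡ _))
 glue (at₃ d) = k₀ F.↑ʳ (k₁ F.↑ʳ (k₂ F.↑ʳ d))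

 split-glue : ∀ p → split (glue p) ≡ p
 split-glue (at₀ a) rewrite FP.splitAt-↑ˡ k₀ a (k₁ + (k₂ + k₃)) = refl
 split-glue (at₁ b) rewrite FP.splitAt-↑ʳ k₀ (k₁ + (k₂ + k₃)) (b F.↑ˡ (k₂ + k₃)) | FP.splitAt-↑ˡ k₁ b (k₂ + k₃) = refl
 split-glue (at₂ c) rewrite FP.splitAt-↑ʳ k₀ (k₁ + (k₂ + k₃)) (k₁ F.↑ʳ (c F.↑ˡ k₃)) | FP.splitAt-↑ʳ k₁ (k₂ + k₃) (c F.↑ˡ k₃)
  | FP.splitAt-↑ˡ k₂ c k₃ = refl
 split-glue (at₃ d) rewrite FP.splitAt-↑ʳ k₀ (k₁ + (k₂ + k₃)) (k₁ F.↑ʳ (k₂ F.↑ʳ d)) | FP.splitAt-↑ʳ k₁ (k₂ + k₃) (k₂ F.↑ʳ d)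
  | FP.splitAt-↑ʳ k₂ k₃ d = refl

 glue-split : ∀ i → glue (split i) ≡ i
 glue-split i with F.splitAt k₀ i in e₀
 ... | inj₁ a = FP.splitAt⁻¹-↑ˡ e₀
 ... | inj₂ j with F.splitAt k₁ j in e₁
 ... | inj₁ b = trans (cong (k₀ F.↑ʳ_) (FP.splitAt⁻¹-↑ˡ e₁)) (FP.splitAt⁻¹-↑ʳ e₀)
 ... | inj₂ l with F.splitAt k₂ l in e₂
 ... | inj₁ c = trans (cong (k₀ F.↑ʳ_) (trans (cong (k₁ F.↑ʳ_) (FP.splitAt⁻¹-↑ˡ e₂)) (FP.splitAt⁻¹-↑ʳ e₁))) (FP.splitAt⁻¹-↑ʳ e₀)
 ... | inj₂ d = trans (cong (k₀ F.↑ʳ_) (trans (cong (k₁ F.↑ʳ_) (FP.splitAt⁻¹-↑ʳ e₂)) (FP.splitAt⁻¹-↑ʳ e₁))) (FP.splitAt⁻¹-↑ʳ e₀)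

 module _ {n : ℕ} (le : size ≤ n) where

  ι : Parts k₀ k₁ k₂ k₃ → Fin n
  ι p = F.inject≤ (glue p) le

  ι-inj : ∀ {p q} → ι p ≡ ι q → p ≡ q
  ι-inj {p} {q} e = trans (sym (split-glue p)) (trans (cong split (FP.inject≤-injective le le _ _ e)) (split-glue q))

  tupleSet : Tuple k₀ k₁ k₂ k₃ → S.Subset n
  tupleSet (a , b , c , d) = set4 (ι (at₀ a)) (ι (at₁ b)) (ι (at₂ c)) (ι (at₃ d))

  tuple-rep : ∀ ((a , b , c , d) : Tuple k₀ k₁ k₂ k₃) → Rep (tupleSet (a , b , c , d)) (ι (at₀ a)) (ι (at₁ b)) (ι (at₂ c)) (ι (at₃ d))
  tuple-rep (a , b , c , d) = set4-rep (ι-≢ {at₀ a} {at₁ b} λ ()) (ι-≢ {at₀ a} {at₂ c} λ ()) (ι-≢ {at₀ a} {at₃ d} λ ())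
   (ι-≢ {at₁ b} {at₂ c} λ ()) (ι-≢ {at₁ b} {at₃ d} λ ()) (ι-≢ {at₂ c} {at₃ d} λ ())
   where
   ι-≢ : ∀ {p q} → p ≢ q → ι p ≢ ι q
   ι-≢ ne e = ne (ι-inj e)

  tupleSet-inj : ∀ {t t′} → tupleSet t ≡ tupleSet t′ → t ≡ t′
  tupleSet-inj {t@(a , b , c , d)} {t′@(a′ , b′ , c′ , d′)} e = cong₂ _,_ ea (cong₂ _,_ eb (cong₂ _,_ ec ed))
   where
   there′ : ∀ {i} → i S.∈ tupleSet t → i ≡ ι (at₀ a′) ⊎ i ≡ ι (at₁ b′) ⊎ i ≡ ι (at₂ c′) ⊎ i ≡ ι (at₃ d′)
   there′ i∈ = Rep.only (tuple-rep t′) (subst (_ S.∈_) e i∈)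
   find : ∀ {p} → ι p S.∈ tupleSet t → p ≡ at₀ a′ ⊎ p ≡ at₁ b′ ⊎ p ≡ at₂ c′ ⊎ p ≡ at₃ d′
   find p∈ with there′ p∈
   ... | inj₁ q = inj₁ (ι-inj q)
   ... | in₁ q = in₁ (ι-inj q)
   ... | in₂ q = in₂ (ι-inj q)
   ... | in₃ q = in₃ (ι-inj q)
   ea : a ≡ a′
   ea with find {at₀ a} (Rep.∈a (tuple-rep t))
   ... | inj₁ refl = refl
   ... | in₁ ()
   ... | in₂ ()
   ... | in₃ ()
   eb : b ≡ b′
   eb with find {at₁ b} (Rep.∈b (tuple-rep t))
   ... | in₁ refl = refl
   ... | inj₁ ()
   ... | in₂ ()
   ... | in₃ ()
   ec : c ≡ c′
   ec with find {at₂ c} (Rep.∈c (tuple-rep t))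
   ... | in₂ refl = refl
   ... | inj₁ ()
   ... | in₁ ()
   ... | in₃ ()
   ed : d ≡ d′
   ed with find {at₃ d} (Rep.∈d (tuple-rep t))
   ... | in₃ refl = refl
   ... | inj₁ ()
   ... | in₁ ()
   ... | in₂ ()

  graphOf : (es : List (Tuple k₀ k₁ k₂ k₃)) → Unique es → Graph4 n
  graphOf es u = record { edges = map tupleSet es ; distinct = Uniq.map⁺ tupleSet-inj u
   ; uniform = AllP.map⁺ (All.tabulate λ {t} _ → rep⇒∣∣≡4 (tuple-rep t)) }

 hyperOf : (es : List (Tuple k₀ k₁ k₂ k₃)) → Unique es → Hyper4
 hyperOf es u = record { verts = size ; graph = graphOf ≤-refl es u }

 ∥hyperOf∥ : ∀ es u → ∥ graph (hyperOf es u) ∥ ≡ length es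
 ∥hyperOf∥ es u = LP.length-map _ es

 contains-hyperOf : ∀ {n} (G : Graph4 n) es u (g : Parts k₀ k₁ k₂ k₃ → Fin n) → (∀ {p q} → g p ≡ g q → p ≡ q)
  → (∀ {a b c d} → (a , b , c , d) ∈ es → Edge G (g (at₀ a)) (g (at₁ b)) (g (at₂ c)) (g (at₃ d)))
  → Contains G (hyperOf es u)
 contains-hyperOf {n} G es u g g-inj E = f , f-inj , AllP.map⁺ (All.tabulate inG)
  where
  f : Fin size → Fin n
  f = g ∘ split
  f-inj : Injective _≡_ _≡_ f
  f-inj {i} {j} e = trans (sym (glue-split i)) (trans (cong glue (g-inj e)) (glue-split j))
  f-ι : ∀ p → f (ι ≤-refl p) ≡ g p
  f-ι p = trans (cong (g ∘ split) (FP.toℕ-injective (FP.toℕ-inject≤ (glue p) ≤-refl))) (cong g (split-glue p))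
  inG : ∀ {t} → t ∈ es → image f (tupleSet ≤-refl t) ∈ edges G
  inG {a , b , c , d} t∈ with E t∈
  ... | s , s∈ , r = subst (_∈ edges G) (rep-unique r r′) s∈
   where
   r′ : Rep (image f (tupleSet ≤-refl (a , b , c , d))) (g (at₀ a)) (g (at₁ b)) (g (at₂ c)) (g (at₃ d))
   r′ = rep-cong (f-ι (at₀ a)) (f-ι (at₁ b)) (f-ι (at₂ c)) (f-ι (at₃ d)) (rep-image f-inj (tuple-rep ≤-refl (a , b , c , d)))

-- Forests of generalised stars

unique-++⁻ : {A : Set} (xs : List A) {ys : List A} → Unique (xs ++ ys) → Unique xs × Unique ys × Disj xs ys
unique-++⁻ [] u = [] , u , λ _ ()
unique-++⁻ (x ∷ xs) (x≢ ∷ u) = let (ux , uy , d) = unique-++⁻ xs u in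
 AllP.++⁻ˡ xs x≢ ∷ ux , uy , λ { _ (here refl) y∈ → All.lookup x≢ (∈-++⁺ʳ xs y∈) refl ; v (there p) y∈ → d v p y∈ }

unique-++⁺ : {A : Set} {xs ys : List A} → Unique xs → Unique ys → Disj xs ys → Unique (xs ++ ys)
unique-++⁺ u v d = Uniq.++⁺ u v λ { (p , q) → d _ p q }

unique-concatMap⁺ : {A B : Set} (f g : A → List B) {xs : List A} → (∀ {a} → a ∈ xs → Unique (f a)) → (∀ a {b} → b ∈ f a → b ∈ g a)
 → AllPairs (λ a a′ → Disj (g a) (g a′)) xs → Unique (concatMap f xs)
unique-concatMap⁺ f g {[]} u sub d = []
unique-concatMap⁺ f g {x ∷ xs} u sub (d ∷ ds) = unique-++⁺ (u (here refl)) (unique-concatMap⁺ f g (u ∘ there) sub ds) λ v p q →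
 let (a , a∈ , v∈) = ∈-concatMap⁻′ f xs q in All.lookup d a∈ v (sub x p) (sub a v∈)

allPairs-∈ : {A : Set} {R : A → A → Set} (R-sym : ∀ {a b} → R a b → R b a) {xs : List A} → AllPairs R xs
 → ∀ {a b} → a ∈ xs → b ∈ xs → a ≡ b ⊎ R a b
allPairs-∈ R-sym (r ∷ rs) (here refl) (here refl) = inj₁ refl
allPairs-∈ R-sym (r ∷ rs) (here refl) (there q) = inj₂ (All.lookup r q)
allPairs-∈ R-sym (r ∷ rs) (there p) (here refl) = inj₂ (R-sym (All.lookup r p))
allPairs-∈ R-sym (r ∷ rs) (there p) (there q) = allPairs-∈ R-sym rs p q

length-concatMap≡ : {A B : Set} (f : A → List B) (k : ℕ) (xs : List A) → (∀ x → length (f x) ≡ k) →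
 length (concatMap f xs) ≡ length xs * k
length-concatMap≡ f k [] h = refl
length-concatMap≡ f k (x ∷ xs) h = trans (LP.length-++ (f x)) (cong₂ _+_ (h x) (length-concatMap≡ f k xs h))

nth : {A : Set} {k : ℕ} (xs : List A) → length xs ≡ k → Fin k → A
nth xs refl i = L.lookup xs i

nth-∈ : {A : Set} {k : ℕ} (xs : List A) (e : length xs ≡ k) (i : Fin k) → nth xs e i ∈ xs
nth-∈ xs refl i = ∈-lookup i

groups-inj : {A B : Set} {k : ℕ} (f : A → List B) (xs : List A) (e : length xs ≡ k) → Unique (concatMap f xs)
 → ∀ i j {b} → b ∈ f (nth xs e i) → b ∈ f (nth xs e j) → i ≡ j
groups-inj f (x ∷ xs) refl u zero zero p q = refl
groups-inj f (x ∷ xs) refl u zero (suc j) p q =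
 ⊥-elim (proj₂ (proj₂ (unique-++⁻ (f x) u)) _ p (∈-concatMap f {xs = xs} (∈-lookup {xs = xs} j) q))
groups-inj f (x ∷ xs) refl u (suc i) zero p q =
 ⊥-elim (proj₂ (proj₂ (unique-++⁻ (f x) u)) _ q (∈-concatMap f {xs = xs} (∈-lookup {xs = xs} i) p))
groups-inj f (x ∷ xs) refl u (suc i) (suc j) p q = cong suc (groups-inj f xs refl (proj₁ (proj₂ (unique-++⁻ (f x) u))) i j p q)

unique-group : {A B : Set} (f : A → List B) {xs : List A} → Unique (concatMap f xs) → ∀ {a} → a ∈ xs → Unique (f a)
unique-group f {x ∷ xs} u (here refl) = proj₁ (unique-++⁻ (f x) u)
unique-group f {x ∷ xs} u (there p) = unique-group f (proj₁ (proj₂ (unique-++⁻ (f x) u))) p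

module Trees (V : Set) where

 PNode : ℕ → Set
 PNode z = V × Σ (List V) λ qs → length qs ≡ z

 XNode : ℕ → ℕ → Set
 XNode y z = V × Σ (List (PNode z)) λ ps → length ps ≡ y

 SNode : ℕ → ℕ → ℕ → Set
 SNode x y z = V × Σ (List (XNode y z)) λ as → length as ≡ x

 module _ {z : ℕ} where

  hdP qsP : PNode z → List V
  hdP (p , _) = p ∷ []
  qsP (_ , qs , _) = qs

  module _ {y : ℕ} where

   hdX psX qsX : XNode y z → List V
   hdX (w , _) = w ∷ []
   psX (_ , ps , _) = concatMap hdP ps
   qsX (_ , ps , _) = concatMap qsP ps

   module _ {x : ℕ} where

    hdS xsS psS qsS : SNode x y z → List V
    hdS (v , _) = v ∷ []
    xsS (_ , as , _) = concatMap hdX as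
    psS (_ , as , _) = concatMap psX as
    qsS (_ , as , _) = concatMap qsX as

    Hs Xs Ps Qs : List (SNode x y z) → List V
    Hs = concatMap hdS
    Xs = concatMap xsS
    Ps = concatMap psS
    Qs = concatMap qsS

-- Each level is numbered consecutively, so the ancestors of a leaf are its successive quotients,
-- and the leaf alone determines its edge.
starTuples : ∀ t x y z → List (Tuple t (t * x) (t * x * y) (t * x * y * z))
starTuples t x y z = map (λ m → let c = F.quotient z m ; b = F.quotient y c in F.quotient x b , b , c , m) (allFin (t * x * y * z))

starTuples-unique : ∀ t x y z → Unique (starTuples t x y z)
starTuples-unique t x y z = Uniq.map⁺ (cong (proj₂ ∘ proj₂ ∘ proj₂)) (Uniq.allFin⁺ _)

starForest : ℕ → ℕ → ℕ → ℕ → Hyper4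
starForest t x y z = Partite.hyperOf t (t * x) (t * x * y) (t * x * y * z) (starTuples t x y z) (starTuples-unique t x y z)

∥starForest∥ : ∀ t x y z → ∥ graph (starForest t x y z) ∥ ≡ t * x * y * z
∥starForest∥ t x y z = trans (Partite.∥hyperOf∥ t (t * x) (t * x * y) _ (starTuples t x y z) (starTuples-unique t x y z))
 (trans (LP.length-map _ (allFin (t * x * y * z))) (LP.length-tabulate {n = t * x * y * z} id))

remQuot-inj : ∀ {n} k {i j : Fin (n * k)} → F.remQuot {n} k i ≡ F.remQuot k j → i ≡ j
remQuot-inj {n} k {i} {j} e = trans (sym (FP.combine-remQuot {n} k i)) (trans (cong (λ (a , b) → F.combine a b) e) (FP.combine-remQuot {n} k j))

module ForestIn {n : ℕ} (G : Graph4 n) where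

 open Trees (Fin n)

 OkP : ∀ {z} → Fin n → Fin n → PNode z → Set
 OkP v w (p , qs , _) = All (λ q → Edge G v w p q) qs

 OkX : ∀ {y z} → Fin n → XNode y z → Set
 OkX v (w , ps , _) = All (OkP v w) ps

 OkS : ∀ {x y z} → SNode x y z → Set
 OkS (v , as , _) = All (OkX v) as

 record GoodForest (t x y z : ℕ) (T : List (SNode x y z)) : Set where
  field
   len : length T ≡ t
   ok : All OkS T
   uH : Unique (Hs T)
   uX : Unique (Xs T)
   uP : Unique (Ps T)
   uQ : Unique (Qs T)
   dHX : Disj (Hs T) (Xs T)
   dHXP : Disj (Hs T ++ Xs T) (Ps T)
   dHXPQ : Disj ((Hs T ++ Xs T) ++ Ps T) (Qs T)

 goodForest⇒contains : ∀ {t x y z T} → GoodForest t x y z T → Contains G (starForest t x y z)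
 goodForest⇒contains {t} {x} {y} {z} {T} gf = contains-hyperOf G _ (starTuples-unique t x y z) g g-inj edge
  where
  open GoodForest gf
  open Partite t (t * x) (t * x * y) (t * x * y * z)
  S : Fin t → SNode x y z
  S = nth T len
  arms : Fin t → List (XNode y z)
  arms i = proj₁ (proj₂ (S i))
  arms≡ : ∀ i → length (arms i) ≡ x
  arms≡ i = proj₂ (proj₂ (S i))
  A : Fin t → Fin x → XNode y z
  A i = nth (arms i) (arms≡ i)
  pets : Fin t → Fin x → List (PNode z)
  pets i j = proj₁ (proj₂ (A i j))
  pets≡ : ∀ i j → length (pets i j) ≡ y
  pets≡ i j = proj₂ (proj₂ (A i j))
  Q : Fin t → Fin x → Fin y → PNode z
  Q i j = nth (pets i j) (pets≡ i j)
  leaf : Fin t → Fin x → Fin y → Fin z → Fin n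
  leaf i j l = nth (proj₁ (proj₂ (Q i j l))) (proj₂ (proj₂ (Q i j l)))
  S∈ : ∀ i → S i ∈ T
  S∈ = nth-∈ T len
  A∈ : ∀ i j → A i j ∈ arms i
  A∈ i = nth-∈ (arms i) (arms≡ i)
  Q∈ : ∀ i j l → Q i j l ∈ pets i j
  Q∈ i j = nth-∈ (pets i j) (pets≡ i j)
  leaf∈ : ∀ i j l h → leaf i j l h ∈ qsP (Q i j l)
  leaf∈ i j l = nth-∈ (qsP (Q i j l)) (proj₂ (proj₂ (Q i j l)))
  g₀ : Fin t → Fin n
  g₀ i = proj₁ (S i)
  g₁ : Fin t × Fin x → Fin n
  g₁ (i , j) = proj₁ (A i j)
  g₂ : (Fin t × Fin x) × Fin y → Fin n
  g₂ ((i , j) , l) = proj₁ (Q i j l)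
  g₃ : ((Fin t × Fin x) × Fin y) × Fin z → Fin n
  g₃ (((i , j) , l) , h) = leaf i j l h
  ix₂ : Fin (t * x * y) → (Fin t × Fin x) × Fin y
  ix₂ c = F.remQuot x (F.quotient y c) , F.remainder {t * x} y c
  ix₃ : Fin (t * x * y * z) → ((Fin t × Fin x) × Fin y) × Fin z
  ix₃ m = ix₂ (F.quotient z m) , F.remainder {t * x * y} z m
  ix₂-inj : ∀ {c c′} → ix₂ c ≡ ix₂ c′ → c ≡ c′
  ix₂-inj e = remQuot-inj y (cong₂ _,_ (remQuot-inj x (cong proj₁ e)) (cong proj₂ e))
  ix₃-inj : ∀ {m m′} → ix₃ m ≡ ix₃ m′ → m ≡ m′
  ix₃-inj e = remQuot-inj z (cong₂ _,_ (ix₂-inj (cong proj₁ e)) (cong proj₂ e))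
  g : Parts t (t * x) (t * x * y) (t * x * y * z) → Fin n
  g (at₀ i) = g₀ i
  g (at₁ b) = g₁ (F.remQuot x b)
  g (at₂ c) = g₂ (ix₂ c)
  g (at₃ m) = g₃ (ix₃ m)
  x∈ : ∀ i j → g₁ (i , j) ∈ xsS (S i)
  x∈ i j = ∈-concatMap hdX (A∈ i j) (here refl)
  p∈X : ∀ i j l → g₂ ((i , j) , l) ∈ psX (A i j)
  p∈X i j l = ∈-concatMap hdP (Q∈ i j l) (here refl)
  p∈ : ∀ i j l → g₂ ((i , j) , l) ∈ psS (S i)
  p∈ i j l = ∈-concatMap psX (A∈ i j) (p∈X i j l)
  q∈X : ∀ i j l h → leaf i j l h ∈ qsX (A i j)
  q∈X i j l h = ∈-concatMap qsP (Q∈ i j l) (leaf∈ i j l h)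
  q∈ : ∀ i j l h → leaf i j l h ∈ qsS (S i)
  q∈ i j l h = ∈-concatMap qsX (A∈ i j) (q∈X i j l h)
  H∋ : ∀ i → g₀ i ∈ Hs T
  H∋ i = ∈-concatMap hdS (S∈ i) (here refl)
  X∋ : ∀ k → g₁ k ∈ Xs T
  X∋ (i , j) = ∈-concatMap xsS (S∈ i) (x∈ i j)
  P∋ : ∀ k → g₂ k ∈ Ps T
  P∋ ((i , j) , l) = ∈-concatMap psS (S∈ i) (p∈ i j l)
  Q∋ : ∀ k → g₃ k ∈ Qs T
  Q∋ (((i , j) , l) , h) = ∈-concatMap qsS (S∈ i) (q∈ i j l h)
  g₀-inj : ∀ {i i′} → g₀ i ≡ g₀ i′ → i ≡ i′
  g₀-inj {i} {i′} e = groups-inj hdS T len uH i i′ (here refl) (here e)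
  g₁-inj : ∀ {k k′} → g₁ k ≡ g₁ k′ → k ≡ k′
  g₁-inj {i , j} {i′ , j′} e with groups-inj xsS T len uX i i′ (x∈ i j) (subst (_∈ xsS (S i′)) (sym e) (x∈ i′ j′))
  ... | refl = cong (i ,_) (groups-inj hdX (arms i) (arms≡ i) (unique-group xsS uX (S∈ i)) j j′ (here refl) (here e))
  g₂-inj : ∀ {k k′} → g₂ k ≡ g₂ k′ → k ≡ k′
  g₂-inj {(i , j) , l} {(i′ , j′) , l′} e with groups-inj psS T len uP i i′ (p∈ i j l) (subst (_∈ psS (S i′)) (sym e) (p∈ i′ j′ l′))
  ... | refl with groups-inj psX (arms i) (arms≡ i) (unique-group psS uP (S∈ i)) j j′ (p∈X i j l) (subst (_∈ psX (A i j′)) (sym e) (p∈X i j′ l′))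
  ... | refl = cong ((i , j) ,_) (groups-inj hdP (pets i j) (pets≡ i j) (unique-group psX (unique-group psS uP (S∈ i)) (A∈ i j)) l l′ (here refl) (here e))
  nth-inj : ∀ {A : Set} {k} (xs : List A) (e : length xs ≡ k) → Unique xs → ∀ {i j} → nth xs e i ≡ nth xs e j → i ≡ j
  nth-inj xs e u {i} {j} eq = groups-inj L.[_] xs e (subst Unique (sym (LP.concat-map-[_] xs)) u) i j (here refl) (here eq)
  g₃-inj : ∀ {k k′} → g₃ k ≡ g₃ k′ → k ≡ k′
  g₃-inj {((i , j) , l) , h} {((i′ , j′) , l′) , h′} e
   with groups-inj qsS T len uQ i i′ (q∈ i j l h) (subst (_∈ qsS (S i′)) (sym e) (q∈ i′ j′ l′ h′))
  ... | refl with groups-inj qsX (arms i) (arms≡ i) (unique-group qsS uQ (S∈ i)) j j′ (q∈X i j l h) (subst (_∈ qsX (A i j′)) (sym e) (q∈X i j′ l′ h′))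
  ... | refl with groups-inj qsP (pets i j) (pets≡ i j) (unique-group qsX (unique-group qsS uQ (S∈ i)) (A∈ i j)) l l′ (leaf∈ i j l h)
   (subst (_∈ qsP (Q i j l′)) (sym e) (leaf∈ i j l′ h′))
  ... | refl = cong (((i , j) , l) ,_) (nth-inj (qsP (Q i j l)) (proj₂ (proj₂ (Q i j l)))
   (unique-group qsP (unique-group qsX (unique-group qsS uQ (S∈ i)) (A∈ i j)) (Q∈ i j l)) e)
  g-inj : ∀ {p q} → g p ≡ g q → p ≡ q
  g-inj {at₀ _} {at₀ _} e = cong at₀ (g₀-inj e)
  g-inj {at₁ b} {at₁ b′} e = cong (inj₂ ∘ inj₁) (remQuot-inj x (g₁-inj e))
  g-inj {at₂ _} {at₂ _} e = cong (inj₂ ∘ inj₂ ∘ inj₁) (ix₂-inj (g₂-inj e))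
  g-inj {at₃ _} {at₃ _} e = cong (inj₂ ∘ inj₂ ∘ inj₂) (ix₃-inj (g₃-inj e))
  g-inj {at₀ i} {at₁ b} e = ⊥-elim (dHX _ (H∋ i) (subst (_∈ Xs T) (sym e) (X∋ _)))
  g-inj {at₁ b} {at₀ i} e = ⊥-elim (dHX _ (H∋ i) (subst (_∈ Xs T) e (X∋ _)))
  g-inj {at₀ i} {at₂ c} e = ⊥-elim (dHXP _ (∈-++⁺ˡ (H∋ i)) (subst (_∈ Ps T) (sym e) (P∋ _)))
  g-inj {at₂ c} {at₀ i} e = ⊥-elim (dHXP _ (∈-++⁺ˡ (H∋ i)) (subst (_∈ Ps T) e (P∋ _)))
  g-inj {at₁ b} {at₂ c} e = ⊥-elim (dHXP _ (∈-++⁺ʳ (Hs T) (X∋ _)) (subst (_∈ Ps T) (sym e) (P∋ _)))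
  g-inj {at₂ c} {at₁ b} e = ⊥-elim (dHXP _ (∈-++⁺ʳ (Hs T) (X∋ _)) (subst (_∈ Ps T) e (P∋ _)))
  g-inj {at₀ i} {at₃ m} e = ⊥-elim (dHXPQ _ (∈-++⁺ˡ (∈-++⁺ˡ (H∋ i))) (subst (_∈ Qs T) (sym e) (Q∋ _)))
  g-inj {at₃ m} {at₀ i} e = ⊥-elim (dHXPQ _ (∈-++⁺ˡ (∈-++⁺ˡ (H∋ i))) (subst (_∈ Qs T) e (Q∋ _)))
  g-inj {at₁ b} {at₃ m} e = ⊥-elim (dHXPQ _ (∈-++⁺ˡ (∈-++⁺ʳ (Hs T) (X∋ _))) (subst (_∈ Qs T) (sym e) (Q∋ _)))
  g-inj {at₃ m} {at₁ b} e = ⊥-elim (dHXPQ _ (∈-++⁺ˡ (∈-++⁺ʳ (Hs T) (X∋ _))) (subst (_∈ Qs T) e (Q∋ _)))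
  g-inj {at₂ c} {at₃ m} e = ⊥-elim (dHXPQ _ (∈-++⁺ʳ (Hs T ++ Xs T) (P∋ _)) (subst (_∈ Qs T) (sym e) (Q∋ _)))
  g-inj {at₃ m} {at₂ c} e = ⊥-elim (dHXPQ _ (∈-++⁺ʳ (Hs T ++ Xs T) (P∋ _)) (subst (_∈ Qs T) e (Q∋ _)))
  edge : ∀ {a b c d} → (a , b , c , d) ∈ starTuples t x y z → Edge G (g (at₀ a)) (g (at₁ b)) (g (at₂ c)) (g (at₃ d))
  edge m∈ with ∈-map⁻ _ m∈
  ... | m , _ , refl = All.lookup (All.lookup (All.lookup (All.lookup ok (S∈ i)) (A∈ i j)) (Q∈ i j l)) (leaf∈ i j l h)
   where
   k = ix₃ m
   i = proj₁ (proj₁ (proj₁ k))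
   j = proj₂ (proj₁ (proj₁ k))
   l = proj₂ (proj₁ k)
   h = proj₂ k

-- Adding one star to a family of stars.

module _ {n : ℕ} (G : Graph4 n) where

 open Trees (Fin n)
 open ForestIn G

 -- The conditions that mention the lists `Bᵢ` separate the new star from the earlier ones, level by
 -- level; the others concern the new star alone.
 record NewStar {x y z : ℕ} (B₁ B₂ B₃ B₄ : List (Fin n)) (s : SNode x y z) : Set where
  field
   ok : OkS s
   v∉ : proj₁ s ∉ B₁
   x∉ : Disj (xsS s) B₂
   p∉ : Disj (psS s) B₃
   q∉ : Disj (qsS s) B₄
   uX : Unique (xsS s)
   uP : Unique (psS s)
   uQ : Unique (qsS s)
   dHX : Disj (hdS s) (xsS s)
   dHXP : Disj (hdS s ++ xsS s) (psS s)
   dHXPQ : Disj ((hdS s ++ xsS s) ++ psS s) (qsS s)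

 vertsP : ∀ {z} → PNode z → List (Fin n)
 vertsP (p , qs , _) = p ∷ qs

 vertsX : ∀ {y z} → XNode y z → List (Fin n)
 vertsX (w , ps , _) = w ∷ concatMap vertsP ps

 WfP : ∀ {z} → PNode z → Set
 WfP (p , qs , _) = p ∉ qs × Unique qs

 WfX : ∀ {y z} → XNode y z → Set
 WfX (w , ps , _) = w ∉ concatMap vertsP ps × AllPairs (λ o o′ → Disj (vertsP o) (vertsP o′)) ps × All WfP ps

 -- This is the form in which the greedy choice delivers a star: whole arms are disjoint, and within
 -- an arm whole petals. The distinctness within levels and the disjointness of levels are derived
 -- from it.
 WfS : ∀ {x y z} → SNode x y z → Set
 WfS (v , as , _) = All (λ a → v ∉ vertsX a) as × AllPairs (λ o o′ → Disj (vertsX o) (vertsX o′)) as × All WfX as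

 module _ {x y z : ℕ} {s : SNode x y z} (wf : WfS s) where

  private
   v : Fin n
   v = proj₁ s
   as : List (XNode y z)
   as = proj₁ (proj₂ s)
   v# : All (λ a → v ∉ vertsX a) as
   v# = proj₁ wf
   as# : AllPairs (λ o o′ → Disj (vertsX o) (vertsX o′)) as
   as# = proj₁ (proj₂ wf)
   wfX : All WfX as
   wfX = proj₂ (proj₂ wf)

  psX⊆ : ∀ (a : XNode y z) {u} → u ∈ psX a → u ∈ vertsX a
  psX⊆ (w , ps , _) u∈ with ∈-concatMap⁻′ hdP ps u∈
  ... | o , o∈ , here refl = there (∈-concatMap vertsP o∈ (here refl))

  qsX⊆ : ∀ (a : XNode y z) {u} → u ∈ qsX a → u ∈ vertsX a
  qsX⊆ (w , ps , _) u∈ with ∈-concatMap⁻′ qsP ps u∈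
  ... | o , o∈ , q = there (∈-concatMap vertsP o∈ (there q))

  hdX⊆ : ∀ (a : XNode y z) {u} → u ∈ hdX a → u ∈ vertsX a
  hdX⊆ a (here refl) = here refl

  same-or-apart : ∀ {a a′ u} → a ∈ as → a′ ∈ as → u ∈ vertsX a → u ∈ vertsX a′ → a ≡ a′
  same-or-apart a∈ a′∈ p q with allPairs-∈ (λ d → disj-sym d) as# a∈ a′∈
  ... | inj₁ e = e
  ... | inj₂ d = ⊥-elim (d _ p q)

  wf-uX : Unique (xsS s)
  wf-uX = unique-concatMap⁺ hdX vertsX (λ _ → [] ∷ []) hdX⊆ as#

  wf-uP : Unique (psS s)
  wf-uP = unique-concatMap⁺ psX vertsX (λ a∈ → unique-concatMap⁺ hdP vertsP (λ _ → [] ∷ [])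
   (λ { _ (here refl) → here refl }) (proj₁ (proj₂ (All.lookup wfX a∈)))) psX⊆ as#

  wf-uQ : Unique (qsS s)
  wf-uQ = unique-concatMap⁺ qsX vertsX (λ a∈ → unique-concatMap⁺ qsP vertsP
   (λ o∈ → proj₂ (All.lookup (proj₂ (proj₂ (All.lookup wfX a∈))) o∈))
   (λ _ → there) (proj₁ (proj₂ (All.lookup wfX a∈)))) qsX⊆ as#

  wf-dHX : Disj (hdS s) (xsS s)
  wf-dHX u (here refl) u∈ with ∈-concatMap⁻′ hdX as u∈
  ... | a , a∈ , p = All.lookup v# a∈ (hdX⊆ a p)

  wf-dHXP : Disj (hdS s ++ xsS s) (psS s)
  wf-dHXP u (here refl) u∈ with ∈-concatMap⁻′ psX as u∈
  ... | a , a∈ , p = All.lookup v# a∈ (psX⊆ a p)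
  wf-dHXP u (there u∈X) u∈ with ∈-concatMap⁻′ hdX as u∈X | ∈-concatMap⁻′ psX as u∈
  ... | a , a∈ , h | a′ , a′∈ , p with same-or-apart a∈ a′∈ (hdX⊆ a h) (psX⊆ a′ p)
  wf-dHXP u (there u∈X) u∈ | (w , ps , _) , a∈ , here refl | _ , a′∈ , p | refl with ∈-concatMap⁻′ hdP ps p
  ... | o , o∈ , here refl = proj₁ (All.lookup wfX a∈) (∈-concatMap vertsP o∈ (here refl))

  wf-dHXPQ : Disj ((hdS s ++ xsS s) ++ psS s) (qsS s)
  wf-dHXPQ u (here refl) u∈ with ∈-concatMap⁻′ qsX as u∈
  ... | a , a∈ , p = All.lookup v# a∈ (qsX⊆ a p)
  wf-dHXPQ u (there u∈XP) u∈ with ∈-++⁻ (xsS s) u∈XP | ∈-concatMap⁻′ qsX as u∈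
  wf-dHXPQ u (there u∈XP) u∈ | inj₁ u∈X | a′ , a′∈ , q with ∈-concatMap⁻′ hdX as u∈X
  ... | a , a∈ , h with same-or-apart a∈ a′∈ (hdX⊆ a h) (qsX⊆ a′ q)
  wf-dHXPQ u (there u∈XP) u∈ | inj₁ u∈X | _ , a′∈ , q | (w , ps , _) , a∈ , here refl | refl with ∈-concatMap⁻′ qsP ps q
  ... | o , o∈ , r = proj₁ (All.lookup wfX a∈) (∈-concatMap vertsP o∈ (there r))
  wf-dHXPQ u (there u∈XP) u∈ | inj₂ u∈P | a′ , a′∈ , q with ∈-concatMap⁻′ psX as u∈P
  ... | a , a∈ , h with same-or-apart a∈ a′∈ (psX⊆ a h) (qsX⊆ a′ q)
  wf-dHXPQ u (there u∈XP) u∈ | inj₂ u∈P | _ , a′∈ , q | (w , ps , _) , a∈ , h | refl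
   with ∈-concatMap⁻′ hdP ps h | ∈-concatMap⁻′ qsP ps q
  ... | o , o∈ , here refl | o′ , o′∈ , r with allPairs-∈ (λ d → disj-sym d) (proj₁ (proj₂ (All.lookup wfX a∈))) o∈ o′∈
  ... | inj₁ refl = proj₁ (All.lookup (proj₂ (proj₂ (All.lookup wfX a∈))) o∈) r
  ... | inj₂ d = d _ (here refl) (there r)

 -- Distinctness is demanded only within a level. A hub may be a leaf of an earlier star, since a
 -- hub is chosen to avoid only earlier hubs; such collisions are left to the pruning.
 record Acc {x y z : ℕ} (k : ℕ) (T : List (SNode x y z)) : Set where
  field
   len : length T ≡ k
   ok : All OkS T
   uH : Unique (Hs T)
   uX : Unique (Xs T)
   uP : Unique (Ps T)
   uQ : Unique (Qs T)

 acc-[] : ∀ {x y z} → Acc {x} {y} {z} 0 []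
 acc-[] = record { len = refl ; ok = [] ; uH = [] ; uX = [] ; uP = [] ; uQ = [] }

 acc-step : ∀ {x y z k} {T : List (SNode x y z)} {s : SNode x y z} → Acc k T
  → NewStar (Hs T) (Hs T ++ Xs T) ((Hs T ++ Xs T) ++ Ps T) (((Hs T ++ Xs T) ++ Ps T) ++ Qs T) s → Acc (suc k) (s ∷ T)
 acc-step {T = T} acc new = record
  { len = cong suc len ; ok = ok′ ∷ ok
  ; uH = unique-++⁺ ([] ∷ []) uH (λ { _ (here refl) q → v∉ q })
  ; uX = unique-++⁺ uX′ uX (λ u p q → x∉ u p (∈-++⁺ʳ (Hs T) q))
  ; uP = unique-++⁺ uP′ uP (λ u p q → p∉ u p (∈-++⁺ʳ (Hs T ++ Xs T) q))
  ; uQ = unique-++⁺ uQ′ uQ (λ u p q → q∉ u p (∈-++⁺ʳ ((Hs T ++ Xs T) ++ Ps T) q)) }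
  where
  open Acc acc
  open NewStar new using (v∉; x∉; p∉; q∉) renaming (ok to ok′; uX to uX′; uP to uP′; uQ to uQ′)

 single-good : ∀ {x y z} {s : SNode x y z} → NewStar [] [] [] [] s → GoodForest 1 x y z (s ∷ [])
 single-good {s = s} new = record
  { len = refl ; ok = ok ∷ [] ; uH = [] ∷ [] ; uX = re uX ; uP = re uP ; uQ = re uQ
  ; dHX = λ u p q → dHX u p (un (xsS s) q)
  ; dHXP = λ u p q → dHXP u (both p) (un (psS s) q)
  ; dHXPQ = λ u p q → dHXPQ u (all p) (un (qsS s) q) }
  where
  open NewStar new
  re : ∀ {xs : List (Fin n)} → Unique xs → Unique (xs ++ [])
  re = subst Unique (sym (LP.++-identityʳ _))
  un : ∀ (xs : List (Fin n)) {u} → u ∈ xs ++ [] → u ∈ xs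
  un xs = subst (_ ∈_) (LP.++-identityʳ xs)
  both : ∀ {u} → u ∈ Hs (s ∷ []) ++ Xs (s ∷ []) → u ∈ hdS s ++ xsS s
  both (here e) = here e
  both (there p) = there (un (xsS s) p)
  all : ∀ {u} → u ∈ (Hs (s ∷ []) ++ Xs (s ∷ [])) ++ Ps (s ∷ []) → u ∈ (hdS s ++ xsS s) ++ psS s
  all p with ∈-++⁻ (Hs (s ∷ []) ++ Xs (s ∷ [])) p
  ... | inj₁ q = ∈-++⁺ˡ (both q)
  ... | inj₂ q = ∈-++⁺ʳ (hdS s ++ xsS s) (un (psS s) q)

 Edge-≢ : ∀ {a b c d} → Edge G a b c d → a ≢ b
 Edge-≢ (_ , _ , r) = Rep.ab r

 module _ (B₁ B₂ B₃ B₄ : List (Fin n)) (B₁⊆B₂ : ∀ {v} → v ∈ B₁ → v ∈ B₂) (B₂⊆B₃ : ∀ {v} → v ∈ B₂ → v ∈ B₃)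
  (B₃⊆B₄ : ∀ {v} → v ∈ B₃ → v ∈ B₄) (x y z₀ : ℕ) where

  open Star (Edge G) (Edge? G) (Edge-sym G) Edge-≢ B₁ B₂ B₃ B₄ B₁⊆B₂ B₂⊆B₃ B₃⊆B₄ x y z₀
   hiding (V; K; K′; Y; θ; κ)

  private
   toP : ∀ {v w} → Petal v w → PNode z
   toP (p , _ , qs , l , _) = p , qs , l

   toX : ∀ {v} → Arm v → XNode y z
   toX (w , _ , _ , (os , l , _) , _) = w , map toP os , trans (LP.length-map toP os) l

   toS : FreeStar → SNode x y z
   toS (v , _ , as , l , _) = v , map toX as , trans (LP.length-map toX as) l

   vertsX-toX : ∀ {v} (a : Arm v) → vertsX (toX a) ≡ armVerts a
   vertsX-toX (w , _ , _ , (os , l , _) , _) = cong (w ∷_) (LP.concatMap-map vertsP toP os)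

   petal-ok : ∀ {v w} (o : Petal v w) → OkP v w (toP o) × WfP (toP o) × proj₁ o ∉ B₃ × Disj (qsP (toP o)) B₄
   petal-ok (p , p∉ , qs , l , u , al) = All.map proj₂ al , ((λ p∈ → E-≢₃₄ (proj₂ (All.lookup al p∈)) refl) , u)
    , p∉ , λ u u∈ → proj₁ (All.lookup al u∈)

   arm-ok : ∀ {v} (a : Arm v) → OkX v (toX a) × WfX (toX a) × proj₁ a ∉ B₂ × Disj (psX (toX a)) B₃ × Disj (qsX (toX a)) B₄
   arm-ok {v} (w , w∉ , _ , (os , l , pw) , w∉os) =
     AllP.map⁺ (All.tabulate λ {o} _ → proj₁ (petal-ok o))
    , ((λ w∈ → w∉os (subst (w ∈_) (LP.concatMap-map vertsP toP os) w∈)) , APP.map⁺ pw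
     , AllP.map⁺ (All.tabulate λ {o} _ → proj₁ (proj₂ (petal-ok o))))
    , w∉ , dp , dq
    where
    dp : Disj (concatMap hdP (map toP os)) B₃
    dp u u∈ with ∈-concatMap⁻′ hdP (map toP os) u∈
    ... | o , o∈ , here refl with ∈-map⁻ toP o∈
    ... | o₁ , _ , refl = proj₁ (proj₂ (proj₂ (petal-ok o₁)))
    dq : Disj (concatMap qsP (map toP os)) B₄
    dq u u∈ with ∈-concatMap⁻′ qsP (map toP os) u∈
    ... | o , o∈ , q with ∈-map⁻ toP o∈
    ... | o₁ , _ , refl = proj₂ (proj₂ (proj₂ (petal-ok o₁))) u q

  freeStar⇒new : FreeStar → Σ (SNode x y z) λ s → NewStar B₁ B₂ B₃ B₄ s
  freeStar⇒new star@(v , v∉ , as , l , v# , as#) = s , record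
   { ok = AllP.map⁺ (All.tabulate λ {a} _ → proj₁ (arm-ok a))
   ; v∉ = v∉ ; x∉ = dx ; p∉ = dp ; q∉ = dq
   ; uX = wf-uX {s = s} wf ; uP = wf-uP {s = s} wf ; uQ = wf-uQ {s = s} wf
   ; dHX = wf-dHX {s = s} wf ; dHXP = wf-dHXP {s = s} wf ; dHXPQ = wf-dHXPQ {s = s} wf }
   where
   s : SNode x y z
   s = toS star
   wf : WfS s
   wf = AllP.map⁺ (All.map (λ {a} h v∈ → h (subst (v ∈_) (vertsX-toX a) v∈)) v#)
    , APP.map⁺ (AP.map (λ {a} {a′} d u p q → d u (subst (u ∈_) (vertsX-toX a) p) (subst (u ∈_) (vertsX-toX a′) q)) as#)
    , AllP.map⁺ (All.tabulate λ {a} _ → proj₁ (proj₂ (arm-ok a)))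
   dx : Disj (xsS s) B₂
   dx u u∈ with ∈-concatMap⁻′ hdX (map toX as) u∈
   ... | a , a∈ , here refl with ∈-map⁻ toX a∈
   ... | a₁ , _ , refl = proj₁ (proj₂ (proj₂ (arm-ok a₁)))
   dp : Disj (psS s) B₃
   dp u u∈ with ∈-concatMap⁻′ psX (map toX as) u∈
   ... | a , a∈ , q with ∈-map⁻ toX a∈
   ... | a₁ , _ , refl = proj₁ (proj₂ (proj₂ (proj₂ (arm-ok a₁)))) u q
   dq : Disj (qsS s) B₄
   dq u u∈ with ∈-concatMap⁻′ qsX (map toX as) u∈
   ... | a , a∈ , q with ∈-map⁻ toX a∈
   ... | a₁ , _ , refl = proj₂ (proj₂ (proj₂ (proj₂ (arm-ok a₁)))) u q

-- Pruning a family of stars whose levels may collide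

module _ {A A′ B B′ : Set} where

 concatMap-⊆ : (keep : A → List A′) (f : A′ → List B) (g : A → List B) → (∀ a → concatMap f (keep a) ⊆ g a)
  → ∀ ns → concatMap f (concatMap keep ns) ⊆ concatMap g ns
 concatMap-⊆ keep f g h [] = []
 concatMap-⊆ keep f g h (a ∷ ns) = subst (_⊆ concatMap g (a ∷ ns)) (sym (LP.concatMap-++ f (keep a) (concatMap keep ns)))
  (SubP.++⁺ (h a) (concatMap-⊆ keep f g h ns))

 all-concatMap : {P : A′ → Set} (keep : A → List A′) → ∀ ns → (∀ {a} → a ∈ ns → All P (keep a)) → All P (concatMap keep ns)
 all-concatMap keep [] h = []
 all-concatMap keep (a ∷ ns) h = AllP.++⁺ (h (here refl)) (all-concatMap keep ns (h ∘ there))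

 -- A node with g + c ∸ 1 children is dropped only when it is dead or at least g of its children are dropped.
 prune-count : (g c₀ : ℕ) (dead : A → List ℕ) (keep : A → List A′) (cs : A → List B) (keepB : B → List B′)
  → (∀ a → length (cs a) ≡ c₀) → (∀ b → length (keepB b) ≤ 1)
  → (∀ a → (1 ≤ length (keep a)) ⊎ (1 ≤ length (dead a)) ⊎ (length (concatMap keepB (cs a)) + g ≤ c₀))
  → ∀ ns → g * length ns + length (concatMap keepB (concatMap cs ns))
   ≤ g * (length (concatMap keep ns) + length (concatMap dead ns)) + length (concatMap cs ns)
 prune-count g c₀ dead keep cs keepB len one h [] = ≤-refl
 prune-count g c₀ dead keep cs keepB len one h (a ∷ ns) = begin
  g * suc (length ns) + length (concatMap keepB (cs a ++ concatMap cs ns))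
   ≡⟨ cong (λ l → g * suc (length ns) + l) (trans (cong length (LP.concatMap-++ keepB (cs a) (concatMap cs ns))) (LP.length-++ (concatMap keepB (cs a)))) ⟩
  g * suc (length ns) + (length (concatMap keepB (cs a)) + length (concatMap keepB (concatMap cs ns)))
   ≡⟨ lem1 g (length ns) (length (concatMap keepB (cs a))) _ ⟩
  (g + length (concatMap keepB (cs a))) + (g * length ns + length (concatMap keepB (concatMap cs ns)))
   ≤⟨ +-mono-≤ head (prune-count g c₀ dead keep cs keepB len one h ns) ⟩
  (g * (length (keep a) + length (dead a)) + length (cs a)) + (g * (length (concatMap keep ns) + length (concatMap dead ns)) + length (concatMap cs ns))
   ≡⟨ lem2 g (length (keep a)) (length (dead a)) (length (cs a)) _ _ _ ⟩
  g * ((length (keep a) + length (concatMap keep ns)) + (length (dead a) + length (concatMap dead ns))) + (length (cs a) + length (concatMap cs ns))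
   ≡⟨ sym (cong₂ (λ u v → g * u + v) (cong₂ _+_ (LP.length-++ (keep a)) (LP.length-++ (dead a))) (LP.length-++ (cs a))) ⟩
  g * (length (concatMap keep (a ∷ ns)) + length (concatMap dead (a ∷ ns))) + length (concatMap cs (a ∷ ns)) ∎
  where
  open ≤-Reasoning
  lem1 : ∀ g n a b → g * suc n + (a + b) ≡ (g + a) + (g * n + b)
  lem1 = solve-∀
  lem2 : ∀ g k d c k′ d′ c′ → (g * (k + d) + c) + (g * (k′ + d′) + c′) ≡ g * ((k + k′) + (d + d′)) + (c + c′)
  lem2 = solve-∀
  kB≤ : length (concatMap keepB (cs a)) ≤ length (cs a)
  kB≤ = ≤-trans (length-concatMap≤ keepB 1 (cs a) one) (≤-reflexive (*-identityʳ _))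
  g≤ : ∀ {k} → 1 ≤ k → g ≤ g * k
  g≤ {suc k} (s≤s _) = m≤m*n g (suc k)
  head : g + length (concatMap keepB (cs a)) ≤ g * (length (keep a) + length (dead a)) + length (cs a)
  head with h a
  ... | inj₁ k = +-mono-≤ (g≤ (≤-trans k (m≤m+n _ _))) kB≤
  ... | in₁ d = +-mono-≤ (g≤ (≤-trans d (m≤n+m _ (length (keep a))))) kB≤
  ... | inj₂ (inj₂ c) = ≤-trans (≤-reflexive (+-comm g _)) (≤-trans c (≤-trans (≤-reflexive (sym (len a))) (m≤n+m _ _)))

concatMap-⊆-mono : {A B : Set} (f : A → List B) {xs ys : List A} → xs ⊆ ys → concatMap f xs ⊆ concatMap f ys
concatMap-⊆-mono f [] = []
concatMap-⊆-mono f (y ∷ʳ s) = SubP.++⁺ˡ (f y) (concatMap-⊆-mono f s)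
concatMap-⊆-mono f (refl ∷ s) = SubP.++⁺ ⊆-refl (concatMap-⊆-mono f s)

unique-⊆ : {A : Set} {xs ys : List A} → xs ⊆ ys → Unique ys → Unique xs
unique-⊆ [] [] = []
unique-⊆ (y ∷ʳ s) (_ ∷ u) = unique-⊆ s u
unique-⊆ (refl ∷ s) (a ∷ u) = SubP.All-resp-⊆ s a ∷ unique-⊆ s u

take-sublist : {A : Set} (k : ℕ) (xs : List A) → take k xs ⊆ xs
take-sublist k xs = SubP.take-⊆ k xs

module _ {n : ℕ} where

 open import Data.List.Membership.DecPropositional (F._≟_ {n}) using (_∈?_)

 alive : List (Fin n) → Fin n → List (Fin n)
 alive D u with u ∈? D
 ... | yes _ = []
 ... | no _ = u ∷ []

 -- One mark per dead vertex turns the number of dead nodes into the length of a list.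
 deadMark : List (Fin n) → Fin n → List ℕ
 deadMark D u with u ∈? D
 ... | yes _ = 0 ∷ []
 ... | no _ = []

 deadMark-count : ∀ D us → Unique us → length (concatMap (deadMark D) us) ≤ length D
 deadMark-count D us u = ≤-trans (≤-reflexive (count us)) (unique-⊆⇒length≤ (Uniq.filter⁺ (_∈? D) u)
   λ {v} p → proj₂ (∈-filter⁻ (_∈? D) {xs = us} p))
  where
  count : ∀ us → length (concatMap (deadMark D) us) ≡ length (filter (_∈? D) us)
  count [] = refl
  count (v ∷ us) with v ∈? D
  ... | yes _ = cong suc (count us)
  ... | no _ = count us

 alive-⊆ : ∀ D us → concatMap (alive D) us ⊆ us
 alive-⊆ D [] = []
 alive-⊆ D (u ∷ us) with u ∈? D
 ... | yes _ = u ∷ʳ alive-⊆ D us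
 ... | no _ = refl ∷ alive-⊆ D us

 alive-∉ : ∀ D us → All (_∉ D) (concatMap (alive D) us)
 alive-∉ D us = all-concatMap {B = ⊤} {B′ = ⊤} (alive D) us λ {a} _ → go a
  where
  go : ∀ a → All (_∉ D) (alive D a)
  go a with a ∈? D
  ... | yes _ = []
  ... | no a∉ = a∉ ∷ []

 open Trees (Fin n)

 -- `DX`, `DP` and `DQ` are the vertices that children, grandchildren and leaves must not be. A node
 -- is kept if it is allowed and enough of its children are kept; doubling `x` and `y` and adding 63
 -- leaves makes room for the losses.
 module Prune (DX DP DQ : List (Fin n)) (x y z gz : ℕ) where

  Z Y X : ℕ
  Z = z + gz
  Y = y + suc y
  X = x + suc x

  leaves : PNode Z → List (Fin n)
  leaves (p , qs , _) = concatMap (alive DQ) qs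

  keepP : PNode Z → List (PNode z)
  keepP a@(p , qs , _) with p ∈? DP | z N.≤? length (leaves a)
  ... | no _ | yes le = (p , take z (leaves a) , trans (LP.length-take z _) (m≤n⇒m⊓n≡m le)) ∷ []
  ... | _ | _ = []

  pets : XNode Y Z → List (PNode z)
  pets (w , ps , _) = concatMap keepP ps

  keepX : XNode Y Z → List (XNode y z)
  keepX a@(w , ps , _) with w ∈? DX | y N.≤? length (pets a)
  ... | no _ | yes le = (w , take y (pets a) , trans (LP.length-take y _) (m≤n⇒m⊓n≡m le)) ∷ []
  ... | _ | _ = []

  arms : SNode X Y Z → List (XNode y z)
  arms (v , as , _) = concatMap keepX as

  keepS : SNode X Y Z → List (SNode x y z)
  keepS a@(v , as , _) with x N.≤? length (arms a)
  ... | yes le = (v , take x (arms a) , trans (LP.length-take x _) (m≤n⇒m⊓n≡m le)) ∷ []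
  ... | no _ = []

  private
   single-⊆ : {A B : Set} (f : A → List B) {b : A} {ys : List B} → f b ⊆ ys → concatMap f (b ∷ []) ⊆ ys
   single-⊆ f {b} s = subst (_⊆ _) (sym (LP.++-identityʳ (f b))) s

   empty-⊆ : {B : Set} (ys : List B) → [] ⊆ ys
   empty-⊆ [] = []
   empty-⊆ (y ∷ ys) = y ∷ʳ empty-⊆ ys

  keepP-hd : ∀ a → concatMap hdP (keepP a) ⊆ hdP a
  keepP-hd a@(p , qs , _) with p ∈? DP | z N.≤? length (leaves a)
  ... | no _ | yes le = ⊆-refl
  ... | yes _ | _ = empty-⊆ _
  ... | no _ | no _ = empty-⊆ _

  keepP-qs : ∀ a → concatMap qsP (keepP a) ⊆ qsP a
  keepP-qs a@(p , qs , _) with p ∈? DP | z N.≤? length (leaves a)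
  ... | no _ | yes le = single-⊆ qsP {b = p , take z (leaves a) , trans (LP.length-take z _) (m≤n⇒m⊓n≡m le)} (⊆-trans (take-sublist z _) (alive-⊆ DQ qs))
  ... | yes _ | _ = empty-⊆ _
  ... | no _ | no _ = empty-⊆ _

  keepX-hd : ∀ a → concatMap hdX (keepX a) ⊆ hdX a
  keepX-hd a@(w , ps , _) with w ∈? DX | y N.≤? length (pets a)
  ... | no _ | yes le = ⊆-refl
  ... | yes _ | _ = empty-⊆ _
  ... | no _ | no _ = empty-⊆ _

  keepX-sub : (f : ∀ {z} → PNode z → List (Fin n)) → (∀ a → concatMap f (keepP a) ⊆ f a)
   → ∀ a → concatMap (λ b → concatMap f (proj₁ (proj₂ b))) (keepX a) ⊆ concatMap f (proj₁ (proj₂ a))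
  keepX-sub f h a@(w , ps , _) with w ∈? DX | y N.≤? length (pets a)
  ... | no _ | yes le = single-⊆ (λ (b : XNode y z) → concatMap f (proj₁ (proj₂ b))) {b = w , take y (pets a) , trans (LP.length-take y _) (m≤n⇒m⊓n≡m le)}
   (⊆-trans (concatMap-⊆-mono (f {z}) (take-sublist y (pets a))) (concatMap-⊆ {B′ = ⊤} keepP (f {z}) (f {Z}) h ps))
  ... | yes _ | _ = empty-⊆ _
  ... | no _ | no _ = empty-⊆ _

  keepS-sub : (f : ∀ {y z} → XNode y z → List (Fin n)) → (∀ a → concatMap f (keepX a) ⊆ f a)
   → ∀ a → concatMap (λ b → concatMap f (proj₁ (proj₂ b))) (keepS a) ⊆ concatMap f (proj₁ (proj₂ a))
  keepS-sub f h a@(v , as , _) with x N.≤? length (arms a)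
  ... | yes le = single-⊆ (λ (b : SNode x y z) → concatMap f (proj₁ (proj₂ b))) {b = v , take x (arms a) , trans (LP.length-take x _) (m≤n⇒m⊓n≡m le)}
   (⊆-trans (concatMap-⊆-mono (f {y} {z}) (take-sublist x (arms a))) (concatMap-⊆ {B′ = ⊤} keepX (f {y} {z}) (f {Y} {Z}) h as))
  ... | no _ = empty-⊆ _

  keepS-hd : ∀ a → concatMap hdS (keepS a) ⊆ hdS a
  keepS-hd a@(v , as , _) with x N.≤? length (arms a)
  ... | yes le = ⊆-refl
  ... | no _ = empty-⊆ _

  AliveP : PNode z → Set
  AliveP (p , qs , _) = p ∉ DP × All (_∉ DQ) qs

  AliveX : XNode y z → Set
  AliveX (w , ps , _) = w ∉ DX × All AliveP ps

  AliveS : SNode x y z → Set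
  AliveS (v , as , _) = All AliveX as

  keepP-alive : ∀ a → All AliveP (keepP a)
  keepP-alive a@(p , qs , _) with p ∈? DP | z N.≤? length (leaves a)
  ... | no p∉ | yes le = (p∉ , AllP.take⁺ z (alive-∉ DQ qs)) ∷ []
  ... | yes _ | _ = []
  ... | no _ | no _ = []

  keepX-alive : ∀ a → All AliveX (keepX a)
  keepX-alive a@(w , ps , _) with w ∈? DX | y N.≤? length (pets a)
  ... | no w∉ | yes le = (w∉ , AllP.take⁺ y (all-concatMap {B = ⊤} {B′ = ⊤} keepP ps λ {a} _ → keepP-alive a)) ∷ []
  ... | yes _ | _ = []
  ... | no _ | no _ = []

  keepS-alive : ∀ a → All AliveS (keepS a)
  keepS-alive a@(v , as , _) with x N.≤? length (arms a)
  ... | yes le = AllP.take⁺ x (all-concatMap {B = ⊤} {B′ = ⊤} keepX as λ {a} _ → keepX-alive a) ∷ []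
  ... | no _ = []

  module _ (G : Graph4 n) where

   open ForestIn G

   keepP-ok : ∀ {v w} a → OkP v w a → All (OkP v w) (keepP a)
   keepP-ok a@(p , qs , _) ok with p ∈? DP | z N.≤? length (leaves a)
   ... | no p∉ | yes le = SubP.All-resp-⊆ (⊆-trans (take-sublist z (leaves a)) (alive-⊆ DQ qs)) ok ∷ []
   ... | yes _ | _ = []
   ... | no _ | no _ = []

   keepX-ok : ∀ {v} a → OkX v a → All (OkX v) (keepX a)
   keepX-ok a@(w , ps , _) ok with w ∈? DX | y N.≤? length (pets a)
   ... | no w∉ | yes le = AllP.take⁺ y (all-concatMap {B = ⊤} {B′ = ⊤} keepP ps λ {a} a∈ → keepP-ok a (All.lookup ok a∈)) ∷ []
   ... | yes _ | _ = []
   ... | no _ | no _ = []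

   keepS-ok : ∀ a → OkS a → All OkS (keepS a)
   keepS-ok a@(v , as , _) ok with x N.≤? length (arms a)
   ... | yes le = AllP.take⁺ x (all-concatMap {B = ⊤} {B′ = ⊤} keepX as λ {a} a∈ → keepX-ok a (All.lookup ok a∈)) ∷ []
   ... | no _ = []

  deadP : PNode Z → List ℕ
  deadP a = concatMap (deadMark DP) (hdP a)

  deadX : XNode Y Z → List ℕ
  deadX a = concatMap (deadMark DX) (hdX a)

  private
   room : ∀ {k c g} → ¬ c ≤ k → k + suc g ≤ c + g
   room {k} {c} {g} c≰k = ≤-trans (≤-reflexive (+-suc k g)) (+-monoˡ-≤ g (≰⇒> c≰k))

  alt-P : ∀ a → (1 ≤ length (keepP a)) ⊎ (1 ≤ length (deadP a)) ⊎ (length (concatMap (alive DQ) (qsP a)) + suc gz ≤ Z)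
  alt-P a@(p , qs , _) with p ∈? DP | z N.≤? length (leaves a)
  ... | no _ | yes le = inj₁ (s≤s z≤n)
  ... | yes p∈ | _ = in₁ (s≤s z≤n)
  ... | no _ | no ¬le = inj₂ (inj₂ (room ¬le))

  alt-X : ∀ a → (1 ≤ length (keepX a)) ⊎ (1 ≤ length (deadX a)) ⊎ (length (concatMap keepP (proj₁ (proj₂ a))) + suc (suc y) ≤ Y)
  alt-X a@(w , ps , _) with w ∈? DX | y N.≤? length (pets a)
  ... | no _ | yes le = inj₁ (s≤s z≤n)
  ... | yes w∈ | _ = in₁ (s≤s z≤n)
  ... | no _ | no ¬le = inj₂ (inj₂ (room ¬le))

  alt-S : ∀ a → (1 ≤ length (keepS a)) ⊎ (1 ≤ length {A = ℕ} []) ⊎ (length (concatMap keepX (proj₁ (proj₂ a))) + suc (suc x) ≤ X)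
  alt-S a@(v , as , _) with x N.≤? length (arms a)
  ... | yes le = inj₁ (s≤s z≤n)
  ... | no ¬le = inj₂ (inj₂ (room ¬le))

  keepP≤1 : ∀ a → length (keepP a) ≤ 1
  keepP≤1 a@(p , qs , _) with p ∈? DP | z N.≤? length (leaves a)
  ... | no _ | yes le = ≤-refl
  ... | yes _ | _ = z≤n
  ... | no _ | no _ = z≤n

  keepX≤1 : ∀ a → length (keepX a) ≤ 1
  keepX≤1 a@(w , ps , _) with w ∈? DX | y N.≤? length (pets a)
  ... | no _ | yes le = ≤-refl
  ... | yes _ | _ = z≤n
  ... | no _ | no _ = z≤n

  alive≤1 : ∀ u → length (alive DQ u) ≤ 1
  alive≤1 u with u ∈? DQ
  ... | yes _ = z≤n
  ... | no _ = ≤-refl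

  alive+dead : ∀ us → length us ≤ length (concatMap (alive DQ) us) + length (concatMap (deadMark DQ) us)
  alive+dead [] = z≤n
  alive+dead (u ∷ us) with u ∈? DQ
  ... | yes _ = ≤-trans (s≤s (alive+dead us)) (≤-reflexive (sym (+-suc _ _)))
  ... | no _ = s≤s (alive+dead us)

concatMap-concatMap : {A B C₀ : Set} (f : B → List C₀) (g : A → List B) (xs : List A)
 → concatMap f (concatMap g xs) ≡ concatMap (λ a → concatMap f (g a)) xs
concatMap-concatMap f g [] = refl
concatMap-concatMap f g (x ∷ xs) = trans (LP.concatMap-++ f (g x) (concatMap g xs)) (cong (concatMap f (g x) ++_) (concatMap-concatMap f g xs))

-- A node that is not dead itself falls only with more than half of its children, so apart from dead
-- nodes the lost fraction at most doubles from level to level. Losing a grandchild takes 64 dead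
-- leaves; this limits the loss to 1/16 of the grandchildren, then to 1/4 of the children and 1/2 of
-- the stars. The bounds 32 make every level negligible against the next one.
prune-arith : ∀ {N x y kP kX kS} (X Y : ℕ) → 32 ≤ x → 32 ≤ y → X ≡ x + suc x → Y ≡ y + suc y
 → 64 * (N * X * Y) ≤ 64 * (kP + (N + N * X)) + (N + N * X + N * X * Y)
 → (2 + y) * (N * X) + kP ≤ (2 + y) * (kX + N) + N * X * Y
 → (2 + x) * N + kX ≤ (2 + x) * (kS + 0) + N * X
 → N ≤ 2 * kS
prune-arith {N} {x} {y} {kP} {kX} {kS} X Y x≥ y≥ eX eY h₁ h₂ h₃ = *-cancelˡ-≤ 2 (*-cancelˡ-≤ (2 + x) step₃)
 where
 open ≤-Reasoning
 X′ P : ℕ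
 X′ = N * X
 P = X′ * Y
 64≤ : ∀ {a b} → 32 ≤ a → b ≡ a + suc a → 64 ≤ b
 64≤ h refl = ≤-trans (+-mono-≤ h h) (+-monoʳ-≤ _ (n≤1+n _))
 N≤ : N * 64 ≤ X′
 N≤ = *-monoʳ-≤ N (64≤ x≥ eX)
 X≤ : X′ * 64 ≤ P
 X≤ = *-monoʳ-≤ X′ (64≤ y≥ eY)
 step₁ : 15 * P ≤ 16 * kP
 step₁ = *-cancelˡ-≤ 4 (+-cancelˡ-≤ (4 * P) _ _ (begin
  4 * P + 4 * (15 * P) ≡⟨ (λ (p : ℕ) → lem p) P ⟩
  64 * P ≤⟨ h₁ ⟩
  64 * (kP + (N + X′)) + (N + X′ + P) ≡⟨ lem2 kP N X′ P ⟩
  P + (4 * (16 * kP) + (65 * N + 65 * X′)) ≤⟨ +-monoʳ-≤ P (+-monoʳ-≤ (4 * (16 * kP)) bnd) ⟩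
  P + (4 * (16 * kP) + 3 * P) ≡⟨ lem4 kP P ⟩
  4 * P + 4 * (16 * kP) ∎))
  where
  lem : ∀ p → 4 * p + 4 * (15 * p) ≡ 64 * p
  lem = solve-∀
  lem2 : ∀ k n x p → 64 * (k + (n + x)) + (n + x + p) ≡ p + (4 * (16 * k) + (65 * n + 65 * x))
  lem2 = solve-∀
  lem4 : ∀ k p → p + (4 * (16 * k) + 3 * p) ≡ 4 * p + 4 * (16 * k)
  lem4 = solve-∀
  lem5 : ∀ n x → 65 * n + 65 * x + (63 * n + 125 * x) ≡ 2 * (n * 64) + 190 * x
  lem5 = solve-∀
  bnd : 65 * N + 65 * X′ ≤ 3 * P
  bnd = begin
   65 * N + 65 * X′ ≤⟨ m≤m+n _ (63 * N + 125 * X′) ⟩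
   65 * N + 65 * X′ + (63 * N + 125 * X′) ≡⟨ lem5 N X′ ⟩
   2 * (N * 64) + 190 * X′ ≤⟨ +-monoˡ-≤ (190 * X′) (*-monoʳ-≤ 2 N≤) ⟩
   2 * X′ + 190 * X′ ≡⟨ lem6 X′ ⟩
   3 * (X′ * 64) ≤⟨ *-monoʳ-≤ 3 X≤ ⟩
   3 * P ∎
   where
   lem6 : ∀ x → 2 * x + 190 * x ≡ 3 * (x * 64)
   lem6 = solve-∀
 P≤ : P ≤ 2 * ((2 + y) * X′)
 P≤ = begin
  X′ * Y ≡⟨ cong (X′ *_) eY ⟩
  X′ * (y + suc y) ≤⟨ m≤m+n _ (X′ * 3) ⟩
  X′ * (y + suc y) + X′ * 3 ≡⟨ lem X′ y ⟩
  2 * ((2 + y) * X′) ∎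
  where
  lem : ∀ a y → a * (y + suc y) + a * 3 ≡ 2 * ((2 + y) * a)
  lem = solve-∀
 step₂ : 3 * X′ ≤ 4 * kX
 step₂ = *-cancelˡ-≤ 4 (*-cancelˡ-≤ (2 + y) (+-cancelˡ-≤ ((2 + y) * (2 * X′) + (2 + y) * (2 * X′) + 15 * P) _ _ (begin
  (2 + y) * (2 * X′) + (2 + y) * (2 * X′) + 15 * P + (2 + y) * (4 * (3 * X′)) ≡⟨ lem1 y X′ P ⟩
  16 * ((2 + y) * X′) + 15 * P ≤⟨ +-monoʳ-≤ (16 * ((2 + y) * X′)) step₁ ⟩
  16 * ((2 + y) * X′) + 16 * kP ≡⟨ sym (*-distribˡ-+ 16 ((2 + y) * X′) kP) ⟩
  16 * ((2 + y) * X′ + kP) ≤⟨ *-monoʳ-≤ 16 h₂ ⟩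
  16 * ((2 + y) * (kX + N) + P) ≡⟨ lem2 y kX N P ⟩
  (2 + y) * (16 * kX) + (2 + y) * (16 * N) + (P + 15 * P) ≤⟨ +-mono-≤ (+-monoʳ-≤ ((2 + y) * (16 * kX)) (*-monoʳ-≤ (2 + y) N16)) (+-monoˡ-≤ (15 * P) P≤) ⟩
  (2 + y) * (16 * kX) + (2 + y) * (2 * X′) + (2 * ((2 + y) * X′) + 15 * P) ≡⟨ lem3 y kX X′ P ⟩
  (2 + y) * (2 * X′) + (2 + y) * (2 * X′) + 15 * P + (2 + y) * (4 * (4 * kX)) ∎)))
  where
  lem1 : ∀ y x p → (2 + y) * (2 * x) + (2 + y) * (2 * x) + 15 * p + (2 + y) * (4 * (3 * x)) ≡ 16 * ((2 + y) * x) + 15 * p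
  lem1 = solve-∀
  lem2 : ∀ y k n p → 16 * ((2 + y) * (k + n) + p) ≡ (2 + y) * (16 * k) + (2 + y) * (16 * n) + (p + 15 * p)
  lem2 = solve-∀
  lem3 : ∀ y k x p → (2 + y) * (16 * k) + (2 + y) * (2 * x) + (2 * ((2 + y) * x) + 15 * p)
   ≡ (2 + y) * (2 * x) + (2 + y) * (2 * x) + 15 * p + (2 + y) * (4 * (4 * k))
  lem3 = solve-∀
  lem4 : ∀ n → 16 * n + 48 * n ≡ n * 64
  lem4 = solve-∀
  N16 : 16 * N ≤ 2 * X′
  N16 = ≤-trans (m≤m+n _ (48 * N)) (≤-trans (≤-reflexive (lem4 N)) (≤-trans N≤ (m≤m+n _ _)))
 step₃ : (2 + x) * (2 * N) ≤ (2 + x) * (2 * (2 * kS))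
 step₃ = +-cancelˡ-≤ (2 * ((2 + x) * N) + 3 * X′) _ _ (begin
  2 * ((2 + x) * N) + 3 * X′ + (2 + x) * (2 * N) ≡⟨ lem1 x N X′ ⟩
  4 * ((2 + x) * N) + 3 * X′ ≤⟨ +-monoʳ-≤ (4 * ((2 + x) * N)) step₂ ⟩
  4 * ((2 + x) * N) + 4 * kX ≡⟨ sym (*-distribˡ-+ 4 ((2 + x) * N) kX) ⟩
  4 * ((2 + x) * N + kX) ≤⟨ *-monoʳ-≤ 4 h₃ ⟩
  4 * ((2 + x) * (kS + 0) + X′) ≡⟨ lem2 x kS X′ ⟩
  (2 + x) * (2 * (2 * kS)) + 3 * X′ + X′ ≤⟨ +-monoʳ-≤ ((2 + x) * (2 * (2 * kS)) + 3 * X′) X≤′ ⟩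
  (2 + x) * (2 * (2 * kS)) + 3 * X′ + 2 * ((2 + x) * N) ≡⟨ lem3 x kS N X′ ⟩
  2 * ((2 + x) * N) + 3 * X′ + (2 + x) * (2 * (2 * kS)) ∎)
  where
  lem1 : ∀ x n a → 2 * ((2 + x) * n) + 3 * a + (2 + x) * (2 * n) ≡ 4 * ((2 + x) * n) + 3 * a
  lem1 = solve-∀
  lem2 : ∀ x k a → 4 * ((2 + x) * (k + 0) + a) ≡ (2 + x) * (2 * (2 * k)) + 3 * a + a
  lem2 = solve-∀
  lem3 : ∀ x k n a → (2 + x) * (2 * (2 * k)) + 3 * a + 2 * ((2 + x) * n) ≡ 2 * ((2 + x) * n) + 3 * a + (2 + x) * (2 * (2 * k))
  lem3 = solve-∀
  lem4 : ∀ n x → n * (x + suc x) + n * 3 ≡ 2 * ((2 + x) * n)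
  lem4 = solve-∀
  X≤′ : X′ ≤ 2 * ((2 + x) * N)
  X≤′ = ≤-trans (≤-reflexive (cong (N *_) eX)) (≤-trans (m≤m+n _ (N * 3)) (≤-reflexive (lem4 N x)))

module _ {n : ℕ} (G : Graph4 n) where

 open Trees (Fin n)
 open ForestIn G

 -- Each level is free of repetitions, so it has at most as many dead vertices as there are vertices
 -- on the levels above it.
 prune-good : ∀ {t x y z} (T : List (SNode (x + suc x) (y + suc y) (z + 63))) → 32 ≤ x → 32 ≤ y
  → Acc G (2 * t) T → Contains G (starForest t x y z)
 prune-good {t} {x} {y} {z} T x≥ y≥ acc = goodForest⇒contains record
  { len = trans (LP.length-take t (concatMap keepS T)) (m≤n⇒m⊓n≡m t≤)
  ; ok = AllP.take⁺ t (all-concatMap {B = ⊤} {B′ = ⊤} keepS T λ {a} a∈ → keepS-ok G a (All.lookup ok a∈))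
  ; uH = unique-⊆ H⊆ uH ; uX = unique-⊆ X⊆ uX ; uP = unique-⊆ P⊆ uP ; uQ = unique-⊆ Q⊆ uQ
  ; dHX = λ u p q → aliveX q (mem H⊆ p)
  ; dHXP = λ u p q → aliveP q ([ (λ r → ∈-++⁺ˡ (mem H⊆ r)) , (λ r → ∈-++⁺ʳ (Hs T) (mem X⊆ r)) ]′ (∈-++⁻ (Hs T′) p))
  ; dHXPQ = λ u p q → aliveQ q (lower p)
  }
  where
  open Acc acc
  DP DQ : List (Fin n)
  DP = Hs T ++ Xs T
  DQ = (Hs T ++ Xs T) ++ Ps T
  open Prune (Hs T) DP DQ x y z 63
  T′ : List (SNode x y z)
  T′ = take t (concatMap keepS T)
  keep-⊆ : (f : ∀ {x y z} → SNode x y z → List (Fin n)) → (∀ a → concatMap f (keepS a) ⊆ f a) → concatMap f T′ ⊆ concatMap f T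
  keep-⊆ f h = ⊆-trans (concatMap-⊆-mono f (take-sublist t (concatMap keepS T))) (concatMap-⊆ {B′ = ⊤} keepS f f h T)
  H⊆ : Hs T′ ⊆ Hs T
  H⊆ = keep-⊆ hdS keepS-hd
  X⊆ : Xs T′ ⊆ Xs T
  X⊆ = keep-⊆ xsS (keepS-sub hdX keepX-hd)
  P⊆ : Ps T′ ⊆ Ps T
  P⊆ = keep-⊆ psS (keepS-sub psX (keepX-sub hdP keepP-hd))
  Q⊆ : Qs T′ ⊆ Qs T
  Q⊆ = keep-⊆ qsS (keepS-sub qsX (keepX-sub qsP keepP-qs))
  mem : ∀ {xs ys : List (Fin n)} → xs ⊆ ys → ∀ {u} → u ∈ xs → u ∈ ys
  mem s = Sub.lookup s
  alive′ : All AliveS T′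
  alive′ = AllP.take⁺ t (all-concatMap {B = ⊤} {B′ = ⊤} keepS T λ {a} _ → keepS-alive a)
  aliveX : ∀ {u} → u ∈ Xs T′ → u ∉ Hs T
  aliveX u∈ with ∈-concatMap⁻′ xsS T′ u∈
  ... | s , s∈ , p with ∈-concatMap⁻′ hdX (proj₁ (proj₂ s)) p
  ... | a , a∈ , here refl = proj₁ (All.lookup (All.lookup alive′ s∈) a∈)
  aliveP : ∀ {u} → u ∈ Ps T′ → u ∉ DP
  aliveP u∈ with ∈-concatMap⁻′ psS T′ u∈
  ... | s , s∈ , p with ∈-concatMap⁻′ psX (proj₁ (proj₂ s)) p
  ... | a , a∈ , q with ∈-concatMap⁻′ hdP (proj₁ (proj₂ a)) q
  ... | o , o∈ , here refl = proj₁ (All.lookup (proj₂ (All.lookup (All.lookup alive′ s∈) a∈)) o∈)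
  aliveQ : ∀ {u} → u ∈ Qs T′ → u ∉ DQ
  aliveQ u∈ with ∈-concatMap⁻′ qsS T′ u∈
  ... | s , s∈ , p with ∈-concatMap⁻′ qsX (proj₁ (proj₂ s)) p
  ... | a , a∈ , q with ∈-concatMap⁻′ qsP (proj₁ (proj₂ a)) q
  ... | o , o∈ , r = All.lookup (proj₂ (All.lookup (proj₂ (All.lookup (All.lookup alive′ s∈) a∈)) o∈)) r
  lower : ∀ {u} → u ∈ (Hs T′ ++ Xs T′) ++ Ps T′ → u ∈ DQ
  lower p with ∈-++⁻ (Hs T′ ++ Xs T′) p
  ... | inj₂ r = ∈-++⁺ʳ DP (mem P⊆ r)
  ... | inj₁ q with ∈-++⁻ (Hs T′) q
  ... | inj₁ r = ∈-++⁺ˡ (∈-++⁺ˡ (mem H⊆ r))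
  ... | inj₂ r = ∈-++⁺ˡ (∈-++⁺ʳ (Hs T) (mem X⊆ r))
  asN : SNode X Y Z → List (XNode Y Z)
  asN (_ , as , _) = as
  psN : XNode Y Z → List (PNode Z)
  psN (_ , ps , _) = ps
  N : ℕ
  N = 2 * t
  xn : List (XNode Y Z)
  xn = concatMap asN T
  pn : List (PNode Z)
  pn = concatMap psN xn
  |xn| : length xn ≡ N * X
  |xn| = trans (length-concatMap≡ asN X T λ s → proj₂ (proj₂ s)) (cong (_* X) len)
  |pn| : length pn ≡ N * X * Y
  |pn| = trans (length-concatMap≡ psN Y xn λ a → proj₂ (proj₂ a)) (cong (_* Y) |xn|)
  Xs≡ : concatMap hdX xn ≡ Xs T
  Xs≡ = concatMap-concatMap hdX asN T
  Ps≡ : concatMap hdP pn ≡ Ps T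
  Ps≡ = trans (concatMap-concatMap hdP psN xn) (concatMap-concatMap psX asN T)
  Qs≡ : concatMap qsP pn ≡ Qs T
  Qs≡ = trans (concatMap-concatMap qsP psN xn) (concatMap-concatMap qsX asN T)
  |Hs| : length (Hs T) ≡ N
  |Hs| = trans (length-concatMap≡ hdS 1 T λ _ → refl) (trans (*-identityʳ _) len)
  |Xs| : length (Xs T) ≡ N * X
  |Xs| = trans (cong length (sym Xs≡)) (trans (length-concatMap≡ hdX 1 xn λ _ → refl) (trans (*-identityʳ _) |xn|))
  |Ps| : length (Ps T) ≡ N * X * Y
  |Ps| = trans (cong length (sym Ps≡)) (trans (length-concatMap≡ hdP 1 pn λ _ → refl) (trans (*-identityʳ _) |pn|))
  |DP| : length DP ≡ N + N * X
  |DP| = trans (LP.length-++ (Hs T)) (cong₂ _+_ |Hs| |Xs|)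
  |DQ| : length DQ ≡ N + N * X + N * X * Y
  |DQ| = trans (LP.length-++ DP) (cong₂ _+_ |DP| |Ps|)
  kP kX kS : ℕ
  kP = length (concatMap keepP pn)
  kX = length (concatMap keepX xn)
  kS = length (concatMap keepS T)
  deadX≤ : length (concatMap deadX xn) ≤ N
  deadX≤ = ≤-trans (≤-reflexive (cong length (trans (sym (concatMap-concatMap (deadMark (Hs T)) hdX xn)) (cong (concatMap _) Xs≡))))
   (≤-trans (deadMark-count (Hs T) (Xs T) uX) (≤-reflexive |Hs|))
  deadP≤ : length (concatMap deadP pn) ≤ N + N * X
  deadP≤ = ≤-trans (≤-reflexive (cong length (trans (sym (concatMap-concatMap (deadMark DP) hdP pn)) (cong (concatMap _) Ps≡))))
   (≤-trans (deadMark-count DP (Ps T) uP) (≤-reflexive |DP|))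
  deadQ≤ : length (concatMap (deadMark DQ) (concatMap qsP pn)) ≤ N + N * X + N * X * Y
  deadQ≤ = ≤-trans (deadMark-count DQ (concatMap qsP pn) (subst Unique (sym Qs≡) uQ)) (≤-reflexive |DQ|)
  kQ : ℕ
  kQ = length (concatMap (alive DQ) (concatMap qsP pn))
  open ≤-Reasoning
  eq₁ : 64 * (N * X * Y) ≤ 64 * (kP + (N + N * X)) + (N + N * X + N * X * Y)
  eq₁ = +-cancelʳ-≤ kQ _ _ (begin
   64 * (N * X * Y) + kQ ≡⟨ cong (λ l → 64 * l + kQ) (sym |pn|) ⟩
   64 * length pn + kQ ≤⟨ prune-count 64 Z deadP keepP qsP (alive DQ) (λ a → proj₂ (proj₂ a)) alive≤1 alt-P pn ⟩
   64 * (kP + length (concatMap deadP pn)) + length (concatMap qsP pn)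
    ≤⟨ +-mono-≤ (*-monoʳ-≤ 64 (+-monoʳ-≤ kP deadP≤)) (≤-trans (alive+dead (concatMap qsP pn)) (+-monoʳ-≤ kQ deadQ≤)) ⟩
   64 * (kP + (N + N * X)) + (kQ + (N + N * X + N * X * Y)) ≡⟨ lem (64 * (kP + (N + N * X))) kQ _ ⟩
   64 * (kP + (N + N * X)) + (N + N * X + N * X * Y) + kQ ∎)
   where
   lem : ∀ a b c → a + (b + c) ≡ a + c + b
   lem = solve-∀
  eq₂ : (2 + y) * (N * X) + kP ≤ (2 + y) * (kX + N) + N * X * Y
  eq₂ = begin
   (2 + y) * (N * X) + kP ≡⟨ cong (λ l → (2 + y) * l + kP) (sym |xn|) ⟩
   (2 + y) * length xn + kP ≤⟨ prune-count (2 + y) Y deadX keepX psN keepP (λ a → proj₂ (proj₂ a)) keepP≤1 alt-X xn ⟩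
   (2 + y) * (kX + length (concatMap deadX xn)) + length pn ≤⟨ +-mono-≤ (*-monoʳ-≤ (2 + y) (+-monoʳ-≤ kX deadX≤)) (≤-reflexive |pn|) ⟩
   (2 + y) * (kX + N) + N * X * Y ∎
  eq₃ : (2 + x) * N + kX ≤ (2 + x) * (kS + 0) + N * X
  eq₃ = begin
   (2 + x) * N + kX ≡⟨ cong (λ l → (2 + x) * l + kX) (sym len) ⟩
   (2 + x) * length T + kX ≤⟨ prune-count (2 + x) X (λ _ → []) keepS asN keepX (λ a → proj₂ (proj₂ a)) keepX≤1 alt-S T ⟩
   (2 + x) * (kS + length (concatMap (λ (_ : SNode X Y Z) → []) T)) + length xn
    ≡⟨ cong₂ (λ a b → (2 + x) * (kS + a) + b) (no-dead T) |xn| ⟩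
   (2 + x) * (kS + 0) + N * X ∎
   where
   no-dead : (T : List (SNode X Y Z)) → length {A = ℕ} (concatMap (λ _ → []) T) ≡ 0
   no-dead [] = refl
   no-dead (_ ∷ T) = no-dead T
  t≤ : t ≤ kS
  t≤ = *-cancelˡ-≤ 2 (prune-arith {N} {x} {y} {kP} {kX} {kS} X Y x≥ y≥ refl refl eq₁ eq₂ eq₃)

-- Stars and star forests in dense graphs.

module _ {n : ℕ} (G : Graph4 n) where

 open Trees (Fin n)
 open ForestIn G

 -- The covering applies to graphs without a free star, so its contrapositive is doubly negated;
 -- containment of a fixed graph is decidable, and this later removes the negations.
 star-or-few : (B₁ B₂ B₃ B₄ : List (Fin n)) (i₁ : ∀ {v} → v ∈ B₁ → v ∈ B₂) (i₂ : ∀ {v} → v ∈ B₂ → v ∈ B₃)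
  (i₃ : ∀ {v} → v ∈ B₃ → v ∈ B₄) (x y z₀ : ℕ) → starBound n (length B₁) (length B₂) (length B₃) (length B₄) x y z₀ < ∥ G ∥
  → ¬ ¬ (Σ (SNode x y (suc z₀)) λ s → NewStar G B₁ B₂ B₃ B₄ s)
 star-or-few B₁ B₂ B₃ B₄ i₁ i₂ i₃ x y z₀ lt none = <⇒≱ lt (≤-trans (count-edges (edges G) (distinct G) (uniform G) Q
   λ P P-sym hyp s∈ r → covered P P-sym hyp (_ , s∈ , r)) Q≤)
  where
  open StarBound (Edge G) (Edge? G) (Edge-sym G) (Edge-≢ G) B₁ B₂ B₃ B₄ i₁ i₂ i₃ x y z₀
   (λ s → none (freeStar⇒new G B₁ B₂ B₃ B₄ i₁ i₂ i₃ x y z₀ s))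

 single-star : ∀ x y z₀ → starBound n 0 0 0 0 x y z₀ < ∥ G ∥ → Contains G (starForest 1 x y (suc z₀))
 single-star x y z₀ lt = decidable-stable (contains? G (starForest 1 x y (suc z₀))) λ none →
  star-or-few [] [] [] [] (λ ()) (λ ()) (λ ()) x y z₀ lt λ (s , new) → none (goodForest⇒contains (single-good G new))

 -- Twice as many stars as wanted are built, with enlarged parameters. The hypothesis says that even
 -- for the full family the covering is smaller than the edge set, so a further star exists at every
 -- stage.
 many-stars : ∀ t x y z → 32 ≤ x → 32 ≤ y
  → (∀ b₁ b₂ b₃ b₄ → b₁ ≤ 2 * t → b₂ ≤ 2 * t + 2 * t * (x + suc x) → b₃ ≤ 2 * t + 2 * t * (x + suc x) + 2 * t * (x + suc x) * (y + suc y)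
   → b₄ ≤ 2 * t + 2 * t * (x + suc x) + 2 * t * (x + suc x) * (y + suc y) + 2 * t * (x + suc x) * (y + suc y) * (z + 63)
   → starBound n b₁ b₂ b₃ b₄ (x + suc x) (y + suc y) (z + 62) < ∥ G ∥)
  → Contains G (starForest t x y z)
 many-stars t x y z x≥ y≥ h = decidable-stable (contains? G (starForest t x y z)) λ none → build (2 * t) ≤-refl λ (T , acc) → none (prune-good G T x≥ y≥ acc)
  where
  X Y Z : ℕ
  X = x + suc x
  Y = y + suc y
  Z = z + 63
  Z≡ : suc (z + 62) ≡ Z
  Z≡ = sym (+-suc z 62)
  build : ∀ k → k ≤ 2 * t → ¬ ¬ (Σ (List (SNode X Y Z)) λ T → Acc G k T)
  build zero _ none = none ([] , acc-[] G)
  build (suc k) k< none = build k (≤-trans (n≤1+n k) k<) λ (T , acc) → extend T acc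
   where
   extend : (T : List (SNode X Y Z)) → Acc G k T → ⊥
   extend T acc = star-or-few (Hs T) (Hs T ++ Xs T) ((Hs T ++ Xs T) ++ Ps T) (((Hs T ++ Xs T) ++ Ps T) ++ Qs T)
     ∈-++⁺ˡ ∈-++⁺ˡ ∈-++⁺ˡ X Y (z + 62) (h _ _ _ _ b₁ b₂ b₃ b₄)
     λ sn → let (s , new) = subst (λ Z → Σ (SNode X Y Z) λ s → NewStar G (Hs T) (Hs T ++ Xs T) ((Hs T ++ Xs T) ++ Ps T) (((Hs T ++ Xs T) ++ Ps T) ++ Qs T) s) Z≡ sn in none (s ∷ T , acc-step G acc new)
    where
    open Acc acc
    len≤ : length T ≤ 2 * t
    len≤ = ≤-trans (≤-reflexive len) (≤-trans (n≤1+n k) k<)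
    cm : ∀ (f : SNode X Y Z → List (Fin n)) m → (∀ s → length (f s) ≤ m) → length (concatMap f T) ≤ 2 * t * m
    cm f m hf = ≤-trans (length-concatMap≤ f m T hf) (*-monoˡ-≤ m len≤)
    lenX : ∀ (a : XNode Y Z) → length (psX a) ≤ Y
    lenX (_ , ps , l) = ≤-trans (length-concatMap≤ hdP 1 ps λ _ → ≤-refl) (≤-reflexive (trans (*-identityʳ _) l))
    lenQ : ∀ (a : XNode Y Z) → length (qsX a) ≤ Y * Z
    lenQ (_ , ps , l) = ≤-trans (length-concatMap≤ qsP Z ps λ (_ , _ , l) → ≤-reflexive l) (≤-reflexive (cong (_* Z) l))
    b₁ : length (Hs T) ≤ 2 * t
    b₁ = ≤-trans (cm hdS 1 λ _ → ≤-refl) (≤-reflexive (*-identityʳ _))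
    b₂ : length (Hs T ++ Xs T) ≤ 2 * t + 2 * t * X
    b₂ = ≤-trans (≤-reflexive (LP.length-++ (Hs T))) (+-mono-≤ b₁ (cm xsS X λ (_ , as , l) →
     ≤-trans (length-concatMap≤ hdX 1 as λ _ → ≤-refl) (≤-reflexive (trans (*-identityʳ _) l))))
    b₃ : length ((Hs T ++ Xs T) ++ Ps T) ≤ 2 * t + 2 * t * X + 2 * t * X * Y
    b₃ = ≤-trans (≤-reflexive (LP.length-++ (Hs T ++ Xs T))) (+-mono-≤ b₂ (≤-trans (cm psS (X * Y) λ (_ , as , l) →
     ≤-trans (length-concatMap≤ psX Y as lenX) (≤-reflexive (cong (_* Y) l))) (≤-reflexive (sym (*-assoc (2 * t) X Y)))))
    b₄ : length (((Hs T ++ Xs T) ++ Ps T) ++ Qs T) ≤ 2 * t + 2 * t * X + 2 * t * X * Y + 2 * t * X * Y * Z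
    b₄ = ≤-trans (≤-reflexive (LP.length-++ ((Hs T ++ Xs T) ++ Ps T))) (+-mono-≤ b₃ (≤-trans (cm qsS (X * (Y * Z)) λ (_ , as , l) →
     ≤-trans (length-concatMap≤ qsX (Y * Z) as lenQ) (≤-reflexive (cong (_* (Y * Z)) l))) (≤-reflexive (lem (2 * t) X Y Z))))
     where
     lem : ∀ a b c d → a * (b * (c * d)) ≡ a * b * c * d
     lem = solve-∀

-- Weighted monomials; the coefficient comes last so that large numerals are never unfolded.

module Monomial (τ u n : ℕ) where

 M : ℕ → ℕ → ℕ → ℕ → ℕ
 M i j l k = τ ^ i * (u ^ j * n ^ l) * k

 M-* : ∀ i j l k i′ j′ l′ k′ → M i j l k * M i′ j′ l′ k′ ≡ M (i + i′) (j + j′) (l + l′) (k * k′)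
 M-* i j l k i′ j′ l′ k′ = trans (lem (τ ^ i) (u ^ j) (n ^ l) k (τ ^ i′) (u ^ j′) (n ^ l′) k′)
  (sym (cong (_* (k * k′)) (cong₂ _*_ (^-distribˡ-+-* τ i i′) (cong₂ _*_ (^-distribˡ-+-* u j j′) (^-distribˡ-+-* n l l′)))))
  where
  lem : ∀ a b c k a′ b′ c′ k′ → a * (b * c) * k * (a′ * (b′ * c′) * k′) ≡ a * a′ * (b * b′ * (c * c′)) * (k * k′)
  lem = solve-∀

 M-*-≤ : ∀ {i j l k i′ j′ l′ k′ a b} → a ≤ M i j l k → b ≤ M i′ j′ l′ k′ → a * b ≤ M (i + i′) (j + j′) (l + l′) (k * k′)
 M-*-≤ {i} {j} {l} {k} {i′} {j′} {l′} {k′} p q = ≤-trans (*-mono-≤ p q) (≤-reflexive (M-* i j l k i′ j′ l′ k′))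

 M-+-≤ : ∀ {i j l k k′ a b} → a ≤ M i j l k → b ≤ M i j l k′ → a + b ≤ M i j l (k + k′)
 M-+-≤ {i} {j} {l} {k} {k′} p q = ≤-trans (+-mono-≤ p q) (≤-reflexive (sym (*-distribˡ-+ (τ ^ i * (u ^ j * n ^ l)) k k′)))

 module _ (1≤τ : 1 ≤ τ) (1≤u : 1 ≤ u) where

  pow-mono : ∀ {a} → 1 ≤ a → ∀ {i i′} → i ≤ i′ → a ^ i ≤ a ^ i′
  pow-mono {suc a} _ = ^-monoʳ-≤ (suc a)

  M-up : ∀ {i j l k i′ j′ k′ a} → T (i N.≤ᵇ i′) → T (j N.≤ᵇ j′) → T (k N.≤ᵇ k′) → a ≤ M i j l k → a ≤ M i′ j′ l k′
  M-up {i} {j} {l} {k} {i′} {j′} {k′} p q r a≤ = ≤-trans a≤ (*-mono-≤ (*-mono-≤ (pow-mono 1≤τ (≤ᵇ⇒≤ i i′ p))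
   (*-monoˡ-≤ (n ^ l) (pow-mono 1≤u (≤ᵇ⇒≤ j j′ q)))) (≤ᵇ⇒≤ k k′ r))

-- The two quantities that dominate every term of starBound when x, y ≤ u, z ≤ 64 τ and u ^ 3 τ ≤ n.

-- The sum of the coefficients in the bounds of the summands of starBound by multiples of W below.
starConstant : ℕ
starConstant = 652696243

module ManyStars (n τ w : ℕ) (1≤τ : 1 ≤ τ) (32≤w : 32 ≤ w) (u³τ≤n : (3 * w) ^ 3 * τ ≤ n) where

 u X : ℕ
 u = 3 * w
 X = w + suc w

 open Monomial τ u n

 1≤w : 1 ≤ w
 1≤w = ≤-trans (s≤s z≤n) 32≤w

 1≤u : 1 ≤ u
 1≤u = ≤-trans 1≤w (m≤m+n w _)

 -- Up to constants, `S₁` is the number of quadruples through the hubs and `D` that of quadruples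
 -- inside the vertex set of all stars.
 S₁ D W : ℕ
 S₁ = τ * n ^ 3
 D = τ ^ 8 * u ^ 8
 W = S₁ + D

 toS₁ : ∀ k {a} → a ≤ M 1 0 3 k → a ≤ W * k
 toS₁ k le = ≤-trans le (*-monoˡ-≤ k (≤-trans (≤-reflexive (lem τ n)) (m≤m+n S₁ D)))
  where
  lem : ∀ τ n → (τ * 1) * (1 * (n * (n * (n * 1)))) ≡ τ * (n * (n * (n * 1)))
  lem = solve-∀

 toD : ∀ k {a} → a ≤ M 8 8 0 k → a ≤ W * k
 toD k le = ≤-trans le (*-monoˡ-≤ k (≤-trans (≤-reflexive (cong (τ ^ 8 *_) (*-identityʳ (u ^ 8)))) (m≤n+m D S₁)))

 -- The hypothesis `u³τ≤n` exchanges one factor for `n` here, and two factors in `S₃≤S₁`.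
 S₂≤S₁ : τ ^ 2 * (u ^ 3 * n ^ 2) ≤ S₁
 S₂≤S₁ = ≤-trans (≤-reflexive (lem τ u n)) (≤-trans (*-monoʳ-≤ τ (*-monoˡ-≤ (n ^ 2) u³τ≤n)) (≤-reflexive (lem2 τ n)))
  where
  lem : ∀ τ u n → (τ * (τ * 1)) * ((u * (u * (u * 1))) * (n * (n * 1))) ≡ τ * ((u * (u * (u * 1))) * τ * (n * (n * 1)))
  lem = solve-∀
  lem2 : ∀ τ n → τ * (n * (n * (n * 1))) ≡ τ * (n * (n * (n * 1)))
  lem2 = solve-∀

 S₃≤S₁ : τ ^ 3 * (u ^ 6 * n ^ 1) ≤ S₁
 S₃≤S₁ = ≤-trans (≤-reflexive (lem τ u n)) (≤-trans (*-monoʳ-≤ τ (*-mono-≤ (*-mono-≤ u³τ≤n u³τ≤n) (≤-refl {n}))) (≤-reflexive (lem2 τ n)))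
  where
  lem : ∀ τ u n → (τ * (τ * (τ * 1))) * ((u * (u * (u * (u * (u * (u * 1)))))) * (n * 1)) ≡ τ * ((u * (u * (u * 1))) * τ * ((u * (u * (u * 1))) * τ) * n)
  lem = solve-∀
  lem2 : ∀ τ n → τ * (n * n * n) ≡ τ * (n * (n * (n * 1)))
  lem2 = solve-∀

 toS₂ : ∀ k {a} → a ≤ M 2 3 2 k → a ≤ W * k
 toS₂ k le = ≤-trans le (*-monoˡ-≤ k (≤-trans S₂≤S₁ (m≤m+n S₁ D)))

 toS₃ : ∀ k {a} → a ≤ M 3 6 1 k → a ≤ W * k
 toS₃ k le = ≤-trans le (*-monoˡ-≤ k (≤-trans S₃≤S₁ (m≤m+n S₁ D)))

 ab≤a²+b² : ∀ a b → a * b ≤ a * a + b * b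
 ab≤a²+b² a b with ≤-total a b
 ... | inj₁ a≤b = ≤-trans (*-monoˡ-≤ b a≤b) (m≤n+m (b * b) (a * a))
 ... | inj₂ b≤a = ≤-trans (*-monoʳ-≤ a b≤a) (m≤m+n (a * a) (b * b))

 -- The monomial is the product of τun and τ⁴u⁴. The square of the first is absorbed by `S₂≤S₁`, the
 -- square of the second is `D`.
 toS₅ : ∀ k {a} → a ≤ M 5 5 1 k → a ≤ W * k
 toS₅ k le = ≤-trans le (*-monoˡ-≤ k (≤-trans (≤-reflexive (lem τ u n)) (≤-trans (ab≤a²+b² (τ * u * n) (τ ^ 4 * u ^ 4))
   (+-mono-≤ (≤-trans (≤-reflexive (lem3 τ u n)) (≤-trans (*-monoʳ-≤ (τ ^ 2) (*-monoˡ-≤ (n ^ 2) (pow-mono 1≤τ 1≤u 1≤u (s≤s (s≤s (z≤n {1})))))) S₂≤S₁))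
    (≤-reflexive (lem2 τ u))))))
  where
  lem : ∀ τ u n → let w = τ * (τ * (τ * (τ * 1))) ; v = u * (u * (u * (u * 1))) in (τ * w) * ((u * v) * (n * 1)) ≡ τ * u * n * (w * v)
  lem = solve-∀
  lem2 : ∀ τ u → let w = τ * (τ * (τ * (τ * 1))) ; v = u * (u * (u * (u * 1))) in w * v * (w * v) ≡ (τ * (τ * (τ * (τ * w)))) * (u * (u * (u * (u * v))))
  lem2 = solve-∀
  lem3 : ∀ τ u n → τ * u * n * (τ * u * n) ≡ (τ * (τ * 1)) * ((u * (u * 1)) * (n * (n * 1)))
  lem3 = solve-∀

 up : ∀ {i j l k} i′ j′ {p : T (i N.≤ᵇ i′)} {q : T (j N.≤ᵇ j′)} {a} → a ≤ M i j l k → a ≤ M i′ j′ l k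
 up {i} {j} {l} {k} i′ j′ {p} {q} = M-up 1≤τ 1≤u {i} {j} {l} {k} {i′} {j′} p q (≤⇒≤ᵇ (≤-refl {k}))

 mul : ∀ i j l k i′ j′ l′ k′ {a b} → a ≤ M i j l k → b ≤ M i′ j′ l′ k′ → a * b ≤ M (i + i′) (j + j′) (l + l′) (k * k′)
 mul i j l k i′ j′ l′ k′ = M-*-≤ {i} {j} {l} {k} {i′} {j′} {l′} {k′}

 add : ∀ k k′ {a b} → a ≤ W * k → b ≤ W * k′ → a + b ≤ W * (k + k′)
 add k k′ p q = ≤-trans (+-mono-≤ p q) (≤-reflexive (sym (*-distribˡ-+ W k k′)))

 X≤u : X ≤ u
 X≤u = ≤-trans (≤-reflexive (+-suc w w)) (≤-trans (+-monoˡ-≤ (w + w) 1≤w) (≤-reflexive (lem w)))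
  where
  lem : ∀ w → w + (w + w) ≡ 3 * w
  lem = solve-∀

 starBound≤ : ∀ b₁ b₂ b₃ b₄ → b₁ ≤ 2 * τ → b₂ ≤ 2 * τ + 2 * τ * X → b₃ ≤ 2 * τ + 2 * τ * X + 2 * τ * X * X
  → b₄ ≤ 2 * τ + 2 * τ * X + 2 * τ * X * X + 2 * τ * X * X * (τ + 63) → starBound n b₁ b₂ b₃ b₄ X X (τ + 62) ≤ W * starConstant
 starBound≤ b₁ b₂ b₃ b₄ h₁ h₂ h₃ h₄ =
   -- In `add k k′` the first number is the coefficient of one summand and the second the sum of the
   -- coefficients of all later ones.
   add 2 652696241 (toS₁ 2 (up {1} {0} {3} {2} 1 0 (mul 1 0 0 2 0 0 3 1 b₁≤ (mul 0 0 1 1 0 0 2 1 n≤ (mul 0 0 1 1 0 0 1 1 n≤ n≤)))))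
   (add 16 652696225 (toS₂ 16 (up {2} {2} {2} {16} 2 3 (mul 1 1 0 4 1 1 2 4 b₂≤ (mul 1 1 0 4 0 0 2 1 b₂≤ (mul 0 0 1 1 0 0 1 1 n≤ n≤)))))
   (add 216 652696009 (toS₃ 216 (up {3} {6} {1} {216} 3 6 (mul 1 2 0 6 2 4 1 36 b₃≤ (mul 1 2 0 6 1 2 1 6 b₃≤ (mul 1 2 0 6 0 0 1 1 b₃≤ n≤)))))
   (add 322417936 330278073 (toD 322417936 (up {8} {8} {0} {322417936} 8 8 (mul 2 2 0 134 6 6 0 2406104 b₄≤ (mul 2 2 0 134 4 4 0 17956 b₄≤ (mul 2 2 0 134 2 2 0 134 b₄≤ b₄≤)))))
   (add 64 330278009 (toS₁ 64 (up {1} {0} {3} {64} 1 0 (mul 0 0 1 1 1 0 2 64 n≤ (mul 0 0 1 1 1 0 1 64 n≤ (mul 0 0 1 1 1 0 0 64 n≤ z₀≤)))))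
   (add 64 330277945 (toS₁ 64 (up {1} {0} {3} {64} 1 0 (mul 0 0 1 1 1 0 2 64 n≤ (mul 0 0 1 1 1 0 1 64 n≤ (mul 0 0 1 1 1 0 0 64 n≤ z₀≤)))))
   (add 1 330277944 (toS₂ 1 (up {0} {2} {2} {1} 2 3 (mul 0 0 1 1 0 2 1 1 n≤ (mul 0 1 0 1 0 1 1 1 x≤ (mul 0 0 1 1 0 1 0 1 n≤ x≤)))))
   (add 267 330277677 (toS₂ 267 (up {2} {3} {2} {267} 2 3 (mul 0 0 1 1 2 3 1 267 n≤ (mul 0 0 1 1 2 3 0 267 n≤ (mul 2 2 0 267 0 1 0 1 bK≤ x≤)))))
   (add 4 330277673 (toS₂ 4 (up {1} {2} {2} {4} 2 3 (mul 1 1 0 4 0 1 2 1 b₂≤ (mul 0 1 0 1 0 0 2 1 x≤ (mul 0 0 1 1 0 0 1 1 n≤ n≤)))))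
   (add 2340 330275333 (toS₃ 2340 (up {3} {5} {1} {2340} 3 6 (mul 1 2 0 6 2 3 1 390 b₃≤ (mul 1 2 0 6 1 1 1 65 b₃≤ (mul 1 1 0 65 0 0 1 1 Y≤ n≤)))))
   (add 1167140 329108193 (toS₅ 1167140 (up {5} {5} {1} {1167140} 5 5 (mul 2 2 0 134 3 3 1 8710 b₄≤ (mul 2 2 0 134 1 1 1 65 b₄≤ (mul 1 1 0 65 0 0 1 1 Y≤ n≤)))))
   (add 4225 329103968 (toS₂ 4225 (up {2} {2} {2} {4225} 2 3 (mul 0 0 1 1 2 2 1 4225 n≤ (mul 0 0 1 1 2 2 0 4225 n≤ (mul 1 1 0 65 1 1 0 65 Y≤ Y≤)))))
   (add 2448 329101520 (toS₃ 2448 (up {3} {6} {1} {2448} 3 6 (mul 1 2 0 6 2 4 1 408 b₃≤ (mul 1 2 0 68 1 2 1 6 K≤ (mul 1 2 0 6 0 0 1 1 b₃≤ n≤)))))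
   (add 163615072 165486448 (toD 163615072 (up {7} {8} {0} {163615072} 8 8 (mul 2 2 0 134 5 6 0 1221008 b₄≤ (mul 1 2 0 68 4 4 0 17956 K≤ (mul 2 2 0 134 2 2 0 134 b₄≤ b₄≤)))))
   (add 162394064 3092384 (toD 162394064 (up {6} {8} {0} {162394064} 8 8 (mul 2 2 0 134 4 6 0 1211896 b₄≤ (mul 1 2 0 68 3 4 0 17822 K≤ (mul 1 2 0 133 2 2 0 134 K′≤ b₄≤)))))
   (add 1781668 1310716 (toS₃ 1781668 (up {3} {6} {1} {1781668} 3 6 (mul 0 0 1 1 3 6 0 1781668 n≤ (mul 1 2 0 68 2 4 0 26201 K≤ (mul 1 2 0 133 1 2 0 197 K′≤ θ≤)))))
   (add 54264 1256452 (toS₃ 54264 (up {3} {6} {1} {54264} 3 6 (mul 1 2 0 6 2 4 1 9044 b₃≤ (mul 1 2 0 68 1 2 1 133 K≤ (mul 1 2 0 133 0 0 1 1 K′≤ n≤)))))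
   (add 53466 1202986 (toS₃ 53466 (up {3} {6} {1} {53466} 3 6 (mul 2 2 0 134 1 4 1 399 b₄≤ (mul 0 2 0 3 1 2 1 133 κ≤ (mul 1 2 0 133 0 0 1 1 K′≤ n≤)))))
   (add 134 1202852 (toS₂ 134 (up {2} {3} {2} {134} 2 3 (mul 2 2 0 134 0 1 2 1 b₄≤ (mul 0 0 1 1 0 1 1 1 n≤ (mul 0 1 0 1 0 0 1 1 x≤ n≤)))))
   (toS₃ 1202852 (up {3} {6} {1} {1202852} 3 6 (mul 0 0 1 1 3 6 0 1202852 n≤ (mul 1 2 0 68 2 4 0 17689 K≤ (mul 1 2 0 133 1 2 0 133 K′≤ K′≤)))))))))))))))))))))))
  where
  z Y K K′ θ κ : ℕ
  z = suc (τ + 62)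
  Y = X * suc z
  K = X * suc Y + 2
  K′ = K + Y
  θ = K′ + z
  κ = X * suc X + 1
  one : ∀ {a b} → 1 ≤ a → 1 ≤ b → 1 ≤ a * b
  one {suc a} {suc b} _ _ = s≤s z≤n
  τ≤ : ∀ k → τ * k ≤ M 1 0 0 k
  τ≤ k = ≤-reflexive (cong (_* k) (lem τ))
   where
   lem : ∀ τ → τ ≡ (τ * 1) * (1 * 1)
   lem = solve-∀
  n≤ : n ≤ M 0 0 1 1
  n≤ = ≤-reflexive (lem n)
   where
   lem : ∀ n → n ≡ 1 * (1 * (n * 1)) * 1
   lem = solve-∀
  x≤ : X ≤ M 0 1 0 1
  x≤ = ≤-trans X≤u (≤-reflexive (lem u))
   where
   lem : ∀ n → n ≡ 1 * ((n * 1) * 1) * 1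
   lem = solve-∀
  k≤ : ∀ k → k ≤ M 0 0 0 k
  k≤ k = ≤-reflexive (sym (+-identityʳ k))
  up₀ : ∀ k i j {a} → a ≤ M 0 0 0 k → a ≤ M i j 0 k
  up₀ k i j = M-up 1≤τ 1≤u {0} {0} {0} {k} {i} {j} tt tt (≤⇒≤ᵇ (≤-refl {k}))
  2τ≤ : 2 * τ ≤ M 1 0 0 2
  2τ≤ = ≤-trans (≤-reflexive (*-comm 2 τ)) (τ≤ 2)
  b₁≤ : b₁ ≤ M 1 0 0 2
  b₁≤ = ≤-trans h₁ 2τ≤
  2τX≤ : 2 * τ * X ≤ M 1 1 0 2
  2τX≤ = mul 1 0 0 2 0 1 0 1 2τ≤ x≤
  2τXX≤ : 2 * τ * X * X ≤ M 1 2 0 2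
  2τXX≤ = mul 1 1 0 2 0 1 0 1 2τX≤ x≤
  b₂≤ : b₂ ≤ M 1 1 0 4
  b₂≤ = ≤-trans h₂ (M-+-≤ {1} {1} {0} {2} {2} (up {1} {0} {0} {2} 1 1 2τ≤) 2τX≤)
  b₃≤ : b₃ ≤ M 1 2 0 6
  b₃≤ = ≤-trans h₃ (M-+-≤ {1} {2} {0} {4} {2} (up {1} {1} {0} {4} 1 2
   (M-+-≤ {1} {1} {0} {2} {2} (up {1} {0} {0} {2} 1 1 2τ≤) 2τX≤)) 2τXX≤)
  τ63≤ : τ + 63 ≤ M 1 0 0 64
  τ63≤ = ≤-trans (+-monoʳ-≤ τ (*-monoˡ-≤ 63 1≤τ)) (≤-trans (≤-reflexive (sym (*-suc τ 63))) (τ≤ 64))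
  b₄≤ : b₄ ≤ M 2 2 0 134
  b₄≤ = ≤-trans h₄ (M-+-≤ {2} {2} {0} {6} {128} (up {1} {2} {0} {6} 2 2 (M-+-≤ {1} {2} {0} {4} {2} (up {1} {1} {0} {4} 1 2
   (M-+-≤ {1} {1} {0} {2} {2} (up {1} {0} {0} {2} 1 1 2τ≤) 2τX≤)) 2τXX≤)) (mul 1 2 0 2 1 0 0 64 2τXX≤ τ63≤))
  z≤ : z ≤ M 1 0 0 64
  z≤ = ≤-trans (≤-reflexive (sym (+-suc τ 62))) τ63≤
  z₀≤ : τ + 62 ≤ M 1 0 0 64
  z₀≤ = ≤-trans (n≤1+n _) z≤
  Y≤ : Y ≤ M 1 1 0 65
  Y≤ = mul 0 1 0 1 1 0 0 65 x≤ (M-+-≤ {1} {0} {0} {1} {64} (up₀ 1 1 0 (k≤ 1)) z≤)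
  K≤ : K ≤ M 1 2 0 68
  K≤ = M-+-≤ {1} {2} {0} {66} {2} (mul 0 1 0 1 1 1 0 66 x≤ (M-+-≤ {1} {1} {0} {1} {65} (up₀ 1 1 1 (k≤ 1)) Y≤)) (up₀ 2 1 2 (k≤ 2))
  K′≤ : K′ ≤ M 1 2 0 133
  K′≤ = M-+-≤ {1} {2} {0} {68} {65} K≤ (up {1} {1} {0} {65} 1 2 Y≤)
  θ≤ : θ ≤ M 1 2 0 197
  θ≤ = M-+-≤ {1} {2} {0} {133} {64} K′≤ (up {1} {0} {0} {64} 1 2 z≤)
  κ≤ : κ ≤ M 0 2 0 3
  κ≤ = M-+-≤ {0} {2} {0} {2} {1} (mul 0 1 0 1 0 1 0 2 x≤ (M-+-≤ {0} {1} {0} {1} {1} (up₀ 1 0 1 (k≤ 1)) x≤)) (up₀ 1 0 2 (k≤ 1))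
  bK≤ : b₄ + K′ ≤ M 2 2 0 267
  bK≤ = M-+-≤ {2} {2} {0} {134} {133} b₄≤ (up {1} {2} {0} {133} 2 2 K′≤)

 many-stars-contains : (G : Graph4 n) → W * suc starConstant ≤ ∥ G ∥ → Contains G (starForest τ w w τ)
 many-stars-contains G le = many-stars G τ w w τ 32≤w 32≤w λ b₁ b₂ b₃ b₄ h₁ h₂ h₃ h₄ →
  ≤-trans (s≤s (starBound≤ b₁ b₂ b₃ b₄ h₁ h₂ h₃ h₄)) (≤-trans (+-monoˡ-≤ (W * starConstant) 1≤W) (≤-trans (≤-reflexive (sym (*-suc W starConstant))) le))
  where
  1≤W : 1 ≤ W
  1≤W = ≤-trans (m^n>0′ 1≤τ 1≤u) (m≤n+m D S₁)
   where
   m^n>0′ : ∀ {a b} → 1 ≤ a → 1 ≤ b → 1 ≤ a ^ 8 * b ^ 8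
   m^n>0′ {suc a} {suc b} _ _ = *-mono-≤ (m^n>0 (suc a) 8) (m^n>0 (suc b) 8)

-- Dense graphs contain many disjoint complete 4-partite graphs K(l,l,l,q)

sumOf : {A : Set} → (A → ℕ) → List A → ℕ
sumOf f [] = 0
sumOf f (x ∷ xs) = f x + sumOf f xs

ind : {P : Set} → Dec P → ℕ
ind (yes _) = 1
ind (no _) = 0

sumOf-cong : {A : Set} {f g : A → ℕ} → (∀ a → f a ≡ g a) → ∀ xs → sumOf f xs ≡ sumOf g xs
sumOf-cong h [] = refl
sumOf-cong h (x ∷ xs) = cong₂ _+_ (h x) (sumOf-cong h xs)

sumOf-mono : {A : Set} {f g : A → ℕ} (xs : List A) → (∀ {a} → a ∈ xs → f a ≤ g a) → sumOf f xs ≤ sumOf g xs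
sumOf-mono [] h = z≤n
sumOf-mono (x ∷ xs) h = +-mono-≤ (h (here refl)) (sumOf-mono xs (h ∘ there))

sumOf-0 : {A : Set} (xs : List A) → sumOf (λ _ → 0) xs ≡ 0
sumOf-0 [] = refl
sumOf-0 (x ∷ xs) = sumOf-0 xs

sumOf-const : {A : Set} (k : ℕ) (xs : List A) → sumOf (λ _ → k) xs ≡ length xs * k
sumOf-const k [] = refl
sumOf-const k (x ∷ xs) = cong (k +_) (sumOf-const k xs)

sumOf-+ : {A : Set} (f g : A → ℕ) (xs : List A) → sumOf (λ a → f a + g a) xs ≡ sumOf f xs + sumOf g xs
sumOf-+ f g [] = refl
sumOf-+ f g (x ∷ xs) = trans (cong (f x + g x +_) (sumOf-+ f g xs)) (lem (f x) (g x) (sumOf f xs) (sumOf g xs))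
 where
 lem : ∀ a b c d → a + b + (c + d) ≡ a + c + (b + d)
 lem = solve-∀

sumOf-* : {A : Set} (k : ℕ) (f : A → ℕ) (xs : List A) → sumOf (λ a → k * f a) xs ≡ k * sumOf f xs
sumOf-* k f [] = sym (*-zeroʳ k)
sumOf-* k f (x ∷ xs) = trans (cong (k * f x +_) (sumOf-* k f xs)) (sym (*-distribˡ-+ k (f x) (sumOf f xs)))

sumOf-swap : {A B : Set} (f : A → B → ℕ) (xs : List A) (ys : List B)
 → sumOf (λ a → sumOf (f a) ys) xs ≡ sumOf (λ b → sumOf (λ a → f a b) xs) ys
sumOf-swap f [] ys = sym (sumOf-0 ys)
sumOf-swap f (x ∷ xs) ys = trans (cong (sumOf (f x) ys +_) (sumOf-swap f xs ys)) (sym (sumOf-+ (f x) _ ys))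

sumOf-map : {A B : Set} (f : B → ℕ) (g : A → B) (xs : List A) → sumOf f (map g xs) ≡ sumOf (f ∘ g) xs
sumOf-map f g [] = refl
sumOf-map f g (x ∷ xs) = cong (f (g x) +_) (sumOf-map f g xs)

sumOf-++ : {A : Set} (f : A → ℕ) (xs ys : List A) → sumOf f (xs ++ ys) ≡ sumOf f xs + sumOf f ys
sumOf-++ f [] ys = refl
sumOf-++ f (x ∷ xs) ys = trans (cong (f x +_) (sumOf-++ f xs ys)) (sym (+-assoc (f x) _ _))

pairs : {A B : Set} → List A → List B → List (A × B)
pairs xs ys = concatMap (λ a → map (a ,_) ys) xs

sumOf-pairs : {A B : Set} (f : A × B → ℕ) (xs : List A) (ys : List B) → sumOf f (pairs xs ys) ≡ sumOf (λ a → sumOf (λ b → f (a , b)) ys) xs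
sumOf-pairs f [] ys = refl
sumOf-pairs f (x ∷ xs) ys = trans (sumOf-++ f (map (x ,_) ys) (pairs xs ys)) (cong₂ _+_ (sumOf-map f (x ,_) ys) (sumOf-pairs f xs ys))

length-pairs : {A B : Set} (xs : List A) (ys : List B) → length (pairs xs ys) ≡ length xs * length ys
length-pairs xs ys = length-concatMap≡ _ (length ys) xs λ a → LP.length-map (a ,_) ys

∈-pairs : {A B : Set} {xs : List A} {ys : List B} {a : A} {b : B} → a ∈ xs → b ∈ ys → (a , b) ∈ pairs xs ys
∈-pairs a∈ b∈ = ∈-concatMap _ a∈ (∈-map⁺ _ b∈)

pairs-unique : {A B : Set} {xs : List A} {ys : List B} → Unique xs → Unique ys → Unique (pairs xs ys)
pairs-unique {xs = []} u v = []
pairs-unique {xs = x ∷ xs} {ys} (x≢ ∷ u) v = unique-++⁺ (Uniq.map⁺ (cong proj₂) v) (pairs-unique u v) apart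
 where
 apart : Disj (map (x ,_) ys) (pairs xs ys)
 apart p p∈ q∈ with ∈-map⁻ (x ,_) p∈ | ∈-concatMap⁻′ (λ a → map (a ,_) ys) xs q∈
 ... | _ , _ , refl | a , a∈ , r with ∈-map⁻ (a ,_) r
 ... | _ , _ , refl = All.lookup x≢ a∈ refl

filter-count : {A : Set} {P : A → Set} (P? : Decidable P) (xs : List A) → length (filter P? xs) ≡ sumOf (λ a → ind (P? a)) xs
filter-count P? [] = refl
filter-count P? (x ∷ xs) with P? x
... | yes _ = cong suc (filter-count P? xs)
... | no _ = filter-count P? xs

abstract

 -- The inverse density after one round of picking `l` vertices, if it was `P` before.
 boost : ℕ → ℕ → ℕ
 boost l P = (4 * P) ^ suc l

 boost≡ : ∀ l P → boost l P ≡ (4 * P) ^ suc l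
 boost≡ l P = refl

 1≤boost : ∀ l {P} → 1 ≤ P → 1 ≤ boost l P
 1≤boost l {suc P} _ = m^n>0 (4 * suc P) (suc l)

 4P≤boost : ∀ l {P} → 1 ≤ P → 4 * P ≤ boost l P
 4P≤boost l {suc P} _ = ≤-trans (≤-reflexive (sym (*-identityʳ _))) (*-monoʳ-≤ (4 * suc P) (m^n>0 (4 * suc P) l))

pos-right : ∀ {a b} k → 1 ≤ a → a ≤ k * b → 1 ≤ b
pos-right {b = zero} k 1≤a a≤ = ⊥-elim (<-irrefl refl (≤-trans 1≤a (≤-trans a≤ (≤-reflexive (*-zeroʳ k)))))
pos-right {b = suc b} k _ _ = s≤s z≤n

module _ {n : ℕ} where

 open import Data.List.Membership.DecPropositional (F._≟_ {n}) using (_∈?_)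

 private
  vs : List (Fin n)
  vs = allFin n

  |vs| : length vs ≡ n
  |vs| = LP.length-tabulate id

 -- Some a outside A is related to a proportion 1/k of ms.
 popular : {M : Set} (R : Fin n → M → Set) (R? : ∀ a m → Dec (R a m)) (k : ℕ) (A : List (Fin n)) (ms : List M)
  → 1 ≤ n → 1 ≤ length ms → (∀ {m} → m ∈ ms → n ≤ k * (sumOf (λ a → ind (R? a m ×-dec ¬? (a ∈? A))) vs))
  → ∃ λ a → a ∉ A × length ms ≤ k * sumOf (λ m → ind (R? a m)) ms
 popular {M} R R? k A ms 1≤n 1≤ms h with Fin-dichotomy dich
  where
  C₁ D₁ : Fin n → Set
  C₁ a = a ∉ A × length ms ≤ k * sumOf (λ m → ind (R? a m)) ms
  D₁ a = suc (k * sumOf (λ m → ind (R? a m ×-dec ¬? (a ∈? A))) ms) ≤ length ms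
  only-outside : ∀ {P Q : Set} (d : Dec P) (e : Dec Q) → ind (d ×-dec e) ≤ ind d
  only-outside (yes _) (yes _) = ≤-refl
  only-outside (yes _) (no _) = z≤n
  only-outside (no _) _ = z≤n
  inside : ∀ {P Q : Set} (d : Dec P) (e : Dec Q) → ¬ Q → ind (d ×-dec e) ≤ 0
  inside (yes _) (yes q) ¬q = ⊥-elim (¬q q)
  inside (yes _) (no _) _ = z≤n
  inside (no _) _ _ = z≤n
  dich : ∀ a → C₁ a ⊎ D₁ a
  dich a with a ∈? A in eq | length ms N.≤? k * sumOf (λ m → ind (R? a m)) ms
  ... | no a∉ | yes le = inj₁ (a∉ , le)
  ... | no a∉ | no ¬le = inj₂ (≤-trans (s≤s (*-monoʳ-≤ k (sumOf-mono ms λ {m} _ → only-outside (R? a m) (¬? (no a∉))))) (≰⇒> ¬le))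
  ... | yes a∈ | _ = inj₂ (≤-trans (s≤s (≤-trans (*-monoʳ-≤ k (≤-trans (sumOf-mono ms λ {m} _ → inside (R? a m) (¬? (yes a∈)) (λ n → n a∈))
   (≤-reflexive (sumOf-0 ms)))) (≤-reflexive (*-zeroʳ k)))) 1≤ms)
 ... | inj₁ r = r
 ... | inj₂ all = ⊥-elim (<-irrefl refl (begin-strict
   length ms * n ≡⟨ sym (sumOf-const n ms) ⟩
   sumOf (λ _ → n) ms ≤⟨ sumOf-mono ms h ⟩
   sumOf (λ m → k * sumOf (λ a → g a m) vs) ms ≡⟨ sumOf-* k _ ms ⟩
   k * sumOf (λ m → sumOf (λ a → g a m) vs) ms ≡⟨ cong (k *_) (sym (sumOf-swap g vs ms)) ⟩
   k * sumOf (λ a → sumOf (g a) ms) vs ≡⟨ sym (sumOf-* k _ vs) ⟩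
   sumOf (λ a → k * sumOf (g a) ms) vs <⟨ m<n+m _ (≤-trans 1≤n (≤-reflexive (sym |vs|))) ⟩
   length vs + sumOf (λ a → k * sumOf (g a) ms) vs ≡⟨ cong (_+ sumOf (λ a → k * sumOf (g a) ms) vs) (sym (trans (sumOf-const 1 vs) (*-identityʳ _))) ⟩
   sumOf (λ _ → 1) vs + sumOf (λ a → k * sumOf (g a) ms) vs ≡⟨ sym (sumOf-+ (λ _ → 1) _ vs) ⟩
   sumOf (λ a → suc (k * sumOf (g a) ms)) vs ≤⟨ sumOf-mono vs (λ {a} _ → all a) ⟩
   sumOf (λ _ → length ms) vs ≡⟨ sumOf-const (length ms) vs ⟩
   length vs * length ms ≡⟨ trans (cong (_* length ms) |vs|) (*-comm n _) ⟩
   length ms * n ∎))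
  where
  open ≤-Reasoning
  g : Fin n → M → ℕ
  g a m = ind (R? a m ×-dec ¬? (a ∈? A))

 module KST {M : Set} (R : Fin n → M → Set) (R? : ∀ a m → Dec (R a m)) (P : ℕ) (1≤n : 1 ≤ n) where

  deg : M → ℕ
  deg m = sumOf (λ a → ind (R? a m)) vs

  deg≤n : ∀ m → deg m ≤ n
  deg≤n m = ≤-trans (sumOf-mono vs λ {a} _ → one (R? a m)) (≤-reflexive (trans (sumOf-const 1 vs) (trans (*-identityʳ _) |vs|)))
   where
   one : ∀ {P : Set} (d : Dec P) → ind d ≤ 1
   one (yes _) = ≤-refl
   one (no _) = z≤n

  deg-outside : ∀ A m → Unique A → deg m ≤ sumOf (λ a → ind (R? a m ×-dec ¬? (a ∈? A))) vs + length A
  deg-outside A m u = ≤-trans (sumOf-mono vs λ {a} _ → split (R? a m) (a ∈? A))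
   (≤-trans (≤-reflexive (sumOf-+ _ (λ a → ind (a ∈? A)) vs)) (+-monoʳ-≤ _ (≤-trans (≤-reflexive (sym (filter-count (_∈? A) vs)))
    (unique-⊆⇒length≤ (Uniq.filter⁺ (_∈? A) (Uniq.allFin⁺ n)) λ p → proj₂ (∈-filter⁻ (_∈? A) {xs = vs} p)))))
   where
   split : ∀ {P Q : Set} (d : Dec P) (e : Dec Q) → ind d ≤ ind (d ×-dec ¬? e) + ind e
   split (no _) _ = z≤n
   split (yes _) (yes _) = ≤-refl
   split (yes _) (no _) = ≤-refl

  Good : ℕ → List M → Set
  Good i ms = Σ (List (Fin n)) λ A → Unique A × length A ≡ i × Σ (List M) λ ms′ → Unique ms′ × (∀ {m} → m ∈ ms′ → m ∈ ms)
   × (∀ {m} → m ∈ ms′ → All (λ a → R a m) A) × length ms ≤ (4 * P) ^ i * length ms′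

  -- One vertex is picked at a time, instead of averaging over all l-sets. A good `m` has at least
  -- n/(2P) neighbours, and at most n/(4P) of them are already in `A`, so some new vertex is joined
  -- to a fraction 1/(4P) of the remaining `m`.
  grow : ∀ ms → Unique ms → 1 ≤ length ms → (∀ {m} → m ∈ ms → n ≤ 2 * P * deg m) → ∀ i → 4 * P * i ≤ n → Good i ms
  grow ms u 1≤ms h zero le = [] , [] , refl , ms , u , id , (λ _ → []) , ≤-reflexive (sym (+-identityʳ _))
  grow ms u 1≤ms h (suc i) le with grow ms u 1≤ms h i (≤-trans (*-monoʳ-≤ (4 * P) (n≤1+n i)) le)
  ... | A , uA , lA , ms′ , u′ , sub , rel , big
   with popular R R? (4 * P) A ms′ 1≤n 1≤ms′ dense
   where
   1≤ms′ : 1 ≤ length ms′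
   1≤ms′ = pos-right ((4 * P) ^ i) 1≤ms big
   dense : ∀ {m} → m ∈ ms′ → n ≤ 4 * P * sumOf (λ a → ind (R? a m ×-dec ¬? (a ∈? A))) vs
   dense {m} m∈ = +-cancelʳ-≤ n n _ (begin
     n + n ≤⟨ +-mono-≤ (h (sub m∈)) (h (sub m∈)) ⟩
     2 * P * deg m + 2 * P * deg m ≡⟨ lem P (deg m) ⟩
     4 * P * deg m ≤⟨ *-monoʳ-≤ (4 * P) (deg-outside A m uA) ⟩
     4 * P * (_ + length A) ≡⟨ *-distribˡ-+ (4 * P) _ (length A) ⟩
     4 * P * _ + 4 * P * length A ≤⟨ +-monoʳ-≤ _ (≤-trans (*-monoʳ-≤ (4 * P) (≤-trans (≤-reflexive lA) (n≤1+n i))) le) ⟩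
     4 * P * _ + n ∎)
    where
    open ≤-Reasoning
    lem : ∀ p d → 2 * p * d + 2 * p * d ≡ 4 * p * d
    lem = solve-∀
  ... | a , a∉ , big′ = a ∷ A , (All.tabulate (λ b∈ e → a∉ (subst (_∈ A) (sym e) b∈)) ∷ uA) , cong suc lA
    , filter (R? a) ms′ , Uniq.filter⁺ (R? a) u′ , (λ p → sub (proj₁ (∈-filter⁻ (R? a) p)))
    , (λ p → let (q , r) = ∈-filter⁻ (R? a) p in r ∷ rel q)
    , ≤-trans big (≤-trans (*-monoʳ-≤ ((4 * P) ^ i) big′) (≤-reflexive
     (trans (cong (λ l → (4 * P) ^ i * (4 * P * l)) (sym (filter-count (R? a) ms′))) (lem ((4 * P) ^ i) (4 * P) _))))
   where
   lem : ∀ a b c → a * (b * c) ≡ b * a * c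
   lem = solve-∀

  good? : ∀ m → Dec (n ≤ 2 * P * deg m)
  good? m = n N.≤? 2 * P * deg m

  -- The elements that are not good contribute at most half of the guaranteed total degree.
  many-good : ∀ ms → n * length ms ≤ P * sumOf deg ms → length ms ≤ 2 * P * length (filter good? ms)
  many-good ms h = *-cancelˡ-≤ n {{N.>-nonZero 1≤n}} (+-cancelʳ-≤ (n * length ms) _ _ (begin
    n * length ms + n * length ms ≤⟨ +-mono-≤ h h ⟩
    P * sumOf deg ms + P * sumOf deg ms ≡⟨ lem P (sumOf deg ms) ⟩
    2 * P * sumOf deg ms ≡⟨ sym (sumOf-* (2 * P) deg ms) ⟩
    sumOf (λ m → 2 * P * deg m) ms ≤⟨ sumOf-mono ms (λ {m} _ → each m) ⟩
    sumOf (λ m → 2 * P * n * ind (good? m) + n) ms ≡⟨ sumOf-+ _ (λ _ → n) ms ⟩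
    sumOf (λ m → 2 * P * n * ind (good? m)) ms + sumOf (λ _ → n) ms
     ≡⟨ cong₂ _+_ (trans (sumOf-* (2 * P * n) _ ms) (cong (2 * P * n *_) (sym (filter-count good? ms)))) (trans (sumOf-const n ms) (*-comm _ n)) ⟩
    2 * P * n * length (filter good? ms) + n * length ms ≡⟨ cong (_+ n * length ms) (lem2 P n (length (filter good? ms))) ⟩
    n * (2 * P * length (filter good? ms)) + n * length ms ∎))
   where
   open ≤-Reasoning
   each : ∀ m → 2 * P * deg m ≤ 2 * P * n * ind (good? m) + n
   each m = by-cases (good? m)
    where
    by-cases : (d : Dec (n ≤ 2 * P * deg m)) → 2 * P * deg m ≤ 2 * P * n * ind d + n
    by-cases (yes _) = ≤-trans (*-monoʳ-≤ (2 * P) (deg≤n m)) (≤-trans (≤-reflexive (sym (*-identityʳ _))) (m≤m+n _ n))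
    by-cases (no ¬le) = ≤-trans (<⇒≤ (≰⇒> ¬le)) (m≤n+m n _)
   lem : ∀ p s → p * s + p * s ≡ 2 * p * s
   lem = solve-∀
   lem2 : ∀ p n s → 2 * p * n * s ≡ n * (2 * p * s)
   lem2 = solve-∀

  kst : ∀ ms → Unique ms → 1 ≤ length ms → n * length ms ≤ P * sumOf deg ms → ∀ l → 4 * P * l ≤ n
   → Σ (List (Fin n)) λ A → Unique A × length A ≡ l
    × length ms ≤ (4 * P) ^ suc l * length (filter (λ m → All.all? (λ a → R? a m) A) ms)
  kst ms u 1≤ms h l le with many-good ms h
  ... | many with grow (filter good? ms) (Uniq.filter⁺ good? u) (pos-right (2 * P) 1≤ms many) (λ p → proj₂ (∈-filter⁻ good? {xs = ms} p)) l le
  ... | A , uA , lA , ms′ , u′ , sub , rel , big = A , uA , lA , (begin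
    length ms ≤⟨ many ⟩
    2 * P * length (filter good? ms) ≤⟨ *-mono-≤ (*-monoˡ-≤ P (s≤s (s≤s (z≤n {2})))) big ⟩
    4 * P * ((4 * P) ^ l * length ms′) ≡⟨ sym (*-assoc (4 * P) ((4 * P) ^ l) (length ms′)) ⟩
    (4 * P) ^ suc l * length ms′ ≤⟨ *-monoʳ-≤ ((4 * P) ^ suc l) (unique-⊆⇒length≤ u′ λ p →
     ∈-filter⁺ (λ m → All.all? (λ a → R? a m) A) (proj₁ (∈-filter⁻ good? {xs = ms} (sub p))) (rel p)) ⟩
    (4 * P) ^ suc l * length (filter (λ m → All.all? (λ a → R? a m) A) ms) ∎)
   where
   open ≤-Reasoning

  level : ∀ (ms : List M) → Unique ms → 1 ≤ length ms
   → length (pairs vs ms) ≤ P * length (filter (λ m → R? (proj₁ m) (proj₂ m)) (pairs vs ms)) → ∀ l → 4 * P * l ≤ n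
   → Σ (List (Fin n)) λ A → Unique A × length A ≡ l
    × length ms ≤ boost l P * length (filter (λ m → All.all? (λ a → R? a m) A) ms)
  level ms u 1≤ms h l le =
   let
    (A , uA , lA , big) = kst ms u 1≤ms dense l le
   in A , uA , lA , ≤-trans big (≤-reflexive (cong (_* length (filter (λ m → All.all? (λ a → R? a m) A) ms)) (sym (boost≡ l P))))
   where
   pair? : (m : Fin n × M) → Dec (R (proj₁ m) (proj₂ m))
   pair? m = R? (proj₁ m) (proj₂ m)
   count : length (filter pair? (pairs vs ms)) ≡ sumOf deg ms
   count = begin
    length (filter pair? (pairs vs ms)) ≡⟨ filter-count pair? (pairs vs ms) ⟩
    sumOf (λ m → ind (pair? m)) (pairs vs ms) ≡⟨ sumOf-pairs (λ m → ind (pair? m)) vs ms ⟩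
    sumOf (λ a → sumOf (λ m → ind (R? a m)) ms) vs ≡⟨ sumOf-swap (λ a m → ind (R? a m)) vs ms ⟩
    sumOf deg ms ∎
    where open ≡-Reasoning
   total : n * length ms ≡ length (pairs vs ms)
   total = trans (cong (_* length ms) (sym |vs|)) (sym (length-pairs vs ms))
   dense : n * length ms ≤ P * sumOf deg ms
   dense = ≤-trans (≤-reflexive total) (≤-trans h (≤-reflexive (cong (P *_) count)))

 -- Each round fixes `l` vertices in one coordinate and passes to those shorter tuples that are
 -- complete to them; the density found is the input of the next round.
 module KST₃ (Ω : Fin n → Fin n → Fin n → Fin n → Set) (Ω? : ∀ a b c d → Dec (Ω a b c d)) (P : ℕ) (1≤n : 1 ≤ n) (l : ℕ) where

  P₁ P₂ P₃ : ℕ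
  P₁ = boost l P
  P₂ = boost l P₁
  P₃ = boost l P₂

  Blob : List (Fin n) → List (Fin n) → List (Fin n) → Fin n → Set
  Blob A B C₁ d = All (λ c → All (λ b → All (λ a → Ω a b c d) A) B) C₁

  blob? : ∀ A B C₁ d → Dec (Blob A B C₁ d)
  blob? A B C₁ d = All.all? (λ c → All.all? (λ b → All.all? (λ a → Ω? a b c d) A) B) C₁

  all₂ : List (Fin n × Fin n)
  all₂ = pairs vs vs

  all₃ : List (Fin n × Fin n × Fin n)
  all₃ = pairs vs all₂

  |all₂| : length all₂ ≡ n * n
  |all₂| = trans (length-pairs vs vs) (cong₂ _*_ |vs| |vs|)

  |all₃| : length all₃ ≡ n * (n * n)
  |all₃| = trans (length-pairs vs all₂) (cong₂ _*_ |vs| |all₂|)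

  1≤* : ∀ {a b} → 1 ≤ a → 1 ≤ b → 1 ≤ a * b
  1≤* = *-mono-≤ {1} {_} {1}

  uV : Unique vs
  uV = Uniq.allFin⁺ n

  R₁ : Fin n → Fin n × Fin n × Fin n → Set
  R₁ a m = Ω a (proj₁ m) (proj₁ (proj₂ m)) (proj₂ (proj₂ m))

  R₁? : ∀ a m → Dec (R₁ a m)
  R₁? a m = Ω? a (proj₁ m) (proj₁ (proj₂ m)) (proj₂ (proj₂ m))

  R₂ : List (Fin n) → Fin n → Fin n × Fin n → Set
  R₂ A b m = All (λ a → Ω a b (proj₁ m) (proj₂ m)) A

  R₂? : ∀ A b m → Dec (R₂ A b m)
  R₂? A b m = All.all? (λ a → Ω? a b (proj₁ m) (proj₂ m)) A

  R₃ : List (Fin n) → List (Fin n) → Fin n → Fin n → Set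
  R₃ A B c d = All (λ b → All (λ a → Ω a b c d) A) B

  R₃? : ∀ A B c d → Dec (R₃ A B c d)
  R₃? A B c d = All.all? (λ b → All.all? (λ a → Ω? a b c d) A) B

  choose₁ : n * (n * (n * n)) ≤ P * length (filter (λ m → R₁? (proj₁ m) (proj₂ m)) (pairs vs all₃)) → 4 * P * l ≤ n
   → Σ (List (Fin n)) λ A → (Unique A × length A ≡ l) × length all₃ ≤ P₁ * length (filter (λ m → R₂? A (proj₁ m) (proj₂ m)) all₃)
  choose₁ h l₀ = let
    (A , uA , lA , big) = KST.level R₁ R₁? P 1≤n all₃ (pairs-unique uV (pairs-unique uV uV))
     (≤-trans (1≤* 1≤n (1≤* 1≤n 1≤n)) (≤-reflexive (sym |all₃|)))
     (≤-trans (≤-reflexive (trans (length-pairs vs all₃) (cong₂ _*_ |vs| |all₃|))) h) l l₀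
   in A , (uA , lA) , big

  choose₂ : ∀ A → length all₃ ≤ P₁ * length (filter (λ m → R₂? A (proj₁ m) (proj₂ m)) all₃) → 4 * P₁ * l ≤ n
   → Σ (List (Fin n)) λ B → (Unique B × length B ≡ l) × length all₂ ≤ P₂ * length (filter (λ m → R₃? A B (proj₁ m) (proj₂ m)) all₂)
  choose₂ A h l₁ = let
    (B , uB , lB , big) = KST.level (R₂ A) (R₂? A) P₁ 1≤n all₂ (pairs-unique uV uV)
     (≤-trans (1≤* 1≤n 1≤n) (≤-reflexive (sym |all₂|))) h l l₁
   in B , (uB , lB) , big

  choose₃ : ∀ A B → length all₂ ≤ P₂ * length (filter (λ m → R₃? A B (proj₁ m) (proj₂ m)) all₂) → 4 * P₂ * l ≤ n
   → Σ (List (Fin n)) λ C₁ → (Unique C₁ × length C₁ ≡ l) × length vs ≤ P₃ * length (filter (blob? A B C₁) vs)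
  choose₃ A B h l₂ = let
    (C₁ , uC , lC , big) = KST.level (R₃ A B) (R₃? A B) P₂ 1≤n vs uV (≤-trans 1≤n (≤-reflexive (sym |vs|))) h l l₂
   in C₁ , (uC , lC) , big

  blobs : n * (n * (n * n)) ≤ P * length (filter (λ m → R₁? (proj₁ m) (proj₂ m)) (pairs vs all₃))
   → 4 * P * l ≤ n → 4 * P₁ * l ≤ n → 4 * P₂ * l ≤ n
   → Σ (List (Fin n)) λ A → Σ (List (Fin n)) λ B → Σ (List (Fin n)) λ C₁ →
    (Unique A × length A ≡ l) × (Unique B × length B ≡ l) × (Unique C₁ × length C₁ ≡ l)
    × n ≤ P₃ * length (filter (blob? A B C₁) vs)
  blobs h l₀ l₁ l₂ =
   let
    (A , uA , hA) = choose₁ h l₀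
    (B , uB , hB) = choose₂ A hA l₁
    (C₁ , uC , hC) = choose₃ A B hB l₂
   in A , B , C₁ , uA , uB , uC , ≤-trans (≤-reflexive (sym |vs|)) hC

density₃ : ℕ → ℕ → ℕ
density₃ P l = boost l (boost l (boost l P))

-- Forests of complete 4-partite graphs.

blobTuples : ∀ t l q → List (Tuple (t * l) (t * l) (t * l) (t * q))
blobTuples t l q = map (λ (i , a , b , c , h) → F.combine i a , F.combine i b , F.combine i c , F.combine i h)
 (pairs (allFin t) (pairs (allFin l) (pairs (allFin l) (pairs (allFin l) (allFin q)))))

blobTuples-unique : ∀ t l q → Unique (blobTuples t l q)
blobTuples-unique t l q = Uniq.map⁺ inj (pairs-unique (Uniq.allFin⁺ t) (pairs-unique (Uniq.allFin⁺ l)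
  (pairs-unique (Uniq.allFin⁺ l) (pairs-unique (Uniq.allFin⁺ l) (Uniq.allFin⁺ q)))))
 where
 inj : ∀ {m m′ : Fin t × Fin l × Fin l × Fin l × Fin q}
  → (F.combine (proj₁ m) (proj₁ (proj₂ m)) , F.combine (proj₁ m) (proj₁ (proj₂ (proj₂ m))) , F.combine (proj₁ m) (proj₁ (proj₂ (proj₂ (proj₂ m))))
    , F.combine (proj₁ m) (proj₂ (proj₂ (proj₂ (proj₂ m)))))
   ≡ (F.combine (proj₁ m′) (proj₁ (proj₂ m′)) , F.combine (proj₁ m′) (proj₁ (proj₂ (proj₂ m′))) , F.combine (proj₁ m′) (proj₁ (proj₂ (proj₂ (proj₂ m′))))
    , F.combine (proj₁ m′) (proj₂ (proj₂ (proj₂ (proj₂ m′)))))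
  → m ≡ m′
 inj {i , a , b , c , h} {i′ , a′ , b′ , c′ , h′} e
  with FP.combine-injective i a i′ a′ (cong proj₁ e) | FP.combine-injective i b i′ b′ (cong (proj₁ ∘ proj₂) e)
   | FP.combine-injective i c i′ c′ (cong (proj₁ ∘ proj₂ ∘ proj₂) e) | FP.combine-injective i h i′ h′ (cong (proj₂ ∘ proj₂ ∘ proj₂) e)
 ... | refl , refl | _ , refl | _ , refl | _ , refl = refl

blobForest : ℕ → ℕ → ℕ → Hyper4
blobForest t l q = Partite.hyperOf (t * l) (t * l) (t * l) (t * q) (blobTuples t l q) (blobTuples-unique t l q)

∥blobForest∥ : ∀ t l q → ∥ graph (blobForest t l q) ∥ ≡ t * (l * (l * (l * q)))
∥blobForest∥ t l q = trans (Partite.∥hyperOf∥ (t * l) (t * l) (t * l) (t * q) (blobTuples t l q) (blobTuples-unique t l q))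
 (trans (LP.length-map _ (pairs (allFin t) p₃)) (trans (length-pairs (allFin t) p₃) (cong₂ _*_ (|fin| t)
  (trans (length-pairs (allFin l) p₂) (cong₂ _*_ (|fin| l) (trans (length-pairs (allFin l) p₁) (cong₂ _*_ (|fin| l)
   (trans (length-pairs (allFin l) (allFin q)) (cong₂ _*_ (|fin| l) (|fin| q))))))))))
 where
 |fin| : ∀ k → length (allFin k) ≡ k
 |fin| k = LP.length-tabulate {n = k} id
 p₁ = pairs (allFin l) (allFin q)
 p₂ = pairs (allFin l) p₁
 p₃ = pairs (allFin l) p₂

nth-inj : ∀ {A : Set} {k} (xs : List A) (e : length xs ≡ k) → Unique xs → ∀ {i j} → nth xs e i ≡ nth xs e j → i ≡ j
nth-inj xs e u {i} {j} eq = groups-inj L.[_] xs e (subst Unique (sym (LP.concat-map-[_] xs)) u) i j (here refl) (here eq)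

module Blobs {n : ℕ} (G : Graph4 n) (l : ℕ) where

 open import Data.List.Membership.DecPropositional (F._≟_ {n}) using (_∈?_)

 record BNode (q : ℕ) : Set where
  field
   A B C₁ ds : List (Fin n)
   lA : length A ≡ l
   lB : length B ≡ l
   lC : length C₁ ≡ l
   ld : length ds ≡ q
   ok : ∀ {a b c d} → a ∈ A → b ∈ B → c ∈ C₁ → d ∈ ds → Edge G a b c d
 open BNode

 core : ∀ {q} → BNode q → List (Fin n)
 core o = A o ++ (B o ++ C₁ o)

 length-core : ∀ {q} (o : BNode q) → length (core o) ≡ l + (l + l)
 length-core o = trans (LP.length-++ (A o)) (cong₂ _+_ (lA o) (trans (LP.length-++ (B o)) (cong₂ _+_ (lB o) (lC o))))

 record GoodBlobs (t q : ℕ) (T : List (BNode q)) : Set where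
  field
   len : length T ≡ t
   uC : Unique (concatMap core T)
   uD : Unique (concatMap ds T)
   apart : Disj (concatMap core T) (concatMap ds T)

 goodBlobs⇒contains : ∀ {t q T} → GoodBlobs t q T → Contains G (blobForest t l q)
 goodBlobs⇒contains {t} {q} {T} gb = contains-hyperOf G _ (blobTuples-unique t l q) g g-inj edge
  where
  open GoodBlobs gb
  open Partite (t * l) (t * l) (t * l) (t * q)
  S : Fin t → BNode q
  S = nth T len
  S∈ : ∀ i → S i ∈ T
  S∈ = nth-∈ T len
  fA fB fC : Fin t → Fin l → Fin n
  fA i = nth (A (S i)) (lA (S i))
  fB i = nth (B (S i)) (lB (S i))
  fC i = nth (C₁ (S i)) (lC (S i))
  fD : Fin t → Fin q → Fin n
  fD i = nth (ds (S i)) (ld (S i))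
  on : ∀ {k} → (Fin t → Fin k → Fin n) → Fin (t * k) → Fin n
  on {k} f m = f (proj₁ (F.remQuot {t} k m)) (proj₂ (F.remQuot {t} k m))
  on-combine : ∀ {k} (f : Fin t → Fin k → Fin n) i a → on f (F.combine i a) ≡ f i a
  on-combine {k} f i a = cong (λ (x : Fin t × Fin k) → f (proj₁ x) (proj₂ x)) (FP.remQuot-combine i a)
  g : Parts (t * l) (t * l) (t * l) (t * q) → Fin n
  g (at₀ m) = on fA m
  g (at₁ m) = on fB m
  g (at₂ m) = on fC m
  g (at₃ m) = on fD m
  A∈ : ∀ i a → fA i a ∈ core (S i)
  A∈ i a = ∈-++⁺ˡ (nth-∈ (A (S i)) (lA (S i)) a)
  B∈ : ∀ i a → fB i a ∈ core (S i)
  B∈ i a = ∈-++⁺ʳ (A (S i)) (∈-++⁺ˡ (nth-∈ (B (S i)) (lB (S i)) a))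
  Cs∈ : ∀ i a → fC i a ∈ core (S i)
  Cs∈ i a = ∈-++⁺ʳ (A (S i)) (∈-++⁺ʳ (B (S i)) (nth-∈ (C₁ (S i)) (lC (S i)) a))
  D∈ : ∀ i a → fD i a ∈ ds (S i)
  D∈ i a = nth-∈ (ds (S i)) (ld (S i)) a
  same : ∀ i j {u v} → u ∈ core (S i) → v ∈ core (S j) → u ≡ v → i ≡ j
  same i j p q refl = groups-inj core T len uC i j p q
  uS : ∀ i → Unique (core (S i))
  uS i = unique-group core uC (S∈ i)
  uA = λ i → proj₁ (unique-++⁻ (A (S i)) (uS i))
  uBC = λ i → proj₁ (proj₂ (unique-++⁻ (A (S i)) (uS i)))
  A#BC = λ i → proj₂ (proj₂ (unique-++⁻ (A (S i)) (uS i)))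
  B#Cs = λ i → proj₂ (proj₂ (unique-++⁻ (B (S i)) (uBC i)))
  on-inj : ∀ {k} (f : Fin t → Fin k → Fin n) → (∀ {i j a b} → f i a ≡ f j b → (i , a) ≡ (j , b)) → ∀ {m m′} → on f m ≡ on f m′ → m ≡ m′
  on-inj {k} f h e = remQuot-inj k (h e)
  A-inj : ∀ {i j a b} → fA i a ≡ fA j b → (i , a) ≡ (j , b)
  A-inj {i} {j} {a} {b} e with same i j (A∈ i a) (A∈ j b) e
  ... | refl = cong (i ,_) (nth-inj (A (S i)) (lA (S i)) (uA i) e)
  B-inj : ∀ {i j a b} → fB i a ≡ fB j b → (i , a) ≡ (j , b)
  B-inj {i} {j} {a} {b} e with same i j (B∈ i a) (B∈ j b) e
  ... | refl = cong (i ,_) (nth-inj (B (S i)) (lB (S i)) (proj₁ (unique-++⁻ (B (S i)) (uBC i))) e)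
  Cs-inj : ∀ {i j a b} → fC i a ≡ fC j b → (i , a) ≡ (j , b)
  Cs-inj {i} {j} {a} {b} e with same i j (Cs∈ i a) (Cs∈ j b) e
  ... | refl = cong (i ,_) (nth-inj (C₁ (S i)) (lC (S i)) (proj₁ (proj₂ (unique-++⁻ (B (S i)) (uBC i)))) e)
  D-inj : ∀ {i j a b} → fD i a ≡ fD j b → (i , a) ≡ (j , b)
  D-inj {i} {j} {a} {b} e with groups-inj ds T len uD i j (D∈ i a) (subst (_∈ ds (S j)) (sym e) (D∈ j b))
  ... | refl = cong (i ,_) (nth-inj (ds (S i)) (ld (S i)) (unique-group ds uD (S∈ i)) e)
  AB : ∀ i a j b → fA i a ≢ fB j b
  AB i a j b e with same i j (A∈ i a) (B∈ j b) e
  ... | refl = A#BC i _ (nth-∈ (A (S i)) (lA (S i)) a) (subst (_∈ B (S i) ++ C₁ (S i)) (sym e) (∈-++⁺ˡ (nth-∈ (B (S i)) (lB (S i)) b)))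
  AC : ∀ i a j b → fA i a ≢ fC j b
  AC i a j b e with same i j (A∈ i a) (Cs∈ j b) e
  ... | refl = A#BC i _ (nth-∈ (A (S i)) (lA (S i)) a) (subst (_∈ B (S i) ++ C₁ (S i)) (sym e) (∈-++⁺ʳ (B (S i)) (nth-∈ (C₁ (S i)) (lC (S i)) b)))
  BC : ∀ i a j b → fB i a ≢ fC j b
  BC i a j b e with same i j (B∈ i a) (Cs∈ j b) e
  ... | refl = B#Cs i _ (nth-∈ (B (S i)) (lB (S i)) a) (subst (_∈ C₁ (S i)) (sym e) (nth-∈ (C₁ (S i)) (lC (S i)) b))
  core# : ∀ i j a {u} → u ∈ core (S i) → u ≢ fD j a
  core# i j a u∈ refl = apart _ (∈-concatMap core (S∈ i) u∈) (∈-concatMap ds (S∈ j) (D∈ j a))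
  g-inj : ∀ {p q} → g p ≡ g q → p ≡ q
  g-inj {at₀ _} {at₀ _} e = cong inj₁ (on-inj fA A-inj e)
  g-inj {at₁ _} {at₁ _} e = cong (inj₂ ∘ inj₁) (on-inj fB B-inj e)
  g-inj {at₂ _} {at₂ _} e = cong (inj₂ ∘ inj₂ ∘ inj₁) (on-inj fC Cs-inj e)
  g-inj {at₃ _} {at₃ _} e = cong (inj₂ ∘ inj₂ ∘ inj₂) (on-inj fD D-inj e)
  g-inj {at₀ _} {at₁ _} e = ⊥-elim (AB _ _ _ _ e)
  g-inj {at₁ _} {at₀ _} e = ⊥-elim (AB _ _ _ _ (sym e))
  g-inj {at₀ _} {at₂ _} e = ⊥-elim (AC _ _ _ _ e)
  g-inj {at₂ _} {at₀ _} e = ⊥-elim (AC _ _ _ _ (sym e))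
  g-inj {at₁ _} {at₂ _} e = ⊥-elim (BC _ _ _ _ e)
  g-inj {at₂ _} {at₁ _} e = ⊥-elim (BC _ _ _ _ (sym e))
  g-inj {at₀ _} {at₃ _} e = ⊥-elim (core# _ _ _ (A∈ _ _) e)
  g-inj {at₃ _} {at₀ _} e = ⊥-elim (core# _ _ _ (A∈ _ _) (sym e))
  g-inj {at₁ _} {at₃ _} e = ⊥-elim (core# _ _ _ (B∈ _ _) e)
  g-inj {at₃ _} {at₁ _} e = ⊥-elim (core# _ _ _ (B∈ _ _) (sym e))
  g-inj {at₂ _} {at₃ _} e = ⊥-elim (core# _ _ _ (Cs∈ _ _) e)
  g-inj {at₃ _} {at₂ _} e = ⊥-elim (core# _ _ _ (Cs∈ _ _) (sym e))
  Edge-cong : ∀ {a b c d a′ b′ c′ d′} → a ≡ a′ → b ≡ b′ → c ≡ c′ → d ≡ d′ → Edge G a′ b′ c′ d′ → Edge G a b c d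
  Edge-cong refl refl refl refl e = e
  edge : ∀ {a b c d} → (a , b , c , d) ∈ blobTuples t l q → Edge G (g (at₀ a)) (g (at₁ b)) (g (at₂ c)) (g (at₃ d))
  edge m∈ with ∈-map⁻ _ m∈
  ... | (i , a , b , c , h) , _ , refl = Edge-cong (on-combine fA i a) (on-combine fB i b) (on-combine fC i c) (on-combine fD i h)
   (ok (S i) (nth-∈ (A (S i)) (lA (S i)) a) (nth-∈ (B (S i)) (lB (S i)) b) (nth-∈ (C₁ (S i)) (lC (S i)) c) (D∈ i h))

 -- As for stars, collisions are tolerated at first: a new core avoids the earlier cores only, while
 -- the large part `ds` avoids all earlier vertices.
 record AccB (k q : ℕ) (T : List (BNode q)) : Set where
  field
   len : length T ≡ k
   uC : Unique (concatMap core T)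
   uD : Unique (concatMap ds T)

 module _ (Cs D : List (Fin n)) where

  Ω : Fin n → Fin n → Fin n → Fin n → Set
  Ω a b c d = Edge G a b c d × (a ∉ Cs × b ∉ Cs × c ∉ Cs) × d ∉ D

  Ω? : ∀ a b c d → Dec (Ω a b c d)
  Ω? a b c d = Edge? G a b c d ×-dec (¬? (a ∈? Cs) ×-dec ¬? (b ∈? Cs) ×-dec ¬? (c ∈? Cs)) ×-dec ¬? (d ∈? D)

  private
   vs : List (Fin n)
   vs = allFin n

  Ωs : List (Quad (Fin n))
  Ωs = filter (λ m → Ω? (proj₁ m) (proj₁ (proj₂ m)) (proj₁ (proj₂ (proj₂ m))) (proj₂ (proj₂ (proj₂ m)))) (pairs vs (pairs vs (pairs vs vs)))

  ∈Ωs : ∀ {a b c d} → Ω a b c d → (a , b , c , d) ∈ Ωs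
  ∈Ωs {a} {b} {c} {d} ω = ∈-filter⁺ (λ m → Ω? (proj₁ m) (proj₁ (proj₂ m)) (proj₁ (proj₂ (proj₂ m))) (proj₂ (proj₂ (proj₂ m))))
   (∈-pairs (∈-allFin a) (∈-pairs (∈-allFin b) (∈-pairs (∈-allFin c) (∈-allFin d)))) ω

  -- An edge that misses `Cs` and does not lie inside `D` has a vertex outside `D`, and this vertex
  -- is placed last.
  edges≤Ω : (∀ {u} → u ∈ Cs → u ∈ D) → ∥ G ∥ ≤ length Ωs + (length Cs * (n * (n * n)) + length D * (length D * (length D * length D)))
  edges≤Ω Cs⊆D = ≤-trans (count-edges (edges G) (distinct G) (uniform G) (Ωs ++ (q₁ ++ q₂)) λ P P-sym hyp s∈ r → cov P P-sym hyp (_ , s∈ , r))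
    (≤-trans (≤-reflexive (LP.length-++ Ωs)) (+-monoʳ-≤ (length Ωs) (≤-trans (≤-reflexive (LP.length-++ q₁)) (+-mono-≤
     (length-quads {as = Cs} {f = λ _ → vs} {g = λ _ _ → vs} {h = λ _ _ _ → vs} ≤-refl (λ _ → v≤) (λ _ _ → v≤) (λ _ _ _ → v≤))
     (length-quads {as = D} {f = λ _ → D} {g = λ _ _ → D} {h = λ _ _ _ → D} ≤-refl (λ _ → ≤-refl) (λ _ _ → ≤-refl) (λ _ _ _ → ≤-refl))))))
   where
   v≤ : length vs ≤ n
   v≤ = ≤-reflexive (LP.length-tabulate id)
   q₁ q₂ : List (Quad (Fin n))
   q₁ = quads Cs (λ _ → vs) (λ _ _ → vs) (λ _ _ _ → vs)
   q₂ = quads D (λ _ → D) (λ _ _ → D) (λ _ _ _ → D)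
   cov : (P : Fin n → Fin n → Fin n → Fin n → Set) → SymClosed P → (∀ {a b c d} → (a , b , c , d) ∈ Ωs ++ (q₁ ++ q₂) → P a b c d)
    → ∀ {a b c d} → Edge G a b c d → P a b c d
   cov P P-sym hyp {a} {b} {c} {d} e = go (a ∈? Cs) (b ∈? Cs) (c ∈? Cs) (d ∈? Cs)
    where
    open Perm P-sym
    open Perm (Edge-sym G) renaming (p1243 to e1243; p1342 to e1342; p2341 to e2341) using ()
    inC : ∀ {a b c d} → a ∈ Cs → P a b c d
    inC a∈ = hyp (∈-++⁺ʳ Ωs (∈-++⁺ˡ (∈-quads {as = Cs} {f = λ _ → vs} {g = λ _ _ → vs} {h = λ _ _ _ → vs} a∈ (∈-allFin _) (∈-allFin _) (∈-allFin _))))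
    free : ∀ {a b c d} → Ω a b c d → P a b c d
    free ω = hyp (∈-++⁺ˡ (∈Ωs ω))
    go : Dec (a ∈ Cs) → Dec (b ∈ Cs) → Dec (c ∈ Cs) → Dec (d ∈ Cs) → P a b c d
    go (yes h) _ _ _ = inC h
    go _ (yes h) _ _ = p2134 (inC h)
    go _ _ (yes h) _ = p2314 (inC h)
    go _ _ _ (yes h) = p2341 (inC h)
    go (no a∉) (no b∉) (no c∉) (no d∉) with a ∈? D | b ∈? D | c ∈? D | d ∈? D
    ... | yes aD | yes bD | yes cD | yes dD = hyp (∈-++⁺ʳ Ωs (∈-++⁺ʳ q₁ (∈-quads {as = D} {f = λ _ → D} {g = λ _ _ → D} {h = λ _ _ _ → D} aD bD cD dD)))
    ... | _ | _ | _ | no dD = free (e , (a∉ , b∉ , c∉) , dD)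
    ... | _ | _ | no cD | _ = p1243 (free (e1243 e , (a∉ , b∉ , d∉) , cD))
    ... | _ | no bD | _ | _ = p1423 (free (e1342 e , (a∉ , c∉ , d∉) , bD))
    ... | no aD | _ | _ | _ = p4123 (free (e2341 e , (b∉ , c∉ , d∉) , aD))

 core-size : ∀ {k q T} → AccB k q T → length (concatMap core T) ≡ k * (l + (l + l))
 core-size {T = T} acc = trans (length-concatMap≡ core (l + (l + l)) T length-core) (cong (_* (l + (l + l))) (AccB.len acc))

 leaf-size : ∀ {k q T} → AccB k q T → length (concatMap ds T) ≡ k * q
 leaf-size {q = q} {T} acc = trans (length-concatMap≡ ds q T ld) (cong (_* q) (AccB.len acc))

 blob-step : ∀ {k q T} (P : ℕ) → AccB k q T → 1 ≤ n → 1 ≤ l → l ≤ q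
  → 4 * (k * (l + (l + l)) * (n * (n * n))) ≤ ∥ G ∥
  → (∀ b → b ≡ k * (l + (l + l)) + k * q → 4 * (b * (b * (b * b))) ≤ ∥ G ∥)
  → 2 * (n * (n * (n * n))) ≤ P * ∥ G ∥
  → q * density₃ P l ≤ n
  → Σ (BNode q) λ o → AccB (suc k) q (o ∷ T)
 blob-step {k} {q} {T} P acc 1≤n 1≤l l≤q h₁ h₂ h₃ h₄ = pick (blobs big (small P P≤P₃) (small P₁ P₁≤P₃) (small P₂ P₂≤P₃))
  where
  open AccB acc
  Cs D : List (Fin n)
  Cs = concatMap core T
  D = Cs ++ concatMap ds T
  open KST₃ (Ω Cs D) (Ω? Cs D) P 1≤n l
  open ≤-Reasoning
  |Cs| : length Cs ≡ k * (l + (l + l))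
  |Cs| = core-size acc
  |D| : length D ≡ k * (l + (l + l)) + k * q
  |D| = trans (LP.length-++ Cs) (cong₂ _+_ |Cs| (leaf-size acc))
  |D|⁴ |Cs|n³ : ℕ
  |D|⁴ = length D * (length D * (length D * length D))
  |Cs|n³ = length Cs * (n * (n * n))
  -- `Cs` and `D` each exclude at most a quarter of the edges.
  half : ∥ G ∥ ≤ 2 * length (Ωs Cs D)
  half = +-cancelʳ-≤ ∥ G ∥ _ _ (begin
   ∥ G ∥ + ∥ G ∥ ≤⟨ +-mono-≤ e≤ e≤ ⟩
   length (Ωs Cs D) + (|Cs|n³ + |D|⁴) + (length (Ωs Cs D) + (|Cs|n³ + |D|⁴)) ≡⟨ lem (length (Ωs Cs D)) |Cs|n³ |D|⁴ ⟩
   2 * length (Ωs Cs D) + (2 * |Cs|n³ + 2 * |D|⁴) ≤⟨ +-monoʳ-≤ (2 * length (Ωs Cs D)) (*-cancelˡ-≤ 2 (begin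
    2 * (2 * |Cs|n³ + 2 * |D|⁴) ≡⟨ lem2 |Cs|n³ |D|⁴ ⟩
    4 * |Cs|n³ + 4 * |D|⁴ ≤⟨ +-mono-≤ (≤-trans (≤-reflexive (cong (λ c → 4 * (c * (n * (n * n)))) |Cs|)) h₁) (h₂ (length D) |D|) ⟩
    ∥ G ∥ + ∥ G ∥ ≡⟨ cong (∥ G ∥ +_) (sym (+-identityʳ _)) ⟩
    2 * ∥ G ∥ ∎)) ⟩
   2 * length (Ωs Cs D) + ∥ G ∥ ∎)
   where
   e≤ : ∥ G ∥ ≤ length (Ωs Cs D) + (|Cs|n³ + |D|⁴)
   e≤ = edges≤Ω Cs D ∈-++⁺ˡ
   lem : ∀ o a b → o + (a + b) + (o + (a + b)) ≡ 2 * o + (2 * a + 2 * b)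
   lem = solve-∀
   lem2 : ∀ a b → 2 * (2 * a + 2 * b) ≡ 4 * a + 4 * b
   lem2 = solve-∀
  big : n * (n * (n * n)) ≤ P * length (Ωs Cs D)
  big = *-cancelˡ-≤ 2 (≤-trans h₃ (≤-trans (*-monoʳ-≤ P half) (≤-reflexive (lem P (length (Ωs Cs D))))))
   where
   lem : ∀ p o → p * (2 * o) ≡ 2 * (p * o)
   lem = solve-∀
  1≤P : 1 ≤ P
  1≤P = pos-right ∥ G ∥ (*-mono-≤ {1} {2} {1} (s≤s z≤n) (*-mono-≤ {1} {n} {1} 1≤n (*-mono-≤ {1} {n} {1} 1≤n (*-mono-≤ {1} {n} {1} 1≤n 1≤n))))
   (≤-trans h₃ (≤-reflexive (*-comm P ∥ G ∥)))
  P≤P₁ : 4 * P ≤ P₁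
  P≤P₁ = 4P≤boost l 1≤P
  P₁≤P₂ : 4 * P₁ ≤ P₂
  P₁≤P₂ = 4P≤boost l (1≤boost l 1≤P)
  P₂≤P₃ : 4 * P₂ ≤ P₃
  P₂≤P₃ = 4P≤boost l (1≤boost l (1≤boost l 1≤P))
  ×4 : ∀ p → p ≤ 4 * p
  ×4 p = m≤m+n p _
  P₁≤P₃ : 4 * P₁ ≤ P₃
  P₁≤P₃ = ≤-trans P₁≤P₂ (≤-trans (×4 P₂) P₂≤P₃)
  P≤P₃ : 4 * P ≤ P₃
  P≤P₃ = ≤-trans P≤P₁ (≤-trans (×4 P₁) P₁≤P₃)
  -- The size conditions of all three rounds follow from the one on the last density, as the inverse
  -- densities increase.
  small : ∀ p → 4 * p ≤ P₃ → 4 * p * l ≤ n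
  small p p≤ = ≤-trans (*-mono-≤ p≤ l≤q) (≤-trans (≤-reflexive (*-comm P₃ q)) h₄)
  pick : (Σ (List (Fin n)) λ A → Σ (List (Fin n)) λ B → Σ (List (Fin n)) λ C₁ →
   (Unique A × length A ≡ l) × (Unique B × length B ≡ l) × (Unique C₁ × length C₁ ≡ l)
   × n ≤ P₃ * length (filter (blob? A B C₁) (allFin n))) → Σ (BNode q) λ o → AccB (suc k) q (o ∷ T)
  pick (A , B , C₁ , (uA , lA) , (uB , lB) , (uC₁ , lC) , many)
   with takeUpTo q {P = Blob A B C₁} (Uniq.filter⁺ (blob? A B C₁) (Uniq.allFin⁺ n)) (AllP.all-filter (blob? A B C₁) (allFin n))
    (*-cancelˡ-≤ P₃ {{N.>-nonZero (≤-trans 1≤P (≤-trans (×4 P) P≤P₃))}} (≤-trans (≤-reflexive (*-comm P₃ q)) (≤-trans h₄ many)))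
  ... | ds , ld , uds , all , _ = o , record
    { len = cong suc len
    ; uC = unique-++⁺ uo uC λ u p q → core∉Cs p q
    ; uD = unique-++⁺ uds uD λ u p q → d∉D p (∈-++⁺ʳ Cs q) }
   where
   ω : ∀ {a b c d} → a ∈ A → b ∈ B → c ∈ C₁ → d ∈ ds → Ω Cs D a b c d
   ω a∈ b∈ c∈ d∈ = All.lookup (All.lookup (All.lookup (All.lookup all d∈) c∈) b∈) a∈
   o : BNode q
   o = record { A = A ; B = B ; C₁ = C₁ ; ds = ds ; lA = lA ; lB = lB ; lC = lC ; ld = ld ; ok = λ a∈ b∈ c∈ d∈ → proj₁ (ω a∈ b∈ c∈ d∈) }
   some : ∀ {xs : List (Fin n)} {m} → length xs ≡ m → 1 ≤ m → ∃ λ x → x ∈ xs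
   some {x ∷ xs} _ _ = x , here refl
   some {[]} refl ()
   -- All four parts are non-empty, so each vertex of the new piece lies in one of its edges;
   -- distinctness and the avoidance of `Cs` and `D` are read off such an edge.
   a₀ = some {A} lA 1≤l
   b₀ = some {B} lB 1≤l
   c₀ = some {C₁} lC 1≤l
   d₀ = some {ds} ld (≤-trans 1≤l l≤q)
   differ : ∀ {a b c d} → a ∈ A → b ∈ B → c ∈ C₁ → d ∈ ds → a ≢ b × a ≢ c × b ≢ c
   differ a∈ b∈ c∈ d∈ = let (_ , _ , r) = proj₁ (ω a∈ b∈ c∈ d∈) in Rep.ab r , Rep.ac r , Rep.bc r
   uo : Unique (A ++ (B ++ C₁))
   uo = unique-++⁺ uA (unique-++⁺ uB uC₁ λ u p q → proj₂ (proj₂ (differ (proj₂ a₀) p q (proj₂ d₀))) refl) λ u p q →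
    [ (λ r → proj₁ (differ p r (proj₂ c₀) (proj₂ d₀)) refl) , (λ r → proj₁ (proj₂ (differ p (proj₂ b₀) r (proj₂ d₀))) refl) ]′ (∈-++⁻ B q)
   core∉Cs : ∀ {u} → u ∈ A ++ (B ++ C₁) → u ∉ Cs
   core∉Cs u∈ with ∈-++⁻ A u∈
   ... | inj₁ r = proj₁ (proj₁ (proj₂ (ω r (proj₂ b₀) (proj₂ c₀) (proj₂ d₀))))
   ... | inj₂ r with ∈-++⁻ B r
   ... | inj₁ r = proj₁ (proj₂ (proj₁ (proj₂ (ω (proj₂ a₀) r (proj₂ c₀) (proj₂ d₀)))))
   ... | inj₂ r = proj₂ (proj₂ (proj₁ (proj₂ (ω (proj₂ a₀) (proj₂ b₀) r (proj₂ d₀)))))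
   d∉D : ∀ {u} → u ∈ ds → u ∉ D
   d∉D u∈ = proj₂ (proj₂ (ω (proj₂ a₀) (proj₂ b₀) (proj₂ c₀) u∈))

 module _ {q g : ℕ} (cs : List (Fin n)) where

  aliveLeaves : BNode (q + g) → List (Fin n)
  aliveLeaves o = concatMap (alive cs) (ds o)

  keepB : BNode (q + g) → List (BNode q)
  keepB o with q N.≤? length (aliveLeaves o)
  ... | no _ = []
  ... | yes le = record { A = A o ; B = B o ; C₁ = C₁ o ; ds = take q (aliveLeaves o) ; lA = lA o ; lB = lB o ; lC = lC o
   ; ld = trans (LP.length-take q _) (m≤n⇒m⊓n≡m le)
   ; ok = λ a∈ b∈ c∈ d∈ → ok o a∈ b∈ c∈ (Sub.lookup (⊆-trans (take-sublist q (aliveLeaves o)) (alive-⊆ cs (ds o))) d∈) } ∷ []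

  keepB-core : ∀ o → concatMap core (keepB o) ⊆ core o
  keepB-core o with q N.≤? length (aliveLeaves o)
  ... | no _ = Sub.minimum _
  ... | yes le = subst (_⊆ core o) (sym (LP.++-identityʳ (core o))) ⊆-refl

  keepB-ds : ∀ o → concatMap ds (keepB o) ⊆ ds o
  keepB-ds o with q N.≤? length (aliveLeaves o)
  ... | no _ = Sub.minimum _
  ... | yes le = subst (_⊆ ds o) (sym (LP.++-identityʳ _)) (⊆-trans (take-sublist q (aliveLeaves o)) (alive-⊆ cs (ds o)))

  keepB-alive : ∀ o → All (λ o → All (_∉ cs) (ds o)) (keepB o)
  keepB-alive o with q N.≤? length (aliveLeaves o)
  ... | no _ = []
  ... | yes le = AllP.take⁺ q (alive-∉ cs (ds o)) ∷ []

  alt-B : ∀ o → (1 ≤ length (keepB o)) ⊎ (1 ≤ length {A = ℕ} []) ⊎ (length (concatMap (alive cs) (ds o)) + suc g ≤ q + g)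
  alt-B o with q N.≤? length (aliveLeaves o)
  ... | yes le = inj₁ (s≤s z≤n)
  ... | no ¬le = inj₂ (inj₂ (≤-trans (≤-reflexive (+-suc _ g)) (+-monoˡ-≤ g (≰⇒> ¬le))))

 -- The vertices of the large parts are distinct, so at most 2t · 3l of them lie in cores. A piece
 -- falls only after losing more than 6l of them, so at most half of the 2t pieces fall.
 prune-blobs : ∀ {t q T} → AccB (2 * t) (q + 6 * l) T → Contains G (blobForest t l q)
 prune-blobs {t} {q} {T} acc = goodBlobs⇒contains {T = T′} record
   { len = trans (LP.length-take t (concatMap keep T)) (m≤n⇒m⊓n≡m t≤)
   ; uC = unique-⊆ Cs⊆ uC ; uD = unique-⊆ D⊆ uD
   ; apart = λ u p r → dead r (Sub.lookup Cs⊆ p) }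
  where
  open AccB acc
  cs : List (Fin n)
  cs = concatMap core T
  keep : BNode (q + 6 * l) → List (BNode q)
  keep = keepB cs
  T′ : List (BNode q)
  T′ = take t (concatMap keep T)
  Cs⊆ : concatMap core T′ ⊆ cs
  Cs⊆ = ⊆-trans (concatMap-⊆-mono core (take-sublist t (concatMap keep T))) (concatMap-⊆ {B′ = ⊤} keep core core (keepB-core {q} {6 * l} cs) T)
  D⊆ : concatMap ds T′ ⊆ concatMap ds T
  D⊆ = ⊆-trans (concatMap-⊆-mono ds (take-sublist t (concatMap keep T))) (concatMap-⊆ {B′ = ⊤} keep ds ds (keepB-ds {q} {6 * l} cs) T)
  dead : ∀ {u} → u ∈ concatMap ds T′ → u ∉ cs
  dead u∈ with ∈-concatMap⁻′ ds T′ u∈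
  ... | o , o∈ , r = All.lookup (All.lookup (AllP.take⁺ t (all-concatMap {B = ⊤} {B′ = ⊤} keep T λ {a} _ → keepB-alive {q} {6 * l} cs a)) o∈) r
  kQ kS : ℕ
  kQ = length (concatMap (alive cs) (concatMap ds T))
  kS = length (concatMap keep T)
  alive≤1 : ∀ u → length (alive cs u) ≤ 1
  alive≤1 u with u ∈? cs
  ... | yes _ = z≤n
  ... | no _ = ≤-refl
  alive+dead : ∀ us → length us ≤ length (concatMap (alive cs) us) + length (concatMap (deadMark cs) us)
  alive+dead [] = z≤n
  alive+dead (u ∷ us) with u ∈? cs
  ... | yes _ = ≤-trans (s≤s (alive+dead us)) (≤-reflexive (sym (+-suc _ _)))
  ... | no _ = s≤s (alive+dead us)
  no-dead : (T : List (BNode (q + 6 * l))) → length {A = ℕ} (concatMap (λ _ → []) T) ≡ 0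
  no-dead [] = refl
  no-dead (_ ∷ T) = no-dead T
  open ≤-Reasoning
  count : suc (6 * l) * (2 * t) ≤ suc (6 * l) * kS + 2 * t * (l + (l + l))
  count = +-cancelʳ-≤ kQ _ _ (begin
   suc (6 * l) * (2 * t) + kQ ≡⟨ cong (λ k → suc (6 * l) * k + kQ) (sym len) ⟩
   suc (6 * l) * length T + kQ ≤⟨ prune-count (suc (6 * l)) (q + 6 * l) (λ _ → []) keep ds (alive cs) ld alive≤1 (alt-B {q} {6 * l} cs) T ⟩
   suc (6 * l) * (kS + length (concatMap (λ (_ : BNode (q + 6 * l)) → []) T)) + length (concatMap ds T)
    ≤⟨ +-mono-≤ (≤-reflexive (cong (λ k → suc (6 * l) * (kS + k)) (no-dead T)))
     (≤-trans (alive+dead (concatMap ds T)) (+-monoʳ-≤ kQ (≤-trans (deadMark-count cs (concatMap ds T) uD) (≤-reflexive (core-size acc))))) ⟩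
   suc (6 * l) * (kS + 0) + (kQ + 2 * t * (l + (l + l))) ≡⟨ lem (suc (6 * l)) kS kQ _ ⟩
   suc (6 * l) * kS + 2 * t * (l + (l + l)) + kQ ∎)
   where
   lem : ∀ a k q c → a * (k + 0) + (q + c) ≡ a * k + c + q
   lem = solve-∀
  t≤ : t ≤ kS
  t≤ = *-cancelˡ-≤ (suc (6 * l)) (+-cancelʳ-≤ (suc (6 * l) * t) _ _ (begin
   suc (6 * l) * t + suc (6 * l) * t ≡⟨ lem l t ⟩
   suc (6 * l) * (2 * t) ≤⟨ count ⟩
   suc (6 * l) * kS + 2 * t * (l + (l + l)) ≤⟨ +-monoʳ-≤ (suc (6 * l) * kS) (≤-trans (m≤n+m _ t) (≤-reflexive (lem2 l t))) ⟩
   suc (6 * l) * kS + suc (6 * l) * t ∎))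
   where
   lem : ∀ l t → suc (6 * l) * t + suc (6 * l) * t ≡ suc (6 * l) * (2 * t)
   lem = solve-∀
   lem2 : ∀ l t → t + 2 * t * (l + (l + l)) ≡ suc (6 * l) * t
   lem2 = solve-∀

 many-blobs : ∀ t q P → 1 ≤ n → 1 ≤ l
  → 4 * (2 * t * (l + (l + l)) * (n * (n * n))) ≤ ∥ G ∥
  → (∀ b → b ≤ 2 * t * (l + (l + l)) + 2 * t * (q + 6 * l) → 4 * (b * (b * (b * b))) ≤ ∥ G ∥)
  → 2 * (n * (n * (n * n))) ≤ P * ∥ G ∥
  → (q + 6 * l) * density₃ P l ≤ n
  → Contains G (blobForest t l q)
 many-blobs t q P 1≤n 1≤l h₁ h₂ h₃ h₄ = prune-blobs (proj₂ (build (2 * t) ≤-refl))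
  where
  build : ∀ k → k ≤ 2 * t → Σ (List (BNode (q + 6 * l))) λ T → AccB k (q + 6 * l) T
  build zero _ = [] , record { len = refl ; uC = [] ; uD = [] }
  build (suc k) k< = extend (proj₁ (build k k≤)) (proj₂ (build k k≤))
   where
   k≤ : k ≤ 2 * t
   k≤ = ≤-trans (n≤1+n k) k<
   core≤ : 4 * (k * (l + (l + l)) * (n * (n * n))) ≤ ∥ G ∥
   core≤ = ≤-trans (*-monoʳ-≤ 4 (*-monoˡ-≤ (n * (n * n)) (*-monoˡ-≤ (l + (l + l)) k≤))) h₁
   all≤ : ∀ b → b ≡ k * (l + (l + l)) + k * (q + 6 * l) → 4 * (b * (b * (b * b))) ≤ ∥ G ∥
   all≤ b e = h₂ b (≤-trans (≤-reflexive e) (+-mono-≤ (*-monoˡ-≤ (l + (l + l)) k≤) (*-monoˡ-≤ (q + 6 * l) k≤)))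
   l≤ : l ≤ q + 6 * l
   l≤ = ≤-trans (m≤m+n l _) (m≤n+m (6 * l) q)
   extend : (T : List (BNode (q + 6 * l))) → AccB k (q + 6 * l) T → Σ (List (BNode (q + 6 * l))) λ T → AccB (suc k) (q + 6 * l) T
   extend T acc = let (o , acc′) = blob-step P acc 1≤n 1≤l l≤ core≤ all≤ h₃ h₄ in o ∷ T , acc′

-- Host graphs and what they force on an unavoidable graph

rep-perm : ∀ {n} {s : S.Subset n} {P : Fin n → Fin n → Fin n → Fin n → Set} → SymClosed P
 → ∀ {i j l m a b c d} → Rep s i j l m → Rep s a b c d → P i j l m → P a b c d
rep-perm {n} {s} {P} P-sym {i} {j} {l} {m} {a} {b} {c} {d} r r′ p = first (Rep.only r (Rep.∈a r′))
 where
 open Perm P-sym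
 open Rep r′ using (ab; ac; ad; bc; bd; cd; ∈b; ∈c; ∈d)
 last : ∀ {i j l m} → Rep s i j l m → P i j l m → a ≡ i → b ≡ j → c ≡ l → P a b c d
 last q p refl refl refl with Rep.only q ∈d
 ... | inj₁ e = ⊥-elim (ad (sym e))
 ... | in₁ e = ⊥-elim (bd (sym e))
 ... | in₂ e = ⊥-elim (cd (sym e))
 ... | in₃ refl = p
 third : ∀ {i j l m} → Rep s i j l m → P i j l m → a ≡ i → b ≡ j → P a b c d
 third q p e₁ e₂ with Rep.only q ∈c
 ... | inj₁ e = ⊥-elim (ac (trans e₁ (sym e)))
 ... | in₁ e = ⊥-elim (bc (trans e₂ (sym e)))
 ... | in₂ e = last q p e₁ e₂ e
 ... | in₃ e = last (rep-swap₃ q) (p1243 p) e₁ e₂ e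
 second : ∀ {i j l m} → Rep s i j l m → P i j l m → a ≡ i → P a b c d
 second q p e₁ with Rep.only q ∈b
 ... | inj₁ e = ⊥-elim (ab (trans e₁ (sym e)))
 ... | in₁ e = third q p e₁ e
 ... | in₂ e = third (rep-swap₂ q) (p1324 p) e₁ e
 ... | in₃ e = third (rep-swap₂ (rep-swap₃ q)) (p1423 p) e₁ e
 first : a ≡ i ⊎ a ≡ j ⊎ a ≡ l ⊎ a ≡ m → P a b c d
 first (inj₁ e) = second r p e
 first (in₁ e) = second (rep-swap₁ r) (p2134 p) e
 first (in₂ e) = second (rep-swap₁ (rep-swap₂ r)) (p3124 p) e
 first (in₃ e) = second (rep-swap₁ (rep-swap₂ (rep-swap₃ r))) (p4123 p) e

module Host {n e : ℕ} {H : Hyper4} (un : Unavoidable n e H) where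

 VH : Set
 VH = Fin (verts H)

 es : List (S.Subset (verts H))
 es = edges (graph H)

 record Placed {k₀ k₁ k₂ k₃ : ℕ} (ts : List (Tuple k₀ k₁ k₂ k₃)) (At : VH → Parts k₀ k₁ k₂ k₃ → Set) (s : S.Subset (verts H)) : Set where
  field
   {a} : Fin k₀
   {b} : Fin k₁
   {c} : Fin k₂
   {d} : Fin k₃
   t∈ : (a , b , c , d) ∈ ts
   {i j l m} : VH
   r : Rep s i j l m
   iAt : At i (inj₁ a)
   jAt : At j (in₁ b)
   lAt : At l (in₂ c)
   mAt : At m (in₃ d)

 -- `At i p` says that the embedding of `H` sends the vertex `i` to the host vertex `p`. By
 -- injectivity, a list of host vertices pulls back to a list of vertices of `H` that is no longer.
 record HostMap (k₀ k₁ k₂ k₃ : ℕ) (ts : List (Tuple k₀ k₁ k₂ k₃)) : Set₁ where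
  field
   At : VH → Parts k₀ k₁ k₂ k₃ → Set
   at₁? : ∀ i p → Dec (At i p)
   at-fun : ∀ {i p q} → At i p → At i q → p ≡ q
   at-inj : ∀ {i j p} → At i p → At j p → i ≡ j

  field
   placed : ∀ {s} → s ∈ es → Placed ts At s

  at? : ∀ ps i → Dec (Any (At i) ps)
  at? ps i = Any.any? (at₁? i) ps

  pre : List (Parts k₀ k₁ k₂ k₃) → List VH
  pre ps = filter (at? ps) (allFin (verts H))

  length-pre : ∀ ps → length (pre ps) ≤ length ps
  length-pre ps = injRel⇒length≤ At (Uniq.filter⁺ (at? ps) (Uniq.allFin⁺ _)) (λ {_} {_} {p} _ _ → at-inj {p = p})
   λ {i} i∈ → find′ (proj₂ (∈-filter⁻ (at? ps) {xs = allFin (verts H)} i∈))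
   where
   find′ : ∀ {i} → Any (At i) ps → ∃ λ p → p ∈ ps × At i p
   find′ = find
    where open import Data.List.Membership.Propositional using (find)

  ∈-pre : ∀ {ps i p} → p ∈ ps → At i p → i ∈ pre ps
  ∈-pre {ps} {i} p∈ x = ∈-filter⁺ (at? ps) (∈-allFin i) (lose p∈ x)
   where open import Data.List.Membership.Propositional using (lose)

 hostMap : ∀ {k₀ k₁ k₂ k₃} → Partite.size k₀ k₁ k₂ k₃ ≤ n → (ts : List (Tuple k₀ k₁ k₂ k₃)) → Unique ts → e ≤ length ts → HostMap k₀ k₁ k₂ k₃ ts
 hostMap {k₀} {k₁} {k₂} {k₃} le ts u e≤ = record
  { At = At ; at₁? = λ i p → f i F.≟ ι le p ; at-fun = λ x y → ι-inj le (trans (sym x) y)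
  ; at-inj = λ x y → f-inj (trans x (sym y)) ; placed = λ s∈ → place s∈ }
  where
  open Partite k₀ k₁ k₂ k₃
  emb : Contains (graphOf le ts u) H
  emb = unavoidable-mono {H = H} (≤-trans e≤ (≤-reflexive (sym (LP.length-map _ ts)))) un (graphOf le ts u) refl
  f : VH → Fin n
  f = proj₁ emb
  f-inj : Injective _≡_ _≡_ f
  f-inj = proj₁ (proj₂ emb)
  At : VH → Parts k₀ k₁ k₂ k₃ → Set
  At i p = f i ≡ ι le p
  place : ∀ {s} → s ∈ es → Placed ts At s
  place {s} s∈ with ∈-map⁻ (tupleSet le) (All.lookup (proj₂ (proj₂ emb)) s∈)
  ... | (a , b , c , d) , t∈ , eq with rep-image⁻ f-inj (subst (λ s → Rep s _ _ _ _) (sym eq) (tuple-rep le (a , b , c , d)))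
  ... | i , j , l , m , r , i₁ , j₁ , l₁ , m₁ = record { t∈ = t∈ ; r = r ; iAt = i₁ ; jAt = j₁ ; lAt = l₁ ; mAt = m₁ }

 private
  |fin| : ∀ k → length (allFin k) ≡ k
  |fin| k = LP.length-tabulate {n = k} id

 record ProductHost (k₀ k₁ k₂ k₃ : ℕ) : Set where
  field
   L₀ L₁ L₂ L₃ : List VH
   l₀ : length L₀ ≤ k₀
   l₁ : length L₁ ≤ k₁
   l₂ : length L₂ ≤ k₂
   l₃ : length L₃ ≤ k₃
   cover : ∀ {s} → s ∈ es → ∃₂ λ i j → ∃₂ λ l m → Rep s i j l m × i ∈ L₀ × j ∈ L₁ × l ∈ L₂ × m ∈ L₃

 -- In a complete 4-partite host every edge has one vertex in each part, so i small parts yield a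
 -- small set that contains i vertices of every edge of `H`.
 productHost : ∀ k₀ k₁ k₂ k₃ → k₀ + (k₁ + (k₂ + k₃)) ≤ n → e ≤ k₀ * (k₁ * (k₂ * k₃)) → ProductHost k₀ k₁ k₂ k₃
 productHost k₀ k₁ k₂ k₃ le e≤ = from (hostMap le ts
   (pairs-unique (Uniq.allFin⁺ k₀) (pairs-unique (Uniq.allFin⁺ k₁) (pairs-unique (Uniq.allFin⁺ k₂) (Uniq.allFin⁺ k₃))))
   (≤-trans e≤ (≤-reflexive (sym |ts|))))
  where
  ts : List (Tuple k₀ k₁ k₂ k₃)
  ts = pairs (allFin k₀) (pairs (allFin k₁) (pairs (allFin k₂) (allFin k₃)))
  |ts| : length ts ≡ k₀ * (k₁ * (k₂ * k₃))
  |ts| = trans (length-pairs (allFin k₀) _) (cong₂ _*_ (|fin| k₀) (trans (length-pairs (allFin k₁) _) (cong₂ _*_ (|fin| k₁)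
   (trans (length-pairs (allFin k₂) _) (cong₂ _*_ (|fin| k₂) (|fin| k₃))))))
  from : HostMap k₀ k₁ k₂ k₃ ts → ProductHost k₀ k₁ k₂ k₃
  from hm = record
   { L₀ = side inj₁ ; L₁ = side (inj₂ ∘ inj₁) ; L₂ = side (inj₂ ∘ inj₂ ∘ inj₁) ; L₃ = side (inj₂ ∘ inj₂ ∘ inj₂)
   ; l₀ = len inj₁ ; l₁ = len (inj₂ ∘ inj₁) ; l₂ = len (inj₂ ∘ inj₂ ∘ inj₁) ; l₃ = len (inj₂ ∘ inj₂ ∘ inj₂)
   ; cover = λ s∈ → let open Placed (placed s∈) in i , j , l , m , r
    , on inj₁ iAt , on (inj₂ ∘ inj₁) jAt , on (inj₂ ∘ inj₂ ∘ inj₁) lAt , on (inj₂ ∘ inj₂ ∘ inj₂) mAt }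
   where
   open HostMap hm
   side : ∀ {k} → (Fin k → Parts k₀ k₁ k₂ k₃) → List VH
   side {k} g = pre (map g (allFin k))
   len : ∀ {k} (g : Fin k → Parts k₀ k₁ k₂ k₃) → length (side g) ≤ k
   len {k} g = ≤-trans (length-pre (map g (allFin k))) (≤-reflexive (trans (LP.length-map g (allFin k)) (|fin| k)))
   on : ∀ {k} (g : Fin k → Parts k₀ k₁ k₂ k₃) {i v} → At i (g v) → i ∈ side g
   on {k} g {v = v} x = ∈-pre {map g (allFin k)} (∈-map⁺ g (∈-allFin v)) x

 -- g groups; every edge has two vertices i, j in a common group, and N lists the (opposite half of the) group of a vertex.
 record GroupHost (g D : ℕ) : Set where
  field
   N : VH → List VH
   N≤ : ∀ i → length (N i) ≤ D
   W : List VH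
   W≤ : length W ≤ 2 * (g * D)
   cover : ∀ {s} → s ∈ es → ∃₂ λ i j → ∃₂ λ l m → Rep s i j l m × j ∈ N i × i ∈ N j × i ∈ W × j ∈ W

 -- The host joins opposite halves, of size `D`, of the same group to two common parts of size `q`.
 groupHost : ∀ g D q → g * D + (g * D + (q + q)) ≤ n → e ≤ g * (D * (D * (q * q))) → GroupHost g D
 groupHost g D q le e≤ = from (hostMap le (map mk is) (Uniq.map⁺ (λ {x} {y} → mk-inj {x} {y})
   (pairs-unique (Uniq.allFin⁺ g) (pairs-unique (Uniq.allFin⁺ D) (pairs-unique (Uniq.allFin⁺ D)
   (pairs-unique (Uniq.allFin⁺ q) (Uniq.allFin⁺ q)))))) (≤-trans e≤ (≤-reflexive (sym (trans (LP.length-map mk is) |is|)))))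
  where
  P₄ : Set
  P₄ = Parts (g * D) (g * D) q q
  mk : Fin g × Fin D × Fin D × Fin q × Fin q → Tuple (g * D) (g * D) q q
  mk (i , a , b , c , d) = F.combine i a , F.combine i b , c , d
  is : List (Fin g × Fin D × Fin D × Fin q × Fin q)
  is = pairs (allFin g) (pairs (allFin D) (pairs (allFin D) (pairs (allFin q) (allFin q))))
  mk-inj : ∀ {x y} → mk x ≡ mk y → x ≡ y
  mk-inj {i , a , b , c , d} {i′ , a′ , b′ , c′ , d′} e
   with FP.combine-injective i a i′ a′ (cong proj₁ e) | FP.combine-injective i b i′ b′ (cong (proj₁ ∘ proj₂) e)
    | cong (proj₁ ∘ proj₂ ∘ proj₂) e | cong (proj₂ ∘ proj₂ ∘ proj₂) e
  ... | refl , refl | _ , refl | refl | refl = refl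
  |is| : length is ≡ g * (D * (D * (q * q)))
  |is| = trans (length-pairs (allFin g) _) (cong₂ _*_ (|fin| g) (trans (length-pairs (allFin D) _) (cong₂ _*_ (|fin| D)
   (trans (length-pairs (allFin D) _) (cong₂ _*_ (|fin| D) (trans (length-pairs (allFin q) (allFin q)) (cong₂ _*_ (|fin| q) (|fin| q))))))))
  module _ (hm : HostMap (g * D) (g * D) q q (map mk is)) where
   open HostMap hm
   member : (Fin (g * D) → P₄) → Fin (g * D) → List P₄
   member side m = map (side ∘ F.combine (F.quotient {g} D m)) (allFin D)
   Loc : VH → Set
   Loc i = (∃ λ m → At i (inj₁ m)) ⊎ (∃ λ m → At i (in₁ m)) ⊎ ⊤
   locate : ∀ i → Loc i
   locate i with FP.any? (λ m → at₁? i (inj₁ m))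
   ... | yes x = inj₁ x
   ... | no _ with FP.any? (λ m → at₁? i (in₁ m))
   ... | yes x = in₁ x
   ... | no _ = inj₂ (inj₂ tt)
   locate₀ : ∀ {i m} → At i (inj₁ m) → ∃ λ x → locate i ≡ inj₁ (m , x)
   locate₀ {i} {m} h with FP.any? (λ m → at₁? i (inj₁ m))
   ... | no ¬x = ⊥-elim (¬x (m , h))
   ... | yes (m′ , x) with at-fun {i} {inj₁ m′} {inj₁ m} x h
   ... | refl = x , refl
   locate₁ : ∀ {i m} → At i (in₁ m) → ∃ λ x → locate i ≡ in₁ (m , x)
   locate₁ {i} {m} h with FP.any? (λ m → at₁? i (inj₁ m))
   ... | yes (m′ , x) = case at-fun {i} {inj₁ m′} {in₁ m} x h of λ ()
   ... | no _ with FP.any? (λ m → at₁? i (in₁ m))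
   ... | no ¬x = ⊥-elim (¬x (m , h))
   ... | yes (m′ , x) with at-fun {i} {in₁ m′} {in₁ m} x h
   ... | refl = x , refl
   Nof : ∀ {i} → Loc i → List VH
   Nof (inj₁ (m , _)) = pre (member (inj₂ ∘ inj₁) m)
   Nof (in₁ (m , _)) = pre (member inj₁ m)
   Nof (inj₂ (inj₂ _)) = []
   N : VH → List VH
   N i = Nof (locate i)
   |member| : ∀ side m → length (pre (member side m)) ≤ D
   |member| side m = ≤-trans (length-pre (member side m)) (≤-reflexive (trans (LP.length-map (side ∘ F.combine (F.quotient {g} D m)) (allFin D)) (|fin| D)))
   Nof≤ : ∀ {i} (x : Loc i) → length (Nof x) ≤ D
   Nof≤ (inj₁ (m , _)) = |member| (inj₂ ∘ inj₁) m
   Nof≤ (in₁ (m , _)) = |member| inj₁ m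
   Nof≤ (inj₂ (inj₂ _)) = z≤n
   N≤ : ∀ i → length (N i) ≤ D
   N≤ i = Nof≤ (locate i)
   quotient-combine : ∀ (i : Fin g) (a : Fin D) → F.quotient {g} D (F.combine i a) ≡ i
   quotient-combine i a = cong proj₁ (FP.remQuot-combine i a)
   in-member : ∀ side (k : Fin g) a b → side (F.combine k b) ∈ member side (F.combine k a)
   in-member side k a b = subst (λ k′ → side (F.combine k b) ∈ map (side ∘ F.combine k′) (allFin D)) (sym (quotient-combine k a))
    (∈-map⁺ (side ∘ F.combine k) (∈-allFin b))
   N-at₀ : ∀ {i j} (k : Fin g) a b → At i (inj₁ (F.combine k a)) → At j (in₁ (F.combine k b)) → j ∈ N i
   N-at₀ {i} {j} k a b x y = subst (λ l → j ∈ Nof l) (sym (proj₂ (locate₀ {i} x)))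
    (∈-pre {member (inj₂ ∘ inj₁) (F.combine k a)} (in-member (inj₂ ∘ inj₁) k a b) y)
   N-at₁ : ∀ {i j} (k : Fin g) a b → At i (in₁ (F.combine k a)) → At j (inj₁ (F.combine k b)) → j ∈ N i
   N-at₁ {i} {j} k a b x y = subst (λ l → j ∈ Nof l) (sym (proj₂ (locate₁ {i} x)))
    (∈-pre {member inj₁ (F.combine k a)} (in-member inj₁ k a b) y)
   W : List VH
   W = pre (map inj₁ (allFin (g * D)) ++ map (inj₂ ∘ inj₁) (allFin (g * D)))
   Cover : S.Subset (verts H) → Set
   Cover s = ∃₂ λ i j → ∃₂ λ l m → Rep s i j l m × j ∈ N i × i ∈ N j × i ∈ W × j ∈ W
   cov : ∀ {s} → s ∈ es → Cover s
   cov {s} s∈ = go (placed s∈)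
    where
    go : Placed (map mk is) At s → Cover s
    go pl with ∈-map⁻ mk {xs = is} (Placed.t∈ pl)
    ... | (k , a , b , c , d) , _ , eq = Placed.i pl , Placed.j pl , Placed.l pl , Placed.m pl , Placed.r pl
      , N-at₀ k a b iAt′ jAt′ , N-at₁ k b a jAt′ iAt′
      , ∈-pre {map inj₁ (allFin (g * D)) ++ map (inj₂ ∘ inj₁) (allFin (g * D))} (∈-++⁺ˡ (∈-map⁺ inj₁ (∈-allFin (F.combine k a)))) iAt′
      , ∈-pre {map inj₁ (allFin (g * D)) ++ map (inj₂ ∘ inj₁) (allFin (g * D))}
       (∈-++⁺ʳ (map inj₁ (allFin (g * D))) (∈-map⁺ (inj₂ ∘ inj₁) (∈-allFin (F.combine k b)))) jAt′
     where
     iAt′ : At (Placed.i pl) (inj₁ (F.combine k a))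
     iAt′ = subst (λ p → At (Placed.i pl) (inj₁ p)) (cong proj₁ eq) (Placed.iAt pl)
     jAt′ : At (Placed.j pl) (in₁ (F.combine k b))
     jAt′ = subst (λ p → At (Placed.j pl) (in₁ p)) (cong (proj₁ ∘ proj₂) eq) (Placed.jAt pl)
   from : GroupHost g D
   from = record { N = N ; N≤ = N≤ ; W = W
    ; W≤ = ≤-trans (length-pre (map inj₁ (allFin (g * D)) ++ map (inj₂ ∘ inj₁) (allFin (g * D)))) (≤-reflexive (trans (LP.length-++ {A = P₄} (map inj₁ (allFin (g * D))))
     (trans (cong₂ _+_ (trans (LP.length-map inj₁ (allFin (g * D))) (|fin| (g * D))) (trans (LP.length-map (inj₂ ∘ inj₁) (allFin (g * D))) (|fin| (g * D))))
     (cong (g * D +_) (sym (+-identityʳ _))))))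
    ; cover = cov }

-- Hosts with small codegrees.

module CodegreeHosts {n e : ℕ} {H : Hyper4} (un : Unavoidable n e H) where

 open Host {n} {e} {H} un

 EdgeH : VH → VH → VH → VH → Set
 EdgeH = Edge (graph H)

 private
  |fin| : ∀ k → length (allFin k) ≡ k
  |fin| k = LP.length-tabulate {n = k} id

 part : ∀ {k₀ k₁ k₂ k₃} → Parts k₀ k₁ k₂ k₃ → Fin 4
 part (inj₁ _) = zero
 part (in₁ _) = suc zero
 part (in₂ _) = suc (suc zero)
 part (in₃ _) = suc (suc (suc zero))

 record TripleHost (z : ℕ) : Set where
  field
   N₃ : VH → VH → VH → List VH
   N₃≤ : ∀ a b c → length (N₃ a b c) ≤ 4 * z
   N₃∋ : ∀ {a b c d} → EdgeH a b c d → d ∈ N₃ a b c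

 -- The host (a , b , c , a + b + c + j), j < z.
 tripleHost : ∀ q z → q + (q + (q + (3 * q + z))) ≤ n → e ≤ q * (q * (q * z)) → TripleHost z
 tripleHost q z le e≤ = from (hostMap le (map mk is) (Uniq.map⁺ (λ {x} {y} → mk-inj {x} {y})
   (pairs-unique (Uniq.allFin⁺ q) (pairs-unique (Uniq.allFin⁺ q) (pairs-unique (Uniq.allFin⁺ q)
   (Uniq.allFin⁺ z))))) (≤-trans e≤ (≤-reflexive (sym (trans (LP.length-map mk is) |is|)))))
  where
  sum< : ∀ (a b c : Fin q) (j : Fin z) → toℕ a + toℕ b + toℕ c + toℕ j < 3 * q + z
  sum< a b c j = +-mono-≤-< (≤-trans (+-mono-≤ (+-mono-≤ (FP.toℕ≤n a) (FP.toℕ≤n b)) (FP.toℕ≤n c)) (≤-reflexive (lem q))) (FP.toℕ<n j)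
   where
   lem : ∀ q → q + q + q ≡ 3 * q
   lem = solve-∀
  mk : Fin q × Fin q × Fin q × Fin z → Tuple q q q (3 * q + z)
  mk (a , b , c , j) = a , b , c , F.fromℕ< (sum< a b c j)
  mk-inj : ∀ {x y} → mk x ≡ mk y → x ≡ y
  mk-inj {a , b , c , j} {a′ , b′ , c′ , j′} eq with cong proj₁ eq | cong (proj₁ ∘ proj₂) eq | cong (proj₁ ∘ proj₂ ∘ proj₂) eq
  ... | refl | refl | refl = cong (λ j → a , b , c , j) (FP.toℕ-injective (+-cancelˡ-≡ (toℕ a + toℕ b + toℕ c) _ _
   (trans (sym (FP.toℕ-fromℕ< (sum< a b c j))) (trans (cong (toℕ ∘ proj₂ ∘ proj₂ ∘ proj₂) eq) (FP.toℕ-fromℕ< (sum< a b c j′))))))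
  is : List (Fin q × Fin q × Fin q × Fin z)
  is = pairs (allFin q) (pairs (allFin q) (pairs (allFin q) (allFin z)))
  |is| : length is ≡ q * (q * (q * z))
  |is| = trans (length-pairs (allFin q) _) (cong₂ _*_ (|fin| q) (trans (length-pairs (allFin q) _) (cong₂ _*_ (|fin| q)
   (trans (length-pairs (allFin q) (allFin z)) (cong₂ _*_ (|fin| q) (|fin| z))))))
  module _ (hm : HostMap q q q (3 * q + z) (map mk is)) where
   open HostMap hm
   -- With `q ∸ toℕ a` in place of `a` the defining equation becomes symmetric: the four values add
   -- up to 3q + j. So three vertices leave only four parts and `z` values of j for the fourth.
   val : Parts q q q (3 * q + z) → ℕ
   val (inj₁ a) = q ∸ toℕ a
   val (in₁ a) = q ∸ toℕ a
   val (in₂ a) = q ∸ toℕ a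
   val (in₃ d) = toℕ d
   val-inj : ∀ {p p′} → part p ≡ part p′ → val p ≡ val p′ → p ≡ p′
   val-inj {inj₁ a} {inj₁ b} _ eq = cong inj₁ (FP.toℕ-injective (∸-cancelˡ-≡ (FP.toℕ≤n a) (FP.toℕ≤n b) eq))
   val-inj {in₁ a} {in₁ b} _ eq = cong (inj₂ ∘ inj₁) (FP.toℕ-injective (∸-cancelˡ-≡ (FP.toℕ≤n a) (FP.toℕ≤n b) eq))
   val-inj {in₂ a} {in₂ b} _ eq = cong (inj₂ ∘ inj₂ ∘ inj₁) (FP.toℕ-injective (∸-cancelˡ-≡ (FP.toℕ≤n a) (FP.toℕ≤n b) eq))
   val-inj {in₃ a} {in₃ b} _ eq = cong (inj₂ ∘ inj₂ ∘ inj₂) (FP.toℕ-injective eq)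
   val-inj {inj₁ _} {in₁ _} ()
   val-inj {inj₁ _} {in₂ _} ()
   val-inj {inj₁ _} {in₃ _} ()
   val-inj {in₁ _} {in₂ _} ()
   val-inj {in₁ _} {in₃ _} ()
   Val : VH → ℕ → Set
   Val i v = ∃ λ p → At i p × val p ≡ v
   val-fun : ∀ {i v v′} → Val i v → Val i v′ → v ≡ v′
   val-fun (p , x , refl) (p′ , x′ , refl) = cong val (at-fun x x′)
   Sum : VH → VH → VH → VH → Set
   Sum a b c d = ∃₂ λ va vb → ∃₂ λ vc vd → Val a va × Val b vb × Val c vc × Val d vd × (∃ λ (j : Fin z) → va + vb + vc + vd ≡ 3 * q + toℕ j)
   Sum-sym : SymClosed Sum
   Sum-sym = (λ (a , b , c , d , A , B , Cv , D , j , eq) → b , a , c , d , B , A , Cv , D , j , trans (lem1 a b c d) eq)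
     , (λ (a , b , c , d , A , B , Cv , D , j , eq) → a , c , b , d , A , Cv , B , D , j , trans (lem2 a b c d) eq)
     , (λ (a , b , c , d , A , B , Cv , D , j , eq) → a , b , d , c , A , B , D , Cv , j , trans (lem3 a b c d) eq)
    where
    lem1 : ∀ a b c d → b + a + c + d ≡ a + b + c + d
    lem1 = solve-∀
    lem2 : ∀ a b c d → a + c + b + d ≡ a + b + c + d
    lem2 = solve-∀
    lem3 : ∀ a b c d → a + b + d + c ≡ a + b + c + d
    lem3 = solve-∀
   sum-edge : ∀ {s} → s ∈ es → ∃₂ λ i j → ∃₂ λ l m → Rep s i j l m × Sum i j l m
   sum-edge s∈ with placed s∈
   ... | pl with ∈-map⁻ mk {xs = is} (Placed.t∈ pl)
   ... | (a , b , c , j) , _ , refl = _ , _ , _ , _ , Placed.r pl , _ , _ , _ , _ , (_ , Placed.iAt pl , refl) , (_ , Placed.jAt pl , refl)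
    , (_ , Placed.lAt pl , refl) , (_ , Placed.mAt pl , refl) , j , (begin
     q ∸ toℕ a + (q ∸ toℕ b) + (q ∸ toℕ c) + toℕ (F.fromℕ< (sum< a b c j)) ≡⟨ cong (q ∸ toℕ a + (q ∸ toℕ b) + (q ∸ toℕ c) +_) (FP.toℕ-fromℕ< (sum< a b c j)) ⟩
     q ∸ toℕ a + (q ∸ toℕ b) + (q ∸ toℕ c) + (toℕ a + toℕ b + toℕ c + toℕ j) ≡⟨ lem (q ∸ toℕ a) (q ∸ toℕ b) (q ∸ toℕ c) (toℕ a) (toℕ b) (toℕ c) (toℕ j) ⟩
     (q ∸ toℕ a + toℕ a) + (q ∸ toℕ b + toℕ b) + (q ∸ toℕ c + toℕ c) + toℕ j
      ≡⟨ cong (_+ toℕ j) (cong₂ _+_ (cong₂ _+_ (m∸n+n≡m (FP.toℕ≤n a)) (m∸n+n≡m (FP.toℕ≤n b))) (m∸n+n≡m (FP.toℕ≤n c))) ⟩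
     q + q + q + toℕ j ≡⟨ cong (_+ toℕ j) (lem2 q) ⟩
     3 * q + toℕ j ∎)
    where
    open ≡-Reasoning
    lem : ∀ x y w a b c j → x + y + w + (a + b + c + j) ≡ (x + a) + (y + b) + (w + c) + j
    lem = solve-∀
    lem2 : ∀ q → q + q + q ≡ 3 * q
    lem2 = solve-∀
   N₃ : VH → VH → VH → List VH
   N₃ a b c = filter (Edge? (graph H) a b c) (allFin (verts H))
   bound : ∀ a b c → length (N₃ a b c) ≤ 4 * z
   bound a b c = ≤-trans (injRel⇒length≤ {ys = pairs (allFin 4) (allFin z)} R (Uniq.filter⁺ (Edge? (graph H) a b c) (Uniq.allFin⁺ _)) inj tot)
     (≤-reflexive (trans (length-pairs (allFin 4) (allFin z)) (cong (4 *_) (|fin| z))))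
    where
    R : VH → Fin 4 × Fin z → Set
    R d (r , j) = ∃ λ p → At d p × part p ≡ r × ∃ λ v → (∃₂ λ va vb → ∃ λ vc → Val a va × Val b vb × Val c vc × va + vb + vc ≡ v) × v + val p ≡ 3 * q + toℕ j
    inj : ∀ {x x′ y} → x ∈ N₃ a b c → x′ ∈ N₃ a b c → R x y → R x′ y → x ≡ x′
    inj _ _ (p , x , refl , v , (va , vb , vc , A , B , Cv , refl) , eq) (p′ , x′ , pe , v′ , (va′ , vb′ , vc′ , A′ , B′ , Cv′ , refl) , eq′)
     with val-fun A A′ | val-fun B B′ | val-fun Cv Cv′
    ... | refl | refl | refl = at-inj (subst (At _) (val-inj (sym pe) (+-cancelˡ-≡ (va + vb + vc) _ _ (trans eq (sym eq′)))) x) x′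
    tot : ∀ {x} → x ∈ N₃ a b c → ∃ λ y → y ∈ pairs (allFin 4) (allFin z) × R x y
    tot {x} x∈ with proj₂ (∈-filter⁻ (Edge? (graph H) a b c) {xs = allFin (verts H)} x∈)
    ... | s , s∈ , r with sum-edge s∈
    ... | i , j , l , m , r′ , sm with rep-perm {P = Sum} Sum-sym r′ r sm
    ... | va , vb , vc , vd , A , B , Cv , (p , y , refl) , j′ , eq = (part p , j′) , ∈-pairs (∈-allFin _) (∈-allFin _) , p , y , refl , _ , (va , vb , vc , A , B , Cv , refl) , eq
   from : TripleHost z
   from = record { N₃ = N₃ ; N₃≤ = bound ; N₃∋ = λ {a} {b} {c} {d} ed → ∈-filter⁺ (Edge? (graph H) a b c) (∈-allFin d) ed }

 record PairHost (b : ℕ) : Set where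
  field
   N₂ : VH → VH → List VH
   N₂≤ : ∀ u w → length (N₂ u w) ≤ 4 * b
   N₂∋ : ∀ {u w c d} → EdgeH u w c d → c ∈ N₂ u w

 -- The host is the b-fold blow-up of the linear graph of all (x , y , x + y , x + 2 y).
 pairHost : ∀ m b → m * b + (m * b + (2 * m * b + 3 * m * b)) ≤ n → e ≤ m * (m * (b * (b * (b * b)))) → PairHost b
 pairHost m b le e≤ = from (hostMap le (map mk is) (Uniq.map⁺ (λ {s} {t} → mk-inj {s} {t})
   (pairs-unique (Uniq.allFin⁺ m) (pairs-unique (Uniq.allFin⁺ m)
   (pairs-unique (Uniq.allFin⁺ b) (pairs-unique (Uniq.allFin⁺ b) (pairs-unique (Uniq.allFin⁺ b) (Uniq.allFin⁺ b)))))))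
   (≤-trans e≤ (≤-reflexive (sym (trans (LP.length-map mk is) |is|)))))
  where
  Pt : Set
  Pt = Parts (m * b) (m * b) (2 * m * b) (3 * m * b)
  lin : Fin 4 → ℕ → ℕ → ℕ
  lin zero x y = x
  lin (suc zero) x y = y
  lin (suc (suc zero)) x y = x + y
  lin (suc (suc (suc zero))) x y = x + 2 * y
  l₂< : ∀ (x y : Fin m) → toℕ x + toℕ y < 2 * m
  l₂< x y = ≤-trans (+-mono-<-≤ (FP.toℕ<n x) (FP.toℕ≤n y)) (≤-reflexive (cong (m +_) (sym (+-identityʳ m))))
  l₃< : ∀ (x y : Fin m) → toℕ x + 2 * toℕ y < 3 * m
  l₃< x y = +-mono-<-≤ (FP.toℕ<n x) (*-monoʳ-≤ 2 (FP.toℕ≤n y))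
  mk : Fin m × Fin m × Fin b × Fin b × Fin b × Fin b → Tuple (m * b) (m * b) (2 * m * b) (3 * m * b)
  mk (x , y , α , β , γ , δ) = F.combine x α , F.combine y β , F.combine (F.fromℕ< (l₂< x y)) γ , F.combine (F.fromℕ< (l₃< x y)) δ
  mk-inj : ∀ {s t} → mk s ≡ mk t → s ≡ t
  mk-inj {x , y , α , β , γ , δ} {x′ , y′ , α′ , β′ , γ′ , δ′} eq
   with FP.combine-injective x α x′ α′ (cong proj₁ eq) | FP.combine-injective y β y′ β′ (cong (proj₁ ∘ proj₂) eq)
  ... | refl , refl | refl , refl with FP.combine-injective (F.fromℕ< (l₂< x y)) γ (F.fromℕ< (l₂< x y)) γ′ (cong (proj₁ ∘ proj₂ ∘ proj₂) eq)
   | FP.combine-injective (F.fromℕ< (l₃< x y)) δ (F.fromℕ< (l₃< x y)) δ′ (cong (proj₂ ∘ proj₂ ∘ proj₂) eq)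
  ... | _ , refl | _ , refl = refl
  is : List (Fin m × Fin m × Fin b × Fin b × Fin b × Fin b)
  is = pairs (allFin m) (pairs (allFin m) (pairs (allFin b) (pairs (allFin b) (pairs (allFin b) (allFin b)))))
  |is| : length is ≡ m * (m * (b * (b * (b * b))))
  |is| = trans (length-pairs (allFin m) _) (cong₂ _*_ (|fin| m) (trans (length-pairs (allFin m) _) (cong₂ _*_ (|fin| m)
   (trans (length-pairs (allFin b) _) (cong₂ _*_ (|fin| b) (trans (length-pairs (allFin b) _) (cong₂ _*_ (|fin| b)
   (trans (length-pairs (allFin b) (allFin b)) (cong₂ _*_ (|fin| b) (|fin| b))))))))))
  module _ (hm : HostMap (m * b) (m * b) (2 * m * b) (3 * m * b) (map mk is)) where
   open HostMap hm
   base : Pt → ℕ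
   base (inj₁ a) = toℕ (F.quotient {m} b a)
   base (in₁ a) = toℕ (F.quotient {m} b a)
   base (in₂ a) = toℕ (F.quotient {2 * m} b a)
   base (in₃ a) = toℕ (F.quotient {3 * m} b a)
   blow : Pt → Fin b
   blow (inj₁ a) = F.remainder {m} b a
   blow (in₁ a) = F.remainder {m} b a
   blow (in₂ a) = F.remainder {2 * m} b a
   blow (in₃ a) = F.remainder {3 * m} b a
   pt-inj : ∀ {p p′} → part p ≡ part p′ → base p ≡ base p′ → blow p ≡ blow p′ → p ≡ p′
   pt-inj {inj₁ _} {inj₁ _} _ x y = cong inj₁ (remQuot-inj {m} b (cong₂ _,_ (FP.toℕ-injective x) y))
   pt-inj {in₁ _} {in₁ _} _ x y = cong (inj₂ ∘ inj₁) (remQuot-inj {m} b (cong₂ _,_ (FP.toℕ-injective x) y))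
   pt-inj {in₂ _} {in₂ _} _ x y = cong (inj₂ ∘ inj₂ ∘ inj₁) (remQuot-inj {2 * m} b (cong₂ _,_ (FP.toℕ-injective x) y))
   pt-inj {in₃ _} {in₃ _} _ x y = cong (inj₂ ∘ inj₂ ∘ inj₂) (remQuot-inj {3 * m} b (cong₂ _,_ (FP.toℕ-injective x) y))
   pt-inj {inj₁ _} {in₁ _} ()
   pt-inj {inj₁ _} {in₂ _} ()
   pt-inj {inj₁ _} {in₃ _} ()
   pt-inj {in₁ _} {in₂ _} ()
   pt-inj {in₁ _} {in₃ _} ()
   2*-cancel : ∀ {y y′} → 2 * y ≡ 2 * y′ → y ≡ y′
   2*-cancel = *-cancelˡ-≡ _ _ 2
   sum-inj : ∀ {x y x′ y′} → x + y ≡ x′ + y′ → x + 2 * y ≡ x′ + 2 * y′ → x ≡ x′ × y ≡ y′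
   sum-inj {x} {y} {x′} {y′} p q = both p (+-cancelˡ-≡ (x + y) _ _ (trans (lem x y) (trans q (trans (sym (lem x′ y′)) (cong (_+ y′) (sym p))))))
    where
    lem : ∀ x y → x + y + y ≡ x + 2 * y
    lem = solve-∀
    both : ∀ {x y x′ y′} → x + y ≡ x′ + y′ → y ≡ y′ → x ≡ x′ × y ≡ y′
    both {y = y} p refl = +-cancelʳ-≡ y _ _ p , refl
   -- Any two of the forms x, y, x + y, x + 2y are linearly independent, so two points on different
   -- parts determine the line.
   lin-inj : ∀ {r r′ x y x′ y′} → r ≢ r′ → lin r x y ≡ lin r x′ y′ → lin r′ x y ≡ lin r′ x′ y′ → x ≡ x′ × y ≡ y′
   lin-inj {zero} {zero} ne p q = ⊥-elim (ne refl)
   lin-inj {zero} {suc zero} ne p q = p , q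
   lin-inj {zero} {suc (suc zero)} ne refl q = refl , +-cancelˡ-≡ _ _ _ q
   lin-inj {zero} {suc (suc (suc zero))} {x} ne refl q = refl , 2*-cancel (+-cancelˡ-≡ x _ _ q)
   lin-inj {suc zero} {zero} ne p q = q , p
   lin-inj {suc zero} {suc zero} ne p q = ⊥-elim (ne refl)
   lin-inj {suc zero} {suc (suc zero)} {x} {y} ne refl q = +-cancelʳ-≡ y _ _ q , refl
   lin-inj {suc zero} {suc (suc (suc zero))} {x} {y} ne refl q = +-cancelʳ-≡ (2 * y) _ _ q , refl
   lin-inj {suc (suc zero)} {zero} ne p refl = refl , +-cancelˡ-≡ _ _ _ p
   lin-inj {suc (suc zero)} {suc zero} {x} {y} ne p refl = +-cancelʳ-≡ y _ _ p , refl
   lin-inj {suc (suc zero)} {suc (suc zero)} ne p q = ⊥-elim (ne refl)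
   lin-inj {suc (suc zero)} {suc (suc (suc zero))} ne p q = sum-inj p q
   lin-inj {suc (suc (suc zero))} {zero} {x} ne p refl = refl , 2*-cancel (+-cancelˡ-≡ x _ _ p)
   lin-inj {suc (suc (suc zero))} {suc zero} {x} {y} ne p refl = +-cancelʳ-≡ (2 * y) _ _ p , refl
   lin-inj {suc (suc (suc zero))} {suc (suc zero)} ne p q = sum-inj q p
   lin-inj {suc (suc (suc zero))} {suc (suc (suc zero))} ne p q = ⊥-elim (ne refl)
   -- i sits in part r on the line (x , y)
   OnLine : ℕ → ℕ → VH → Fin 4 → Set
   OnLine x y i r = ∃ λ p → At i p × part p ≡ r × base p ≡ lin r x y
   Line : VH → VH → VH → VH → Set
   Line a b c d = ∃₂ λ x y → ∃₂ λ ra rb → ∃₂ λ rc rd → (OnLine x y a ra × OnLine x y b rb × OnLine x y c rc × OnLine x y d rd)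
    × (ra ≢ rb × ra ≢ rc × ra ≢ rd × rb ≢ rc × rb ≢ rd × rc ≢ rd)
   Line-sym : SymClosed Line
   Line-sym = (λ (x , y , ra , rb , rc , rd , (A , B , Cv , D) , (ab , ac , ad , bc , bd , cd)) →
     x , y , rb , ra , rc , rd , (B , A , Cv , D) , (≢-sym ab , bc , bd , ac , ad , cd))
    , (λ (x , y , ra , rb , rc , rd , (A , B , Cv , D) , (ab , ac , ad , bc , bd , cd)) →
     x , y , ra , rc , rb , rd , (A , Cv , B , D) , (ac , ab , ad , ≢-sym bc , cd , bd))
    , (λ (x , y , ra , rb , rc , rd , (A , B , Cv , D) , (ab , ac , ad , bc , bd , cd)) →
     x , y , ra , rb , rd , rc , (A , B , D , Cv) , (ab , ad , ac , bd , bc , ≢-sym cd))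
   quot : ∀ {k} (i : Fin k) (a : Fin b) → toℕ (F.quotient {k} b (F.combine i a)) ≡ toℕ i
   quot i a = cong (toℕ ∘ proj₁) (FP.remQuot-combine i a)
   line-edge : ∀ {s} → s ∈ es → ∃₂ λ i j → ∃₂ λ l m → Rep s i j l m × Line i j l m
   line-edge s∈ with placed s∈
   ... | pl with ∈-map⁻ mk {xs = is} (Placed.t∈ pl)
   ... | (x , y , α , β , γ , δ) , _ , refl = _ , _ , _ , _ , Placed.r pl , toℕ x , toℕ y , zero , suc zero , suc (suc zero) , suc (suc (suc zero))
    , ((_ , Placed.iAt pl , refl , quot x α) , (_ , Placed.jAt pl , refl , quot y β)
     , (_ , Placed.lAt pl , refl , trans (quot (F.fromℕ< (l₂< x y)) γ) (FP.toℕ-fromℕ< (l₂< x y)))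
     , (_ , Placed.mAt pl , refl , trans (quot (F.fromℕ< (l₃< x y)) δ) (FP.toℕ-fromℕ< (l₃< x y))))
    , (λ ()) , (λ ()) , (λ ()) , (λ ()) , (λ ()) , (λ ())
   pair? : ∀ u w c → Dec (∃ λ d → EdgeH u w c d)
   pair? u w c = FP.any? (Edge? (graph H) u w c)
   N₂ : VH → VH → List VH
   N₂ u w = filter (pair? u w) (allFin (verts H))
   -- Two vertices of an edge determine their line, and a third vertex on it is given by its part
   -- and its copy in the blow-up.
   bound : ∀ u w → length (N₂ u w) ≤ 4 * b
   bound u w = ≤-trans (injRel⇒length≤ {ys = pairs (allFin 4) (allFin b)} R (Uniq.filter⁺ (pair? u w) (Uniq.allFin⁺ _)) inj tot)
     (≤-reflexive (trans (length-pairs (allFin 4) (allFin b)) (cong (4 *_) (|fin| b))))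
    where
    R : VH → Fin 4 × Fin b → Set
    R c (r , t) = ∃₂ λ x y → (∃₂ λ ru rw → ru ≢ rw × OnLine x y u ru × OnLine x y w rw)
     × ∃ λ p → At c p × part p ≡ r × base p ≡ lin r x y × blow p ≡ t
    inj : ∀ {c c′ t} → c ∈ N₂ u w → c′ ∈ N₂ u w → R c t → R c′ t → c ≡ c′
    inj _ _ (x , y , (ru , rw , ne , (pu , au , refl , bu) , (pw , aw , refl , bw)) , p , at , refl , bp , refl)
     (x′ , y′ , (ru′ , rw′ , ne′ , (pu′ , au′ , refl , bu′) , (pw′ , aw′ , refl , bw′)) , p′ , at′ , pe , bp′ , ble)
     with at-fun au au′ | at-fun aw aw′
    ... | refl | refl with lin-inj {part pu} {part pw} ne (trans (sym bu) bu′) (trans (sym bw) bw′)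
    ... | refl , refl = at-inj (subst (At _) (pt-inj (sym pe) (trans bp (sym bp′)) (sym ble)) at) at′
    tot : ∀ {c} → c ∈ N₂ u w → ∃ λ t → t ∈ pairs (allFin 4) (allFin b) × R c t
    tot {c} c∈ with proj₂ (∈-filter⁻ (pair? u w) {xs = allFin (verts H)} c∈)
    ... | d , s , s∈ , r with line-edge s∈
    ... | i , j , l , k , r′ , ln with rep-perm {P = Line} Line-sym r′ r ln
    ... | x , y , ra , rb , rc , rd , (A , B , (p , at , refl , bp) , D) , (ab , _) =
     (part p , blow p) , ∈-pairs (∈-allFin _) (∈-allFin _) , x , y , (ra , rb , ab , A , B) , p , at , refl , bp , refl
   from : PairHost b
   from = record { N₂ = N₂ ; N₂≤ = bound ; N₂∋ = λ {u} {w} {c} {d} ed → ∈-filter⁺ (pair? u w) (∈-allFin c) (d , ed) }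

-- Density of unavoidable graphs: a transversal of large blocks avoids any small family of sets

module Transversal {X : Set} (_≟_ : DecidableEquality X) (B : ℕ) (1≤B : 1 ≤ B) where

 open import Data.List.Membership.DecPropositional _≟_ using (_∈?_)

 minus : X → List X → List X
 minus x F = filter (λ y → ¬? (y ≟ x)) F

 Hits : List X → X → List X → Set
 Hits b x F = Any (λ y → y ≢ x × y ∈ F) b

 hits? : ∀ b x F → Dec (Hits b x F)
 hits? b x F = Any.any? (λ y → ¬? (y ≟ x) ×-dec (y ∈? F)) b

 -- The choice of `x` excludes the rest of its block: a set that needs another member of the block
 -- is avoided for good, and from any other set at most `x` has to be struck.
 reduce : List X → X → List X → List (List X)
 reduce b x F with hits? b x F
 ... | yes _ = []
 ... | no _ = minus x F ∷ []

 module _ (M : ℕ) where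

  -- Divided by `B ^ M`, this bounds the probability that a random transversal contains `F`.
  weight : List X → ℕ
  weight F = B ^ (M ∸ length F)

  Small : List X → Set
  Small F = Unique F × length F ≤ M

  minus-small : ∀ x {F} → Small F → Small (minus x F)
  minus-small x {F} (u , le) = Uniq.filter⁺ _ u , ≤-trans (LP.length-filter _ F) le

  reduce-small : ∀ b x {F} → Small F → All Small (reduce b x F)
  reduce-small b x {F} s with hits? b x F
  ... | yes _ = []
  ... | no _ = minus-small x s ∷ []

  minus-∉ : ∀ x F → x ∉ F → minus x F ≡ F
  minus-∉ x F x∉ = LP.filter-all _ (All.tabulate λ {y} y∈ e → x∉ (subst (_∈ F) e y∈))

  minus-∈ : ∀ x F → Unique F → x ∈ F → suc (length (minus x F)) ≡ length F
  minus-∈ x (y ∷ F) (y≢ ∷ u) x∈ with y ≟ x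
  minus-∈ x (y ∷ F) (y≢ ∷ u) x∈ | yes refl = cong suc (cong length (minus-∉ y F λ p → All.lookup y≢ p refl))
  minus-∈ x (y ∷ F) (y≢ ∷ u) (here e) | no ne = ⊥-elim (ne (sym e))
  minus-∈ x (y ∷ F) (y≢ ∷ u) (there p) | no ne = cong suc (minus-∈ x F u p)

  weight-minus : ∀ x F → Small F → x ∈ F → weight (minus x F) ≡ B * weight F
  weight-minus x F (u , le) x∈ = trans (cong (λ l → B ^ (M ∸ l)) (cong N.pred (minus-∈ x F u x∈)))
    (cong (B ^_) (eq (length F) le (subst (1 ≤_) (minus-∈ x F u x∈) (s≤s z≤n))))
   where
   eq : ∀ l → l ≤ M → 1 ≤ l → M ∸ N.pred l ≡ suc (M ∸ l)
   eq (suc l) le _ = +-∸-assoc 1 le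

  total : List (List X) → ℕ
  total = sumOf weight

  sum-one : ∀ (g : X → ℕ) (c : ℕ) (b : List X) → Unique b → ∀ {y} → (∀ {x} → x ∈ b → x ≢ y → g x ≤ 0) → g y ≤ c → sumOf g b ≤ c
  sum-one g c [] u h k = z≤n
  sum-one g c (x ∷ b) (x≢ ∷ u) {y} h k with x ≟ y
  ... | yes refl = ≤-trans (+-mono-≤ k (≤-trans (sumOf-mono b λ p → h (there p) λ e → All.lookup x≢ p (sym e)) (≤-reflexive (sumOf-0 b)))) (≤-reflexive (+-identityʳ c))
  ... | no ne = ≤-trans (+-monoˡ-≤ (sumOf g b) (h (here refl) ne)) (sum-one g c b u (h ∘ there) k)

  -- If `F` misses the block, each of the `B` choices preserves its weight. If it meets the block in
  -- `y`, every choice other than `y` makes it disappear, and the choice `y` multiplies its weight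
  -- by at most `B`.
  reduce-weight : ∀ b F → Unique b → length b ≡ B → Small F → sumOf (λ x → total (reduce b x F)) b ≤ B * weight F
  reduce-weight b F ub lb sm with Any.any? (_∈? F) b
  ... | no none = ≤-trans (sumOf-mono b each) (≤-reflexive (trans (sumOf-const (weight F) b) (cong (_* weight F) lb)))
   where
   each : ∀ {x} → x ∈ b → total (reduce b x F) ≤ weight F
   each {x} x∈ with hits? b x F
   ... | yes _ = z≤n
   ... | no _ = ≤-reflexive (trans (+-identityʳ _) (cong weight (minus-∉ x F λ p → none (lose x∈ p))))
    where open import Data.List.Membership.Propositional using (lose)
  ... | yes some with find some
   where open import Data.List.Membership.Propositional using (find)
  ... | y , y∈ , y∈F = sum-one (λ x → total (reduce b x F)) (B * weight F) b ub {y} other same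
   where
   open import Data.List.Membership.Propositional using (lose)
   other : ∀ {x} → x ∈ b → x ≢ y → total (reduce b x F) ≤ 0
   other {x} _ ne with hits? b x F
   ... | yes _ = z≤n
   ... | no ¬h = ⊥-elim (¬h (lose y∈ ((λ e → ne (sym e)) , y∈F)))
   same : total (reduce b y F) ≤ B * weight F
   same with hits? b y F
   ... | yes _ = z≤n
   ... | no _ = ≤-reflexive (trans (+-identityʳ _) (weight-minus y F sm y∈F))

  total-concatMap : ∀ (f : List X → List (List X)) 𝓕 → total (concatMap f 𝓕) ≡ sumOf (λ F → total (f F)) 𝓕
  total-concatMap f [] = refl
  total-concatMap f (F ∷ 𝓕) = trans (sumOf-++ weight (f F) (concatMap f 𝓕)) (cong (total (f F) +_) (total-concatMap f 𝓕))

  some-small : ∀ (g : X → ℕ) (c : ℕ) (b : List X) → sumOf g b < length b * c → ∃ λ x → x ∈ b × g x < c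
  some-small g c (x ∷ b) lt with g x N.<? c
  ... | yes p = x , here refl , p
  ... | no ¬p = let (x′ , m , q) = some-small g c b (+-cancelˡ-< c _ _ (≤-<-trans (+-monoˡ-≤ (sumOf g b) (≮⇒≥ ¬p)) lt)) in x′ , there m , q

  -- The method of conditional expectations: with a suitable element from each block the total
  -- weight stays below `B ^ M`, whereas a set contained in the final choice would have been reduced
  -- to the empty set, whose weight alone is `B ^ M`.
  transversal : ∀ (bs : List (List X)) → All (λ b → Unique b × length b ≡ B) bs → AllPairs Disj bs → (𝓕 : List (List X))
   → All Small 𝓕 → total 𝓕 < B ^ M
   → ∃ λ c → length c ≡ length bs × Unique c × (∀ {x} → x ∈ c → ∃ λ b → b ∈ bs × x ∈ b) × (∀ {F} → F ∈ 𝓕 → ¬ (∀ {x} → x ∈ F → x ∈ c))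
  transversal [] _ _ 𝓕 sm lt = [] , refl , [] , (λ ()) , λ {F} F∈ sub → <-irrefl refl (<-≤-trans lt (heavy 𝓕 F F∈ sub))
   where
   heavy : ∀ 𝓕 F → F ∈ 𝓕 → (∀ {x} → x ∈ F → x ∈ []) → B ^ M ≤ total 𝓕
   heavy (_ ∷ 𝓕) [] (here refl) _ = m≤m+n _ _
   heavy (_ ∷ 𝓕) (x ∷ F) (here refl) sub = case sub (here refl) of λ ()
   heavy (F′ ∷ 𝓕) F (there p) sub = ≤-trans (heavy 𝓕 F p sub) (m≤n+m _ (weight F′))
  transversal (b ∷ bs) ((ub , lb) ∷ ok) (b# ∷ bs#) 𝓕 sm lt
   with some-small (λ x → total (concatMap (reduce b x) 𝓕)) (B ^ M) b sum<
   where
   sum< : sumOf (λ x → total (concatMap (reduce b x) 𝓕)) b < length b * B ^ M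
   sum< = ≤-<-trans (begin
    sumOf (λ x → total (concatMap (reduce b x) 𝓕)) b ≡⟨ sumOf-cong (λ x → total-concatMap (reduce b x) 𝓕) b ⟩
    sumOf (λ x → sumOf (λ F → total (reduce b x F)) 𝓕) b ≡⟨ sumOf-swap (λ x F → total (reduce b x F)) b 𝓕 ⟩
    sumOf (λ F → sumOf (λ x → total (reduce b x F)) b) 𝓕 ≤⟨ sumOf-mono 𝓕 (λ {F} F∈ → reduce-weight b F ub lb (All.lookup sm F∈)) ⟩
    sumOf (λ F → B * weight F) 𝓕 ≡⟨ sumOf-* B weight 𝓕 ⟩
    B * total 𝓕 ≡⟨ cong (_* total 𝓕) (sym lb) ⟩
    length b * total 𝓕 ∎) (*-monoʳ-< (length b) {{N.>-nonZero (≤-trans 1≤B (≤-reflexive (sym lb)))}} lt)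
    where open ≤-Reasoning
  ... | x , x∈ , small with transversal bs ok bs# (concatMap (reduce b x) 𝓕) (all-concatMap {B = ⊤} {B′ = ⊤} (reduce b x) 𝓕 λ F∈ → reduce-small b x (All.lookup sm F∈)) small
  ... | c , lc , uc , src , avoid = x ∷ c , cong suc lc , (All.tabulate (λ {y} y∈ e → fresh y∈ (subst (_∈ b) e x∈)) ∷ uc)
    , (λ { (here refl) → b , here refl , x∈ ; (there p) → let (b′ , m , q) = src p in b′ , there m , q })
    , bad
   where
   open import Data.List.Membership.Propositional using (find)
   fresh : ∀ {y} → y ∈ c → y ∉ b
   fresh y∈ y∈b = let (b′ , m , q) = src y∈ in All.lookup b# m _ y∈b q
   bad : ∀ {F} → F ∈ 𝓕 → ¬ (∀ {y} → y ∈ F → y ∈ x ∷ c)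
   bad {F} F∈ sub = avoid (∈-concatMap (reduce b x) F∈ kept) λ {y} y∈ → rest y∈
    where
    kept : minus x F ∈ reduce b x F
    kept with hits? b x F
    ... | no _ = here refl
    ... | yes h with find h
    ... | y , y∈b , ne , y∈F with sub y∈F
    ... | here e = ⊥-elim (ne e)
    ... | there y∈c = ⊥-elim (fresh y∈c y∈b)
    rest : ∀ {y} → y ∈ minus x F → y ∈ c
    rest {y} y∈ with ∈-filter⁻ (λ y → ¬? (y ≟ x)) {xs = F} y∈
    ... | y∈F , ne with sub y∈F
    ... | here e = ⊥-elim (ne e)
    ... | there p = p

chunk : {X : Set} (B e : ℕ) (xs : List X) → Unique xs → e * B ≤ length xs
 → Σ (List (List X)) λ bs → length bs ≡ e × All (λ b → Unique b × length b ≡ B) bs × AllPairs Disj bs × (∀ {b x} → b ∈ bs → x ∈ b → x ∈ xs)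
chunk B zero xs u le = [] , refl , [] , [] , λ ()
chunk B (suc e) xs u le =
 let (bs , l , ok , dj , sub) = chunk B e (L.drop B xs) (proj₁ (proj₂ parts)) rest≤ in
 take B xs ∷ bs , cong suc l , (proj₁ parts , trans (LP.length-take B xs) (m≤n⇒m⊓n≡m (≤-trans (m≤m+n B _) le))) ∷ ok
 , All.tabulate (λ b∈ x p q → proj₂ (proj₂ parts) x p (sub b∈ q)) ∷ dj
 , λ { (here refl) p → subst (_ ∈_) (LP.take++drop≡id B xs) (∈-++⁺ˡ p)
  ; (there b∈) p → subst (_ ∈_) (LP.take++drop≡id B xs) (∈-++⁺ʳ (take B xs) (sub b∈ p)) }
 where
 parts : Unique (take B xs) × Unique (L.drop B xs) × Disj (take B xs) (L.drop B xs)
 parts = unique-++⁻ (take B xs) (subst Unique (sym (LP.take++drop≡id B xs)) u)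
 rest≤ : e * B ≤ length (L.drop B xs)
 rest≤ = ≤-trans (≤-trans (≤-reflexive (sym (m+n∸m≡n B (e * B)))) (∸-monoˡ-≤ B le)) (≤-reflexive (sym (LP.length-drop B xs)))

maps : (n : ℕ) {A : Set} → List A → List (List (Fin n))
maps n [] = [] ∷ []
maps n (a ∷ as) = concatMap (λ v → map (v ∷_) (maps n as)) (allFin n)

length-maps : ∀ n {A : Set} (as : List A) → length (maps n as) ≡ n ^ length as
length-maps n [] = refl
length-maps n (a ∷ as) = trans (length-concatMap≡ _ (length (maps n as)) (allFin n) (λ v → LP.length-map (v ∷_) (maps n as)))
 (cong₂ _*_ (LP.length-tabulate {n = n} id) (length-maps n as))

∈-maps : ∀ {n} {A : Set} (f : A → Fin n) as → map f as ∈ maps n as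
∈-maps f [] = here refl
∈-maps f (a ∷ as) = ∈-concatMap _ (∈-allFin (f a)) (∈-map⁺ (f a ∷_) (∈-maps f as))

module Density {n e : ℕ} {H : Hyper4} (un : Unavoidable n e H) where

 private
  k : ℕ
  k = verts H

 extend : Fin n → List (Fin k) → List (Fin n) → Fin k → Fin n
 extend v₀ (w ∷ W) (v ∷ vs) i with i F.≟ w
 ... | yes _ = v
 ... | no _ = extend v₀ W vs i
 extend v₀ _ _ i = v₀

 extend-map : ∀ v₀ (f : Fin k → Fin n) W {i} → i ∈ W → extend v₀ W (map f W) i ≡ f i
 extend-map v₀ f (w ∷ W) {i} i∈ with i F.≟ w
 ... | yes refl = refl
 extend-map v₀ f (w ∷ W) {i} (here e) | no ne = ⊥-elim (ne e)
 extend-map v₀ f (w ∷ W) {i} (there p) | no ne = extend-map v₀ f W p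

 image-cong-on : ∀ {f g : Fin k → Fin n} s → (∀ {i} → i S.∈ s → f i ≡ g i) → image f s ≡ image g s
 image-cong-on {f} {g} s eq = subset-ext _ _
  (λ i p → let (j , j∈ , e) = ∈-image⁻ f s p in subst (S._∈ image g s) (trans (sym (eq j∈)) e) (∈-image⁺ g s j∈))
  (λ i p → let (j , j∈ , e) = ∈-image⁻ g s p in subst (S._∈ image f s) (trans (eq j∈) e) (∈-image⁺ f s j∈))

 -- A complete 4-partite host is cut into `e` blocks of `B` edges. If there were fewer than
 -- `B ^ length es₀` maps of `W`, some transversal of the blocks, a graph with `e` edges, would
 -- contain none of the images of `es₀`, although `H` embeds into it.
 density : ∀ B q → 1 ≤ B → 1 ≤ n → q + (q + (q + q)) ≤ n → e * B ≤ q * (q * (q * q))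
  → ∀ es₀ → Unique es₀ → (∀ {s} → s ∈ es₀ → s ∈ edges (graph H)) → ∀ W → (∀ {s i} → s ∈ es₀ → i S.∈ s → i ∈ W)
  → B ^ length es₀ ≤ n ^ length W
 density B q 1≤B 1≤n q≤ eB≤ es₀ u₀ sub W inW = ≮⇒≥ λ lt → contra (transversal M blocks ok dj 𝓕 small (≤-<-trans few lt))
  where
  open Transversal {S.Subset n} subset-≟ B 1≤B
  open Partite q q q q
  M : ℕ
  M = length es₀
  ts : List (Tuple q q q q)
  ts = pairs (allFin q) (pairs (allFin q) (pairs (allFin q) (allFin q)))
  |ts| : length ts ≡ q * (q * (q * q))
  |ts| = trans (length-pairs (allFin q) _) (cong₂ _*_ l (trans (length-pairs (allFin q) _) (cong₂ _*_ l
   (trans (length-pairs (allFin q) (allFin q)) (cong₂ _*_ l l)))))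
   where
   l = LP.length-tabulate {n = q} id
  G₀ : Graph4 n
  G₀ = graphOf q≤ ts (pairs-unique (Uniq.allFin⁺ q) (pairs-unique (Uniq.allFin⁺ q) (pairs-unique (Uniq.allFin⁺ q) (Uniq.allFin⁺ q))))
  ch = chunk B e (edges G₀) (distinct G₀) (≤-trans eB≤ (≤-reflexive (sym (trans (LP.length-map _ ts) |ts|))))
  blocks = proj₁ ch
  ok = proj₁ (proj₂ (proj₂ ch))
  dj = proj₁ (proj₂ (proj₂ (proj₂ ch)))
  v₀ : Fin n
  v₀ = F.fromℕ< 1≤n
  images : List (Fin n) → List (S.Subset n)
  images vs = map (image (extend v₀ W vs)) es₀
  unique? : ∀ (F : List (S.Subset n)) → Dec (Unique F)
  unique? = AP.allPairs? (λ x y → ¬? (subset-≟ x y))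
  𝓕 : List (List (S.Subset n))
  𝓕 = filter unique? (map images (maps n W))
  member : ∀ {F} → F ∈ 𝓕 → Unique F × length F ≡ M
  member F∈ with ∈-filter⁻ unique? {xs = map images (maps n W)} F∈
  ... | p , uF with ∈-map⁻ images p
  ... | vs , _ , refl = uF , LP.length-map _ es₀
  small : All (Small M) 𝓕
  small = All.tabulate λ F∈ → proj₁ (member F∈) , ≤-reflexive (proj₂ (member F∈))
  -- Every set in the family has exactly `M` members and so weight 1; there is at most one set for
  -- each map of `W`.
  few : total M 𝓕 ≤ n ^ length W
  few = ≤-trans (sumOf-mono 𝓕 λ F∈ → ≤-reflexive (cong (B ^_) (trans (cong (M ∸_) (proj₂ (member F∈))) (n∸n≡0 M))))
   (≤-trans (≤-reflexive (trans (sumOf-const 1 𝓕) (*-identityʳ _)))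
    (≤-trans (LP.length-filter unique? (map images (maps n W))) (≤-reflexive (trans (LP.length-map images (maps n W)) (length-maps n W)))))
  contra : (∃ λ c → length c ≡ length blocks × Unique c × (∀ {x} → x ∈ c → ∃ λ b → b ∈ blocks × x ∈ b) × (∀ {F} → F ∈ 𝓕 → ¬ (∀ {x} → x ∈ F → x ∈ c))) → ⊥
  contra (c , lc , uc , src , avoid) = avoid F∈ λ {x} x∈ → inC x∈
   where
   G : Graph4 n
   G = record { edges = c ; distinct = uc ; uniform = All.tabulate λ x∈ → let (b , b∈ , m) = src x∈ in
    All.lookup (uniform G₀) (proj₂ (proj₂ (proj₂ (proj₂ ch))) b∈ m) }
   emb : Contains G H
   emb = un G (trans lc (proj₁ (proj₂ ch)))
   f = proj₁ emb
   agree : ∀ {s} → s ∈ es₀ → image (extend v₀ W (map f W)) s ≡ image f s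
   agree {s} s∈ = image-cong-on s λ i∈ → extend-map v₀ f W (inW s∈ i∈)
   images≡ : ∀ xs → (∀ {s} → s ∈ xs → s ∈ es₀) → map (image (extend v₀ W (map f W))) xs ≡ map (image f) xs
   images≡ [] _ = refl
   images≡ (s ∷ xs) h = cong₂ _∷_ (agree (h (here refl))) (images≡ xs (h ∘ there))
   F∈ : images (map f W) ∈ 𝓕
   F∈ = ∈-filter⁺ unique? (∈-map⁺ images (∈-maps f W)) (subst Unique (sym (images≡ es₀ id)) (Uniq.map⁺ (image-injective (proj₁ (proj₂ emb))) u₀))
   inC : ∀ {x} → x ∈ images (map f W) → x ∈ c
   inC {x} x∈ with ∈-map⁻ (image f) (subst (x ∈_) (images≡ es₀ id) x∈)
   ... | s , s∈ , refl = All.lookup (proj₂ (proj₂ emb)) (sub s∈)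

-- Counting the edges of an unavoidable graph

partition⊎ : {X : Set} {A B : X → Set} (xs : List X) → (∀ {x} → x ∈ xs → A x ⊎ B x)
 → Σ (List X) λ ys → Σ (List X) λ zs → All A ys × All B zs × ys ⊆ xs × zs ⊆ xs × length xs ≤ length ys + length zs
partition⊎ [] h = [] , [] , [] , [] , [] , [] , z≤n
partition⊎ (x ∷ xs) h with h (here refl) | partition⊎ xs (h ∘ there)
... | inj₁ a | ys , zs , as , bs , sy , sz , le = x ∷ ys , zs , a ∷ as , bs , refl ∷ sy , x ∷ʳ sz , s≤s le
... | inj₂ b | ys , zs , as , bs , sy , sz , le = ys , x ∷ zs , as , b ∷ bs , x ∷ʳ sy , refl ∷ sz , ≤-trans (s≤s le) (≤-reflexive (sym (+-suc _ _)))

-- The bound is required for all sublists, because what remains after the elements of one index are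
-- split off is again a sublist.
cover-count : {X I : Set} (Q : I → X → Set) (c : ℕ) (is : List I) (xs : List X)
 → (∀ i ys → ys ⊆ xs → All (Q i) ys → length ys ≤ c) → All (λ x → ∃ λ i → i ∈ is × Q i x) xs → length xs ≤ length is * c
cover-count Q c [] [] h al = z≤n
cover-count Q c [] (x ∷ xs) h ((i , () , _) ∷ _)
cover-count Q c (i ∷ is) xs h al with partition⊎ {A = Q i} {B = λ x → ∃ λ i → i ∈ is × Q i x} xs (λ x∈ → split (All.lookup al x∈))
 where
 split : ∀ {x} → (∃ λ j → j ∈ i ∷ is × Q j x) → Q i x ⊎ (∃ λ j → j ∈ is × Q j x)
 split (_ , here refl , q) = inj₁ q
 split (j , there p , q) = inj₂ (j , p , q)
... | ys , zs , as , bs , sy , sz , le = ≤-trans le (+-mono-≤ (h i ys sy as) (cover-count Q c is zs (λ j ws sub → h j ws (⊆-trans sub sz)) bs))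

module Assembly {n e : ℕ} {H : Hyper4} (un : Unavoidable n e H) where

 open Host {n} {e} {H} un
 open CodegreeHosts {n} {e} {H} un
 open import Data.List.Membership.DecPropositional (F._≟_ {verts H}) using (_∈?_)

 module Counting {ρ D ξ ζ β g : ℕ}
  (R : List VH) (R≤ : length R ≤ ρ) (hit : ∀ {s} → s ∈ es → ∃ λ r → r ∈ R × r S.∈ s)
  (X : List VH) (X≤ : length X ≤ ξ) (two : ∀ {s} → s ∈ es → ∃₂ λ i j → ∃₂ λ l m → Rep s i j l m × i ∈ X × j ∈ X)
  (th : TripleHost ζ) (ph : PairHost β)
  (dens : ∀ es₀ → es₀ ⊆ es → ∀ W → (∀ {s i} → s ∈ es₀ → i S.∈ s → i ∈ W) → length es₀ ≤ 2 * length W) where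

  open TripleHost th
  open PairHost ph

  PairIn : VH × VH → S.Subset (verts H) → Set
  PairIn (u , w) s = ∃₂ λ l m → Rep s u w l m

  -- All edges through the pair lie inside `u`, `w` and `N₂ u w`, and the density bound for this
  -- small vertex set counts them.
  pair-codegree : ∀ p ys → ys ⊆ es → All (PairIn p) ys → length ys ≤ 2 * (2 + 4 * β)
  pair-codegree (u , w) ys sub al = ≤-trans (dens ys sub (u ∷ w ∷ N₂ u w) inW) (*-monoʳ-≤ 2 (+-monoʳ-≤ 2 (N₂≤ u w)))
   where
   inW : ∀ {s i} → s ∈ ys → i S.∈ s → i ∈ u ∷ w ∷ N₂ u w
   inW {s} {i} s∈ i∈ with All.lookup al s∈
   ... | l , m , r with Rep.only r i∈
   ... | inj₁ refl = here refl
   ... | in₁ refl = there (here refl)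
   ... | in₂ refl = there (there (N₂∋ (s , Sub.lookup sub s∈ , r)))
   ... | in₃ refl = there (there (N₂∋ (s , Sub.lookup sub s∈ , rep-swap₃ r)))

  hub-pairs : (N : VH → List VH) (D : ℕ) → (∀ i → length (N i) ≤ D) → ∀ ys → ys ⊆ es
   → All (λ s → ∃₂ λ i j → i ∈ R × j ∈ N i × PairIn (i , j) s) ys → length ys ≤ ρ * D * (2 * (2 + 4 * β))
  hub-pairs N D N≤ ys sub al = ≤-trans (cover-count PairIn (2 * (2 + 4 * β)) is ys (λ p zs sz → pair-codegree p zs (⊆-trans sz sub))
    (All.map (λ (i , j , i∈ , j∈ , q) → (i , j) , ∈-concatMap (λ r → map (r ,_) (N r)) i∈ (∈-map⁺ (i ,_) j∈) , q) al))
    (*-monoˡ-≤ (2 * (2 + 4 * β)) (≤-trans (length-concatMap≤ _ D R λ r → ≤-trans (≤-reflexive (LP.length-map (r ,_) (N r))) (N≤ r)) (*-monoˡ-≤ D R≤)))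
   where
   is : List (VH × VH)
   is = concatMap (λ r → map (r ,_) (N r)) R

  module _ (gh : GroupHost g D) where

   open GroupHost gh using (N; N≤; cover)

   T₁ T₂ T₃ : S.Subset (verts H) → Set
   T₁ s = ∃₂ λ i j → i ∈ R × j ∈ N i × PairIn (i , j) s
   T₂ s = ∃₂ λ x u → ∃₂ λ r d → Rep s x u r d × x ∈ X × u ∈ N x × r ∈ R
   T₃ s = ∃₂ λ i j → ∃₂ λ l m → Rep s i j l m × j ∈ N i × i ∈ N j × i ∉ R × j ∉ R × l ∈ X × m ∈ X

   -- Two vertices `i` and `j` of the edge share a group. If one of them is a hub, `T₁` holds.
   -- Otherwise the hub is `l` or `m`: if `X` contains `i` or `j`, this gives `T₂`, and if not, the
   -- two vertices in `X` are `l` and `m`, as in `T₃`.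
   classify : ∀ {s} → s ∈ es → T₁ s ⊎ (T₂ s ⊎ T₃ s)
   classify {s} s∈ with cover s∈
   ... | i , j , l , m , r , j∈N , i∈N , _ , _ with i ∈? R | j ∈? R
   ... | yes i∈R | _ = inj₁ (i , j , i∈R , j∈N , l , m , r)
   ... | no _ | yes j∈R = inj₁ (j , i , j∈R , i∈N , l , m , rep-swap₁ r)
   ... | no i∉R | no j∉R with i ∈? X | j ∈? X | hub
    where
    hub : (l ∈ R) ⊎ (m ∈ R)
    hub with hit s∈
    ... | h , h∈ , h∈s with Rep.only r h∈s
    ... | inj₁ refl = ⊥-elim (i∉R h∈)
    ... | in₁ refl = ⊥-elim (j∉R h∈)
    ... | in₂ refl = inj₁ h∈
    ... | in₃ refl = inj₂ h∈
   ... | yes i∈X | _ | inj₁ l∈R = in₁ (i , j , l , m , r , i∈X , j∈N , l∈R)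
   ... | yes i∈X | _ | inj₂ m∈R = in₁ (i , j , m , l , rep-swap₃ r , i∈X , j∈N , m∈R)
   ... | no _ | yes j∈X | inj₁ l∈R = in₁ (j , i , l , m , rep-swap₁ r , j∈X , i∈N , l∈R)
   ... | no _ | yes j∈X | inj₂ m∈R = inj₂ (inj₁ (j , i , m , l , rep-swap₃ (rep-swap₁ r) , j∈X , i∈N , m∈R))
   ... | no i∉X | no j∉X | _ with two s∈
   ... | x , x′ , _ , _ , r′ , x∈ , x′∈ with Rep.only r (Rep.∈a r′) | Rep.only r (Rep.∈b r′)
   ... | inj₁ refl | _ = ⊥-elim (i∉X x∈)
   ... | in₁ refl | _ = ⊥-elim (j∉X x∈)
   ... | _ | inj₁ refl = ⊥-elim (i∉X x′∈)
   ... | _ | in₁ refl = ⊥-elim (j∉X x′∈)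
   ... | in₂ refl | in₂ refl = ⊥-elim (Rep.ab r′ refl)
   ... | in₃ refl | in₃ refl = ⊥-elim (Rep.ab r′ refl)
   ... | in₂ refl | in₃ refl = inj₂ (inj₂ (i , j , l , m , r , j∈N , i∈N , i∉R , j∉R , x∈ , x′∈))
   ... | in₃ refl | in₂ refl = inj₂ (inj₂ (i , j , l , m , r , j∈N , i∈N , i∉R , j∉R , x′∈ , x∈))

   -- Three vertices are found in `X`, in the group of the first and in `R`; the triple codegree
   -- then leaves `4 * ζ` choices for the last one.
   count-T₂ : ∀ ys → ys ⊆ es → All T₂ ys → length ys ≤ ξ * (D * (ρ * (4 * ζ)))
   count-T₂ ys sub al = ≤-trans (count-edges ys (unique-⊆ sub (distinct (graph H))) (SubP.All-resp-⊆ sub (uniform (graph H))) qs cov)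
     (length-quads {as = X} {f = N} {g = λ _ _ → R} {h = N₃} X≤ N≤ (λ _ _ → R≤) N₃≤)
    where
    qs : List (Quad VH)
    qs = quads X N (λ _ _ → R) N₃
    cov : (P : VH → VH → VH → VH → Set) → SymClosed P → (∀ {a b c d} → (a , b , c , d) ∈ qs → P a b c d)
     → ∀ {s a b c d} → s ∈ ys → Rep s a b c d → P a b c d
    cov P P-sym hyp {s} s∈ r with All.lookup al s∈
    ... | x , u , h , d , r′ , x∈ , u∈ , h∈ = rep-perm {P = P} P-sym r′ r
     (hyp (∈-quads {as = X} {f = N} {g = λ _ _ → R} {h = N₃} x∈ u∈ h∈ (N₃∋ (s , Sub.lookup sub s∈ , r′))))

   module _ {ω : ℕ} (W : List VH) (W≤ : length W ≤ ω) where

    -- The two vertices in a common group lie in `W` or are partners of a vertex of `W`, and the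
    -- other two lie in `X`. So all these edges live on one small vertex set.
    count-T₃ : ∀ ys → ys ⊆ es → (∀ {s} → s ∈ ys → ∀ {i j l m} → Rep s i j l m → i ∉ R → j ∉ R → i ∈ W ⊎ j ∈ W) → All T₃ ys
     → length ys ≤ 2 * (ξ + (ω + ω * D))
    count-T₃ ys sub inW al = ≤-trans (dens ys sub L₀ mem) (*-monoʳ-≤ 2 (≤-trans (≤-reflexive (LP.length-++ X)) (+-mono-≤ X≤
      (≤-trans (≤-reflexive (LP.length-++ W)) (+-mono-≤ W≤ (≤-trans (length-concatMap≤ N D W N≤) (*-monoˡ-≤ D W≤)))))))
     where
     L₀ : List VH
     L₀ = X ++ (W ++ concatMap N W)
     mem : ∀ {s v} → s ∈ ys → v S.∈ s → v ∈ L₀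
     mem {s} {v} s∈ v∈ with All.lookup al s∈
     ... | i , j , l , m , r , j∈N , i∈N , i∉R , j∉R , l∈X , m∈X with Rep.only r v∈ | inW s∈ r i∉R j∉R
     ... | in₂ refl | _ = ∈-++⁺ˡ l∈X
     ... | in₃ refl | _ = ∈-++⁺ˡ m∈X
     ... | inj₁ refl | inj₁ i∈W = ∈-++⁺ʳ X (∈-++⁺ˡ i∈W)
     ... | inj₁ refl | inj₂ j∈W = ∈-++⁺ʳ X (∈-++⁺ʳ W (∈-concatMap N j∈W i∈N))
     ... | in₁ refl | inj₁ i∈W = ∈-++⁺ʳ X (∈-++⁺ʳ W (∈-concatMap N i∈W j∈N))
     ... | in₁ refl | inj₂ j∈W = ∈-++⁺ʳ X (∈-++⁺ˡ j∈W)

    count : ∀ ys → ys ⊆ es → (∀ {s} → s ∈ ys → ∀ {i j l m} → Rep s i j l m → i ∉ R → j ∉ R → i ∈ W ⊎ j ∈ W)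
     → length ys ≤ ρ * D * (2 * (2 + 4 * β)) + (ξ * (D * (ρ * (4 * ζ))) + 2 * (ξ + (ω + ω * D)))
    count ys sub inW =
     let
      (as , bs , aT , bT , sa , sb , le) = partition⊎ {A = T₁} {B = λ s → T₂ s ⊎ T₃ s} ys (λ s∈ → classify (Sub.lookup sub s∈))
      (cs , ds , cT , dT , sc , sd , le′) = partition⊎ {A = T₂} {B = T₃} bs (λ s∈ → All.lookup bT s∈)
     in ≤-trans le (+-mono-≤ (hub-pairs N D N≤ as (⊆-trans sa sub) aT) (≤-trans le′
      (+-mono-≤ (count-T₂ cs (⊆-trans sc (⊆-trans sb sub)) cT)
       (count-T₃ ds (⊆-trans sd (⊆-trans sb sub)) (λ s∈ → inW (Sub.lookup (⊆-trans sd sb) s∈)) dT))))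

  -- `W` contains three vertices of every edge and therefore one of any two of them.
  count-core : (gh : GroupHost g D) → ∀ {σ} (W : List VH) → length W ≤ σ
   → (∀ {s} → s ∈ es → ∃₂ λ i j → ∃₂ λ l m → Rep s i j l m × i ∈ W × j ∈ W × l ∈ W)
   → length es ≤ ρ * D * (2 * (2 + 4 * β)) + (ξ * (D * (ρ * (4 * ζ))) + 2 * (ξ + (σ + σ * D)))
  count-core gh W W≤ three = count gh W W≤ es ⊆-refl λ s∈ r _ _ → pick (three s∈) r
   where
   pick : ∀ {s} → (∃₂ λ i j → ∃₂ λ l m → Rep s i j l m × i ∈ W × j ∈ W × l ∈ W)
    → ∀ {i j l m} → Rep s i j l m → i ∈ W ⊎ j ∈ W
   pick (a , b , c , d , r′ , a∈ , b∈ , c∈) r with Rep.only r′ (Rep.∈a r) | Rep.only r′ (Rep.∈b r)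
   ... | inj₁ refl | _ = inj₁ a∈
   ... | in₁ refl | _ = inj₁ b∈
   ... | in₂ refl | _ = inj₁ c∈
   ... | in₃ _ | inj₁ refl = inj₂ a∈
   ... | in₃ _ | in₁ refl = inj₂ b∈
   ... | in₃ _ | in₂ refl = inj₂ c∈
   ... | in₃ e | in₃ e′ = ⊥-elim (Rep.ab r (trans e (sym e′)))

  -- A second group structure supplies a `W` with only two vertices of each edge. This is enough
  -- once the edges in which one of these two is a hub have been counted through the pair codegrees.
  count-groups : (gh : GroupHost g D) → ∀ {g′ D′} (gh′ : GroupHost g′ D′)
   → length es ≤ ρ * D′ * (2 * (2 + 4 * β))
    + (ρ * D * (2 * (2 + 4 * β)) + (ξ * (D * (ρ * (4 * ζ))) + 2 * (ξ + (2 * (g′ * D′) + 2 * (g′ * D′) * D))))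
  count-groups gh {g′} {D′} gh′ =
   let
    (as , bs , aT , bT , sa , sb , le) = partition⊎ {A = HubPair} {B = Off} es split
   in ≤-trans le (+-mono-≤ (hub-pairs N D′ N≤ as sa aT) (count gh W W≤ bs sb λ s∈ → pick (Sub.lookup sb s∈) (All.lookup bT s∈)))
   where
   open GroupHost gh′
   HubPair Off : S.Subset (verts H) → Set
   HubPair s = ∃₂ λ i j → i ∈ R × j ∈ N i × PairIn (i , j) s
   Off s = ∃₂ λ i j → ∃₂ λ l m → Rep s i j l m × (i ∈ W × j ∈ W) × (i ∉ R × j ∉ R)
   split : ∀ {s} → s ∈ es → HubPair s ⊎ Off s
   split s∈ with cover s∈
   ... | i , j , l , m , r , j∈N , i∈N , i∈W , j∈W with i ∈? R | j ∈? R
   ... | yes i∈R | _ = inj₁ (i , j , i∈R , j∈N , l , m , r)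
   ... | no _ | yes j∈R = inj₁ (j , i , j∈R , i∈N , l , m , rep-swap₁ r)
   ... | no i∉R | no j∉R = inj₂ (i , j , l , m , r , (i∈W , j∈W) , (i∉R , j∉R))
   -- The hub is neither i nor j, so at most one of the two vertices i′, j′ lies outside {i , j}.
   pick : ∀ {s} → s ∈ es → Off s → ∀ {i j l m} → Rep s i j l m → i ∉ R → j ∉ R → i ∈ W ⊎ j ∈ W
   pick s∈ (i′ , j′ , _ , _ , r′ , (i′∈ , j′∈) , (i′∉ , j′∉)) r i∉ j∉ with hit s∈
   ... | h , h∈ , h∈s with Rep.only r (Rep.∈a r′) | Rep.only r (Rep.∈b r′) | Rep.only r h∈s
   ... | inj₁ refl | _ | _ = inj₁ i′∈
   ... | in₁ refl | _ | _ = inj₂ i′∈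
   ... | _ | inj₁ refl | _ = inj₁ j′∈
   ... | _ | in₁ refl | _ = inj₂ j′∈
   ... | _ | _ | inj₁ refl = ⊥-elim (i∉ h∈)
   ... | _ | _ | in₁ refl = ⊥-elim (j∉ h∈)
   ... | in₂ refl | _ | in₂ refl = ⊥-elim (i′∉ h∈)
   ... | _ | in₂ refl | in₂ refl = ⊥-elim (j′∉ h∈)
   ... | in₃ e | in₃ e′ | in₂ _ = ⊥-elim (Rep.ab r′ (trans e (sym e′)))
   ... | in₃ refl | _ | in₃ refl = ⊥-elim (i′∉ h∈)
   ... | _ | in₃ refl | in₃ refl = ⊥-elim (j′∉ h∈)
   ... | in₂ e | in₂ e′ | in₃ _ = ⊥-elim (Rep.ab r′ (trans e (sym e′)))

-- Numerical consequences of the hosts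

root : ∀ r a → 1 ≤ r → ∃ λ k → k ^ r ≤ a × a < suc k ^ r
root r a 1≤r with bounded-max {P = λ k → k ^ r ≤ a} (λ k → k ^ r N.≤? a) (zero-pow r 1≤r) a bound
 where
 zero-pow : ∀ r → 1 ≤ r → 0 ^ r ≤ a
 zero-pow (suc r) _ = z≤n
 bound : ∀ k → k ^ r ≤ a → k ≤ a
 bound zero _ = z≤n
 bound (suc k) h = ≤-trans (≤-trans (≤-reflexive (sym (^-identityʳ (suc k)))) (^-monoʳ-≤ (suc k) 1≤r)) h
... | k , h , max = k , h , ≰⇒> λ h′ → <-irrefl refl (max (suc k) h′)

pow-cancel-≤ : ∀ {a b} r → a ^ r ≤ b ^ r → 1 ≤ r → a ≤ b
pow-cancel-≤ {a} {b} (suc r) h _ = ≮⇒≥ λ b<a → <⇒≱ (^-monoˡ-< (suc r) b<a) h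

1≤root : ∀ {a k} r → 1 ≤ a → a < suc k ^ r → 1 ≤ k
1≤root {k = zero} r 1≤a h = ⊥-elim (<-irrefl refl (≤-trans h (≤-trans (≤-reflexive (^-zeroˡ r)) 1≤a)))
1≤root {k = suc k} r _ _ = s≤s z≤n

suc≤2* : ∀ {k} → 1 ≤ k → suc k ≤ 2 * k
suc≤2* {k} h = ≤-trans (+-monoˡ-≤ k h) (≤-reflexive (cong (k +_) (sym (+-identityʳ k))))

*≤* : ∀ {a b c d} → a ≤ b → c ≤ d → a * c ≤ b * d
*≤* = *-mono-≤

3+1≤ : ∀ {a b c d n} → 16 * a ≤ n → 16 * b ≤ n → 16 * c ≤ n → 16 * d ≤ n → 4 * (a + (b + (c + d))) ≤ n
3+1≤ {a} {b} {c} {d} {n} ha hb hc hd = *-cancelˡ-≤ 4 (≤-trans (≤-reflexive (lem a b c d)) (≤-trans (+-mono-≤ (+-mono-≤ ha hb) (+-mono-≤ hc hd)) (≤-reflexive (lem2 n))))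
 where
 lem : ∀ a b c d → 4 * (4 * (a + (b + (c + d)))) ≡ (16 * a + 16 * b) + (16 * c + 16 * d)
 lem = solve-∀
 lem2 : ∀ n → (n + n) + (n + n) ≡ 4 * n
 lem2 = solve-∀

-- The large parts have a constant fraction of `n` as their size, and the factor `c` in the small
-- ones compensates for this constant, so that every host below has at least `e` edges.
module HostSizes (n e q k c : ℕ) (q≤ : 16 * q ≤ n) (n≤ : n ≤ k * q)
 (h₁ : 2 * (k * (k * k)) ≤ c) (h₂ : 32 * (k * k) ≤ c) (h₃ : 2048 ≤ c) where

 open ≤-Reasoning

 1≤c : 1 ≤ c
 1≤c = ≤-trans (s≤s z≤n) h₃

 c≤c² : c ≤ c * c
 c≤c² = ≤-trans (≤-reflexive (sym (*-identityʳ c))) (*-monoʳ-≤ c 1≤c)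

 c≤c³ : c ≤ c * (c * c)
 c≤c³ = ≤-trans c≤c² (*-monoʳ-≤ c c≤c²)

 n²≤ : n * n ≤ k * k * (q * q)
 n²≤ = ≤-trans (*≤* n≤ n≤) (≤-reflexive (lem k q))
  where
  lem : ∀ k q → k * q * (k * q) ≡ k * k * (q * q)
  lem = solve-∀

 n³≤ : n * (n * n) ≤ k * (k * k) * (q * (q * q))
 n³≤ = ≤-trans (*≤* n≤ n²≤) (≤-reflexive (lem k q))
  where
  lem : ∀ k q → k * q * (k * k * (q * q)) ≡ k * (k * k) * (q * (q * q))
  lem = solve-∀

 hub-edges : ∀ z → e ≤ 2 * (z * (n * (n * n))) → e ≤ z * c * (q * (q * q))
 hub-edges z he = begin
  e ≤⟨ he ⟩
  2 * (z * (n * (n * n))) ≤⟨ *-monoʳ-≤ 2 (*-monoʳ-≤ z n³≤) ⟩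
  2 * (z * (k * (k * k) * (q * (q * q)))) ≡⟨ lem z (k * (k * k)) (q * (q * q)) ⟩
  z * (2 * (k * (k * k))) * (q * (q * q)) ≤⟨ *-monoˡ-≤ (q * (q * q)) (*-monoʳ-≤ z h₁) ⟩
  z * c * (q * (q * q)) ∎
  where
  lem : ∀ z k q → 2 * (z * (k * q)) ≡ z * (2 * k) * q
  lem = solve-∀

 clique-edges : ∀ d β → e ≤ 2 * (d * (n * n)) → d ≤ 4 * (β * β) → e ≤ β * c * (β * c * (q * q))
 clique-edges d β he hd = begin
  e ≤⟨ he ⟩
  2 * (d * (n * n)) ≤⟨ *-monoʳ-≤ 2 (*≤* hd n²≤) ⟩
  2 * (4 * (β * β) * (k * k * (q * q))) ≡⟨ lem β k (q * q) ⟩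
  8 * (k * k) * (β * β * (q * q)) ≤⟨ *-monoˡ-≤ (β * β * (q * q)) (≤-trans (*-monoˡ-≤ (k * k) (m≤m+n 8 24)) (≤-trans h₂ c≤c²)) ⟩
  c * c * (β * β * (q * q)) ≡⟨ lem2 β c (q * q) ⟩
  β * c * (β * c * (q * q)) ∎
  where
  lem : ∀ b k q → 2 * (4 * (b * b) * (k * k * q)) ≡ 8 * (k * k) * (b * b * q)
  lem = solve-∀
  lem2 : ∀ b c q → c * c * (b * b * q) ≡ b * c * (b * c * q)
  lem2 = solve-∀

 group-edges : ∀ z g → e ≤ 2 * (z * (n * (n * n))) → n ≤ 16 * (g * (z * c)) → e ≤ g * (z * c * (z * c * (q * q)))
 group-edges z g he hn = begin
  e ≤⟨ he ⟩
  2 * (z * (n * (n * n))) ≤⟨ *-monoʳ-≤ 2 (*-monoʳ-≤ z (*≤* hn n²≤)) ⟩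
  2 * (z * (16 * (g * (z * c)) * (k * k * (q * q)))) ≡⟨ lem z g c k (q * q) ⟩
  32 * (k * k) * (z * (g * (z * c) * (q * q))) ≤⟨ *-monoˡ-≤ (z * (g * (z * c) * (q * q))) h₂ ⟩
  c * (z * (g * (z * c) * (q * q))) ≡⟨ lem2 z g c (q * q) ⟩
  g * (z * c * (z * c * (q * q))) ∎
  where
  lem : ∀ z g c k q → 2 * (z * (16 * (g * (z * c)) * (k * k * q))) ≡ 32 * (k * k) * (z * (g * (z * c) * q))
  lem = solve-∀
  lem2 : ∀ z g c q → c * (z * (g * (z * c) * q)) ≡ g * (z * c * (z * c * q))
  lem2 = solve-∀

 pair-edges : ∀ d β m → e ≤ 2 * (d * (n * n)) → d ≤ 4 * (β * β) → n ≤ 16 * (m * (β * c))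
  → e ≤ m * (m * (β * c * (β * c * (β * c * (β * c)))))
 pair-edges d β m he hd hn = begin
  e ≤⟨ he ⟩
  2 * (d * (n * n)) ≤⟨ *-monoʳ-≤ 2 (*≤* hd (*≤* hn hn)) ⟩
  2 * (4 * (β * β) * (16 * (m * (β * c)) * (16 * (m * (β * c))))) ≡⟨ lem β (m * (β * c)) ⟩
  8 * (16 * 16) * (β * β * (m * (β * c) * (m * (β * c)))) ≤⟨ *-monoˡ-≤ (β * β * (m * (β * c) * (m * (β * c)))) (≤-trans h₃ c≤c²) ⟩
  c * c * (β * β * (m * (β * c) * (m * (β * c)))) ≡⟨ lem2 β c m ⟩
  m * (m * (β * c * (β * c * (β * c * (β * c))))) ∎
  where
  lem : ∀ b m → 2 * (4 * (b * b) * (16 * m * (16 * m))) ≡ 8 * (16 * 16) * (b * b * (m * m))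
  lem = solve-∀
  lem2 : ∀ b c m → c * c * (b * b * (m * (b * c) * (m * (b * c)))) ≡ m * (m * (b * c * (b * c * (b * c * (b * c)))))
  lem2 = solve-∀

 core-edges : ∀ d σ → e ≤ 2 * (d * (n * n)) → n * d ≤ 8 * (σ * (σ * σ)) → e ≤ σ * c * (σ * c * (σ * c * q))
 core-edges d σ he hd = begin
  e ≤⟨ he ⟩
  2 * (d * (n * n)) ≡⟨ lem d n ⟩
  2 * (n * d * n) ≤⟨ *-monoʳ-≤ 2 (*≤* hd n≤) ⟩
  2 * (8 * (σ * (σ * σ)) * (k * q)) ≡⟨ lem2 σ k q ⟩
  16 * k * (σ * (σ * σ) * q) ≤⟨ *-monoˡ-≤ (σ * (σ * σ) * q) 16k≤ ⟩
  c * (c * c) * (σ * (σ * σ) * q) ≡⟨ lem3 σ c q ⟩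
  σ * c * (σ * c * (σ * c * q)) ∎
  where
  lem : ∀ d n → 2 * (d * (n * n)) ≡ 2 * (n * d * n)
  lem = solve-∀
  lem2 : ∀ s k q → 2 * (8 * (s * (s * s)) * (k * q)) ≡ 16 * k * (s * (s * s) * q)
  lem2 = solve-∀
  lem3 : ∀ s c q → c * (c * c) * (s * (s * s) * q) ≡ s * c * (s * c * (s * c * q))
  lem3 = solve-∀
  16k≤ : 16 * k ≤ c * (c * c)
  16k≤ = ≤-trans (*≤* {16} {32} {k} (m≤m+n 16 16) (k≤k² k)) (≤-trans h₂ c≤c³)
   where
   k≤k² : ∀ k → k ≤ k * k
   k≤k² zero = z≤n
   k≤k² (suc k) = m≤m*n (suc k) (suc k)

 groups-edges : ∀ d δ → e ≤ 2 * (d * (n * n)) → d ≤ 16 * (δ * δ * (δ * δ)) → e ≤ δ * δ * c * (δ * c * (δ * c * (q * q)))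
 groups-edges d δ he hd = begin
  e ≤⟨ he ⟩
  2 * (d * (n * n)) ≤⟨ *-monoʳ-≤ 2 (*≤* hd n²≤) ⟩
  2 * (16 * (δ * δ * (δ * δ)) * (k * k * (q * q))) ≡⟨ lem δ k (q * q) ⟩
  32 * (k * k) * (δ * δ * (δ * δ) * (q * q)) ≤⟨ *-monoˡ-≤ (δ * δ * (δ * δ) * (q * q)) (≤-trans h₂ c≤c³) ⟩
  c * (c * c) * (δ * δ * (δ * δ) * (q * q)) ≡⟨ lem2 δ c (q * q) ⟩
  δ * δ * c * (δ * c * (δ * c * (q * q))) ∎
  where
  lem : ∀ b k q → 2 * (16 * (b * b * (b * b)) * (k * k * q)) ≡ 32 * (k * k) * (b * b * (b * b) * q)
  lem = solve-∀
  lem2 : ∀ b c q → c * (c * c) * (b * b * (b * b) * q) ≡ b * b * c * (b * c * (b * c * q))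
  lem2 = solve-∀

divide : ∀ a b → 1 ≤ b → ∃ λ t → t * b ≤ a × a < suc t * b
divide a b 1≤b with bounded-max {P = λ t → t * b ≤ a} (λ t → t * b N.≤? a) z≤n a
 (λ t h → ≤-trans (m≤m*n t b {{N.>-nonZero 1≤b}}) h)
... | t , h , max = t , h , ≰⇒> λ h′ → <-irrefl refl (max (suc t) h′)

-- Blocks of size `B` with B² at least `n` turn the density inequality into a linear one, with
-- factor 2.
square-dominates : ∀ {B n l m} → 2 ≤ B → n ≤ B * B → B ^ l ≤ n ^ m → l ≤ 2 * m
square-dominates {B} {n} {l} {m} 2≤B n≤ h = ≮⇒≥ λ lt → <⇒≱ (^-monoʳ-< B 2≤B lt) (≤-trans h (≤-trans (^-monoˡ-≤ m n≤)
 (≤-reflexive (trans (cong (_^ m) (cong (B *_) (sym (*-identityʳ B)))) (^-*-assoc B 2 m)))))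

-- These collect the coefficients that remain when every term of a count is replaced by a dominant
-- one.
coreConstant groupsConstant : ℕ → ℕ
coreConstant c = c * c * (2 * (2 + 4 * c)) + (2 * c * (c * (c * (4 * c))) + 2 * (2 * c)) + 2 * (3 * c + 3 * c * c)
groupsConstant c = c * c * (2 * (2 + 4 * (2 * c))) + (c * c * (2 * (2 + 4 * (2 * c))) + (4 * c * (c * (c * (4 * c))) + 2 * (4 * c + (2 * (c * c) + 2 * (c * c) * c))))

-- `β` stands for d^(1/2) and `σ` for (nd)^(1/3), which is s up to constants since nd is of order
-- e/n.
module UpperBounds {n e : ℕ} {H : Hyper4} (un : Unavoidable n e H) (q k c z d β σ B : ℕ) (1≤n : 1 ≤ n) (q≤ : 16 * q ≤ n) (n≤ : n ≤ k * q)
 (h₁ : 2 * (k * (k * k)) ≤ c) (h₂ : 32 * (k * k) ≤ c) (h₃ : 2048 ≤ c) (1≤z : 1 ≤ z) (1≤β : 1 ≤ β) (1≤σ : 1 ≤ σ)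
 (e≤z : e ≤ 2 * (z * (n * (n * n)))) (e≤d : e ≤ 2 * (d * (n * n))) (d≤ : d ≤ 4 * (β * β)) (nd≤ : n * d ≤ 8 * (σ * (σ * σ)))
 (z≤ : 16 * (z * c) ≤ n) (β≤ : 16 * (β * c) ≤ n) (σ≤ : 16 * (σ * c) ≤ n) (2≤B : 2 ≤ B) (n≤B² : n ≤ B * B) (eB≤ : e * B ≤ q * (q * (q * q))) where

 open HostSizes n e q k c q≤ n≤ h₁ h₂ h₃
 open Host {n} {e} {H} un
 open CodegreeHosts {n} {e} {H} un
 open Assembly {n} {e} {H} un

 fits : ∀ {a b c d} → 16 * a ≤ n → 16 * b ≤ n → 16 * c ≤ n → 16 * d ≤ n → a + (b + (c + d)) ≤ n
 fits {a} {b} {c} {d} ha hb hc hd = ≤-trans (m≤m+n x (x + (x + (x + 0)))) (3+1≤ {a} {b} {c} {d} ha hb hc hd)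
  where
  x : ℕ
  x = a + (b + (c + d))

 positive : ∀ {a b} → 1 ≤ a → 1 ≤ b → 1 ≤ a * b
 positive {a} {b} = *-mono-≤ {1} {a} {1} {b}

 hubHost : ProductHost (z * c) q q q
 hubHost = productHost (z * c) q q q (fits {z * c} {q} {q} {q} z≤ q≤ q≤ q≤) (hub-edges z e≤z)

 cliqueHost : ProductHost (β * c) (β * c) q q
 cliqueHost = productHost (β * c) (β * c) q q (fits {β * c} {β * c} {q} {q} β≤ β≤ q≤ q≤) (clique-edges d β e≤d d≤)

 coreHost : ProductHost (σ * c) (σ * c) (σ * c) q
 coreHost = productHost (σ * c) (σ * c) (σ * c) q (fits {σ * c} {σ * c} {σ * c} {q} σ≤ σ≤ σ≤ q≤) (core-edges d σ e≤d nd≤)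

 two-groups-fit : ∀ {a} → 8 * a ≤ n → a + (a + (q + q)) ≤ n
 two-groups-fit {a} h = *-cancelˡ-≤ 8 (≤-trans (≤-reflexive (lem a q)) (≤-trans (+-mono-≤ (*-monoʳ-≤ 2 h) q≤)
   (≤-trans (≤-reflexive (lem2 n)) (*-monoˡ-≤ n (m≤m+n 3 5)))))
  where
  lem : ∀ a q → 8 * (a + (a + (q + q))) ≡ 2 * (8 * a) + 16 * q
  lem = solve-∀
  lem2 : ∀ n → 2 * n + n ≡ 3 * n
  lem2 = solve-∀

 -- The groups together fill a constant fraction of the vertices. Halves of size `z * c` are then
 -- large enough for a host with order zn³ edges.
 smallGroups : ∃ λ g → GroupHost g (z * c)
 smallGroups with divide n (16 * (z * c)) (positive {16} {z * c} (s≤s z≤n) (positive {z} {c} 1≤z 1≤c))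
 ... | t , lo , hi = suc t , groupHost (suc t) (z * c) q (two-groups-fit {suc t * (z * c)} size) (group-edges z (suc t) e≤z
   (≤-trans (<⇒≤ hi) (≤-reflexive (lem (suc t) (z * c)))))
  where
  lem : ∀ t D → t * (16 * D) ≡ 16 * (t * D)
  lem = solve-∀
  lem2 : ∀ t D → 2 * (8 * (D + t * D)) ≡ 16 * D + t * (16 * D)
  lem2 = solve-∀
  size : 8 * (suc t * (z * c)) ≤ n
  size = *-cancelˡ-≤ 2 (≤-trans (≤-reflexive (lem2 t (z * c))) (≤-trans (+-mono-≤ z≤ lo) (≤-reflexive (cong (n +_) (sym (+-identityʳ n))))))

 triples : TripleHost (z * c)
 triples = tripleHost q (z * c) (*-cancelˡ-≤ 16 (≤-trans (≤-reflexive (lem q (z * c))) (≤-trans (+-mono-≤ (*-monoʳ-≤ 6 q≤) z≤)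
   (≤-trans (≤-reflexive (lem2 n)) (*-monoˡ-≤ n (m≤m+n 7 9)))))) (≤-trans (hub-edges z e≤z) (≤-reflexive (lem3 (z * c) q)))
  where
  lem : ∀ q D → 16 * (q + (q + (q + (3 * q + D)))) ≡ 6 * (16 * q) + 16 * D
  lem = solve-∀
  lem2 : ∀ n → 6 * n + n ≡ 7 * n
  lem2 = solve-∀
  lem3 : ∀ D q → D * (q * (q * q)) ≡ q * (q * (q * D))
  lem3 = solve-∀

 -- The linear graph is scaled so that its blow-up by `β * c` fills a constant fraction of `n`; the
 -- number of edges is then of order n²β², and β² is at least d/4.
 pairCodegrees : PairHost (β * c)
 pairCodegrees with divide n (8 * (β * c)) (positive {8} {β * c} (s≤s z≤n) (positive {β} {c} 1≤β 1≤c))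
 ... | t , lo , hi = pairHost t (β * c) (≤-trans (≤-reflexive (lem t (β * c))) (≤-trans (m≤n+m _ (t * (β * c))) (≤-trans (≤-reflexive (lem2 t (β * c))) lo)))
   (pair-edges d β t e≤d d≤ big)
  where
  lem : ∀ t D → t * D + (t * D + (2 * t * D + 3 * t * D)) ≡ 7 * (t * D)
  lem = solve-∀
  lem2 : ∀ t D → t * D + 7 * (t * D) ≡ t * (8 * D)
  lem2 = solve-∀
  lem3 : ∀ t D → 2 * (8 * D + t * (8 * D)) ≡ 16 * D + 16 * (t * D)
  lem3 = solve-∀
  big : n ≤ 16 * (t * (β * c))
  big = +-cancelˡ-≤ n _ _ (≤-trans (≤-reflexive (cong (n +_) (sym (+-identityʳ n)))) (≤-trans (*-monoʳ-≤ 2 (<⇒≤ hi))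
   (≤-trans (≤-reflexive (lem3 t (β * c))) (+-monoˡ-≤ _ β≤))))

 dens : ∀ es₀ → es₀ ⊆ es → ∀ W → (∀ {s i} → s ∈ es₀ → i S.∈ s → i ∈ W) → length es₀ ≤ 2 * length W
 dens es₀ sub W inW = square-dominates {B} {n} {length es₀} {length W} 2≤B n≤B² (Density.density {H = H} un B q (≤-trans (s≤s z≤n) 2≤B) 1≤n (fits {q} {q} {q} {q} q≤ q≤ q≤ q≤) eB≤
  es₀ (unique-⊆ sub (distinct (graph H))) (Sub.lookup sub) W inW)

 private
  R X : List VH
  R = ProductHost.L₀ hubHost
  X = ProductHost.L₀ cliqueHost ++ ProductHost.L₁ cliqueHost

  hit : ∀ {s} → s ∈ es → ∃ λ r → r ∈ R × r S.∈ s
  hit s∈ = let (i , _ , _ , _ , r , i∈ , _) = ProductHost.cover hubHost s∈ in i , i∈ , Rep.∈a r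

  X≤ : length X ≤ β * c + β * c
  X≤ = ≤-trans (≤-reflexive (LP.length-++ (ProductHost.L₀ cliqueHost))) (+-mono-≤ (ProductHost.l₀ cliqueHost) (ProductHost.l₁ cliqueHost))

  two : ∀ {s} → s ∈ es → ∃₂ λ i j → ∃₂ λ l m → Rep s i j l m × i ∈ X × j ∈ X
  two s∈ = let (i , j , l , m , r , i∈ , j∈ , _) = ProductHost.cover cliqueHost s∈ in
   i , j , l , m , r , ∈-++⁺ˡ i∈ , ∈-++⁺ʳ (ProductHost.L₀ cliqueHost) j∈

  g : ℕ
  g = proj₁ smallGroups

 open Counting {z * c} {z * c} {β * c + β * c} {z * c} {β * c} {g} R (ProductHost.l₀ hubHost) hit X X≤ two triples pairCodegrees dens

 core-count : length es ≤ z * c * (z * c) * (2 * (2 + 4 * (β * c)))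
  + ((β * c + β * c) * (z * c * (z * c * (4 * (z * c)))) + 2 * (β * c + β * c + ((σ * c + (σ * c + σ * c)) + (σ * c + (σ * c + σ * c)) * (z * c))))
 core-count = count-core (proj₂ smallGroups) W W≤ three
  where
  open ProductHost coreHost
  W : List VH
  W = L₀ ++ (L₁ ++ L₂)
  W≤ : length W ≤ σ * c + (σ * c + σ * c)
  W≤ = ≤-trans (≤-reflexive (LP.length-++ L₀)) (+-mono-≤ l₀ (≤-trans (≤-reflexive (LP.length-++ L₁)) (+-mono-≤ l₁ l₂)))
  three : ∀ {s} → s ∈ es → ∃₂ λ i j → ∃₂ λ l m → Rep s i j l m × i ∈ W × j ∈ W × l ∈ W
  three s∈ = let (i , j , l , m , r , i∈ , j∈ , l∈ , _) = cover s∈ in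
   i , j , l , m , r , ∈-++⁺ˡ i∈ , ∈-++⁺ʳ L₀ (∈-++⁺ˡ j∈) , ∈-++⁺ʳ L₀ (∈-++⁺ʳ L₁ l∈)

 -- δ²c groups with halves of size δc give a host with δ⁴c³q² edges, enough for dn², although the
 -- groups have only order δ³ vertices. With δ of order d^(1/4) this is d^(3/4).
 groups-count : ∀ δ → d ≤ 16 * (δ * δ * (δ * δ)) → 8 * (δ * δ * c * (δ * c)) ≤ n
  → length es ≤ z * c * (δ * c) * (2 * (2 + 4 * (β * c)))
   + (z * c * (z * c) * (2 * (2 + 4 * (β * c))) + ((β * c + β * c) * (z * c * (z * c * (4 * (z * c))))
    + 2 * (β * c + β * c + (2 * (δ * δ * c * (δ * c)) + 2 * (δ * δ * c * (δ * c)) * (z * c)))))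
 groups-count δ d≤δ fit = count-groups (proj₂ smallGroups) (groupHost (δ * δ * c) (δ * c) q (two-groups-fit {δ * δ * c * (δ * c)} fit) (groups-edges d δ e≤d d≤δ))

 C₁ C₂ : ℕ
 C₁ = coreConstant c
 C₂ = groupsConstant c

 -- Every term of core-count is at most a constant times z ^ 3 β or σ z.
 core-bound : length es ≤ (z * (z * z) * β + σ * z) * C₁
 core-bound = ≤-trans core-count (begin
  z * c * (z * c) * (2 * (2 + 4 * (β * c))) + ((β * c + β * c) * (z * c * (z * c * (4 * (z * c)))) + 2 * (β * c + β * c + ((σ * c + (σ * c + σ * c)) + (σ * c + (σ * c + σ * c)) * (z * c))))
   ≡⟨ lem1 z c β σ ⟩
  z * z * (c * c * (2 * (2 + 4 * (β * c)))) + (P * (2 * c * (c * (c * (4 * c)))) + β * (2 * (2 * c))) + (σ * (2 * (3 * c)) + σ * z * (2 * (3 * c * c)))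
   ≤⟨ +-mono-≤ (+-mono-≤ first (+-monoʳ-≤ _ (*-monoˡ-≤ (2 * (2 * c)) β≤P))) (+-monoˡ-≤ (σ * z * (2 * (3 * c * c))) (*-monoˡ-≤ (2 * (3 * c)) σ≤σz)) ⟩
  P * (c * c * (2 * (2 + 4 * c))) + (P * (2 * c * (c * (c * (4 * c)))) + P * (2 * (2 * c))) + (σ * z * (2 * (3 * c)) + σ * z * (2 * (3 * c * c)))
   ≡⟨ lem2 P (σ * z) c ⟩
  P * (c * c * (2 * (2 + 4 * c)) + (2 * c * (c * (c * (4 * c))) + 2 * (2 * c))) + σ * z * (2 * (3 * c + 3 * c * c))
   ≤⟨ +-mono-≤ (*-monoʳ-≤ P (m≤m+n A₁ A₂)) (*-monoʳ-≤ (σ * z) (m≤n+m A₂ A₁)) ⟩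
  P * C₁ + σ * z * C₁ ≡⟨ sym (*-distribʳ-+ C₁ P (σ * z)) ⟩
  (P + σ * z) * C₁ ∎)
  where
  open ≤-Reasoning
  P : ℕ
  P = z * (z * z) * β
  A₁ A₂ : ℕ
  A₁ = c * c * (2 * (2 + 4 * c)) + (2 * c * (c * (c * (4 * c))) + 2 * (2 * c))
  A₂ = 2 * (3 * c + 3 * c * c)
  lem1 : ∀ z c b s → z * c * (z * c) * (2 * (2 + 4 * (b * c))) + ((b * c + b * c) * (z * c * (z * c * (4 * (z * c)))) + 2 * (b * c + b * c + ((s * c + (s * c + s * c)) + (s * c + (s * c + s * c)) * (z * c))))
   ≡ z * z * (c * c * (2 * (2 + 4 * (b * c)))) + (z * (z * z) * b * (2 * c * (c * (c * (4 * c)))) + b * (2 * (2 * c))) + (s * (2 * (3 * c)) + s * z * (2 * (3 * c * c)))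
  lem1 = solve-∀
  lem2 : ∀ p s c → p * (c * c * (2 * (2 + 4 * c))) + (p * (2 * c * (c * (c * (4 * c)))) + p * (2 * (2 * c))) + (s * (2 * (3 * c)) + s * (2 * (3 * c * c)))
   ≡ p * (c * c * (2 * (2 + 4 * c)) + (2 * c * (c * (c * (4 * c))) + 2 * (2 * c))) + s * (2 * (3 * c + 3 * c * c))
  lem2 = solve-∀
  lem3 : ∀ z c b → z * (z * b) * (c * c * (2 * (2 + 4 * c))) ≡ z * z * (c * c * (2 * (b * 2 + 4 * (b * c))))
  lem3 = solve-∀
  lem4 : ∀ z b → z * (z * z) * b ≡ z * (z * (z * b))
  lem4 = solve-∀
  zβ : β ≤ z * β
  zβ = ≤-trans (≤-reflexive (sym (+-identityʳ β))) (*-monoˡ-≤ β 1≤z)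
  z²β≤P : z * (z * β) ≤ P
  z²β≤P = ≤-trans (*-monoʳ-≤ z (*-monoʳ-≤ z zβ)) (≤-reflexive (sym (lem4 z β)))
  first : z * z * (c * c * (2 * (2 + 4 * (β * c)))) ≤ P * (c * c * (2 * (2 + 4 * c)))
  first = ≤-trans (*-monoʳ-≤ (z * z) (*-monoʳ-≤ (c * c) (*-monoʳ-≤ 2 (+-monoˡ-≤ (4 * (β * c)) (*-monoˡ-≤ 2 1≤β)))))
   (≤-trans (≤-reflexive (sym (lem3 z c β))) (*-monoˡ-≤ (c * c * (2 * (2 + 4 * c))) z²β≤P))
  β≤P : β ≤ P
  β≤P = ≤-trans zβ (≤-trans (≤-trans (≤-reflexive (sym (+-identityʳ (z * β)))) (*-monoˡ-≤ (z * β) 1≤z)) z²β≤P)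
  σ≤σz : σ ≤ σ * z
  σ≤σz = ≤-trans (≤-reflexive (sym (*-identityʳ σ))) (*-monoʳ-≤ σ 1≤z)

 -- With `z` equal to 1 and `β` of order δ², every term of `groups-count` is of order at most δ³.
 groups-bound : ∀ δ → 1 ≤ δ → z ≡ 1 → β ≡ 2 * (δ * δ) → d ≤ 16 * (δ * δ * (δ * δ)) → 8 * (δ * δ * c * (δ * c)) ≤ n → length es ≤ δ * (δ * δ) * C₂
 groups-bound δ 1≤δ z≡ β≡ d≤δ fit = ≤-trans (groups-count δ d≤δ fit) (≤-trans (≤-reflexive (cong₂ total z≡ β≡)) (begin
  total 1 (2 * (δ * δ)) ≡⟨ lem δ c ⟩
  δ * (c * c * (2 * (2 + 4 * (2 * (δ * δ) * c)))) + (c * c * (2 * (2 + 4 * (2 * (δ * δ) * c)))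
   + (δ * δ * (4 * c * (c * (c * (4 * c)))) + 2 * (δ * δ * (4 * c) + δ * (δ * δ) * (2 * (c * c) + 2 * (c * c) * c))))
   ≤⟨ +-mono-≤ (≤-trans (*-monoʳ-≤ δ grow) (≤-reflexive (sym (*-assoc δ (δ * δ) _)))) (+-mono-≤ (≤-trans grow (*-monoˡ-≤ _ δ²≤δ³))
    (+-mono-≤ (*-monoˡ-≤ _ δ²≤δ³) (*-monoʳ-≤ 2 (+-monoˡ-≤ _ (*-monoˡ-≤ (4 * c) δ²≤δ³))))) ⟩
  δ * (δ * δ) * (c * c * (2 * (2 + 4 * (2 * c)))) + (δ * (δ * δ) * (c * c * (2 * (2 + 4 * (2 * c))))
   + (δ * (δ * δ) * (4 * c * (c * (c * (4 * c)))) + 2 * (δ * (δ * δ) * (4 * c) + δ * (δ * δ) * (2 * (c * c) + 2 * (c * c) * c))))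
   ≡⟨ lem2 (δ * (δ * δ)) c ⟩
  δ * (δ * δ) * C₂ ∎))
  where
  open ≤-Reasoning
  total : ℕ → ℕ → ℕ
  total z β = z * c * (δ * c) * (2 * (2 + 4 * (β * c)))
   + (z * c * (z * c) * (2 * (2 + 4 * (β * c))) + ((β * c + β * c) * (z * c * (z * c * (4 * (z * c))))
    + 2 * (β * c + β * c + (2 * (δ * δ * c * (δ * c)) + 2 * (δ * δ * c * (δ * c)) * (z * c)))))
  lem : ∀ δ c → 1 * c * (δ * c) * (2 * (2 + 4 * (2 * (δ * δ) * c)))
   + (1 * c * (1 * c) * (2 * (2 + 4 * (2 * (δ * δ) * c))) + ((2 * (δ * δ) * c + 2 * (δ * δ) * c) * (1 * c * (1 * c * (4 * (1 * c))))
    + 2 * (2 * (δ * δ) * c + 2 * (δ * δ) * c + (2 * (δ * δ * c * (δ * c)) + 2 * (δ * δ * c * (δ * c)) * (1 * c)))))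
   ≡ δ * (c * c * (2 * (2 + 4 * (2 * (δ * δ) * c)))) + (c * c * (2 * (2 + 4 * (2 * (δ * δ) * c)))
   + (δ * δ * (4 * c * (c * (c * (4 * c)))) + 2 * (δ * δ * (4 * c) + δ * (δ * δ) * (2 * (c * c) + 2 * (c * c) * c))))
  lem = solve-∀
  lem2 : ∀ a c → a * (c * c * (2 * (2 + 4 * (2 * c)))) + (a * (c * c * (2 * (2 + 4 * (2 * c)))) + (a * (4 * c * (c * (c * (4 * c)))) + 2 * (a * (4 * c) + a * (2 * (c * c) + 2 * (c * c) * c))))
   ≡ a * (c * c * (2 * (2 + 4 * (2 * c))) + (c * c * (2 * (2 + 4 * (2 * c))) + (4 * c * (c * (c * (4 * c))) + 2 * (4 * c + (2 * (c * c) + 2 * (c * c) * c)))))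
  lem2 = solve-∀
  lem3 : ∀ δ c → c * c * (2 * (2 * δ + 4 * (2 * δ * c))) ≡ δ * (c * c * (2 * (2 + 4 * (2 * c))))
  lem3 = solve-∀
  δ²≤δ³ : δ * δ ≤ δ * (δ * δ)
  δ²≤δ³ = ≤-trans (≤-reflexive (sym (+-identityʳ (δ * δ)))) (*-monoˡ-≤ (δ * δ) 1≤δ)
  grow : c * c * (2 * (2 + 4 * (2 * (δ * δ) * c))) ≤ δ * δ * (c * c * (2 * (2 + 4 * (2 * c))))
  grow = ≤-trans (*-monoʳ-≤ (c * c) (*-monoʳ-≤ 2 (+-monoˡ-≤ _ (*-monoʳ-≤ 2 (positive {δ} {δ} 1≤δ 1≤δ))))) (≤-reflexive (lem3 (δ * δ) c))

*-^ : ∀ a b r → (a * b) ^ r ≡ a ^ r * b ^ r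
*-^ a b zero = refl
*-^ a b (suc r) = trans (cong (a * b *_) (*-^ a b r)) (lem a b (a ^ r) (b ^ r))
 where
 lem : ∀ a b p q → a * b * (p * q) ≡ a * p * (b * q)
 lem = solve-∀

pow≥1 : ∀ {a} r → 1 ≤ a → 1 ≤ a ^ r
pow≥1 {a} r h = ≤-trans (≤-reflexive (sym (^-zeroˡ r))) (^-monoˡ-≤ r h)

pow-mono : ∀ {a i j} → 1 ≤ a → i ≤ j → a ^ i ≤ a ^ j
pow-mono {a} h le = ^-monoʳ-≤ a {{N.>-nonZero h}} le

≤pow : ∀ {a} r → 1 ≤ r → 1 ≤ a → a ≤ a ^ r
≤pow {a} r 1≤r h = ≤-trans (≤-reflexive (sym (^-identityʳ a))) (pow-mono h 1≤r)

cancelʳ : ∀ {a b} o → 1 ≤ o → a * o ≤ b * o → a ≤ b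
cancelʳ {a} {b} o h = *-cancelʳ-≤ a b o {{N.>-nonZero h}}

-- `q` serves as the size of the large parts of hosts and `B` as a block size of order n^(1/2).
record Scale (n k : ℕ) : Set where
 field
  q B : ℕ
  q≤ : 16 * q ≤ n
  n≤ : n ≤ k * q
  2≤B : 2 ≤ B
  n≤B² : n ≤ B * B
  B²≤ : B * B ≤ 4 * n

scale : ∀ n k → 32 ≤ k → 16 ≤ n → Scale n k
scale n k 32≤k 16≤n with divide n 16 (s≤s z≤n) | root 2 n (s≤s z≤n)
... | q , lo , hi | s , lo′ , hi′ = record
 { q = q ; B = suc s ; q≤ = ≤-trans (≤-reflexive (*-comm 16 q)) lo
 ; n≤ = ≤-trans (<⇒≤ hi) (≤-trans (*-monoˡ-≤ 16 (suc≤2* 1≤q)) (≤-trans (≤-reflexive (lem q)) (*-monoˡ-≤ q 32≤k)))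
 ; 2≤B = s≤s 1≤s
 ; n≤B² = ≤-trans (<⇒≤ hi′) (≤-reflexive (cong (suc s *_) (*-identityʳ (suc s))))
 ; B²≤ = ≤-trans (*≤* (suc≤2* 1≤s) (suc≤2* 1≤s)) (≤-trans (≤-reflexive (lem2 s)) (*-monoʳ-≤ 4 lo′)) }
 where
 lem : ∀ q → 2 * q * 16 ≡ 32 * q
 lem = solve-∀
 lem2 : ∀ s → 2 * s * (2 * s) ≡ 4 * (s * (s * 1))
 lem2 = solve-∀
 1≤s : 1 ≤ s
 1≤s = 1≤root 2 (≤-trans (s≤s z≤n) 16≤n) hi′
 1≤q : 1 ≤ q
 1≤q = pos q hi
  where
  pos : ∀ q → n < suc q * 16 → 1 ≤ q
  pos zero h = ⊥-elim (<⇒≱ h 16≤n)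
  pos (suc q) _ = s≤s z≤n

-- The product `e * B` is at most of order zn^(7/2), and z ≤ n^(1/4) keeps this below n⁴ with room
-- for constants. Fourth powers remove the roots.
density-fits : ∀ {n e k z q B} → 1 ≤ k → e ≤ 2 * (z * (n * (n * n))) → z ^ 4 ≤ n → B * B ≤ 4 * n → 16 * (16 * k ^ 16) ≤ n → n ≤ k * q
 → e * B ≤ q * (q * (q * q))
density-fits {n} {e} {k} {z} {q} {B} 1≤k he hz hB hk hq = pow-cancel-≤ 4 (cancelʳ (k ^ 16) (pow≥1 16 1≤k) (begin
  (e * B) ^ 4 * k ^ 16 ≤⟨ *-monoˡ-≤ (k ^ 16) (≤-trans (≤-reflexive (lem1 e B)) (*≤* (^-monoˡ-≤ 4 he) (*≤* hB hB))) ⟩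
  (2 * (z * (n * (n * n)))) ^ 4 * (4 * n * (4 * n)) * k ^ 16 ≡⟨ lem2 z n (k ^ 16) ⟩
  16 * (16 * k ^ 16) * (z ^ 4 * n ^ 14) ≤⟨ *≤* hk (*-monoˡ-≤ (n ^ 14) hz) ⟩
  n ^ 16 ≤⟨ ^-monoˡ-≤ 16 hq ⟩
  (k * q) ^ 16 ≡⟨ *-^ k q 16 ⟩
  k ^ 16 * q ^ 16 ≡⟨ lem3 (k ^ 16) q ⟩
  (q * (q * (q * q))) ^ 4 * k ^ 16 ∎)) (s≤s z≤n)
 where
 open ≤-Reasoning
 lem1 : ∀ e B → let v = e * B in (v * (v * (v * (v * 1)))) ≡ (e * (e * (e * (e * 1)))) * (B * B * (B * B))
 lem1 = solve-∀
 lem2 : ∀ z n k → let v = 2 * (z * (n * (n * n))) in (v * (v * (v * (v * 1)))) * (4 * n * (4 * n)) * k ≡ 16 * (16 * k) * ((z * (z * (z * (z * 1)))) * (n * (n * (n * (n * (n * (n * (n * (n * (n * (n * (n * (n * (n * (n * 1)))))))))))))))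
 lem2 = solve-∀
 lem3 : ∀ k q → let v = q * (q * (q * q)) in k * (q * (q * (q * (q * (q * (q * (q * (q * (q * (q * (q * (q * (q * (q * (q * (q * 1)))))))))))))))) ≡ (v * (v * (v * (v * 1)))) * k
 lem3 = solve-∀

-- Upper bounds for e between n² and n³.

module MiddleUpper (k c : ℕ) (32≤k : 32 ≤ k) (h₁ : 2 * (k * (k * k)) ≤ c) (h₂ : 32 * (k * k) ≤ c) (h₃ : 2048 ≤ c) where

 u : ℕ
 u = k * c

 1≤c : 1 ≤ c
 1≤c = ≤-trans (s≤s z≤n) h₃

 1≤k : 1 ≤ k
 1≤k = ≤-trans (s≤s z≤n) 32≤k

 1≤u : 1 ≤ u
 1≤u = *≤* 1≤k 1≤c

 16c≤u : 16 * c ≤ u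
 16c≤u = *-monoˡ-≤ c (≤-trans (m≤m+n 16 16) 32≤k)

 32c≤u : 32 * c ≤ u
 32c≤u = *-monoˡ-≤ c 32≤k

 16k^16≤ : ∀ {n} → u ^ 16 ≤ n → 16 * (16 * k ^ 16) ≤ n
 16k^16≤ h = ≤-trans (≤-trans (≤-reflexive (sym (*-assoc 16 16 (k ^ 16)))) (≤-trans (*-monoˡ-≤ (k ^ 16) (≤-trans (≤-trans (m≤m+n 256 1792) h₃) (≤pow 16 (s≤s z≤n) 1≤c)))
  (≤-trans (≤-reflexive (*-comm (c ^ 16) (k ^ 16))) (≤-reflexive (sym (*-^ k c 16)))))) h

 u≤ : ∀ {n} j → j ≤ 16 → u ^ 16 ≤ n → u ^ j ≤ n
 u≤ j le h = ≤-trans (pow-mono 1≤u le) h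

 16≤n : ∀ {n} → u ^ 16 ≤ n → 16 ≤ n
 16≤n h = ≤-trans (≤-trans (*≤* {16} {16} {1} ≤-refl 1≤c) 16c≤u) (≤-trans (≤pow 16 (s≤s z≤n) 1≤u) h)

quotient-pos : ∀ {a b t} → b ≤ a → a < suc t * b → 1 ≤ t
quotient-pos {a} {b} {zero} le lt = ⊥-elim (<⇒≱ lt (≤-trans (≤-reflexive (+-identityʳ b)) le))
quotient-pos {t = suc t} _ _ = s≤s z≤n

double-quotient : ∀ {a b t} → b ≤ a → a < suc t * b → a ≤ 2 * (t * b)
double-quotient {a} {b} {t} le lt = ≤-trans (<⇒≤ lt) (≤-trans (*-monoˡ-≤ b (suc≤2* (quotient-pos {a} {b} {t} le lt))) (≤-reflexive (*-assoc 2 t b)))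

double-root : ∀ {a k} r → 1 ≤ a → a < suc k ^ r → a ≤ 2 ^ r * k ^ r
double-root {a} {k} r 1≤a h = ≤-trans (<⇒≤ h) (≤-trans (^-monoˡ-≤ r (suc≤2* (1≤root r 1≤a h))) (≤-reflexive (*-^ 2 k r)))

module MiddleUpperBounds (k c : ℕ) (32≤k : 32 ≤ k) (h₁ : 2 * (k * (k * k)) ≤ c) (h₂ : 32 * (k * k) ≤ c) (h₃ : 2048 ≤ c) where

 open MiddleUpper k c 32≤k h₁ h₂ h₃
 open ≤-Reasoning

 -- `d`, `σ` and `δ` are the integer parts of e/n², (nd)^(1/3) and d^(1/4), and 2δ² plays the role
 -- of d^(1/2). The core count yields the bound by s, the group count the bound by d^(3/4).
 middle-upper : ∀ {n e} {H : Hyper4} → Unavoidable n e H → u ^ 16 ≤ n → n ^ 2 ≤ e → e ≤ n ^ 3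
  → ∥ graph H ∥ ^ 3 * n ≤ (3 * coreConstant c) ^ 3 * e × ∥ graph H ∥ ^ 4 * n ^ 6 ≤ groupsConstant c ^ 4 * e ^ 3
 middle-upper {n} {e} {H} un N≤ lo hi
  with scale n k 32≤k (16≤n N≤) | divide e (n * n) (*≤* (≤-trans (s≤s z≤n) (16≤n N≤)) (≤-trans (s≤s z≤n) (16≤n N≤)))
 ... | sc | d , dn² , d< with root 3 (n * d) (s≤s z≤n) | root 4 d (s≤s z≤n)
 ... | σ , σ³ , σ< | δ , δ⁴ , δ< = bound₁ , bound₂
  where
  open Scale sc
  m : ℕ
  m = ∥ graph H ∥
  1≤n : 1 ≤ n
  1≤n = ≤-trans (s≤s z≤n) (16≤n N≤)
  n²≤e : n * n ≤ e
  n²≤e = ≤-trans (≤-reflexive (cong (n *_) (sym (*-identityʳ n)))) lo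
  e≤n³ : e ≤ n * (n * n)
  e≤n³ = ≤-trans hi (≤-reflexive (cong (λ x → n * (n * x)) (*-identityʳ n)))
  1≤d : 1 ≤ d
  1≤d = quotient-pos {e} {n * n} {d} n²≤e d<
  d≤n : d ≤ n
  d≤n = cancelʳ (n * n) (*≤* 1≤n 1≤n) (≤-trans dn² e≤n³)
  1≤σ : 1 ≤ σ
  1≤σ = 1≤root {n * d} {σ} 3 (*≤* 1≤n 1≤d) σ<
  1≤δ : 1 ≤ δ
  1≤δ = 1≤root {d} {δ} 4 1≤d δ<
  nd≤ : n * d ≤ 8 * (σ * (σ * σ))
  nd≤ = ≤-trans (double-root {n * d} {σ} 3 (*≤* 1≤n 1≤d) σ<) (≤-reflexive (lem σ))
   where
   lem : ∀ s → 8 * (s * (s * (s * 1))) ≡ 8 * (s * (s * s))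
   lem = solve-∀
  d≤16 : d ≤ 16 * (δ * δ * (δ * δ))
  d≤16 = ≤-trans (double-root {d} {δ} 4 1≤d δ<) (≤-reflexive (lem δ))
   where
   lem : ∀ s → 16 * (s * (s * (s * (s * 1)))) ≡ 16 * (s * s * (s * s))
   lem = solve-∀
  d≤β : d ≤ 4 * (2 * (δ * δ) * (2 * (δ * δ)))
  d≤β = ≤-trans d≤16 (≤-reflexive (lem δ))
   where
   lem : ∀ s → 16 * (s * s * (s * s)) ≡ 4 * (2 * (s * s) * (2 * (s * s)))
   lem = solve-∀
  β-fits : 16 * (2 * (δ * δ) * c) ≤ n
  β-fits = pow-cancel-≤ 2 (begin
   (16 * (2 * (δ * δ) * c)) ^ 2 ≡⟨ lem δ c ⟩
   (32 * c) ^ 2 * δ ^ 4 ≤⟨ *≤* (≤-trans (^-monoˡ-≤ 2 32c≤u) (u≤ 2 (m≤m+n 2 14) N≤)) (≤-trans δ⁴ (≤-trans d≤n (≤-reflexive (sym (*-identityʳ n))))) ⟩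
   n ^ 2 ∎) (s≤s z≤n)
   where
   lem : ∀ δ c → ((16 * (2 * (δ * δ) * c)) * ((16 * (2 * (δ * δ) * c)) * 1)) ≡ ((32 * c) * ((32 * c) * 1)) * (δ * (δ * (δ * (δ * 1))))
   lem = solve-∀
  σ-fits : 16 * (σ * c) ≤ n
  σ-fits = pow-cancel-≤ 3 (begin
   (16 * (σ * c)) ^ 3 ≡⟨ lem σ c ⟩
   (16 * c) ^ 3 * σ ^ 3 ≤⟨ *≤* (≤-trans (^-monoˡ-≤ 3 16c≤u) (u≤ 3 (m≤m+n 3 13) N≤)) (≤-trans σ³ (*-monoʳ-≤ n (≤-trans d≤n (≤-reflexive (sym (*-identityʳ n)))))) ⟩
   n ^ 3 ∎) (s≤s z≤n)
   where
   lem : ∀ δ c → let v = 16 * (δ * c) ; w = 16 * c in (v * (v * (v * 1))) ≡ (w * (w * (w * 1))) * (δ * (δ * (δ * 1)))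
   lem = solve-∀
  δ-fits : 8 * (δ * δ * c * (δ * c)) ≤ n
  δ-fits = pow-cancel-≤ 4 (begin
   (8 * (δ * δ * c * (δ * c))) ^ 4 ≤⟨ ^-monoˡ-≤ 4 (≤-trans (≤-reflexive (lem1 δ c)) (*-monoˡ-≤ (δ * (δ * δ)) (≤-trans (*-monoˡ-≤ (c * c) (m≤m+n 8 1016)) (≤-trans (≤-reflexive (lem2 c)) (*≤* 32c≤u 32c≤u))))) ⟩
   (u * u * (δ * (δ * δ))) ^ 4 ≡⟨ lem3 u δ ⟩
   u ^ 8 * (δ ^ 4) ^ 3 ≤⟨ *≤* (u≤ 8 (m≤m+n 8 8) N≤) (^-monoˡ-≤ 3 (≤-trans δ⁴ d≤n)) ⟩
   n ^ 4 ∎) (s≤s z≤n)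
   where
   lem1 : ∀ δ c → 8 * (δ * δ * c * (δ * c)) ≡ 8 * (c * c) * (δ * (δ * δ))
   lem1 = solve-∀
   lem2 : ∀ c → 1024 * (c * c) ≡ 32 * c * (32 * c)
   lem2 = solve-∀
   lem3 : ∀ u δ → let v = u * u * (δ * (δ * δ)) ; w = (δ * (δ * (δ * (δ * 1)))) in (v * (v * (v * (v * 1)))) ≡ (u * (u * (u * (u * (u * (u * (u * (u * 1)))))))) * (w * (w * (w * 1)))
   lem3 = solve-∀
  e≤z : e ≤ 2 * (1 * (n * (n * n)))
  e≤z = ≤-trans e≤n³ (≤-trans (m≤m+n (n * (n * n)) (n * (n * n))) (≤-reflexive (lem (n * (n * n)))))
   where
   lem : ∀ x → x + x ≡ 2 * (1 * x)
   lem = solve-∀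
  z-fits : 16 * (1 * c) ≤ n
  z-fits = ≤-trans (≤-reflexive (cong (16 *_) (*-identityˡ c))) (≤-trans 16c≤u (≤-trans (≤pow 16 (s≤s z≤n) 1≤u) N≤))
  eB≤ : e * B ≤ q * (q * (q * q))
  eB≤ = density-fits {n} {e} {k} {1} {q} {B} 1≤k e≤z 1≤n B²≤ (16k^16≤ N≤) n≤
  1≤β : 1 ≤ 2 * (δ * δ)
  1≤β = *≤* {1} {2} (s≤s z≤n) (*≤* 1≤δ 1≤δ)
  -- This is d^(1/2) ≤ (nd)^(1/3) in integers: the cube of δ² is at most δ⁸, and δ⁴ is at most both
  -- d and n.
  β≤2σ : 2 * (δ * δ) ≤ 2 * σ
  β≤2σ = *-monoʳ-≤ 2 (m<1+n⇒m≤n {δ * δ} {σ} (≰⇒> {suc σ} {δ * δ} λ h → <⇒≱ σ< (begin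
   suc σ ^ 3 ≤⟨ ^-monoˡ-≤ 3 h ⟩
   (δ * δ) ^ 3 ≤⟨ ≤-trans (≤-reflexive (sym (*-identityˡ ((δ * δ) ^ 3)))) (*-monoˡ-≤ ((δ * δ) ^ 3) (*≤* {1} {δ} {1} {δ} 1≤δ 1≤δ)) ⟩
   δ * δ * (δ * δ) ^ 3 ≡⟨ lem δ ⟩
   δ ^ 4 * δ ^ 4 ≤⟨ *≤* (≤-trans δ⁴ d≤n) δ⁴ ⟩
   n * d ∎)))
   where
   lem : ∀ δ → let w = δ * (δ * (δ * (δ * 1))) ; v = δ * δ in δ * δ * (v * (v * (v * 1))) ≡ w * w
   lem = solve-∀
  m≤σ : m ≤ (1 * (1 * 1) * (2 * (δ * δ)) + σ * 1) * coreConstant c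
  m≤σ = UpperBounds.core-bound {n} {e} {H} un q k c 1 d (2 * (δ * δ)) σ B 1≤n q≤ n≤ h₁ h₂ h₃ (s≤s z≤n) 1≤β 1≤σ
   e≤z (double-quotient {e} {n * n} {d} n²≤e d<) d≤β nd≤ z-fits β-fits σ-fits 2≤B n≤B² eB≤
  m≤δ : m ≤ δ * (δ * δ) * groupsConstant c
  m≤δ = UpperBounds.groups-bound {n} {e} {H} un q k c 1 d (2 * (δ * δ)) σ B 1≤n q≤ n≤ h₁ h₂ h₃ (s≤s z≤n) 1≤β 1≤σ
   e≤z (double-quotient {e} {n * n} {d} n²≤e d<) d≤β nd≤ z-fits β-fits σ-fits 2≤B n≤B² eB≤ δ 1≤δ refl refl d≤16 δ-fits
  bound₁ : m ^ 3 * n ≤ (3 * coreConstant c) ^ 3 * e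
  bound₁ = begin
   m ^ 3 * n ≤⟨ *-monoˡ-≤ n (^-monoˡ-≤ 3 (≤-trans m≤σ (*-monoˡ-≤ (coreConstant c) (≤-trans (≤-reflexive (lem1 (δ * δ) σ)) (≤-trans (+-monoˡ-≤ σ β≤2σ) (≤-reflexive (lem2 σ))))))) ⟩
   (3 * σ * coreConstant c) ^ 3 * n ≡⟨ lem3 σ (coreConstant c) n ⟩
   (3 * coreConstant c) ^ 3 * (n * σ ^ 3) ≤⟨ *-monoʳ-≤ ((3 * coreConstant c) ^ 3) (≤-trans (*-monoʳ-≤ n σ³) (≤-trans (≤-reflexive (lem4 n d)) dn²)) ⟩
   (3 * coreConstant c) ^ 3 * e ∎
   where
   lem1 : ∀ b s → 1 * (1 * 1) * (2 * b) + s * 1 ≡ 2 * b + s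
   lem1 = solve-∀
   lem2 : ∀ s → 2 * s + s ≡ 3 * s
   lem2 = solve-∀
   lem3 : ∀ s c n → let v = 3 * s * c ; w = 3 * c in (v * (v * (v * 1))) * n ≡ (w * (w * (w * 1))) * (n * (s * (s * (s * 1))))
   lem3 = solve-∀
   lem4 : ∀ n d → n * (n * d) ≡ d * (n * n)
   lem4 = solve-∀
  bound₂ : m ^ 4 * n ^ 6 ≤ groupsConstant c ^ 4 * e ^ 3
  bound₂ = begin
   m ^ 4 * n ^ 6 ≤⟨ *-monoˡ-≤ (n ^ 6) (^-monoˡ-≤ 4 m≤δ) ⟩
   (δ * (δ * δ) * groupsConstant c) ^ 4 * n ^ 6 ≡⟨ lem1 δ (groupsConstant c) n ⟩
   groupsConstant c ^ 4 * (δ ^ 4 * (n * n)) ^ 3 ≤⟨ *-monoʳ-≤ (groupsConstant c ^ 4) (^-monoˡ-≤ 3 (≤-trans (*-monoˡ-≤ (n * n) δ⁴) dn²)) ⟩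
   groupsConstant c ^ 4 * e ^ 3 ∎
   where
   lem1 : ∀ s g n → let v = s * (s * s) * g ; w = (s * (s * (s * (s * 1)))) * (n * n) in (v * (v * (v * (v * 1)))) * (n * (n * (n * (n * (n * (n * 1)))))) ≡ (g * (g * (g * (g * 1)))) * (w * (w * (w * 1)))
   lem1 = solve-∀

-- Binomial coefficients and logarithms

private
 choose4 : ∀ m → ((4 + m) C 4) * 24 ≡ (1 + m) * ((2 + m) * ((3 + m) * ((4 + m) * 1)))
 choose4 m = trans (cong (_* 24) (Comb.nCk≡nPk/k! {4} {4 + m} (m≤m+n 4 m))) (DM.m/n*n≡m (CombSpec.k!∣nP′k {4 + m} {4} (m≤m+n 4 m)))

choose4≤ : ∀ n → n C 4 ≤ n ^ 4
choose4≤ 0 = z≤n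
choose4≤ 1 = z≤n
choose4≤ 2 = z≤n
choose4≤ 3 = z≤n
choose4≤ (suc (suc (suc (suc m)))) = ≤-trans (m≤m*n ((4 + m) C 4) 24) (≤-trans (≤-reflexive (choose4 m))
 (*≤* {d = (4 + m) * ((4 + m) * ((4 + m) * 1))} (m≤n+m (1 + m) 3) (*≤* {d = (4 + m) * ((4 + m) * 1)} (m≤n+m (2 + m) 2) (*≤* {d = (4 + m) * 1} (m≤n+m (3 + m) 1) ≤-refl))))

-- From n = 12 on, n - 3 is at least 3n/4, and 64 · (3/4)³ = 27 exceeds 4! = 24.
choose4≥ : ∀ {n} → 12 ≤ n → n ^ 4 ≤ 64 * (n C 4)
choose4≥ {n} 12≤n = subst (λ n → n ^ 4 ≤ 64 * (n C 4)) (m+[n∸m]≡n (≤-trans (m≤m+n 4 8) 12≤n)) (from (n ∸ 4) (∸-monoˡ-≤ 4 12≤n))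
 where
 from : ∀ m → 8 ≤ m → (4 + m) ^ 4 ≤ 64 * ((4 + m) C 4)
 from m 8≤m = *-cancelʳ-≤ ((4 + m) ^ 4) (64 * ((4 + m) C 4)) 24 (begin
  (4 + m) ^ 4 * 24 ≤⟨ *-monoʳ-≤ ((4 + m) ^ 4) (m≤m+n 24 3) ⟩
  (4 + m) ^ 4 * 27 ≡⟨ lem (4 + m) ⟩
  3 * (4 + m) * (3 * (4 + m) * (3 * (4 + m) * ((4 + m) * 1))) ≤⟨ *≤* three (*≤* three (*-monoˡ-≤ ((4 + m) * 1) three)) ⟩
  4 * (1 + m) * (4 * (1 + m) * (4 * (1 + m) * ((4 + m) * 1))) ≡⟨ lem2 (1 + m) ((4 + m) * 1) ⟩
  64 * ((1 + m) * ((1 + m) * ((1 + m) * ((4 + m) * 1)))) ≤⟨ *-monoʳ-≤ 64 (*-monoʳ-≤ (1 + m) (*≤* (n≤1+n (1 + m)) (*-monoˡ-≤ ((4 + m) * 1) (m≤n+m (1 + m) 2)))) ⟩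
  64 * ((1 + m) * ((2 + m) * ((3 + m) * ((4 + m) * 1)))) ≡⟨ cong (64 *_) (sym (choose4 m)) ⟩
  64 * (((4 + m) C 4) * 24) ≡⟨ sym (*-assoc 64 ((4 + m) C 4) 24) ⟩
  64 * ((4 + m) C 4) * 24 ∎)
  where
  open ≤-Reasoning
  lem : ∀ x → (x * (x * (x * (x * 1)))) * 27 ≡ 3 * x * (3 * x * (3 * x * (x * 1)))
  lem = solve-∀
  lem2 : ∀ x y → 4 * x * (4 * x * (4 * x * y)) ≡ 64 * (x * (x * (x * y)))
  lem2 = solve-∀
  lem3 : ∀ m → 3 * (4 + m) ≡ 4 + 3 * m + 8
  lem3 = solve-∀
  lem4 : ∀ m → 4 + 3 * m + m ≡ 4 * (1 + m)
  lem4 = solve-∀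
  three : 3 * (4 + m) ≤ 4 * (1 + m)
  three = ≤-trans (≤-reflexive (lem3 m)) (≤-trans (+-monoʳ-≤ (4 + 3 * m) 8≤m) (≤-reflexive (lem4 m)))

2^log≤ : ∀ x → 1 ≤ x → 2 ^ ⌊log₂ x ⌋ ≤ x
2^log≤ x = go x x ≤-refl
 where
 go : ∀ f x → x ≤ f → 1 ≤ x → 2 ^ ⌊log₂ x ⌋ ≤ x
 go f 1 _ _ = s≤s z≤n
 go (suc f) x@(suc (suc y)) (s≤s le) _ = begin
  2 ^ ⌊log₂ x ⌋ ≡⟨ cong (2 ^_) (sym (m+[n∸m]≡n {1} {⌊log₂ x ⌋} 1≤L)) ⟩
  2 * 2 ^ (⌊log₂ x ⌋ ∸ 1) ≡⟨ cong (λ l → 2 * 2 ^ l) (sym (Log.⌊log₂⌊n/2⌋⌋≡⌊log₂n⌋∸1 x)) ⟩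
  2 * 2 ^ ⌊log₂ N.⌊ x /2⌋ ⌋ ≤⟨ *-monoʳ-≤ 2 (go f N.⌊ x /2⌋ (≤-trans (s≤s (⌊n/2⌋≤n y)) le) (s≤s z≤n)) ⟩
  2 * N.⌊ x /2⌋ ≡⟨ cong (N.⌊ x /2⌋ +_) (+-identityʳ N.⌊ x /2⌋) ⟩
  N.⌊ x /2⌋ + N.⌊ x /2⌋ ≤⟨ +-monoʳ-≤ N.⌊ x /2⌋ (⌊n/2⌋≤⌈n/2⌉ x) ⟩
  N.⌊ x /2⌋ + N.⌈ x /2⌉ ≡⟨ ⌊n/2⌋+⌈n/2⌉≡n x ⟩
  x ∎
  where
  open ≤-Reasoning
  1≤L : 1 ≤ ⌊log₂ x ⌋
  1≤L = Log.⌊log₂⌋-mono-≤ {2} {x} (s≤s (s≤s z≤n))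

log-≥ : ∀ {l x} → 2 ^ l ≤ x → l ≤ ⌊log₂ x ⌋
log-≥ {l} {x} h = ≤-trans (≤-reflexive (sym (Log.⌊log₂[2^n]⌋≡n l))) (Log.⌊log₂⌋-mono-≤ h)

<2^log : ∀ x → x < 2 ^ suc ⌊log₂ x ⌋
<2^log x = ≰⇒> λ h → <-irrefl refl (log-≥ {suc ⌊log₂ x ⌋} h)

2^-cancel-≤ : ∀ {a b} → 2 ^ a ≤ 2 ^ b → a ≤ b
2^-cancel-≤ {a} {b} h = ≮⇒≥ λ lt → <⇒≱ (^-monoʳ-< 2 (s≤s (s≤s z≤n)) lt) h

n<2^n : ∀ n → n < 2 ^ n
n<2^n zero = s≤s z≤n
n<2^n (suc n) = ≤-trans (+-mono-≤ (pow≥1 {2} n (s≤s z≤n)) (n<2^n n)) (≤-reflexive (cong (2 ^ n +_) (sym (+-identityʳ (2 ^ n)))))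

-- An integer form of log n ≤ 6n^(1/6): `y` is 2 to the integer part of a sixth of the logarithm.
log-root : ∀ n → 1 ≤ n → ∃ λ y → ⌊log₂ n ⌋ ≤ 6 * y × y ^ 6 ≤ n × 1 ≤ y
log-root n 1≤n with divide ⌊log₂ n ⌋ 6 (s≤s z≤n)
... | h , lo , hi = 2 ^ h
 , ≤-trans (<⇒≤ hi) (≤-trans (*-monoˡ-≤ 6 (n<2^n h)) (≤-reflexive (*-comm (2 ^ h) 6)))
 , ≤-trans (≤-reflexive (^-*-assoc 2 h 6)) (≤-trans (^-monoʳ-≤ 2 lo) (2^log≤ n 1≤n))
 , pow≥1 {2} h (s≤s z≤n)

2^ratio≤ : ∀ n e → 1 ≤ e → e ≤ n C 4 → 2 ^ logRatio n e * e ≤ n C 4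
2^ratio≤ n (suc k) _ le = ≤-trans (*-monoˡ-≤ (suc k) (2^log≤ ((n C 4) / suc k) (DM.m≥n⇒m/n>0 le))) (DM.m/n*n≤m (n C 4) (suc k))

-- Rounding down the quotient and then its logarithm costs one in the exponent.
<2^ratio : ∀ n e → 1 ≤ e → n C 4 ≤ 2 ^ suc (logRatio n e) * e
<2^ratio n (suc k) _ = begin
 n C 4 ≡⟨ DM.m≡m%n+[m/n]*n (n C 4) (suc k) ⟩
 (n C 4) % suc k + (n C 4) / suc k * suc k ≤⟨ +-monoˡ-≤ ((n C 4) / suc k * suc k) (<⇒≤ (DM.m%n<n (n C 4) (suc k))) ⟩
 suc ((n C 4) / suc k) * suc k ≤⟨ *-monoˡ-≤ (suc k) (<2^log ((n C 4) / suc k)) ⟩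
 2 ^ suc (logRatio n (suc k)) * suc k ∎
 where open ≤-Reasoning

ratio-≥ : ∀ l n e → 1 ≤ e → 2 ^ l * e ≤ n C 4 → l ≤ logRatio n e
ratio-≥ l n (suc k) _ h = log-≥ {l} (≤-trans (≤-reflexive (sym (DM.m*n/n≡m (2 ^ l) (suc k)))) (DM./-monoˡ-≤ (suc k) h))

-- Upper bounds for e above n³.

module Covered {n e : ℕ} {H : Hyper4} (un : Unavoidable n e H) (1≤n : 1 ≤ n) (κ κ′ : ℕ) (κ′≤ : κ′ ≤ 2 * κ) (e≤ : e ≤ κ′ ^ 4) (8κ≤n : 8 * κ ≤ n) where

 open Host {n} {e} {H} un

 private
  fits : 4 * κ′ ≤ 8 * κ
  fits = ≤-trans (*-monoʳ-≤ 4 κ′≤) (≤-reflexive (lem κ))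
   where
   lem : ∀ k → 4 * (2 * k) ≡ 8 * k
   lem = solve-∀
  abstract
   host : ProductHost κ′ κ′ κ′ κ′
   host = productHost κ′ κ′ κ′ κ′ (≤-trans (≤-reflexive (cong (λ x → κ′ + (κ′ + (κ′ + x))) (sym (+-identityʳ κ′)))) (≤-trans fits 8κ≤n))
    (≤-trans e≤ (≤-reflexive (cong (λ x → κ′ * (κ′ * (κ′ * x))) (*-identityʳ κ′))))
  open ProductHost host
  W : List VH
  W = L₀ ++ (L₁ ++ (L₂ ++ L₃))
  W≤ : length W ≤ 8 * κ
  W≤ = ≤-trans (≤-reflexive (trans (LP.length-++ L₀) (cong (length L₀ +_) (trans (LP.length-++ L₁) (cong (length L₁ +_) (LP.length-++ L₂))))))
   (≤-trans (+-mono-≤ l₀ (+-mono-≤ l₁ (+-mono-≤ l₂ l₃))) (≤-trans (≤-reflexive (cong (λ x → κ′ + (κ′ + (κ′ + x))) (sym (+-identityʳ κ′)))) fits))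
  inW : ∀ {s i} → s ∈ es → i S.∈ s → i ∈ W
  inW s∈ i∈ with cover s∈
  ... | a , b , c , d , r , a∈ , b∈ , c∈ , d∈ with Rep.only r i∈
  ... | inj₁ refl = ∈-++⁺ˡ a∈
  ... | in₁ refl = ∈-++⁺ʳ L₀ (∈-++⁺ˡ b∈)
  ... | in₂ refl = ∈-++⁺ʳ L₀ (∈-++⁺ʳ L₁ (∈-++⁺ˡ c∈))
  ... | in₃ refl = ∈-++⁺ʳ L₀ (∈-++⁺ʳ L₁ (∈-++⁺ʳ L₂ d∈))

 -- All of `H` fits into four parts of size about e^(1/4), so the density bound applies to its whole
 -- edge set.
 dense : ∀ B q → 1 ≤ B → q + (q + (q + q)) ≤ n → e * B ≤ q * (q * (q * q)) → B ^ ∥ graph H ∥ ≤ n ^ (8 * κ)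
 dense B q 1≤B q≤ eB≤ = ≤-trans {_} {n ^ length W} (Density.density {H = H} un B q 1≤B 1≤n q≤ eB≤ es (distinct (graph H)) id W inW) (pow-mono {n} {length W} {8 * κ} 1≤n W≤)

four-fit : ∀ {q n} → 16 * q ≤ n → q + (q + (q + q)) ≤ n
four-fit {q} h = ≤-trans (m≤m+n (q + (q + (q + q))) (12 * q)) (≤-trans (≤-reflexive (lem q)) h)
 where
 lem : ∀ q → q + (q + (q + q)) + 12 * q ≡ 16 * q
 lem = solve-∀

power-split : ∀ a κ y x r t → ((a * (κ * y)) ^ r * x) ^ t ≡ (a ^ r) ^ t * ((κ ^ t) ^ r * (y ^ (r * t) * x ^ t))
power-split a κ y x r t = begin
 ((a * (κ * y)) ^ r * x) ^ t ≡⟨ *-^ ((a * (κ * y)) ^ r) x t ⟩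
 ((a * (κ * y)) ^ r) ^ t * x ^ t ≡⟨ cong (λ w → w ^ t * x ^ t) (trans (*-^ a (κ * y) r) (cong (a ^ r *_) (*-^ κ y r))) ⟩
 (a ^ r * (κ ^ r * y ^ r)) ^ t * x ^ t ≡⟨ cong (_* x ^ t) (trans (*-^ (a ^ r) (κ ^ r * y ^ r) t) (cong ((a ^ r) ^ t *_) (*-^ (κ ^ r) (y ^ r) t))) ⟩
 (a ^ r) ^ t * ((κ ^ r) ^ t * (y ^ r) ^ t) * x ^ t ≡⟨ cong₂ (λ v w → (a ^ r) ^ t * (v * w) * x ^ t) (trans (^-*-assoc κ r t) (trans (cong (κ ^_) (*-comm r t)) (sym (^-*-assoc κ t r)))) (^-*-assoc y r t) ⟩
 (a ^ r) ^ t * ((κ ^ t) ^ r * y ^ (r * t)) * x ^ t ≡⟨ lem ((a ^ r) ^ t) ((κ ^ t) ^ r) (y ^ (r * t)) (x ^ t) ⟩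
 (a ^ r) ^ t * ((κ ^ t) ^ r * (y ^ (r * t) * x ^ t)) ∎
 where
 open ≡-Reasoning
 lem : ∀ a k y n → a * (k * y) * n ≡ a * (k * (y * n))
 lem = solve-∀

root-transfer : ∀ {m a κ y x e} r t → 1 ≤ t → m ≤ a * (κ * y) → κ ^ t ≤ e → y ^ (r * t) * x ^ t ≤ e ^ (t * t ∸ r) → r ≤ t * t → m ^ r * x ≤ a ^ r * e ^ t
root-transfer {m} {a} {κ} {y} {x} {e} r t 1≤t hm hκ hy r≤ = pow-cancel-≤ {m ^ r * x} {a ^ r * e ^ t} t (begin
  (m ^ r * x) ^ t ≤⟨ ^-monoˡ-≤ t (*-monoˡ-≤ x (^-monoˡ-≤ r hm)) ⟩
  ((a * (κ * y)) ^ r * x) ^ t ≡⟨ power-split a κ y x r t ⟩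
  (a ^ r) ^ t * ((κ ^ t) ^ r * (y ^ (r * t) * x ^ t)) ≤⟨ *-monoʳ-≤ ((a ^ r) ^ t) (*≤* (^-monoˡ-≤ r hκ) hy) ⟩
  (a ^ r) ^ t * (e ^ r * e ^ (t * t ∸ r)) ≡⟨ cong ((a ^ r) ^ t *_) (trans (sym (^-distribˡ-+-* e r (t * t ∸ r))) (trans (cong (e ^_) (m+[n∸m]≡n r≤)) (sym (^-*-assoc e t t)))) ⟩
  (a ^ r) ^ t * (e ^ t) ^ t ≡⟨ sym (*-^ (a ^ r) (e ^ t) t) ⟩
  (a ^ r * e ^ t) ^ t ∎) 1≤t
 where open ≤-Reasoning

-- A bound of order e^(1/4)y for `m` implies one of order e^(4/3)/n^(10/3) as soon as y¹²n⁴⁰ ≤ e¹³;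
-- twelfth powers show this.
m-from-root : ∀ {m a κ y n e} → m ≤ a * (κ * y) → κ ^ 4 ≤ e → y ^ 12 * n ^ 40 ≤ e ^ 13 → m ^ 3 * n ^ 10 ≤ a ^ 3 * e ^ 4
m-from-root {m} {a} {κ} {y} {n} {e} hm hκ hy = root-transfer {m} {a} {κ} {y} {n ^ 10} {e} 3 4 (s≤s z≤n) hm hκ
 (≤-trans (≤-reflexive (cong (y ^ 12 *_) (^-*-assoc n 10 4))) hy) (m≤m+n 3 13)

module LargeUpper (k c l p a₁ a₂ : ℕ) (32≤k : 32 ≤ k) (h₁ : 2 * (k * (k * k)) ≤ c) (h₂ : 32 * (k * k) ≤ c) (h₃ : 2048 ≤ c)
 (1≤l : 1 ≤ l) (k≤l : 2 * k ^ 4 ≤ 2 ^ l) (8≤p : 8 ≤ p) (p≤l : p ^ 4 ≤ 2 ^ l) (a₁≥ : 192 ≤ a₁) (core≤a₁ : 3 * coreConstant c ≤ a₁) (a₂≥ : 32 ≤ a₂) where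

 open MiddleUpper k c 32≤k h₁ h₂ h₃
 open ≤-Reasoning

 large-upper : ∀ {n e} {H : Hyper4} → Unavoidable n e H → u ^ 16 ≤ n → n ^ 3 < e → 2 ^ (l + l) * e ≤ n C 4
  → ∥ graph H ∥ ^ 3 * n ^ 10 ≤ a₁ ^ 3 * e ^ 4 × ∥ graph H ∥ ^ 4 * logRatio n e ^ 4 ≤ a₂ ^ 4 * (e * ⌊log₂ n ⌋ ^ 4)
 large-upper {n} {e} {H} un N≤ lo hi
   = from (scale n k 32≤k (16≤n N≤)) (divide e (n * (n * n)) (*≤* {1} {n} {1} 1≤n′ (*≤* {1} {n} {1} {n} 1≤n′ 1≤n′))) (root 4 e (s≤s z≤n)) (log-root n 1≤n′)
  where
  1≤n′ : 1 ≤ n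
  1≤n′ = ≤-trans (s≤s z≤n) (16≤n N≤)
  from : Scale n k → (∃ λ z → z * (n * (n * n)) ≤ e × e < suc z * (n * (n * n))) → (∃ λ κ → κ ^ 4 ≤ e × e < suc κ ^ 4)
   → (∃ λ y → ⌊log₂ n ⌋ ≤ 6 * y × y ^ 6 ≤ n × 1 ≤ y)
   → ∥ graph H ∥ ^ 3 * n ^ 10 ≤ a₁ ^ 3 * e ^ 4 × ∥ graph H ∥ ^ 4 * logRatio n e ^ 4 ≤ a₂ ^ 4 * (e * ⌊log₂ n ⌋ ^ 4)
  from sc (z , zn³ , z<) (κ , κ⁴ , κ<) (y , L≤y , y⁶ , 1≤y) = bound₁ , bound₂
   where
   open Scale sc
   m L lam : ℕ
   m = ∥ graph H ∥
   L = ⌊log₂ n ⌋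
   lam = logRatio n e
   1≤n : 1 ≤ n
   1≤n = ≤-trans (s≤s z≤n) (16≤n N≤)
   1≤e : 1 ≤ e
   1≤e = ≤-trans (s≤s z≤n) lo
   n³≤e : n * (n * n) ≤ e
   n³≤e = ≤-trans (≤-reflexive (cong (λ x → n * (n * x)) (sym (*-identityʳ n)))) (<⇒≤ lo)
   1≤z : 1 ≤ z
   1≤z = quotient-pos {e} {n * (n * n)} {z} n³≤e z<
   e≤z : e ≤ 2 * (z * (n * (n * n)))
   e≤z = double-quotient {e} {n * (n * n)} {z} n³≤e z<
   1≤κ : 1 ≤ κ
   1≤κ = 1≤root {e} {κ} 4 1≤e κ<
   l≤lam : l + l ≤ lam
   l≤lam = ratio-≥ (l + l) n e 1≤e hi
   e≤C : e ≤ n C 4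
   e≤C = ≤-trans (≤-trans (≤-reflexive (sym (*-identityˡ e))) (*-monoˡ-≤ e (pow≥1 {2} (l + l) (s≤s z≤n)))) hi
   8κ≤n : 8 * κ ≤ n
   8κ≤n = pow-cancel-≤ 4 (begin
    (8 * κ) ^ 4 ≤⟨ ^-monoˡ-≤ 4 (*-monoˡ-≤ κ 8≤p) ⟩
    (p * κ) ^ 4 ≡⟨ *-^ p κ 4 ⟩
    p ^ 4 * κ ^ 4 ≤⟨ *≤* (≤-trans p≤l (^-monoʳ-≤ 2 (m≤m+n l l))) κ⁴ ⟩
    2 ^ (l + l) * e ≤⟨ hi ⟩
    n C 4 ≤⟨ choose4≤ n ⟩
    n ^ 4 ∎) (s≤s z≤n)
   open Covered {n} {e} {H} un 1≤n κ (suc κ) (suc≤2* 1≤κ) (<⇒≤ κ<) 8κ≤n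

   -- The blocks are now as large as possible, `b` being the quotient of q⁴ by e. The constant lost
   -- against `2 ^ lam` is absorbed by squaring: `2 ^ lam ≤ 2 ^ l * b` and `2 ^ (l + l) ≤ 2 ^ lam`
   -- imply `2 ^ lam ≤ b * b`.
   mλ≤ : m * lam ≤ 32 * (κ * L)
   mλ≤ with divide (q * (q * (q * q))) e 1≤e
   ... | b , be≤ , <be = 2^-cancel-≤ (begin
     2 ^ (m * lam) ≡⟨ trans (cong (2 ^_) (*-comm m lam)) (sym (^-*-assoc 2 lam m)) ⟩
     (2 ^ lam) ^ m ≤⟨ ^-monoˡ-≤ m λ≤bb ⟩
     (b * b) ^ m ≡⟨ *-^ b b m ⟩
     b ^ m * b ^ m ≤⟨ *≤* d d ⟩
     n ^ (8 * κ) * n ^ (8 * κ) ≡⟨ sym (^-distribˡ-+-* n (8 * κ) (8 * κ)) ⟩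
     n ^ (8 * κ + 8 * κ) ≤⟨ ^-monoˡ-≤ (8 * κ + 8 * κ) (<⇒≤ (<2^log n)) ⟩
     (2 ^ suc L) ^ (8 * κ + 8 * κ) ≡⟨ ^-*-assoc 2 (suc L) (8 * κ + 8 * κ) ⟩
     2 ^ (suc L * (8 * κ + 8 * κ)) ≤⟨ ^-monoʳ-≤ 2 (≤-trans (*-monoˡ-≤ (8 * κ + 8 * κ) (suc≤2* 1≤L)) (≤-reflexive (lem L κ))) ⟩
     2 ^ (32 * (κ * L)) ∎)
    where
    lem : ∀ L k → 2 * L * (8 * k + 8 * k) ≡ 32 * (k * L)
    lem = solve-∀
    lem2 : ∀ k b e → k * (b * e) ≡ k * b * e
    lem2 = solve-∀
    lem3 : ∀ k b → k * (2 * b) ≡ 2 * k * b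
    lem3 = solve-∀
    lem4 : ∀ q → (q * (q * (q * (q * 1)))) ≡ q * (q * (q * q))
    lem4 = solve-∀
    lem5 : ∀ p b → p * b * (p * b) ≡ p * p * (b * b)
    lem5 = solve-∀
    1≤L : 1 ≤ L
    1≤L = Log.⌊log₂⌋-mono-≤ {2} {n} (≤-trans (m≤m+n 2 14) (16≤n N≤))
    λ<k : 2 ^ lam ≤ k ^ 4 * suc b
    λ<k = cancelʳ e 1≤e (begin
     2 ^ lam * e ≤⟨ 2^ratio≤ n e 1≤e e≤C ⟩
     n C 4 ≤⟨ choose4≤ n ⟩
     n ^ 4 ≤⟨ ^-monoˡ-≤ 4 n≤ ⟩
     (k * q) ^ 4 ≡⟨ trans (*-^ k q 4) (cong (k ^ 4 *_) (lem4 q)) ⟩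
     k ^ 4 * (q * (q * (q * q))) ≤⟨ *-monoʳ-≤ (k ^ 4) (<⇒≤ <be) ⟩
     k ^ 4 * (suc b * e) ≡⟨ lem2 (k ^ 4) (suc b) e ⟩
     k ^ 4 * suc b * e ∎)
    1≤b : 1 ≤ b
    1≤b = pos b λ<k
     where
     pos : ∀ b → 2 ^ lam ≤ k ^ 4 * suc b → 1 ≤ b
     pos (suc b) _ = s≤s z≤n
     pos zero h = ⊥-elim (<⇒≱ (≤-trans (≤-trans (+-monoˡ-≤ (k ^ 4) (pow≥1 4 1≤k)) (≤-trans (≤-reflexive (cong (k ^ 4 +_) (sym (+-identityʳ (k ^ 4))))) k≤l))
      (^-monoʳ-≤ 2 (≤-trans (m≤m+n l l) l≤lam))) (≤-trans h (≤-reflexive (*-identityʳ (k ^ 4)))))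
    λ≤lb : 2 ^ lam ≤ 2 ^ l * b
    λ≤lb = ≤-trans λ<k (≤-trans (*-monoʳ-≤ (k ^ 4) (suc≤2* 1≤b)) (≤-trans (≤-reflexive (lem3 (k ^ 4) b)) (*-monoˡ-≤ b k≤l)))
    λ≤bb : 2 ^ lam ≤ b * b
    λ≤bb = cancelʳ (2 ^ lam) (pow≥1 {2} lam (s≤s z≤n)) (begin
     2 ^ lam * 2 ^ lam ≤⟨ *≤* λ≤lb λ≤lb ⟩
     2 ^ l * b * (2 ^ l * b) ≡⟨ lem5 (2 ^ l) b ⟩
     2 ^ l * 2 ^ l * (b * b) ≡⟨ cong (_* (b * b)) (sym (^-distribˡ-+-* 2 l l)) ⟩
     2 ^ (l + l) * (b * b) ≤⟨ *-monoˡ-≤ (b * b) (^-monoʳ-≤ 2 l≤lam) ⟩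
     2 ^ lam * (b * b) ≡⟨ *-comm (2 ^ lam) (b * b) ⟩
     b * b * 2 ^ lam ∎)
    d : b ^ m ≤ n ^ (8 * κ)
    d = dense b q 1≤b (four-fit {q} q≤) (≤-trans (≤-reflexive (*-comm e b)) be≤)

   bound₂ : m ^ 4 * lam ^ 4 ≤ a₂ ^ 4 * (e * L ^ 4)
   bound₂ = begin
    m ^ 4 * lam ^ 4 ≡⟨ sym (*-^ m lam 4) ⟩
    (m * lam) ^ 4 ≤⟨ ^-monoˡ-≤ 4 (≤-trans mλ≤ (*-monoˡ-≤ (κ * L) a₂≥)) ⟩
    (a₂ * (κ * L)) ^ 4 ≡⟨ trans (*-^ a₂ (κ * L) 4) (cong (a₂ ^ 4 *_) (*-^ κ L 4)) ⟩
    a₂ ^ 4 * (κ ^ 4 * L ^ 4) ≤⟨ *-monoʳ-≤ (a₂ ^ 4) (*-monoˡ-≤ (L ^ 4) κ⁴) ⟩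
    a₂ ^ 4 * (e * L ^ 4) ∎

   n³^13 : (n * (n * n)) ^ 13 ≡ n ^ 39
   n³^13 = trans (cong (λ x → (n * (n * x)) ^ 13) (sym (*-identityʳ n))) (^-*-assoc n 3 13)

   z^13n^39≤ : z ^ 13 * n ^ 39 ≤ e ^ 13
   z^13n^39≤ = ≤-trans (≤-reflexive (trans (cong (z ^ 13 *_) (sym n³^13)) (sym (*-^ z (n * (n * n)) 13)))) (^-monoˡ-≤ 13 zn³)

   -- For z ^ 4 > n the slack between n ^ 42 and n ^ 40 absorbs log n.
   huge : n ≤ z ^ 4 → m ^ 3 * n ^ 10 ≤ a₁ ^ 3 * e ^ 4
   huge n≤z = m-from-root {m} {a₁} {κ} {y} {n} {e}
    (begin
     m ≤⟨ m≤m*n m lam {{N.>-nonZero (≤-trans (≤-trans 1≤l (m≤m+n l l)) l≤lam)}} ⟩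
     m * lam ≤⟨ mλ≤ ⟩
     32 * (κ * L) ≤⟨ *-monoʳ-≤ 32 (*-monoʳ-≤ κ L≤y) ⟩
     32 * (κ * (6 * y)) ≡⟨ lem κ y ⟩
     192 * (κ * y) ≤⟨ *-monoˡ-≤ (κ * y) a₁≥ ⟩
     a₁ * (κ * y) ∎) κ⁴
    (begin
     y ^ 12 * n ^ 40 ≡⟨ cong (_* n ^ 40) (sym (^-*-assoc y 6 2)) ⟩
     (y ^ 6) ^ 2 * n ^ 40 ≤⟨ *-monoˡ-≤ (n ^ 40) (^-monoˡ-≤ 2 y⁶) ⟩
     n ^ 2 * n ^ 40 ≡⟨ trans (sym (^-distribˡ-+-* n 2 40)) (^-distribˡ-+-* n 3 39) ⟩
     n ^ 3 * n ^ 39 ≤⟨ *-monoˡ-≤ (n ^ 39) (^-monoˡ-≤ 3 n≤z) ⟩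
     (z ^ 4) ^ 3 * n ^ 39 ≤⟨ *-monoˡ-≤ (n ^ 39) (≤-trans (≤-reflexive (^-*-assoc z 4 3)) (pow-mono 1≤z (n≤1+n 12))) ⟩
     z ^ 13 * n ^ 39 ≤⟨ z^13n^39≤ ⟩
     e ^ 13 ∎)
    where
    lem : ∀ k y → 32 * (k * (6 * y)) ≡ 192 * (k * y)
    lem = solve-∀

   eB≤ : z ^ 4 ≤ n → e * B ≤ q * (q * (q * q))
   eB≤ z⁴ = density-fits {n} {e} {k} {z} {q} {B} 1≤k e≤z z⁴ B²≤ (16k^16≤ N≤) n≤

   -- Blocks of order n^(1/2) bound `m` by `16 * κ` without a logarithm, and zn³ ≤ e with n ≤ z¹³
   -- gives n⁴⁰ ≤ e¹³.
   medium : z ^ 4 ≤ n → n ≤ z ^ 13 → m ^ 3 * n ^ 10 ≤ a₁ ^ 3 * e ^ 4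
   medium z⁴ n≤z = m-from-root {m} {a₁} {κ} {1} {n} {e}
    (≤-trans (square-dominates {B} {n} {m} {8 * κ} 2≤B n≤B² (dense B q (≤-trans (s≤s z≤n) 2≤B) (four-fit {q} q≤) (eB≤ z⁴))) (≤-trans (≤-reflexive (lem κ)) (*-monoˡ-≤ (κ * 1) (≤-trans (m≤m+n 16 176) a₁≥)))) κ⁴
    (begin
     1 ^ 12 * n ^ 40 ≡⟨ *-identityˡ (n ^ 40) ⟩
     n * n ^ 39 ≤⟨ *-monoˡ-≤ (n ^ 39) n≤z ⟩
     z ^ 13 * n ^ 39 ≤⟨ z^13n^39≤ ⟩
     e ^ 13 ∎)
    where
    lem : ∀ k → 2 * (8 * k) ≡ 16 * (k * 1)
    lem = solve-∀

   -- The exponent 13 marks where z²(nz)^(1/2) equals (n²z)^(1/3): up to there the term `σ * z` of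
   -- `core-bound` dominates the other one.
   small : z ^ 13 ≤ n → m ^ 3 * n ^ 10 ≤ a₁ ^ 3 * e ^ 4
   small z^13≤ = roots (root 3 (n * (n * z)) (s≤s z≤n)) (root 2 (n * z) (s≤s z≤n))
    where
    roots : (∃ λ σ → σ ^ 3 ≤ n * (n * z) × n * (n * z) < suc σ ^ 3) → (∃ λ β → β ^ 2 ≤ n * z × n * z < suc β ^ 2)
     → m ^ 3 * n ^ 10 ≤ a₁ ^ 3 * e ^ 4
    roots (σ , σ³ , σ<) (β , β² , β<) = begin
      m ^ 3 * n ^ 10 ≤⟨ *-monoˡ-≤ (n ^ 10) (^-monoˡ-≤ 3 m≤) ⟩
      (a₁ * (σ * z)) ^ 3 * n ^ 10 ≡⟨ lem5 σ z a₁ (n ^ 10) ⟩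
      a₁ ^ 3 * (σ ^ 3 * z ^ 3 * n ^ 10) ≤⟨ *-monoʳ-≤ (a₁ ^ 3) (*-monoˡ-≤ (n ^ 10) (*-monoˡ-≤ (z ^ 3) σ³)) ⟩
      a₁ ^ 3 * (n * (n * z) * z ^ 3 * n ^ 10) ≡⟨ cong (a₁ ^ 3 *_) (lem6 z n) ⟩
      a₁ ^ 3 * (z * (n * (n * n))) ^ 4 ≤⟨ *-monoʳ-≤ (a₁ ^ 3) (^-monoˡ-≤ 4 zn³) ⟩
      a₁ ^ 3 * e ^ 4 ∎
     where
     lem5 : ∀ s z c n → let v = c * (s * z) in (v * (v * (v * 1))) * n ≡ (c * (c * (c * 1))) * ((s * (s * (s * 1))) * (z * (z * (z * 1))) * n)
     lem5 = solve-∀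
     lem6 : ∀ z n → let v = z * (n * (n * n)) in n * (n * z) * (z * (z * (z * 1))) * (n * (n * (n * (n * (n * (n * (n * (n * (n * (n * 1)))))))))) ≡ (v * (v * (v * (v * 1))))
     lem6 = solve-∀
     z≤n′ : ∀ j → j ≤ 13 → z ^ j ≤ n
     z≤n′ j le = ≤-trans (pow-mono 1≤z le) z^13≤
     1≤nz : 1 ≤ n * z
     1≤nz = *≤* {1} {n} {1} {z} 1≤n 1≤z
     1≤nnz : 1 ≤ n * (n * z)
     1≤nnz = *≤* {1} {n} {1} {n * z} 1≤n 1≤nz
     1≤σ : 1 ≤ σ
     1≤σ = 1≤root {n * (n * z)} {σ} 3 1≤nnz σ<
     1≤β : 1 ≤ β
     1≤β = 1≤root {n * z} {β} 2 1≤nz β<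
     e≤d : e ≤ 2 * (n * z * (n * n))
     e≤d = ≤-trans e≤z (≤-reflexive (lem z n))
      where
      lem : ∀ z n → 2 * (z * (n * (n * n))) ≡ 2 * (n * z * (n * n))
      lem = solve-∀
     d≤ : n * z ≤ 4 * (β * β)
     d≤ = ≤-trans (double-root {n * z} {β} 2 1≤nz β<) (≤-reflexive (cong (λ x → 4 * (β * x)) (*-identityʳ β)))
     nd≤ : n * (n * z) ≤ 8 * (σ * (σ * σ))
     nd≤ = ≤-trans (double-root {n * (n * z)} {σ} 3 1≤nnz σ<) (≤-reflexive (cong (λ x → 8 * (σ * (σ * x))) (*-identityʳ σ)))
     16c^ : ∀ j → j ≤ 16 → (16 * c) ^ j ≤ n
     16c^ j le = ≤-trans (^-monoˡ-≤ j 16c≤u) (u≤ j le N≤)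
     z-fits : 16 * (z * c) ≤ n
     z-fits = pow-cancel-≤ 2 (begin
      (16 * (z * c)) ^ 2 ≡⟨ lem z c ⟩
      (16 * c) ^ 2 * z ^ 2 ≤⟨ *≤* (16c^ 2 (m≤m+n 2 14)) (z≤n′ 2 (m≤m+n 2 11)) ⟩
      n * n ≡⟨ cong (n *_) (sym (*-identityʳ n)) ⟩
      n ^ 2 ∎) (s≤s z≤n)
      where
      lem : ∀ z c → ((16 * (z * c)) * ((16 * (z * c)) * 1)) ≡ ((16 * c) * ((16 * c) * 1)) * (z * (z * 1))
      lem = solve-∀
     β-fits : 16 * (β * c) ≤ n
     β-fits = pow-cancel-≤ 4 (begin
      (16 * (β * c)) ^ 4 ≡⟨ lem β c ⟩
      (16 * c) ^ 4 * (β ^ 2) ^ 2 ≤⟨ *≤* (16c^ 4 (m≤m+n 4 12)) (^-monoˡ-≤ 2 β²) ⟩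
      n * (n * z) ^ 2 ≡⟨ lem2 n z ⟩
      n * (n * (n * z ^ 2)) ≤⟨ *-monoʳ-≤ n (*-monoʳ-≤ n (*-monoʳ-≤ n (≤-trans (z≤n′ 2 (m≤m+n 2 11)) (≤-reflexive (sym (*-identityʳ n)))))) ⟩
      n ^ 4 ∎) (s≤s z≤n)
      where
      lem : ∀ b c → let v = 16 * (b * c) ; w = 16 * c in (v * (v * (v * (v * 1)))) ≡ (w * (w * (w * (w * 1)))) * (((b * (b * 1))) * (((b * (b * 1))) * 1))
      lem = solve-∀
      lem2 : ∀ n z → n * ((n * z) * ((n * z) * 1)) ≡ n * (n * (n * (z * (z * 1))))
      lem2 = solve-∀
     σ-fits : 16 * (σ * c) ≤ n
     σ-fits = pow-cancel-≤ 6 (begin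
      (16 * (σ * c)) ^ 6 ≡⟨ trans (cong (_^ 6) (lem σ c)) (trans (*-^ (16 * c) σ 6) (cong ((16 * c) ^ 6 *_) (sym (^-*-assoc σ 3 2)))) ⟩
      (16 * c) ^ 6 * (σ ^ 3) ^ 2 ≤⟨ *≤* (16c^ 6 (m≤m+n 6 10)) (^-monoˡ-≤ 2 σ³) ⟩
      n * (n * (n * z)) ^ 2 ≡⟨ lem2 n z ⟩
      n * (n * (n * (n * (n * z ^ 2)))) ≤⟨ *-monoʳ-≤ n (*-monoʳ-≤ n (*-monoʳ-≤ n (*-monoʳ-≤ n (*-monoʳ-≤ n (≤-trans (z≤n′ 2 (m≤m+n 2 11)) (≤-reflexive (sym (*-identityʳ n)))))))) ⟩
      n ^ 6 ∎) (s≤s z≤n)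
      where
      lem : ∀ s c → 16 * (s * c) ≡ 16 * c * s
      lem = solve-∀
      lem2 : ∀ n z → n * ((n * (n * z)) * ((n * (n * z)) * 1)) ≡ n * (n * (n * (n * (n * (z * (z * 1))))))
      lem2 = solve-∀
     zzβ≤ : z * z * β ≤ 2 * σ
     zzβ≤ = ≤-trans (pow-cancel-≤ {z * z * β} {suc σ} 6 (begin
      (z * z * β) ^ 6 ≡⟨ lem z β ⟩
      z ^ 12 * (β ^ 2) ^ 3 ≤⟨ *-monoʳ-≤ (z ^ 12) (^-monoˡ-≤ 3 β²) ⟩
      z ^ 12 * (n * z) ^ 3 ≡⟨ lem2 z n ⟩
      z ^ 13 * (z * z * (n * (n * n))) ≤⟨ *-monoˡ-≤ (z * z * (n * (n * n))) z^13≤ ⟩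
      n * (z * z * (n * (n * n))) ≡⟨ lem3 z n ⟩
      (n * (n * z)) ^ 2 ≤⟨ ^-monoˡ-≤ 2 (<⇒≤ σ<) ⟩
      (suc σ ^ 3) ^ 2 ≡⟨ lem4 (suc σ) ⟩
      suc σ ^ 6 ∎) (s≤s z≤n)) (suc≤2* 1≤σ)
      where
      lem : ∀ z b → let v = z * z * b ; w = (b * (b * 1)) in (v * (v * (v * (v * (v * (v * 1)))))) ≡ (z * (z * (z * (z * (z * (z * (z * (z * (z * (z * (z * (z * 1)))))))))))) * (w * (w * (w * 1)))
      lem = solve-∀
      lem2 : ∀ z n → let w = z * (z * (z * (z * (z * (z * (z * (z * (z * (z * (z * (z * 1))))))))))) ; v = n * z in w * (v * (v * (v * 1))) ≡ (z * w) * (z * z * (n * (n * n)))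
      lem2 = solve-∀
      lem4 : ∀ s → (s ^ 3) ^ 2 ≡ s ^ 6
      lem4 s = ^-*-assoc s 3 2
      lem3 : ∀ z n → n * (z * z * (n * (n * n))) ≡ ((n * (n * z)) * ((n * (n * z)) * 1))
      lem3 = solve-∀
     m≤ : m ≤ a₁ * (σ * z)
     m≤ = ≤-trans (UpperBounds.core-bound {n} {e} {H} un q k c z (n * z) β σ B 1≤n q≤ n≤ h₁ h₂ h₃ 1≤z 1≤β 1≤σ
       e≤z e≤d d≤ nd≤ z-fits β-fits σ-fits 2≤B n≤B² (eB≤ (z≤n′ 4 (m≤m+n 4 9))))
      (≤-trans (*-monoˡ-≤ (coreConstant c) (≤-trans (≤-reflexive (lem z β σ)) (≤-trans (+-monoˡ-≤ (σ * z) (*-monoˡ-≤ z zzβ≤)) (≤-reflexive (lem2 z σ)))))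
       (≤-trans (≤-reflexive (lem3 (σ * z) (coreConstant c))) (*-monoˡ-≤ (σ * z) core≤a₁)))
      where
      lem : ∀ z b s → z * (z * z) * b + s * z ≡ z * z * b * z + s * z
      lem = solve-∀
      lem3 : ∀ a b → 3 * a * b ≡ 3 * b * a
      lem3 = solve-∀
      lem2 : ∀ z s → 2 * s * z + s * z ≡ 3 * (s * z)
      lem2 = solve-∀

   bound₁ : m ^ 3 * n ^ 10 ≤ a₁ ^ 3 * e ^ 4
   bound₁ = [ small , (λ h → [ (λ h′ → medium h′ h) , huge ]′ (≤-total (z ^ 4) n)) ]′ (≤-total (z ^ 13) n)

-- Graphs contained in every sufficiently dense graph

Achieves : ℕ → ℕ → ℕ → Set
Achieves n e m = ∃ λ H → Unavoidable n e H × ∥ graph H ∥ ≡ m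

single-edge : ∀ {n e} → 1 ≤ e → Achieves n e 1
single-edge {n} {e} 1≤e = hyperOf es ([] ∷ []) , un , ∥hyperOf∥ es ([] ∷ [])
 where
 open Partite 1 1 1 1
 es : List (Tuple 1 1 1 1)
 es = (zero , zero , zero , zero) ∷ []
 un : Unavoidable n e (hyperOf es ([] ∷ []))
 un G eq = from (edges G) refl
  where
  from : ∀ xs → edges G ≡ xs → Contains G (hyperOf es ([] ∷ []))
  from [] eq′ = ⊥-elim (<⇒≱ (≤-trans 1≤e (≤-reflexive (trans (sym eq) (cong length eq′)))) z≤n)
  from (s ∷ xs) eq′ = place (∣∣≡4⇒rep s (All.lookup (uniform G) s∈))
   where
   s∈ : s ∈ edges G
   s∈ = subst (s ∈_) (sym eq′) (here refl)
   place : (∃₂ λ i j → ∃₂ λ l m → Rep s i j l m) → Contains G (hyperOf es ([] ∷ []))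
   place (i , j , l , m , r) = contains-hyperOf G es ([] ∷ []) g (λ {p} {q} → g-inj p q) λ { {zero} {zero} {zero} {zero} _ → s , s∈ , r }
    where
    open Rep r using (ab; ac; ad; bc; bd; cd)
    g : Parts 1 1 1 1 → Fin n
    g (at₀ _) = i
    g (at₁ _) = j
    g (at₂ _) = l
    g (at₃ _) = m
    g-inj : ∀ p q → g p ≡ g q → p ≡ q
    g-inj (at₀ zero) (at₀ zero) _ = refl
    g-inj (at₁ zero) (at₁ zero) _ = refl
    g-inj (at₂ zero) (at₂ zero) _ = refl
    g-inj (at₃ zero) (at₃ zero) _ = refl
    g-inj (at₀ _) (at₁ _) h = ⊥-elim (ab h)
    g-inj (at₀ _) (at₂ _) h = ⊥-elim (ac h)
    g-inj (at₀ _) (at₃ _) h = ⊥-elim (ad h)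
    g-inj (at₁ _) (at₂ _) h = ⊥-elim (bc h)
    g-inj (at₁ _) (at₃ _) h = ⊥-elim (bd h)
    g-inj (at₂ _) (at₃ _) h = ⊥-elim (cd h)
    g-inj (at₁ _) (at₀ _) h = ⊥-elim (ab (sym h))
    g-inj (at₂ _) (at₀ _) h = ⊥-elim (ac (sym h))
    g-inj (at₃ _) (at₀ _) h = ⊥-elim (ad (sym h))
    g-inj (at₂ _) (at₁ _) h = ⊥-elim (bc (sym h))
    g-inj (at₃ _) (at₁ _) h = ⊥-elim (bd (sym h))
    g-inj (at₃ _) (at₂ _) h = ⊥-elim (cd (sym h))

-- Lower bounds for e between n² and n³.

module _ (n x y : ℕ) (1≤x : 1 ≤ x) (1≤y : 1 ≤ y) where

 private
  K K′ p : ℕ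
  K = x * suc (y * 2) + 2
  K′ = K + y * 2
  p = x * y
  x≤p : x ≤ p
  x≤p = ≤-trans (≤-reflexive (sym (*-identityʳ x))) (*-monoʳ-≤ x 1≤y)
  y≤p : y ≤ p
  y≤p = ≤-trans (≤-reflexive (sym (+-identityʳ y))) (*-monoˡ-≤ y 1≤x)
  1≤p : 1 ≤ p
  1≤p = *≤* {1} {x} {1} {y} 1≤x 1≤y
  K≤ : K ≤ 5 * p
  K≤ = ≤-trans (≤-reflexive (lem x y)) (≤-trans (+-mono-≤ (+-monoʳ-≤ (2 * p) x≤p) (*-monoʳ-≤ 2 1≤p)) (≤-reflexive (lem2 p)))
   where
   lem : ∀ x y → x * suc (y * 2) + 2 ≡ 2 * (x * y) + x + 2 * 1
   lem = solve-∀
   lem2 : ∀ p → 2 * p + p + 2 * p ≡ 5 * p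
   lem2 = solve-∀
  K′≤ : K′ ≤ 7 * p
  K′≤ = ≤-trans (+-mono-≤ K≤ (*-monoˡ-≤ 2 y≤p)) (≤-reflexive (lem p))
   where
   lem : ∀ p → 5 * p + p * 2 ≡ 7 * p
   lem = solve-∀
  θ≤ : K′ + 1 ≤ 8 * p
  θ≤ = ≤-trans (+-mono-≤ K′≤ 1≤p) (≤-reflexive (+-comm (7 * p) p))

 -- Without forbidden vertices and with one leaf per grandchild five summands remain, and they are
 -- of three orders of magnitude.
 starBound-single : starBound n 0 0 0 0 x y 0 ≤ 8 * (n * n * (x * (x * y))) + 4 * (n * n * (y * y)) + 525 * (n * (p * (p * p)))
 starBound-single = begin
  starBound n 0 0 0 0 x y 0 ≡⟨ lem₀ n (n * (x * (n * x))) (n * (n * ((0 + K′) * x))) (n * (n * (y * 2 * (y * 2)))) (n * (K * (K′ * (K′ + 1)))) (n * (K * (K′ * K′))) ⟩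
  n * (x * (n * x)) + n * (n * (K′ * x)) + n * (n * (y * 2 * (y * 2))) + (n * (K * (K′ * (K′ + 1))) + n * (K * (K′ * K′)))
   ≤⟨ +-mono-≤ (+-mono-≤ (+-mono-≤ (*-monoʳ-≤ n (*-monoʳ-≤ x (*-monoʳ-≤ n x≤p))) (*-monoʳ-≤ n (*-monoʳ-≤ n (*-monoˡ-≤ x K′≤)))) (≤-refl {n * (n * (y * 2 * (y * 2)))}))
    (+-mono-≤ (*-monoʳ-≤ n (*≤* K≤ (*≤* K′≤ θ≤))) (*-monoʳ-≤ n (*≤* K≤ (*≤* K′≤ K′≤)))) ⟩
  n * (x * (n * (x * y))) + n * (n * (7 * (x * y) * x)) + n * (n * (y * 2 * (y * 2))) + (n * (5 * p * (7 * p * (8 * p))) + n * (5 * p * (7 * p * (7 * p))))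
   ≡⟨ cong₂ _+_ (lem1 n x y) (lem2 n p) ⟩
  8 * (n * n * (x * (x * y))) + 4 * (n * n * (y * y)) + 525 * (n * (p * (p * p))) ∎
  where
  open ≤-Reasoning
  lem₀ : ∀ n a b c d e → n * (n * (n * 0)) + (n * (n * (n * 0)) + (a + (b + (c + (d + e))))) ≡ a + b + c + (d + e)
  lem₀ = solve-∀
  lem1 : ∀ n x y → n * (x * (n * (x * y))) + n * (n * (7 * (x * y) * x)) + n * (n * (y * 2 * (y * 2))) ≡ 8 * (n * n * (x * (x * y))) + 4 * (n * n * (y * y))
  lem1 = solve-∀
  lem2 : ∀ n p → n * (5 * p * (7 * p * (8 * p))) + n * (5 * p * (7 * p * (7 * p))) ≡ 525 * (n * (p * (p * p)))
  lem2 = solve-∀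

module MiddleLower (g a : ℕ) (g≥ : 1050 ≤ g) (a≥ : 32 * g ≤ a) {n e : ℕ} (1≤n : 1 ≤ n) where

 open ≤-Reasoning

 private
  1≤g : 1 ≤ g
  1≤g = ≤-trans (s≤s z≤n) g≥
  1≤a : 1 ≤ a
  1≤a = ≤-trans (≤-trans 1≤g (m≤m+n g (31 * g))) a≥
  1≤n² : 1 ≤ n * n
  1≤n² = *≤* {1} {n} {1} {n} 1≤n 1≤n

 Big : ℕ → Set
 Big m = (e ^ 3 ≤ a ^ 4 * m ^ 4 * n ^ 6) ⊎ (e ≤ a ^ 3 * m ^ 3 * n)

 big₁ : ∀ {m} → 1 ≤ m → e ≤ a * (n * n) → Big m
 big₁ {m} 1≤m h = inj₁ (begin
  e ^ 3 ≤⟨ ^-monoˡ-≤ 3 h ⟩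
  (a * (n * n)) ^ 3 ≡⟨ lem a n ⟩
  a ^ 3 * 1 * n ^ 6 ≤⟨ *-monoˡ-≤ (n ^ 6) (*≤* (pow-mono 1≤a (n≤1+n 3)) (pow≥1 4 1≤m)) ⟩
  a ^ 4 * m ^ 4 * n ^ 6 ∎)
  where
  lem : ∀ a n → let v = a * (n * n) in (v * (v * (v * 1))) ≡ (a * (a * (a * 1))) * 1 * (n * (n * (n * (n * (n * (n * 1))))))
  lem = solve-∀

 big₂ : ∀ η → e ≤ a * (η ^ 4 * (n * n)) → Big (η * (η * η))
 big₂ η h = inj₁ (begin
  e ^ 3 ≤⟨ ^-monoˡ-≤ 3 h ⟩
  (a * (η ^ 4 * (n * n))) ^ 3 ≡⟨ lem a η n ⟩
  a ^ 3 * (η * (η * η)) ^ 4 * n ^ 6 ≤⟨ *-monoˡ-≤ (n ^ 6) (*-monoˡ-≤ ((η * (η * η)) ^ 4) (pow-mono 1≤a (n≤1+n 3))) ⟩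
  a ^ 4 * (η * (η * η)) ^ 4 * n ^ 6 ∎)
  where
  lem : ∀ a h n → let v = a * ((h * (h * (h * (h * 1)))) * (n * n)) ; w = h * (h * h) in (v * (v * (v * 1))) ≡ (a * (a * (a * 1))) * (w * (w * (w * (w * 1)))) * (n * (n * (n * (n * (n * (n * 1))))))
  lem = solve-∀

 big₃ : ∀ m → e ≤ a * (m ^ 3 * n) → Big m
 big₃ m h = inj₂ (begin
  e ≤⟨ h ⟩
  a * (m ^ 3 * n) ≡⟨ sym (*-assoc a (m ^ 3) n) ⟩
  a * m ^ 3 * n ≤⟨ *-monoˡ-≤ n (*-monoˡ-≤ (m ^ 3) (≤pow 3 (s≤s z≤n) 1≤a)) ⟩
  a ^ 3 * m ^ 3 * n ∎)

 -- With y = η² and x ≤ η both quadratic terms of `starBound-single` are of order at most η⁴n²,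
 -- hence below dn². Only the cubic term then restricts `x` further.
 small-star : ∀ d η x → d * (n * n) ≤ e → 1 ≤ d → 1 ≤ η → 1 ≤ x → x ≤ η → η ^ 4 * g ≤ d → (x * (η * η)) ^ 3 * g ≤ n * d → Achieves n e (x * (η * η))
 small-star d η x de 1≤d 1≤η 1≤x x≤η hη hx = starForest 1 x y 1 , (λ G eq → single-star G x y 0 (<-≤-trans lt (≤-trans de (≤-reflexive (sym eq)))))
   , trans (∥starForest∥ 1 x y 1) (trans (*-identityʳ (1 * x * y)) (cong (_* y) (*-identityˡ x)))
  where
  y A P D : ℕ
  y = η * η
  A = n * n * η ^ 4
  P = n * (x * y * (x * y * (x * y)))
  D = d * (n * n)
  1≤y : 1 ≤ y
  1≤y = *≤* {1} {η} {1} {η} 1≤η 1≤η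
  1≤D : 1 ≤ D
  1≤D = *≤* {1} {d} {1} {n * n} 1≤d 1≤n²
  gA≤ : A * g ≤ D
  gA≤ = ≤-trans (≤-reflexive (lem (n * n) (η ^ 4) g)) (*-monoˡ-≤ (n * n) hη)
   where
   lem : ∀ n h g → n * h * g ≡ h * g * n
   lem = solve-∀
  gP≤ : P * g ≤ D
  gP≤ = ≤-trans (≤-reflexive (lem n (x * y) g)) (≤-trans (*-monoʳ-≤ n hx) (≤-reflexive (lem2 n d)))
   where
   lem : ∀ n p g → n * (p * (p * p)) * g ≡ n * ((p * (p * (p * 1))) * g)
   lem = solve-∀
   lem2 : ∀ n d → n * (n * d) ≡ d * (n * n)
   lem2 = solve-∀
  few : starBound n 0 0 0 0 x y 0 ≤ A * 12 + P * 525
  few = ≤-trans (starBound-single n x y 1≤x 1≤y) (begin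
   8 * (n * n * (x * (x * y))) + 4 * (n * n * (y * y)) + 525 * P
    ≤⟨ +-monoˡ-≤ (525 * P) (+-monoˡ-≤ (4 * (n * n * (y * y))) (*-monoʳ-≤ 8 (*-monoʳ-≤ (n * n) (*≤* x≤η (*-monoˡ-≤ y x≤η))))) ⟩
   8 * (n * n * (η * (η * y))) + 4 * (n * n * (y * y)) + 525 * P ≡⟨ cong₂ _+_ (lem (n * n) η) (*-comm 525 P) ⟩
   A * 12 + P * 525 ∎)
   where
   lem : ∀ n h → 8 * (n * (h * (h * (h * h)))) + 4 * (n * (h * h * (h * h))) ≡ n * (h * (h * (h * (h * 1)))) * 12
   lem = solve-∀
  lt : starBound n 0 0 0 0 x y 0 < D
  lt = *-cancelˡ-< 4 _ _ (begin-strict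
   4 * starBound n 0 0 0 0 x y 0 ≤⟨ *-monoʳ-≤ 4 few ⟩
   4 * (A * 12 + P * 525) ≡⟨ lem A P ⟩
   A * 48 + P * 1050 * 2 ≤⟨ +-mono-≤ (≤-trans (*-monoʳ-≤ A (≤-trans (m≤m+n 48 1002) g≥)) gA≤) (*-monoˡ-≤ 2 (≤-trans (*-monoʳ-≤ P g≥) gP≤)) ⟩
   D + D * 2 <⟨ m<m+n (D + D * 2) 1≤D ⟩
   D + D * 2 + D ≡⟨ lem2 D ⟩
   4 * D ∎)
   where
   lem : ∀ A P → 4 * (A * 12 + P * 525) ≡ A * 48 + P * 1050 * 2
   lem = solve-∀
   lem2 : ∀ D → D + D * 2 + D ≡ 4 * D
   lem2 = solve-∀

 module _ (lo : n ^ 2 ≤ e) (hi : e ≤ n ^ 3) where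

  private
   1≤e : 1 ≤ e
   1≤e = ≤-trans (pow≥1 2 1≤n) lo
   n²≤e : n * n ≤ e
   n²≤e = ≤-trans (≤-reflexive (cong (n *_) (sym (*-identityʳ n)))) lo

   module _ (d : ℕ) (1≤d : 1 ≤ d) (dn² : d * (n * n) ≤ e) (e≤ : e ≤ 2 * (d * (n * n))) where

    d≤n : d ≤ n
    d≤n = cancelʳ (n * n) 1≤n² (≤-trans dn² (≤-trans hi (≤-reflexive (cong (λ x → n * (n * x)) (*-identityʳ n)))))

    -- When `x` can reach `η`, the star has η³ edges, of order d^(3/4): the first term of the
    -- minimum.
    narrow : ∀ η → d ≤ 16 * (η ^ 4 * g) → (∃ λ x → x ≡ η × Achieves n e (x * (η * η))) → ∃ λ m → Achieves n e m × Big m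
    narrow η d≤ (x , refl , ach) = η * (η * η) , ach , big₂ η (begin
     e ≤⟨ e≤ ⟩
     2 * (d * (n * n)) ≤⟨ *-monoʳ-≤ 2 (*-monoˡ-≤ (n * n) d≤) ⟩
     2 * (16 * (η ^ 4 * g) * (n * n)) ≡⟨ lem (η ^ 4) g (n * n) ⟩
     32 * g * (η ^ 4 * (n * n)) ≤⟨ *-monoˡ-≤ (η ^ 4 * (n * n)) a≥ ⟩
     a * (η ^ 4 * (n * n)) ∎)
     where
     lem : ∀ h g n → 2 * (16 * (h * g) * n) ≡ 32 * g * (h * n)
     lem = solve-∀

    -- When the cubic condition stops `x` before `η`, the star has order (nd)^(1/3) edges: the
    -- second term of the minimum.
    wide : ∀ m → n * d ≤ 8 * (m ^ 3 * g) → Achieves n e m → ∃ λ m → Achieves n e m × Big m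
    wide m nd≤ ach = m , ach , big₃ m (begin
     e ≤⟨ e≤ ⟩
     2 * (d * (n * n)) ≡⟨ lem d n ⟩
     2 * (n * (n * d)) ≤⟨ *-monoʳ-≤ 2 (*-monoʳ-≤ n nd≤) ⟩
     2 * (n * (8 * (m ^ 3 * g))) ≡⟨ lem2 n (m ^ 3) g ⟩
     16 * g * (m ^ 3 * n) ≤⟨ *-monoˡ-≤ (m ^ 3 * n) (≤-trans (*-monoˡ-≤ g (m≤m+n 16 16)) a≥) ⟩
     a * (m ^ 3 * n) ∎)
     where
     lem : ∀ d n → 2 * (d * (n * n)) ≡ 2 * (n * (n * d))
     lem = solve-∀
     lem2 : ∀ n m g → 2 * (n * (8 * (m * g))) ≡ 16 * g * (m * n)
     lem2 = solve-∀

    stars : (∃ λ η → η ^ 4 * g ≤ d × d < suc η ^ 4 * g) → ∃ λ m → Achieves n e m × Big m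
    -- For d below `g` the target is bounded by a constant, and a single edge reaches it.
    stars (zero , _ , hi′) = 1 , single-edge 1≤e , big₁ {1} (s≤s z≤n) (begin
     e ≤⟨ e≤ ⟩
     2 * (d * (n * n)) ≡⟨ sym (*-assoc 2 d (n * n)) ⟩
     2 * d * (n * n) ≤⟨ *-monoˡ-≤ (n * n) (≤-trans (*≤* {2} {32} {d} {g} (m≤m+n 2 30) (≤-trans (<⇒≤ hi′) (≤-reflexive (*-identityˡ g)))) a≥) ⟩
     a * (n * n) ∎)
    stars (η@(suc _) , lo′ , hi′) = widen (bounded-max {P = P} (λ x → (x N.≤? η) ×-dec ((x * (η * η)) ^ 3 * g N.≤? n * d)) (z≤n , z≤n) η λ _ → proj₁)
     where
     P : ℕ → Set
     P x = x ≤ η × (x * (η * η)) ^ 3 * g ≤ n * d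
     1≤η : 1 ≤ η
     1≤η = s≤s z≤n
     16≥ : d ≤ 16 * (η ^ 4 * g)
     16≥ = ≤-trans (<⇒≤ hi′) (≤-trans (*-monoˡ-≤ g (≤-trans (^-monoˡ-≤ 4 (suc≤2* 1≤η)) (≤-reflexive (*-^ 2 η 4)))) (≤-reflexive (*-assoc 16 (η ^ 4) g)))
     one : P 1
     one = 1≤η , (begin
      (1 * (η * η)) ^ 3 * g ≡⟨ cong (λ v → v ^ 3 * g) (*-identityˡ (η * η)) ⟩
      (η * η) ^ 3 * g ≤⟨ *≤* (≤-trans (≤-reflexive (sym (*-identityˡ ((η * η) ^ 3)))) (*-monoˡ-≤ ((η * η) ^ 3) (*≤* {1} {η} {1} {η} 1≤η 1≤η))) (≤-trans (≤-reflexive (sym (*-identityʳ g))) (*-monoʳ-≤ g 1≤g)) ⟩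
      η * η * (η * η) ^ 3 * (g * g) ≡⟨ lem η g ⟩
      η ^ 4 * g * (η ^ 4 * g) ≤⟨ *≤* (≤-trans lo′ d≤n) lo′ ⟩
      n * d ∎)
      where
      lem : ∀ h g → let w = h * (h * (h * (h * 1))) ; v = h * h in h * h * (v * (v * (v * 1))) * (g * g) ≡ w * g * (w * g)
      lem = solve-∀
     widen : (∃ λ x → P x × (∀ j → P j → j ≤ x)) → ∃ λ m → Achieves n e m × Big m
     widen (x , (x≤η , hx) , max) = choose (m≤n⇒m<n∨m≡n x≤η)
      where
      1≤x : 1 ≤ x
      1≤x = max 1 one
      ach : Achieves n e (x * (η * η))
      ach = small-star d η x dn² 1≤d 1≤η 1≤x x≤η lo′ hx
      choose : x < η ⊎ x ≡ η → ∃ λ m → Achieves n e m × Big m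
      choose (inj₂ eq) = narrow η 16≥ (x , eq , ach)
      choose (inj₁ lt) = wide (x * (η * η)) (begin
       n * d ≤⟨ <⇒≤ (≰⇒> λ h → <-irrefl refl (max (suc x) (lt , h))) ⟩
       (suc x * (η * η)) ^ 3 * g ≤⟨ *-monoˡ-≤ g (^-monoˡ-≤ 3 (*-monoˡ-≤ (η * η) (suc≤2* 1≤x))) ⟩
       (2 * x * (η * η)) ^ 3 * g ≡⟨ lem x (η * η) g ⟩
       8 * ((x * (η * η)) ^ 3 * g) ∎) ach
       where
       lem : ∀ x y g → let v = 2 * x * y ; w = x * y in (v * (v * (v * 1))) * g ≡ 8 * ((w * (w * (w * 1))) * g)
       lem = solve-∀

  middle-lower : ∃ λ m → Achieves n e m × Big m
  middle-lower = from (divide e (n * n) 1≤n²)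
   where
   root-g : ∀ d → ∃ λ η → η ^ 4 * g ≤ d × d < suc η ^ 4 * g
   root-g d = step (bounded-max {P = λ η → η ^ 4 * g ≤ d} (λ η → η ^ 4 * g N.≤? d) z≤n d λ η h → bound η h)
    where
    bound : ∀ η → η ^ 4 * g ≤ d → η ≤ d
    bound zero _ = z≤n
    bound (suc η) h = ≤-trans (≤pow 4 (s≤s z≤n) (s≤s z≤n)) (≤-trans (≤-trans (≤-reflexive (sym (*-identityʳ (suc η ^ 4)))) (*-monoʳ-≤ (suc η ^ 4) 1≤g)) h)
    step : (∃ λ η → η ^ 4 * g ≤ d × (∀ j → j ^ 4 * g ≤ d → j ≤ η)) → ∃ λ η → η ^ 4 * g ≤ d × d < suc η ^ 4 * g
    step (η , h , max) = η , h , ≰⇒> λ h′ → <-irrefl refl (max (suc η) h′)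
   from : (∃ λ d → d * (n * n) ≤ e × e < suc d * (n * n)) → ∃ λ m → Achieves n e m × Big m
   from (d , dn² , d<) = stars d (quotient-pos {e} {n * n} {d} n²≤e d<) dn² (double-quotient {e} {n * n} {d} n²≤e d<) (root-g d)

-- Star forests for e above n³.

module StarLower (g a s T p A : ℕ) (g≥ : 1050 ≤ g) (a≥ : 32 * g ≤ a) (s≥ : 216 ≤ s) (T≥ : 2 * suc starConstant ≤ T) (p≥ : 96 ≤ p) (A≥ : s * T * a * (s * T * a) ≤ A)
 {n e : ℕ} (n≥ : p ^ 12 ≤ n) (lo : n ^ 3 < e) (hi : e ≤ n ^ 4) where

 open ≤-Reasoning

 private
  1≤p : 1 ≤ p
  1≤p = ≤-trans (s≤s z≤n) p≥
  1≤n : 1 ≤ n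
  1≤n = ≤-trans (pow≥1 12 1≤p) n≥
  1≤s : 1 ≤ s
  1≤s = ≤-trans (s≤s z≤n) s≥
  2≤s : 2 ≤ s
  2≤s = ≤-trans (m≤m+n 2 214) s≥
  1≤T : 1 ≤ T
  1≤T = ≤-trans (*≤* {1} {2} {1} {suc starConstant} (s≤s z≤n) (s≤s z≤n)) T≥
  1≤a : 1 ≤ a
  1≤a = ≤-trans (*≤* {1} {32} {1} {g} (s≤s z≤n) (≤-trans (s≤s z≤n) g≥)) a≥
  1≤e : 1 ≤ e
  1≤e = ≤-trans (s≤s z≤n) lo
  Q : ℕ
  Q = s * T * a
  1≤sT : 1 ≤ s * T
  1≤sT = *≤* {1} {s} {1} {T} 1≤s 1≤T
  sT≤Q : s * T ≤ Q
  sT≤Q = ≤-trans (≤-reflexive (sym (*-identityʳ (s * T)))) (*-monoʳ-≤ (s * T) 1≤a)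
  Ta≤Q : T * a ≤ Q
  Ta≤Q = *-monoˡ-≤ a (≤-trans (≤-reflexive (sym (*-identityˡ T))) (*-monoˡ-≤ T 1≤s))
  1≤Q : 1 ≤ Q
  1≤Q = ≤-trans 1≤sT sT≤Q
  Q^≤A : ∀ r → Q ^ (2 * r) ≤ A ^ r
  Q^≤A r = ≤-trans (≤-reflexive (trans (sym (^-*-assoc Q 2 r)) (cong (λ x → (Q * x) ^ r) (*-identityʳ Q)))) (^-monoˡ-≤ r A≥)

 Big : ℕ → Set
 Big m = (e ^ 4 ≤ A ^ 3 * m ^ 3 * n ^ 10) ⊎ (e ≤ A ^ 4 * m ^ 4)

 private
  -- At e = n³ either alternative of the middle range gives at least order n^(2/3) edges, which is
  -- the value of e^(4/3)/n^(10/3) as long as e is of order n³.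
  from-middle : ∀ {m} → e ≤ T * n ^ 3 → ((n ^ 3) ^ 3 ≤ a ^ 4 * m ^ 4 * n ^ 6) ⊎ (n ^ 3 ≤ a ^ 3 * m ^ 3 * n) → Big m
  from-middle {m} e≤ alt = inj₁ (begin
   e ^ 4 ≤⟨ ^-monoˡ-≤ 4 e≤ ⟩
   (T * n ^ 3) ^ 4 ≡⟨ lem T n ⟩
   T ^ 4 * (n * n) * n ^ 10 ≤⟨ *-monoˡ-≤ (n ^ 10) (*-monoʳ-≤ (T ^ 4) (n²≤ alt)) ⟩
   T ^ 4 * (a ^ 4 * m ^ 3) * n ^ 10 ≡⟨ cong (_* n ^ 10) (trans (sym (*-assoc (T ^ 4) (a ^ 4) (m ^ 3))) (cong (_* m ^ 3) (sym (*-^ T a 4)))) ⟩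
   (T * a) ^ 4 * m ^ 3 * n ^ 10 ≤⟨ *-monoˡ-≤ (n ^ 10) (*-monoˡ-≤ (m ^ 3) (≤-trans (^-monoˡ-≤ 4 Ta≤Q) (≤-trans (pow-mono 1≤Q (m≤m+n 4 2)) (Q^≤A 3)))) ⟩
   A ^ 3 * m ^ 3 * n ^ 10 ∎)
   where
   lem : ∀ T n → let v = T * (n * (n * (n * 1))) in (v * (v * (v * (v * 1)))) ≡ (T * (T * (T * (T * 1)))) * (n * n) * (n * (n * (n * (n * (n * (n * (n * (n * (n * (n * 1))))))))))
   lem = solve-∀
   lem2 : ∀ n → (n * (n * (n * 1))) ≡ n * n * n
   lem2 = solve-∀
   lem3 : ∀ n → let v = (n * (n * (n * 1))) in n * (n * n) * (n * (n * (n * (n * (n * (n * 1)))))) ≡ (v * (v * (v * 1)))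
   lem3 = solve-∀
   lem4 : ∀ n → let v = n * n ; w = n * (n * n) in (v * (v * (v * (v * 1)))) * n ≡ (w * (w * (w * 1)))
   lem4 = solve-∀
   n²≤ : ((n ^ 3) ^ 3 ≤ a ^ 4 * m ^ 4 * n ^ 6) ⊎ (n ^ 3 ≤ a ^ 3 * m ^ 3 * n) → n * n ≤ a ^ 4 * m ^ 3
   n²≤ (inj₂ h) = ≤-trans (cancelʳ {n * n} {a ^ 3 * m ^ 3} n 1≤n (≤-trans (≤-reflexive (sym (lem2 n))) h)) (*-monoˡ-≤ (m ^ 3) (pow-mono 1≤a (n≤1+n 3)))
   n²≤ (inj₁ h) = pow-cancel-≤ {n * n} {a ^ 4 * m ^ 3} 4 (begin
    (n * n) ^ 4 ≤⟨ ≤-trans (≤-reflexive (sym (*-identityʳ ((n * n) ^ 4)))) (*-monoʳ-≤ ((n * n) ^ 4) 1≤n) ⟩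
    (n * n) ^ 4 * n ≡⟨ lem4 n ⟩
    (n * (n * n)) ^ 3 ≤⟨ ^-monoˡ-≤ 3 (cancelʳ {n * (n * n)} {a ^ 4 * m ^ 4} (n ^ 6) (pow≥1 6 1≤n) (≤-trans (≤-reflexive (lem3 n)) h)) ⟩
    (a ^ 4 * m ^ 4) ^ 3 ≡⟨ trans (*-^ (a ^ 4) (m ^ 4) 3) (cong ((a ^ 4) ^ 3 *_) (trans (^-*-assoc m 4 3) (sym (^-*-assoc m 3 4)))) ⟩
    (a ^ 4) ^ 3 * (m ^ 3) ^ 4 ≤⟨ *-monoˡ-≤ ((m ^ 3) ^ 4) (pow-mono (pow≥1 4 1≤a) (n≤1+n 3)) ⟩
    (a ^ 4) ^ 4 * (m ^ 3) ^ 4 ≡⟨ sym (*-^ (a ^ 4) (m ^ 3) 4) ⟩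
    (a ^ 4 * m ^ 3) ^ 4 ∎) (s≤s z≤n)

  sparse : e ≤ T * n ^ 3 → ∃ λ m → Achieves n e m × Big m
  sparse e≤ = from (MiddleLower.middle-lower g a g≥ a≥ {n} {n ^ 3} 1≤n (pow-mono 1≤n (n≤1+n 2)) ≤-refl)
   where
   from : (∃ λ m → Achieves n (n ^ 3) m × (((n ^ 3) ^ 3 ≤ a ^ 4 * m ^ 4 * n ^ 6) ⊎ (n ^ 3 ≤ a ^ 3 * m ^ 3 * n))) → ∃ λ m → Achieves n e m × Big m
   from (m , (H , un , eq) , alt) = m , (H , unavoidable-mono {H = H} (<⇒≤ lo) un , eq) , from-middle {m} e≤ alt

  -- The number of stars is `τ`, and `w` will be chosen with w³τ of order n. The two conditions keep
  -- the dominant terms τn³ and τ⁸w⁸ of the covering below e; the cube of the second is τ¹⁶(w³τ)⁸.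
  P : ℕ → Set
  P τ = τ * (T * n ^ 3) ≤ e × τ ^ 16 * (T ^ 3 * n ^ 8) ≤ e ^ 3

  P? : ∀ τ → Dec (P τ)
  P? τ = (τ * (T * n ^ 3) N.≤? e) ×-dec (τ ^ 16 * (T ^ 3 * n ^ 8) N.≤? e ^ 3)

  module _ (τ : ℕ) (1≤τ : 1 ≤ τ) (Pτ : P τ) (stop : ¬ P (suc τ)) where

   τ⁴≤n : τ ^ 4 ≤ n
   τ⁴≤n = pow-cancel-≤ {τ ^ 4} {n} 4 (cancelʳ {(τ ^ 4) ^ 4} {n ^ 4} (n ^ 8) (pow≥1 8 1≤n) (begin
    (τ ^ 4) ^ 4 * n ^ 8 ≡⟨ cong (_* n ^ 8) (^-*-assoc τ 4 4) ⟩
    τ ^ 16 * n ^ 8 ≤⟨ *-monoʳ-≤ (τ ^ 16) (≤-trans (≤-reflexive (sym (*-identityˡ (n ^ 8)))) (*-monoˡ-≤ (n ^ 8) (pow≥1 3 1≤T))) ⟩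
    τ ^ 16 * (T ^ 3 * n ^ 8) ≤⟨ proj₂ Pτ ⟩
    e ^ 3 ≤⟨ ^-monoˡ-≤ 3 hi ⟩
    (n ^ 4) ^ 3 ≡⟨ trans (^-*-assoc n 4 3) (^-distribˡ-+-* n 4 8) ⟩
    n ^ 4 * n ^ 8 ∎)) (s≤s z≤n)

   -- As `τ` is at most n^(1/4), n/τ is still large, which permits a `w` of at least 32 as the
   -- pruning demands.
   fits-32 : (3 * 32) ^ 3 * τ ≤ n
   fits-32 = ≤-trans (*-monoˡ-≤ τ (^-monoˡ-≤ 3 p≥)) (pow-cancel-≤ {p ^ 3 * τ} {n} 4 (begin
    (p ^ 3 * τ) ^ 4 ≡⟨ trans (*-^ (p ^ 3) τ 4) (cong (_* τ ^ 4) (^-*-assoc p 3 4)) ⟩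
    p ^ 12 * τ ^ 4 ≤⟨ *≤* n≥ (≤-trans τ⁴≤n (≤pow 3 (s≤s z≤n) 1≤n)) ⟩
    n ^ 4 ∎) (s≤s z≤n))

   module _ (w : ℕ) (32≤w : 32 ≤ w) (wτ≤ : (3 * w) ^ 3 * τ ≤ n) (w-max : n ≤ (3 * suc w) ^ 3 * τ) where

    private
     u m M : ℕ
     u = 3 * w
     m = τ * w * w * τ
     M = τ * n ^ 3

    D≤ : τ ^ 8 * u ^ 8 * T ≤ e
    D≤ = pow-cancel-≤ {τ ^ 8 * u ^ 8 * T} {e} 3 (begin
     (τ ^ 8 * u ^ 8 * T) ^ 3 ≡⟨ trans (lem (τ ^ 8) (u ^ 8) T) (cong₂ (λ v w → v * (T ^ 3 * w)) (sym (^-distribˡ-+-* τ 8 8))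
      (trans (cong (_* τ ^ 8) (trans (^-*-assoc u 8 3) (sym (^-*-assoc u 3 8)))) (sym (*-^ (u ^ 3) τ 8)))) ⟩
     τ ^ 16 * (T ^ 3 * (u ^ 3 * τ) ^ 8) ≤⟨ *-monoʳ-≤ (τ ^ 16) (*-monoʳ-≤ (T ^ 3) (^-monoˡ-≤ 8 wτ≤)) ⟩
     τ ^ 16 * (T ^ 3 * n ^ 8) ≤⟨ proj₂ Pτ ⟩
     e ^ 3 ∎) (s≤s z≤n)
     where
     lem : ∀ t u T → let v = t * u * T in (v * (v * (v * 1))) ≡ t * t * ((T * (T * (T * 1))) * ((u * (u * (u * 1))) * t))
     lem = solve-∀

    enough : (τ * n ^ 3 + τ ^ 8 * u ^ 8) * suc starConstant ≤ e
    enough = *-cancelˡ-≤ 2 (begin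
     2 * ((M + τ ^ 8 * u ^ 8) * suc starConstant) ≡⟨ lem M (τ ^ 8 * u ^ 8) (suc starConstant) ⟩
     M * (2 * suc starConstant) + τ ^ 8 * u ^ 8 * (2 * suc starConstant) ≤⟨ +-mono-≤ (*-monoʳ-≤ M T≥) (*-monoʳ-≤ (τ ^ 8 * u ^ 8) T≥) ⟩
     M * T + τ ^ 8 * u ^ 8 * T ≤⟨ +-mono-≤ (≤-trans (≤-reflexive (lem2 τ (n ^ 3) T)) (proj₁ Pτ)) D≤ ⟩
     e + e ≡⟨ cong (e +_) (sym (+-identityʳ e)) ⟩
     2 * e ∎)
     where
     lem : ∀ a b c → 2 * ((a + b) * c) ≡ a * (2 * c) + b * (2 * c)
     lem = solve-∀
     lem2 : ∀ a b c → a * b * c ≡ a * (c * b)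
     lem2 = solve-∀

    achieved : Achieves n e m
    achieved = starForest τ w w τ , (λ G eq → ManyStars.many-stars-contains n τ w 1≤τ 32≤w wτ≤ G (≤-trans enough (≤-reflexive (sym eq)))) , ∥starForest∥ τ w w τ

    -- The forest has τ²w² edges, and the cube of this is τ⁴(w³τ)². By the maximality of `w`, n is
    -- at most `s` times w³τ, where `s` covers the cube of 3(w + 1) ≤ 6w.
    τ⁴n²≤ : τ ^ 4 * (n * n) ≤ s * s * m ^ 3
    τ⁴n²≤ = begin
     τ ^ 4 * (n * n) ≤⟨ *-monoʳ-≤ (τ ^ 4) (*≤* n≤ n≤) ⟩
     τ ^ 4 * (s * (w ^ 3 * τ) * (s * (w ^ 3 * τ))) ≡⟨ lem2 τ s w ⟩
     s * s * m ^ 3 ∎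
     where
     lem : ∀ w t → let v = 3 * (2 * w) in (v * (v * (v * 1))) * t ≡ 216 * ((w * (w * (w * 1))) * t)
     lem = solve-∀
     lem2 : ∀ t s w → let v = t * w * w * t in (t * (t * (t * (t * 1)))) * (s * ((w * (w * (w * 1))) * t) * (s * ((w * (w * (w * 1))) * t))) ≡ s * s * (v * (v * (v * 1)))
     lem2 = solve-∀
     n≤ : n ≤ s * (w ^ 3 * τ)
     n≤ = ≤-trans w-max (≤-trans (*-monoˡ-≤ τ (^-monoˡ-≤ 3 (*-monoʳ-≤ 3 (suc≤2* (≤-trans (s≤s z≤n) 32≤w)))))
      (≤-trans (≤-reflexive (lem w τ)) (*-monoˡ-≤ (w ^ 3 * τ) s≥)))

    sτ : suc τ ≤ s * τ
    sτ = ≤-trans (suc≤2* 1≤τ) (*-monoˡ-≤ τ 2≤s)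

    -- If the first condition stops `τ`, then `τ` is of order e/n³, and m³ of order at least τ⁴n²
    -- becomes e⁴/n¹⁰.
    many-copies : e ≤ suc τ * (T * n ^ 3) → Big m
    many-copies h = inj₁ (begin
     e ^ 4 ≤⟨ ^-monoˡ-≤ 4 (≤-trans h (*-monoˡ-≤ (T * n ^ 3) sτ)) ⟩
     (s * τ * (T * n ^ 3)) ^ 4 ≡⟨ lem s τ T n ⟩
     s ^ 4 * T ^ 4 * (τ ^ 4 * (n * n)) * n ^ 10 ≤⟨ *-monoˡ-≤ (n ^ 10) (*-monoʳ-≤ (s ^ 4 * T ^ 4) τ⁴n²≤) ⟩
     s ^ 4 * T ^ 4 * (s * s * m ^ 3) * n ^ 10 ≡⟨ lem2 s T (m ^ 3) (n ^ 10) ⟩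
     s ^ 6 * T ^ 4 * m ^ 3 * n ^ 10 ≤⟨ *-monoˡ-≤ (n ^ 10) (*-monoˡ-≤ (m ^ 3) (≤-trans (*-monoʳ-≤ (s ^ 6) (pow-mono 1≤T (m≤m+n 4 2)))
      (≤-trans (≤-reflexive (sym (*-^ s T 6))) (≤-trans (^-monoˡ-≤ 6 sT≤Q) (Q^≤A 3))))) ⟩
     A ^ 3 * m ^ 3 * n ^ 10 ∎)
     where
     lem : ∀ s t T n → let v = s * t * (T * (n * (n * (n * 1)))) in (v * (v * (v * (v * 1)))) ≡ (s * (s * (s * (s * 1)))) * (T * (T * (T * (T * 1)))) * ((t * (t * (t * (t * 1)))) * (n * n)) * (n * (n * (n * (n * (n * (n * (n * (n * (n * (n * 1))))))))))
     lem = solve-∀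
     lem2 : ∀ s T m n → let w = s * (s * (s * (s * 1))) ; v = T * (T * (T * (T * 1))) in w * v * (s * s * m) * n ≡ (s * (s * w)) * v * m * n
     lem2 = solve-∀

    -- If the second condition stops `τ`, then e³ is at most of order (τ⁴n²)⁴, hence of order m¹².
    many-vertices : e ^ 3 ≤ suc τ ^ 16 * (T ^ 3 * n ^ 8) → Big m
    many-vertices h = inj₂ (pow-cancel-≤ {e} {A ^ 4 * m ^ 4} 3 (begin
     e ^ 3 ≤⟨ ≤-trans h (*-monoˡ-≤ (T ^ 3 * n ^ 8) (^-monoˡ-≤ 16 sτ)) ⟩
     (s * τ) ^ 16 * (T ^ 3 * n ^ 8) ≡⟨ trans (cong (_* (T ^ 3 * n ^ 8)) (*-^ s τ 16)) (lem (s ^ 16) τ (T ^ 3) n) ⟩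
     s ^ 16 * T ^ 3 * (τ ^ 4 * (n * n)) ^ 4 ≤⟨ *-monoʳ-≤ (s ^ 16 * T ^ 3) (^-monoˡ-≤ 4 τ⁴n²≤) ⟩
     s ^ 16 * T ^ 3 * (s * s * m ^ 3) ^ 4 ≡⟨ lem2 s (T ^ 3) m ⟩
     s ^ 24 * T ^ 3 * (m ^ 4) ^ 3 ≤⟨ *-monoˡ-≤ ((m ^ 4) ^ 3) (≤-trans (*-monoʳ-≤ (s ^ 24) (pow-mono 1≤T (m≤m+n 3 21)))
      (≤-trans (≤-reflexive (sym (*-^ s T 24))) (≤-trans (^-monoˡ-≤ 24 sT≤Q) (Q^≤A 12)))) ⟩
     A ^ 12 * (m ^ 4) ^ 3 ≡⟨ trans (cong (_* (m ^ 4) ^ 3) (sym (^-*-assoc A 4 3))) (sym (*-^ (A ^ 4) (m ^ 4) 3)) ⟩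
     (A ^ 4 * m ^ 4) ^ 3 ∎) (s≤s z≤n))
     where
     lem : ∀ s t T n → let w = t * (t * (t * (t * 1))) ; v = w * (n * n) in s * (t * (t * (t * (t * (t * (t * (t * (t * (t * (t * (t * (t * w)))))))))))) * (T * (n * (n * (n * (n * (n * (n * (n * (n * 1))))))))) ≡ s * T * (v * (v * (v * (v * 1))))
     lem = solve-∀
     lem2 : ∀ s T m → let x′ = s * (s * (s * (s * (s * (s * (s * (s * (s * (s * (s * (s * (s * (s * (s * (s * 1))))))))))))))) ; v = s * s * (m * (m * (m * 1))) ; w = (m * (m * (m * (m * 1)))) in x′ * T * (v * (v * (v * (v * 1)))) ≡ (s * (s * (s * (s * (s * (s * (s * (s * x′)))))))) * T * (w * (w * (w * 1)))
     lem2 = solve-∀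

    large : ∃ λ m → Achieves n e m × Big m
    large = m , achieved , [ many-copies , (λ h → [ many-vertices , (λ h′ → ⊥-elim (stop (h , h′))) ]′ (≤-total (e ^ 3) (suc τ ^ 16 * (T ^ 3 * n ^ 8)))) ]′
     (≤-total e (suc τ * (T * n ^ 3)))

   dense-stars : ∃ λ m → Achieves n e m × Big m
   dense-stars = from (bounded-max {P = λ w → (3 * w) ^ 3 * τ ≤ n} (λ w → (3 * w) ^ 3 * τ N.≤? n) z≤n n bound)
    where
    bound : ∀ w → (3 * w) ^ 3 * τ ≤ n → w ≤ n
    bound zero _ = z≤n
    bound w@(suc _) h = ≤-trans (≤-trans (≤-trans (m≤n*m w 3) (≤pow {3 * w} 3 (s≤s z≤n) (s≤s z≤n)))
     (≤-trans (≤-reflexive (sym (*-identityʳ ((3 * w) ^ 3)))) (*-monoʳ-≤ ((3 * w) ^ 3) 1≤τ))) h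
    from : (∃ λ w → (3 * w) ^ 3 * τ ≤ n × (∀ j → (3 * j) ^ 3 * τ ≤ n → j ≤ w)) → ∃ λ m → Achieves n e m × Big m
    from (w , h , max) = large w (max 32 fits-32) h (<⇒≤ (≰⇒> λ h′ → <-irrefl refl (max (suc w) h′)))

  abundant : T * n ^ 3 ≤ e → ∃ λ m → Achieves n e m × Big m
  abundant h = from (bounded-max {P = P} P? (z≤n , z≤n) e λ τ Pτ → ≤-trans (m≤m*n τ (T * n ^ 3) {{N.>-nonZero 1≤Tn³}}) (proj₁ Pτ))
   where
   1≤Tn³ : 1 ≤ T * n ^ 3
   1≤Tn³ = *≤* {1} {T} {1} {n ^ 3} 1≤T (pow≥1 3 1≤n)
   P₁ : P 1
   P₁ = ≤-trans (≤-reflexive (*-identityˡ (T * n ^ 3))) h , (begin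
    1 ^ 16 * (T ^ 3 * n ^ 8) ≡⟨ *-identityˡ (T ^ 3 * n ^ 8) ⟩
    T ^ 3 * n ^ 8 ≤⟨ *-monoʳ-≤ (T ^ 3) (pow-mono 1≤n (n≤1+n 8)) ⟩
    T ^ 3 * n ^ 9 ≡⟨ trans (cong (T ^ 3 *_) (sym (^-*-assoc n 3 3))) (sym (*-^ T (n ^ 3) 3)) ⟩
    (T * n ^ 3) ^ 3 ≤⟨ ^-monoˡ-≤ 3 h ⟩
    e ^ 3 ∎)
   from : (∃ λ τ → P τ × (∀ j → P j → j ≤ τ)) → ∃ λ m → Achieves n e m × Big m
   from (τ , Pτ , max) = dense-stars τ (max 1 P₁) Pτ λ h′ → <-irrefl refl (max (suc τ) h′)

 star-lower : ∃ λ m → Achieves n e m × Big m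
 star-lower = [ sparse , abundant ]′ (≤-total e (T * n ^ 3))

-- Complete 4-partite pieces for e close to n⁴.

boost-≤ : ∀ {l P a b} → 1 ≤ l → P ≤ 2 ^ a → 2 + a ≤ b → boost l P ≤ 2 ^ (b * (2 * l))
boost-≤ {l} {P} {a} {b} 1≤l hP hb = begin
 boost l P ≡⟨ boost≡ l P ⟩
 (4 * P) ^ suc l ≤⟨ ^-monoˡ-≤ (suc l) (≤-trans (*-monoʳ-≤ 4 hP) (≤-trans (≤-reflexive (sym (^-distribˡ-+-* 2 2 a))) (pow-mono {2} {2 + a} {b} (s≤s z≤n) hb))) ⟩
 (2 ^ b) ^ suc l ≡⟨ ^-*-assoc 2 b (suc l) ⟩
 2 ^ (b * suc l) ≤⟨ pow-mono {2} {b * suc l} {b * (2 * l)} (s≤s z≤n) (*-monoʳ-≤ b (suc≤2* 1≤l)) ⟩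
 2 ^ (b * (2 * l)) ∎
 where open ≤-Reasoning

-- Each round multiplies the exponent by about 2l; the coefficients 2, 5 and 11 absorb the additive
-- constants because `λ′` is at least 10.
density₃-≤ : ∀ {λ′ l} → 10 ≤ λ′ → 1 ≤ l → density₃ (2 ^ (8 + λ′)) l ≤ 2 ^ (22 * (λ′ * (l * (l * l))))
density₃-≤ {λ′} {l} 10≤λ 1≤l = ≤-trans (boost-≤ {l} {boost l (boost l P)} {b₂ * (2 * l)} {b₃} 1≤l
  (boost-≤ {l} {boost l P} {b₁ * (2 * l)} {b₂} 1≤l (boost-≤ {l} {P} {8 + λ′} {b₁} 1≤l ≤-refl h₁) h₂) h₃) (≤-reflexive (cong (2 ^_) (lem3 λ′ l)))
 where
 P b₁ b₂ b₃ : ℕ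
 P = 2 ^ (8 + λ′)
 b₁ = 2 * λ′
 b₂ = 5 * (λ′ * l)
 b₃ = 11 * (λ′ * (l * l))
 lem1 : ∀ a l → a * l + 2 * a * (2 * l) ≡ 5 * (a * l)
 lem1 = solve-∀
 lem2 : ∀ a l → a * (l * l) + 5 * (a * l) * (2 * l) ≡ 11 * (a * (l * l))
 lem2 = solve-∀
 lem3 : ∀ a l → 11 * (a * (l * l)) * (2 * l) ≡ 22 * (a * (l * (l * l)))
 lem3 = solve-∀
 2≤λl : 2 ≤ λ′ * l
 2≤λl = *≤* {2} {λ′} {1} {l} (≤-trans (m≤m+n 2 8) 10≤λ) 1≤l
 h₁ : 2 + (8 + λ′) ≤ b₁
 h₁ = ≤-trans (+-monoˡ-≤ λ′ 10≤λ) (≤-reflexive (cong (λ′ +_) (sym (+-identityʳ λ′))))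
 h₂ : 2 + b₁ * (2 * l) ≤ b₂
 h₂ = ≤-trans (+-monoˡ-≤ (b₁ * (2 * l)) 2≤λl) (≤-reflexive (lem1 λ′ l))
 h₃ : 2 + b₂ * (2 * l) ≤ b₃
 h₃ = ≤-trans (+-monoˡ-≤ (b₂ * (2 * l)) (*≤* {2} {λ′} {1} {l * l} (≤-trans (m≤m+n 2 8) 10≤λ) (*≤* {1} {l} {1} {l} 1≤l 1≤l))) (≤-reflexive (lem2 λ′ l))

-- With l³ of order L/λ′, t of order e/(ln³) and q of order e^(1/4)/t, a forest of `t` copies of
-- K(l,l,l,q) has tl³q edges, which is of order e^(1/4)L/λ′.
module BlobLower (X Y A : ℕ) (X≥ : 160 ≤ X) (Y≥ : 1536 ≤ Y) (A≥ : X * Y ≤ A)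
 {n e λ′ L : ℕ} (12≤n : 12 ≤ n) (1≤e : 1 ≤ e) (10≤λ : 10 ≤ λ′) (sparse : 16 * e ≤ n ^ 4) (dense : 2 * n ^ 4 ≤ 2 ^ (8 + λ′) * e)
 (2^L≤n : 2 ^ L ≤ n) (λ≤L : 192 * λ′ ≤ L) where

 open ≤-Reasoning

 private
  P : ℕ
  P = 2 ^ (8 + λ′)
  1≤P : 1 ≤ P
  1≤P = pow≥1 {2} (8 + λ′) (s≤s z≤n)
  1≤n : 1 ≤ n
  1≤n = ≤-trans (s≤s z≤n) 12≤n
  1≤λ : 1 ≤ λ′
  1≤λ = ≤-trans (s≤s z≤n) 10≤λ

 module _ (l : ℕ) (1≤l : 1 ≤ l) (l-lo : l ^ 3 * (192 * λ′) ≤ L) (l-hi : L ≤ suc l ^ 3 * (192 * λ′)) where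

  private
   M : ℕ
   M = λ′ * (l * (l * l))
   1≤ll : 1 ≤ l * l
   1≤ll = *≤* {1} {l} {1} {l} 1≤l 1≤l
   1≤lll : 1 ≤ l * (l * l)
   1≤lll = *≤* {1} {l} {1} {l * l} 1≤l 1≤ll
   λ≤M : λ′ ≤ M
   λ≤M = ≤-trans (≤-reflexive (sym (*-identityʳ λ′))) (*-monoʳ-≤ λ′ 1≤lll)
   l≤M : l ≤ M
   l≤M = ≤-trans (≤-trans (≤-trans (≤-reflexive (sym (*-identityʳ l))) (*-monoʳ-≤ l 1≤ll)) (≤-reflexive (sym (*-identityˡ (l * (l * l)))))) (*-monoˡ-≤ (l * (l * l)) 1≤λ)
   1≤N : 1 ≤ l * (n * (n * n))
   1≤N = *≤* {1} {l} {1} {n * (n * n)} 1≤l (*≤* {1} {n} {1} {n * n} 1≤n (*≤* {1} {n} {1} {n} 1≤n 1≤n))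
   -- The choice of `l` means that `192 * M` is at most `L`, so that `2 ^ M` is at most a small
   -- power of n.
   power≤n : ∀ j → j ≤ 192 → 2 ^ (j * M) ≤ n
   power≤n j le = ≤-trans (pow-mono {2} {j * M} {L} (s≤s z≤n) (≤-trans (*-monoˡ-≤ M le) (≤-trans (≤-reflexive (lem λ′ l)) l-lo))) 2^L≤n
    where
    lem : ∀ a l → 192 * (a * (l * (l * l))) ≡ (l * (l * (l * 1))) * (192 * a)
    lem = solve-∀
   16Pl≤ : 16 * (P * l) ≤ 2 ^ (4 * M)
   16Pl≤ = begin
    16 * (P * l) ≤⟨ *≤* {16} {2 ^ M} {P * l} (pow-mono {2} {4} {M} (s≤s z≤n) (≤-trans (≤-trans (m≤m+n 4 6) 10≤λ) λ≤M))
     (*≤* {P} {2 ^ (M + M)} {l} {2 ^ M} (pow-mono {2} {8 + λ′} {M + M} (s≤s z≤n) (+-mono-≤ (≤-trans (≤-trans (m≤m+n 8 2) 10≤λ) λ≤M) λ≤M)) (≤-trans l≤M (<⇒≤ (n<2^n M)))) ⟩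
    2 ^ M * (2 ^ (M + M) * 2 ^ M) ≡⟨ trans (cong (2 ^ M *_) (sym (^-distribˡ-+-* 2 (M + M) M))) (trans (sym (^-distribˡ-+-* 2 M (M + M + M))) (cong (2 ^_) (lem M))) ⟩
    2 ^ (4 * M) ∎
    where
    lem : ∀ m → m + (m + m + m) ≡ 4 * m
    lem = solve-∀
   16Pl≤n : 16 * (P * l) ≤ n
   16Pl≤n = ≤-trans 16Pl≤ (power≤n 4 (m≤m+n 4 188))

   one-blob : 24 * (l * (n * (n * n))) ≤ e
   one-blob = cancelʳ {24 * (l * (n * (n * n)))} {e} P 1≤P (begin
    24 * (l * (n * (n * n))) * P ≤⟨ *-monoˡ-≤ P (*-monoˡ-≤ (l * (n * (n * n))) (m≤m+n 24 8)) ⟩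
    32 * (l * (n * (n * n))) * P ≡⟨ lem P l n ⟩
    2 * (16 * (P * l) * (n * (n * n))) ≤⟨ *-monoʳ-≤ 2 (*-monoˡ-≤ (n * (n * n)) 16Pl≤n) ⟩
    2 * (n * (n * (n * n))) ≡⟨ cong (λ v → 2 * (n * (n * (n * v)))) (sym (*-identityʳ n)) ⟩
    2 * n ^ 4 ≤⟨ dense ⟩
    P * e ≡⟨ *-comm P e ⟩
    e * P ∎)
    where
    lem : ∀ P l n → 32 * (l * (n * (n * n))) * P ≡ 2 * (16 * (P * l) * (n * (n * n)))
    lem = solve-∀

  module _ (t κ q : ℕ) (t-lo : t * (24 * (l * (n * (n * n)))) ≤ e) (t-hi : e ≤ 2 * (t * (24 * (l * (n * (n * n)))))) (1≤t : 1 ≤ t)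
   (κ⁴ : κ ^ 4 ≤ e) (κ< : e < suc κ ^ 4) (q-lo : q * (40 * t) ≤ κ) (q-hi : κ < suc q * (40 * t)) where

   private
    N : ℕ
    N = n * (n * n)
    N⁴ : N ^ 4 ≡ (n ^ 4) ^ 3
    N⁴ = lem n
     where
     lem : ∀ n → let v = n * (n * n) ; w = (n * (n * (n * (n * 1)))) in (v * (v * (v * (v * 1)))) ≡ (w * (w * (w * 1)))
     lem = solve-∀
    1≤N⁴ : 1 ≤ N ^ 4
    1≤N⁴ = pow≥1 4 (*≤* {1} {n} {1} {n * n} 1≤n (*≤* {1} {n} {1} {n} 1≤n 1≤n))

   -- By the choice of `t`, 40tln³ is at most 2e. Fourth powers and 16e ≤ n⁴ turn this into (40tl)⁴
   -- ≤ e, so 40tl is at most `κ`.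
   l≤q : l ≤ q
   l≤q = ≮⇒≥ λ lt → <⇒≱ q-hi (≤-trans (*-monoˡ-≤ (40 * t) lt) fits)
    where
    lem : ∀ l t N → l * (40 * t) * N ≡ 40 * (t * (l * N))
    lem = solve-∀
    lem2 : ∀ l t N → 48 * (t * (l * N)) ≡ 2 * (t * (24 * (l * N)))
    lem2 = solve-∀
    lem3 : ∀ e → let v = 2 * e in (v * (v * (v * (v * 1)))) ≡ e * (16 * (e * (e * (e * 1))))
    lem3 = solve-∀
    lem4 : ∀ e → let v = 16 * e in (v * (v * (v * 1))) ≡ 16 * (16 * (16 * (e * (e * (e * 1)))))
    lem4 = solve-∀
    step : (l * (40 * t)) ^ 4 ≤ e
    step = cancelʳ {(l * (40 * t)) ^ 4} {e} (N ^ 4) 1≤N⁴ (begin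
     (l * (40 * t)) ^ 4 * N ^ 4 ≡⟨ sym (*-^ (l * (40 * t)) N 4) ⟩
     (l * (40 * t) * N) ^ 4 ≤⟨ ^-monoˡ-≤ 4 (≤-trans (≤-reflexive (lem l t N)) (≤-trans (*-monoˡ-≤ (t * (l * N)) (m≤m+n 40 8)) (≤-trans (≤-reflexive (lem2 l t N)) (*-monoʳ-≤ 2 t-lo)))) ⟩
     (2 * e) ^ 4 ≡⟨ lem3 e ⟩
     e * (16 * e ^ 3) ≤⟨ *-monoʳ-≤ e (≤-trans (m≤n*m (16 * e ^ 3) 16) (≤-trans (m≤n*m (16 * (16 * e ^ 3)) 16) (≤-reflexive (sym (lem4 e))))) ⟩
     e * (16 * e) ^ 3 ≤⟨ *-monoʳ-≤ e (^-monoˡ-≤ 3 sparse) ⟩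
     e * (n ^ 4) ^ 3 ≡⟨ cong (e *_) (sym N⁴) ⟩
     e * N ^ 4 ∎)
    fits : l * (40 * t) ≤ κ
    fits = ≮⇒≥ λ lt → <⇒≱ κ< (≤-trans (^-monoˡ-≤ 4 lt) step)

   -- As `t` is of order e/(ln³), `q` is at most of order ln³/e^(3/4), and 2n⁴ ≤ Pe makes this at
   -- most of order P^(3/4)l.
   q≤2Pl : q ≤ 2 * (P * l)
   q≤2Pl = pow-cancel-≤ {q} {2 * (P * l)} 4 (≤-trans (cancelʳ {q ^ 4} {2 * (P ^ 3 * l ^ 4)} (e * N ^ 4 * 8) 1≤eN (begin
    q ^ 4 * (e * N ^ 4 * 8) ≡⟨ cong (λ v → q ^ 4 * (e * v * 8)) N⁴ ⟩
    q ^ 4 * (e * (n ^ 4) ^ 3 * 8) ≡⟨ lem q e (n ^ 4) ⟩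
    q ^ 4 * e * (2 * n ^ 4) ^ 3 ≤⟨ *-monoʳ-≤ (q ^ 4 * e) (^-monoˡ-≤ 3 dense) ⟩
    q ^ 4 * e * (P * e) ^ 3 ≡⟨ lem2 q e P ⟩
    (q * e) ^ 4 * P ^ 3 ≤⟨ *-monoˡ-≤ (P ^ 3) (^-monoˡ-≤ 4 qe≤) ⟩
    (2 * (κ * (l * N))) ^ 4 * P ^ 3 ≡⟨ lem3 κ l N P ⟩
    16 * (κ ^ 4 * (P ^ 3 * l ^ 4 * N ^ 4)) ≤⟨ *-monoʳ-≤ 16 (*-monoˡ-≤ (P ^ 3 * l ^ 4 * N ^ 4) κ⁴) ⟩
    16 * (e * (P ^ 3 * l ^ 4 * N ^ 4)) ≡⟨ lem4 e (P ^ 3 * l ^ 4) (N ^ 4) ⟩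
    2 * (P ^ 3 * l ^ 4) * (e * N ^ 4 * 8) ∎)) (begin
    2 * (P ^ 3 * l ^ 4) ≤⟨ *≤* {2} {16} (m≤m+n 2 14) (*-monoˡ-≤ (l ^ 4) (pow-mono 1≤P (n≤1+n 3))) ⟩
    16 * (P ^ 4 * l ^ 4) ≡⟨ lem5 P l ⟩
    (2 * (P * l)) ^ 4 ∎)) (s≤s z≤n)
    where
    1≤eN : 1 ≤ e * N ^ 4 * 8
    1≤eN = *≤* {1} {e * N ^ 4} {1} {8} (*≤* {1} {e} {1} {N ^ 4} 1≤e 1≤N⁴) (s≤s z≤n)
    lem : ∀ q e n → let w = q * (q * (q * (q * 1))) ; v = 2 * n in w * (e * (n * (n * (n * 1))) * 8) ≡ w * e * (v * (v * (v * 1)))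
    lem = solve-∀
    lem2 : ∀ q e P → let v = P * e ; w = q * e in (q * (q * (q * (q * 1)))) * e * (v * (v * (v * 1))) ≡ (w * (w * (w * (w * 1)))) * (P * (P * (P * 1)))
    lem2 = solve-∀
    lem3 : ∀ k l N P → let v = 2 * (k * (l * N)) in (v * (v * (v * (v * 1)))) * (P * (P * (P * 1))) ≡ 16 * ((k * (k * (k * (k * 1)))) * ((P * (P * (P * 1))) * (l * (l * (l * (l * 1)))) * (N * (N * (N * (N * 1))))))
    lem3 = solve-∀
    lem4 : ∀ e p n → 16 * (e * (p * n)) ≡ 2 * p * (e * n * 8)
    lem4 = solve-∀
    lem5 : ∀ P l → let v = 2 * (P * l) in 16 * ((P * (P * (P * (P * 1)))) * (l * (l * (l * (l * 1))))) ≡ (v * (v * (v * (v * 1))))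
    lem5 = solve-∀
    lem6 : ∀ q t l → q * (2 * (t * (24 * l))) ≡ 48 * (q * t * l)
    lem6 = solve-∀
    lem7 : ∀ q t l → 80 * (q * t * l) ≡ 2 * (q * (40 * t) * l)
    lem7 = solve-∀
    qe≤ : q * e ≤ 2 * (κ * (l * N))
    qe≤ = ≤-trans (*-monoʳ-≤ q t-hi) (≤-trans (≤-reflexive (lem6 q t (l * N))) (≤-trans (*-monoˡ-≤ (q * t * (l * N)) (m≤m+n 48 32))
     (≤-trans (≤-reflexive (lem7 q t (l * N))) (*-monoʳ-≤ 2 (*-monoˡ-≤ (l * N) q-lo)))))

   -- The 40 in the choice of `q` comes from here: 2t pieces, each with three parts of size l ≤ q
   -- and one of size q + 6l, have at most 20tq vertices, and twice that is at most `κ`.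
   few-vertices : ∀ b → b ≤ 2 * t * (l + (l + l)) + 2 * t * (q + 6 * l) → 4 * (b * (b * (b * b))) ≤ e
   few-vertices b h = begin
    4 * (b * (b * (b * b))) ≤⟨ *-monoˡ-≤ (b * (b * (b * b))) (m≤m+n 4 12) ⟩
    16 * (b * (b * (b * b))) ≡⟨ lem b ⟩
    (2 * b) ^ 4 ≤⟨ ^-monoˡ-≤ 4 (≤-trans (*-monoʳ-≤ 2 (≤-trans h (+-mono-≤ (*-monoʳ-≤ (2 * t) (+-mono-≤ l≤q (+-mono-≤ l≤q l≤q))) (*-monoʳ-≤ (2 * t) (+-monoʳ-≤ q (*-monoʳ-≤ 6 l≤q))))))
     (≤-trans (≤-reflexive (lem2 t q)) q-lo)) ⟩
    κ ^ 4 ≤⟨ κ⁴ ⟩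
    e ∎
    where
    lem : ∀ b → let v = 2 * b in 16 * (b * (b * (b * b))) ≡ (v * (v * (v * (v * 1))))
    lem = solve-∀
    lem2 : ∀ t q → 2 * (2 * t * (q + (q + q)) + 2 * t * (q + 6 * q)) ≡ q * (40 * t)
    lem2 = solve-∀

   room : (q + 6 * l) * density₃ P l ≤ n
   room = ≤-trans (*≤* {q + 6 * l} {2 ^ (4 * M)} (≤-trans (+-monoʳ-≤ q (*-monoʳ-≤ 6 l≤q)) (≤-trans (*-monoʳ-≤ 7 q≤2Pl)
     (≤-trans (≤-reflexive (sym (*-assoc 7 2 (P * l)))) (≤-trans (*-monoˡ-≤ (P * l) (m≤m+n 14 2)) 16Pl≤)))) (density₃-≤ {λ′} {l} 10≤λ 1≤l))
    (≤-trans (≤-reflexive (trans (sym (^-distribˡ-+-* 2 (4 * M) (22 * M))) (cong (2 ^_) (sym (*-distribʳ-+ M 4 22))))) (power≤n 26 (m≤m+n 26 166)))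

   -- The 24 in the choice of `t` is 4 · 2 · 3, from three small parts in each of 2t pieces.
   cores : 4 * (2 * t * (l + (l + l)) * (n * (n * n))) ≤ e
   cores = ≤-trans (≤-reflexive (lem t l (n * (n * n)))) t-lo
    where
    lem : ∀ t l n → 4 * (2 * t * (l + (l + l)) * n) ≡ t * (24 * (l * n))
    lem = solve-∀

   achieved : Achieves n e (t * (l * (l * (l * q))))
   achieved = blobForest t l q , un , ∥blobForest∥ t l q
    where
    un : Unavoidable n e (blobForest t l q)
    un G eq = Blobs.many-blobs G l t q P 1≤n 1≤l (to cores) (λ b h → to (few-vertices b h))
      (≤-trans (≤-reflexive (cong (λ v → 2 * (n * (n * (n * v)))) (sym (*-identityʳ n)))) (≤-trans dense (≤-reflexive (cong (P *_) (sym eq))))) room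
     where
     to : ∀ {x} → x ≤ e → x ≤ ∥ G ∥
     to h = ≤-trans h (≤-reflexive (sym eq))

   large : e * L ^ 4 ≤ A ^ 4 * (t * (l * (l * (l * q)))) ^ 4 * λ′ ^ 4
   large = begin
    e * L ^ 4 ≤⟨ *≤* {e} {(X * (t * q)) ^ 4} {L ^ 4} {(Y * (λ′ * (l * (l * l)))) ^ 4} e≤ (^-monoˡ-≤ 4 L≤) ⟩
    (X * (t * q)) ^ 4 * (Y * (λ′ * (l * (l * l)))) ^ 4 ≡⟨ sym (*-^ (X * (t * q)) (Y * (λ′ * (l * (l * l)))) 4) ⟩
    (X * (t * q) * (Y * (λ′ * (l * (l * l))))) ^ 4 ≡⟨ cong (_^ 4) (lem X Y t q λ′ l) ⟩
    (X * Y * (t * (l * (l * (l * q)))) * λ′) ^ 4 ≤⟨ ^-monoˡ-≤ 4 (*-monoˡ-≤ λ′ (*-monoˡ-≤ (t * (l * (l * (l * q)))) A≥)) ⟩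
    (A * (t * (l * (l * (l * q)))) * λ′) ^ 4 ≡⟨ trans (*-^ (A * (t * (l * (l * (l * q))))) λ′ 4) (cong (_* λ′ ^ 4) (*-^ A (t * (l * (l * (l * q)))) 4)) ⟩
    A ^ 4 * (t * (l * (l * (l * q)))) ^ 4 * λ′ ^ 4 ∎
    where
    lem : ∀ X Y t q a l → X * (t * q) * (Y * (a * (l * (l * l)))) ≡ X * Y * (t * (l * (l * (l * q)))) * a
    lem = solve-∀
    lem2 : ∀ q t → 2 * (2 * q * (40 * t)) ≡ 160 * (t * q)
    lem2 = solve-∀
    lem3 : ∀ l a → let v = 2 * l in (v * (v * (v * 1))) * (192 * a) ≡ 1536 * (a * (l * (l * l)))
    lem3 = solve-∀
    1≤κ : 1 ≤ κ
    1≤κ = 1≤root {e} {κ} 4 1≤e κ<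
    e≤ : e ≤ (X * (t * q)) ^ 4
    e≤ = ≤-trans (<⇒≤ κ<) (^-monoˡ-≤ 4 (≤-trans (suc≤2* 1≤κ) (≤-trans (*-monoʳ-≤ 2 (≤-trans (<⇒≤ q-hi) (*-monoˡ-≤ (40 * t) (suc≤2* (≤-trans 1≤l l≤q)))))
     (≤-trans (≤-reflexive (lem2 q t)) (*-monoˡ-≤ (t * q) X≥)))))
    L≤ : L ≤ Y * (λ′ * (l * (l * l)))
    L≤ = ≤-trans l-hi (≤-trans (*-monoˡ-≤ (192 * λ′) (^-monoˡ-≤ 3 (suc≤2* 1≤l))) (≤-trans (≤-reflexive (lem3 l λ′)) (*-monoˡ-≤ (λ′ * (l * (l * l))) Y≥)))

  private
   Result : Set
   Result = ∃ λ m → Achieves n e m × e * L ^ 4 ≤ A ^ 4 * m ^ 4 * λ′ ^ 4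

   with-q : ∀ t κ → t * (24 * (l * (n * (n * n)))) ≤ e → e ≤ 2 * (t * (24 * (l * (n * (n * n))))) → 1 ≤ t → κ ^ 4 ≤ e → e < suc κ ^ 4
    → (∃ λ q → q * (40 * t) ≤ κ × κ < suc q * (40 * t)) → Result
   with-q t κ h₁ h₂ h₃ h₄ h₅ (q , q-lo , q-hi) = t * (l * (l * (l * q))) , achieved t κ q h₁ h₂ h₃ h₄ h₅ q-lo q-hi , large t κ q h₁ h₂ h₃ h₄ h₅ q-lo q-hi

   with-t : (∃ λ t → t * (24 * (l * (n * (n * n)))) ≤ e × e < suc t * (24 * (l * (n * (n * n))))) → (∃ λ κ → κ ^ 4 ≤ e × e < suc κ ^ 4) → Result
   with-t (t , t-lo , t-hi) (κ , κ⁴ , κ<) = with-q t κ t-lo (double-quotient {e} {24 * (l * (n * (n * n)))} {t} one-blob t-hi) 1≤t κ⁴ κ<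
     (divide κ (40 * t) (*≤* {1} {40} {1} {t} (s≤s z≤n) 1≤t))
    where
    1≤t : 1 ≤ t
    1≤t = quotient-pos {e} {24 * (l * (n * (n * n)))} {t} one-blob t-hi

  with-l : Result
  with-l = with-t (divide e (24 * (l * (n * (n * n)))) (*≤* {1} {24} {1} {l * (n * (n * n))} (s≤s z≤n) 1≤N)) (root 4 e (s≤s z≤n))

 blob-lower : ∃ λ m → Achieves n e m × e * L ^ 4 ≤ A ^ 4 * m ^ 4 * λ′ ^ 4
 blob-lower = from (bounded-max {P = λ l → l ^ 3 * (192 * λ′) ≤ L} (λ l → l ^ 3 * (192 * λ′) N.≤? L) z≤n L bound)
  where
  1≤c : 1 ≤ 192 * λ′
  1≤c = *≤* {1} {192} {1} {λ′} (s≤s z≤n) 1≤λ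
  bound : ∀ l → l ^ 3 * (192 * λ′) ≤ L → l ≤ L
  bound zero _ = z≤n
  bound (suc l) h = ≤-trans (≤pow {suc l} 3 (s≤s z≤n) (s≤s z≤n)) (≤-trans (≤-trans (≤-reflexive (sym (*-identityʳ (suc l ^ 3)))) (*-monoʳ-≤ (suc l ^ 3) 1≤c)) h)
  from : (∃ λ l → l ^ 3 * (192 * λ′) ≤ L × (∀ j → j ^ 3 * (192 * λ′) ≤ L → j ≤ l)) → ∃ λ m → Achieves n e m × e * L ^ 4 ≤ A ^ 4 * m ^ 4 * λ′ ^ 4
  from (l , h , max) = with-l l (max 1 (≤-trans (≤-reflexive (*-identityˡ (192 * λ′))) λ≤L)) h (<⇒≤ (≰⇒> λ h′ → <-irrefl refl (max (suc l) h′)))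

-- Constants and final assembly.

record Constants : Set where
 field
  k c l p g a s h r A₁ A : ℕ
  32≤k : 32 ≤ k
  k³≤c : 2 * (k * (k * k)) ≤ c
  k²≤c : 32 * (k * k) ≤ c
  2048≤c : 2048 ≤ c
  5≤l : 5 ≤ l
  k⁴≤ : 2 * k ^ 4 ≤ 2 ^ l
  8≤p : 8 ≤ p
  p⁴≤ : p ^ 4 ≤ 2 ^ l
  1050≤g : 1050 ≤ g
  32g≤a : 32 * g ≤ a
  216≤s : 216 ≤ s
  star≤h : 2 * suc starConstant ≤ h
  96≤r : 96 ≤ r
  sha≤A₁ : s * h * a * (s * h * a) ≤ A₁
  core≤A : 3 * coreConstant c ≤ A
  groups≤A : groupsConstant c ≤ A
  a≤A : a ≤ A
  160*1536≤A : 160 * 1536 ≤ A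
  A₁≤A : A₁ ≤ A
  192A₁≤A : A₁ * 192 ≤ A

graph-exists : ∀ {n e q} → q + (q + (q + q)) ≤ n → e ≤ q ^ 4 → Σ (Graph4 n) λ G → ∥ G ∥ ≡ e
graph-exists {n} {e} {q} q≤ e≤ = record { edges = take e (edges G₀) ; distinct = Uniq.take⁺ e (distinct G₀) ; uniform = AllP.take⁺ e (uniform G₀) }
  , trans (LP.length-take e (edges G₀)) (m≤n⇒m⊓n≡m (≤-trans e≤ (≤-reflexive (sym size₀))))
 where
 open Partite q q q q
 |fin| : length (allFin q) ≡ q
 |fin| = LP.length-tabulate {n = q} id
 ts : List (Tuple q q q q)
 ts = pairs (allFin q) (pairs (allFin q) (pairs (allFin q) (allFin q)))
 G₀ : Graph4 n
 G₀ = graphOf q≤ ts (pairs-unique (Uniq.allFin⁺ q) (pairs-unique (Uniq.allFin⁺ q) (pairs-unique (Uniq.allFin⁺ q) (Uniq.allFin⁺ q))))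
 size₀ : length (edges G₀) ≡ q ^ 4
 size₀ = trans (LP.length-map _ ts) (trans (length-pairs (allFin q) _) (cong₂ _*_ |fin| (trans (length-pairs (allFin q) _) (cong₂ _*_ |fin|
  (trans (length-pairs (allFin q) (allFin q)) (cong₂ _*_ |fin| (trans |fin| (sym (*-identityʳ q)))))))))

achieves≤ : ∀ {n e m₀ m} → IsUn4 n e m → Achieves n e m₀ → m₀ ≤ m
achieves≤ is (H , un , refl) = proj₂ is H un

module Estimates (constants : Constants) where

 open Constants constants
 open MiddleUpper k c 32≤k k³≤c k²≤c 2048≤c using (u; 1≤u; 1≤c; 16≤n)

 N : ℕ
 N = u ^ 16 + r ^ 12

 u≤n : ∀ {n} → N ≤ n → u ^ 16 ≤ n
 u≤n h = ≤-trans (m≤m+n (u ^ 16) (r ^ 12)) h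

 r≤n : ∀ {n} → N ≤ n → r ^ 12 ≤ n
 r≤n h = ≤-trans (m≤n+m (r ^ 12) (u ^ 16)) h

 1≤k : 1 ≤ k
 1≤k = ≤-trans (s≤s z≤n) 32≤k

 1≤n : ∀ {n} → N ≤ n → 1 ≤ n
 1≤n h = ≤-trans (s≤s z≤n) (16≤n (u≤n h))

 1≤A : 1 ≤ A
 1≤A = ≤-trans (s≤s z≤n) 160*1536≤A

 exists : ∀ {n e} → N ≤ n → k ^ 4 * e ≤ n ^ 4 → ∃ λ m → IsUn4 n e m
 exists {n} {e} N≤ le = from (scale n k 32≤k (16≤n (u≤n N≤)))
  where
  from : Scale n k → ∃ λ m → IsUn4 n e m
  from sc = let
    (G , eq) = graph-exists {n} {e} {q} (four-fit {q} q≤) (*-cancelˡ-≤ (k ^ 4) {{N.>-nonZero (pow≥1 4 1≤k)}}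
     (≤-trans le (≤-trans (^-monoˡ-≤ 4 n≤) (≤-reflexive (*-^ k q 4))))) in un4-exists G eq
   where open Scale sc

 cubic-exists : ∀ {n e} → N ≤ n → e ≤ n ^ 3 → ∃ λ m → IsUn4 n e m
 cubic-exists {n} {e} N≤ le = exists N≤ (*≤* (≤-trans (≤-trans (^-monoˡ-≤ 4 k≤u) (pow-mono 1≤u (m≤m+n 4 12))) (u≤n N≤)) le)
  where
  k≤u : k ≤ u
  k≤u = ≤-trans (≤-reflexive (sym (*-identityʳ k))) (*-monoʳ-≤ k 1≤c)

 middle : ∀ {n e m} → N ≤ n → n ^ 2 ≤ e → e ≤ n ^ 3 → IsUn4 n e m → (m ^ 4 * n ^ 6 ≤ A ^ 4 * e ^ 3) × (m ^ 3 * n ≤ A ^ 3 * e)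
 middle {n} {e} N≤ lo hi ((H , un , refl) , _) = from (MiddleUpperBounds.middle-upper k c 32≤k k³≤c k²≤c 2048≤c {n} {e} {H} un (u≤n N≤) lo hi)
  where
  from : ∥ graph H ∥ ^ 3 * n ≤ (3 * coreConstant c) ^ 3 * e × ∥ graph H ∥ ^ 4 * n ^ 6 ≤ groupsConstant c ^ 4 * e ^ 3
   → (∥ graph H ∥ ^ 4 * n ^ 6 ≤ A ^ 4 * e ^ 3) × (∥ graph H ∥ ^ 3 * n ≤ A ^ 3 * e)
  from (h₁ , h₂) = ≤-trans h₂ (*-monoˡ-≤ (e ^ 3) (^-monoˡ-≤ 4 groups≤A)) , ≤-trans h₁ (*-monoˡ-≤ e (^-monoˡ-≤ 3 core≤A))

 -- An (n,e)-unavoidable graph is also (n,n²)-unavoidable, and at e = n² the bound by d^(3/4) is a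
 -- constant.
 sparse-upper : ∀ {n e m} → N ≤ n → e ≤ n ^ 2 → IsUn4 n e m → m ≤ A
 sparse-upper {n} {e} {m} N≤ hi ((H , un , refl) , _) = from (cubic-exists N≤ n²≤n³)
  where
  n²≤n³ : n ^ 2 ≤ n ^ 3
  n²≤n³ = pow-mono (1≤n N≤) (n≤1+n 2)
  from : (∃ λ m′ → IsUn4 n (n ^ 2) m′) → ∥ graph H ∥ ≤ A
  from (m′ , is) = ≤-trans (proj₂ is H (unavoidable-mono {H = H} hi un)) (pow-cancel-≤ {m′} {A} 4 (cancelʳ {m′ ^ 4} {A ^ 4} (n ^ 6) (pow≥1 6 (1≤n N≤))
   (≤-trans (proj₁ (middle {n} {n ^ 2} {m′} N≤ ≤-refl n²≤n³ is)) (≤-reflexive (cong (A ^ 4 *_) (^-*-assoc n 2 3))))) (s≤s z≤n))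

 MiddleLarge : ℕ → ℕ → ℕ → Set
 MiddleLarge n e m = (e ^ 3 ≤ A ^ 4 * m ^ 4 * n ^ 6) ⊎ (e ≤ A ^ 3 * m ^ 3 * n)

 middle-lower : ∀ {n e m} → N ≤ n → n ^ 2 ≤ e → e ≤ n ^ 3 → IsUn4 n e m → MiddleLarge n e m
 middle-lower {n} {e} {m} N≤ lo hi is = from (MiddleLower.middle-lower g A 1050≤g (≤-trans 32g≤a a≤A) {n} {e} (1≤n N≤) lo hi)
  where
  from : (∃ λ m₀ → Achieves n e m₀ × MiddleLarge n e m₀) → MiddleLarge n e m
  from (m₀ , ach , inj₁ h) = inj₁ (≤-trans h (*-monoˡ-≤ (n ^ 6) (*-monoʳ-≤ (A ^ 4) (^-monoˡ-≤ 4 (achieves≤ is ach)))))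
  from (m₀ , ach , inj₂ h) = inj₂ (≤-trans h (*-monoˡ-≤ n (*-monoʳ-≤ (A ^ 3) (^-monoˡ-≤ 3 (achieves≤ is ach)))))

 module Dense {n e m : ℕ} (N≤ : N ≤ n) (lo : n ^ 3 < e) (hi : 2 ^ (l + l) * e ≤ n C 4) (is : IsUn4 n e m) where

  private
   1≤e : 1 ≤ e
   1≤e = ≤-trans (s≤s z≤n) lo
   1≤l : 1 ≤ l
   1≤l = ≤-trans (s≤s z≤n) 5≤l
   lam L : ℕ
   lam = logRatio n e
   L = ⌊log₂ n ⌋
   e≤C : e ≤ n C 4
   e≤C = ≤-trans (≤-trans (≤-reflexive (sym (*-identityˡ e))) (*-monoˡ-≤ e (pow≥1 {2} (l + l) (s≤s z≤n)))) hi
   12≤n : 12 ≤ n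
   12≤n = ≤-trans (m≤m+n 12 4) (16≤n (u≤n N≤))

  upper : (m ^ 3 * n ^ 10 ≤ A ^ 3 * e ^ 4) × (m ^ 4 * lam ^ 4 ≤ A ^ 4 * e * L ^ 4)
  upper = from (proj₁ is)
   where
   from : (∃ λ H → Unavoidable n e H × ∥ graph H ∥ ≡ m) → (m ^ 3 * n ^ 10 ≤ A ^ 3 * e ^ 4) × (m ^ 4 * lam ^ 4 ≤ A ^ 4 * e * L ^ 4)
   from (H , un , eq) = subst (λ m → (m ^ 3 * n ^ 10 ≤ A ^ 3 * e ^ 4) × (m ^ 4 * lam ^ 4 ≤ A ^ 4 * (e * L ^ 4))) eq
     (LargeUpper.large-upper k c l p A A 32≤k k³≤c k²≤c 2048≤c 1≤l k⁴≤ 8≤p p⁴≤ (≤-trans (m≤m+n 192 245568) 160*1536≤A) core≤A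
      (≤-trans (m≤m+n 32 245728) 160*1536≤A) {n} {e} {H} un (u≤n N≤) lo hi)
    |> λ (h₁ , h₂) → h₁ , ≤-trans h₂ (≤-reflexive (sym (*-assoc (A ^ 4) e (L ^ 4))))
    where open import Function using (_|>_)

  DenseLarge : ℕ → Set
  DenseLarge m = (e ^ 4 ≤ A ^ 3 * m ^ 3 * n ^ 10) ⊎ (e * L ^ 4 ≤ A ^ 4 * m ^ 4 * lam ^ 4)

  private
   grow : (∃ λ m₀ → Achieves n e m₀ × DenseLarge m₀) → DenseLarge m
   grow (m₀ , ach , inj₁ h) = inj₁ (≤-trans h (*-monoˡ-≤ (n ^ 10) (*-monoʳ-≤ (A ^ 3) (^-monoˡ-≤ 3 (achieves≤ is ach)))))
   grow (m₀ , ach , inj₂ h) = inj₂ (≤-trans h (*-monoˡ-≤ (lam ^ 4) (*-monoʳ-≤ (A ^ 4) (^-monoˡ-≤ 4 (achieves≤ is ach)))))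

   -- While log n is at most 192 times the logarithm of the ratio, a forest with order e^(1/4) edges
   -- reaches the second term of the minimum, so the star forests suffice.
   stars : L ≤ 192 * lam → DenseLarge m
   stars L≤ = grow (from (StarLower.star-lower g a s h r A₁ 1050≤g 32g≤a 216≤s star≤h 96≤r sha≤A₁ {n} {e} (r≤n N≤) lo (≤-trans e≤C (choose4≤ n))))
    where
    from : (∃ λ m → Achieves n e m × ((e ^ 4 ≤ A₁ ^ 3 * m ^ 3 * n ^ 10) ⊎ (e ≤ A₁ ^ 4 * m ^ 4))) → ∃ λ m → Achieves n e m × DenseLarge m
    from (m , ach , inj₁ h) = m , ach , inj₁ (≤-trans h (*-monoˡ-≤ (n ^ 10) (*-monoˡ-≤ (m ^ 3) (^-monoˡ-≤ 3 A₁≤A))))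
    from (m , ach , inj₂ h) = m , ach , inj₂ (begin
     e * L ^ 4 ≤⟨ *≤* h (^-monoˡ-≤ 4 L≤) ⟩
     A₁ ^ 4 * m ^ 4 * (192 * lam) ^ 4 ≡⟨ trans (cong₂ _*_ (sym (*-^ A₁ m 4)) refl) (sym (*-^ (A₁ * m) (192 * lam) 4)) ⟩
     (A₁ * m * (192 * lam)) ^ 4 ≡⟨ cong (_^ 4) (lem A₁ m 192 lam) ⟩
     (A₁ * 192 * m * lam) ^ 4 ≤⟨ ^-monoˡ-≤ 4 (*-monoˡ-≤ lam (*-monoˡ-≤ m 192A₁≤A)) ⟩
     (A * m * lam) ^ 4 ≡⟨ trans (*-^ (A * m) lam 4) (cong (_* lam ^ 4) (*-^ A m 4)) ⟩
     A ^ 4 * m ^ 4 * lam ^ 4 ∎)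
     where
     open ≤-Reasoning
     lem : ∀ a m b x → a * m * (b * x) ≡ a * b * m * x
     lem = solve-∀

   blobs : 192 * lam ≤ L → DenseLarge m
   blobs ≤L = grow (from (BlobLower.blob-lower 160 1536 A ≤-refl ≤-refl 160*1536≤A {n} {e} {lam} {L} 12≤n 1≤e
     (≤-trans (+-mono-≤ 5≤l 5≤l) (ratio-≥ (l + l) n e 1≤e hi)) few many (2^log≤ n (1≤n N≤)) ≤L))
    where
    open ≤-Reasoning
    few : 16 * e ≤ n ^ 4
    few = ≤-trans (*-monoˡ-≤ e (pow-mono {2} {4} {l + l} (s≤s z≤n) (≤-trans (n≤1+n 4) (≤-trans 5≤l (m≤m+n l l))))) (≤-trans hi (choose4≤ n))
    -- The 8 in the exponent: 64 comes from comparing n⁴ with the binomial coefficient, one factor 2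
    -- from rounding the logarithm and one from the left side.
    many : 2 * n ^ 4 ≤ 2 ^ (8 + lam) * e
    many = begin
     2 * n ^ 4 ≤⟨ *-monoʳ-≤ 2 (≤-trans (choose4≥ 12≤n) (*-monoʳ-≤ 64 (<2^ratio n e 1≤e))) ⟩
     2 * (64 * (2 ^ suc lam * e)) ≡⟨ lem (2 ^ lam) e ⟩
     256 * 2 ^ lam * e ≡⟨ cong (_* e) (sym (^-distribˡ-+-* 2 8 lam)) ⟩
     2 ^ (8 + lam) * e ∎
     where
     lem : ∀ x e → 2 * (64 * (2 * x * e)) ≡ 256 * x * e
     lem = solve-∀
    from : (∃ λ m → Achieves n e m × e * L ^ 4 ≤ A ^ 4 * m ^ 4 * lam ^ 4) → ∃ λ m → Achieves n e m × DenseLarge m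
    from (m , ach , h) = m , ach , inj₂ h

  lower : DenseLarge m
  lower = [ stars , blobs ]′ (≤-total L (192 * lam))

 dense-exists : ∀ {n e} → N ≤ n → 2 ^ (l + l) * e ≤ n C 4 → ∃ λ m → IsUn4 n e m
 dense-exists {n} {e} N≤ hi = exists N≤ (≤-trans (*-monoˡ-≤ e (≤-trans (≤-trans (m≤m+n (k ^ 4) (k ^ 4 + 0)) k⁴≤) (^-monoʳ-≤ 2 (m≤m+n l l)))) (≤-trans hi (choose4≤ n)))

abstract
 constants : Constants
 constants = record
  -- Most values are equality cases: c = 2k³, 2^l = 2k⁴, g = 2 · 525, a = 32g, s = 6³, r = 3 · 32.
  { k = 32 ; c = 65536 ; l = 21 ; p = 8 ; g = 1050 ; a = 33600 ; s = 216 ; h = 2 * suc starConstant ; r = 96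
  ; A₁ = A₁ ; A = 3 * coreConstant 65536 + (groupsConstant 65536 + (33600 + (160 * 1536 + (A₁ + A₁ * 192))))
  ; 32≤k = ≤-refl ; k³≤c = ≤-refl ; k²≤c = m≤m+n 32768 32768 ; 2048≤c = m≤m+n 2048 63488
  ; 5≤l = m≤m+n 5 16 ; k⁴≤ = ≤-refl ; 8≤p = ≤-refl ; p⁴≤ = m≤m+n 4096 2093056 ; 1050≤g = ≤-refl ; 32g≤a = ≤-refl
  ; 216≤s = ≤-refl ; star≤h = ≤-refl ; 96≤r = ≤-refl ; sha≤A₁ = ≤-refl
  ; core≤A = m≤m+n x₁ (x₂ + (x₃ + (x₄ + (A₁ + x₅))))
  ; groups≤A = ≤-trans (m≤m+n x₂ (x₃ + (x₄ + (A₁ + x₅)))) (m≤n+m (x₂ + (x₃ + (x₄ + (A₁ + x₅)))) x₁)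
  ; a≤A = ≤-trans (m≤m+n x₃ (x₄ + (A₁ + x₅))) (≤-trans (m≤n+m (x₃ + (x₄ + (A₁ + x₅))) x₂) (m≤n+m (x₂ + (x₃ + (x₄ + (A₁ + x₅)))) x₁))
  ; 160*1536≤A = ≤-trans (m≤m+n x₄ (A₁ + x₅)) tail₃
  ; A₁≤A = ≤-trans (m≤m+n A₁ x₅) tail₄
  ; 192A₁≤A = ≤-trans (m≤n+m x₅ A₁) tail₄ }
  where
  A₁ x₁ x₂ x₃ x₄ x₅ : ℕ
  A₁ = 216 * (2 * suc starConstant) * 33600 * (216 * (2 * suc starConstant) * 33600)
  x₁ = 3 * coreConstant 65536
  x₂ = groupsConstant 65536
  x₃ = 33600
  x₄ = 160 * 1536
  x₅ = A₁ * 192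
  tail₃ : x₄ + (A₁ + x₅) ≤ x₁ + (x₂ + (x₃ + (x₄ + (A₁ + x₅))))
  tail₃ = ≤-trans (m≤n+m (x₄ + (A₁ + x₅)) x₃) (≤-trans (m≤n+m (x₃ + (x₄ + (A₁ + x₅))) x₂) (m≤n+m (x₂ + (x₃ + (x₄ + (A₁ + x₅)))) x₁))
  tail₄ : A₁ + x₅ ≤ x₁ + (x₂ + (x₃ + (x₄ + (A₁ + x₅))))
  tail₄ = ≤-trans (m≤n+m (A₁ + x₅) x₄) tail₃

open Constants constants using (A; l)
open Estimates constants

theorem1p1 :
 -- (i)  1 ≤ e ≤ n²  :  un₄(n,e) ≈ 1
 (Σ ℕ λ A → Σ ℕ λ N → (n : ℕ) → N ≤ n → (e : ℕ) → 1 ≤ e → e ≤ n ^ 2 →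
  Σ ℕ λ m → IsUn4 n e m × (1 ≤ A * m) × (m ≤ A))
 ×
 -- (ii)  n² ≤ e ≤ n³  :  un₄(n,e) ≈ min{(e/n²)^{3/4}, (e/n)^{1/3}}
 (Σ ℕ λ A → Σ ℕ λ N → (n : ℕ) → N ≤ n → (e : ℕ) → n ^ 2 ≤ e → e ≤ n ^ 3 →
  Σ ℕ λ m → IsUn4 n e m
   × ((e ^ 3 ≤ A ^ 4 * m ^ 4 * n ^ 6) ⊎ (e ≤ A ^ 3 * m ^ 3 * n))
   × (m ^ 4 * n ^ 6 ≤ A ^ 4 * e ^ 3)
   × (m ^ 3 * n ≤ A ^ 3 * e))
 ×
 -- (iii)  n³ < e ≤ binom(n,4)/K  :
 --        un₄(n,e) ≈ min{e^{4/3}/n^{10/3}, e^{1/4} log n / log(binom(n,4)/e)}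
 (Σ ℕ λ K → Σ ℕ λ A → Σ ℕ λ N → (n : ℕ) → N ≤ n → (e : ℕ) → n ^ 3 < e →
  K * e ≤ n C 4 →
  Σ ℕ λ m → IsUn4 n e m
   × ((e ^ 4 ≤ A ^ 3 * m ^ 3 * n ^ 10)
    ⊎ (e * ⌊log₂ n ⌋ ^ 4 ≤ A ^ 4 * m ^ 4 * logRatio n e ^ 4))
   × (m ^ 3 * n ^ 10 ≤ A ^ 3 * e ^ 4)
   × (m ^ 4 * logRatio n e ^ 4 ≤ A ^ 4 * e * ⌊log₂ n ⌋ ^ 4))
theorem1p1 =
  (A , N , λ n N≤ e 1≤e hi → let (m , is) = cubic-exists N≤ (≤-trans hi (pow-mono (1≤n N≤) (n≤1+n 2))) in
   m , is , *≤* {1} {A} {1} {m} 1≤A (achieves≤ is (single-edge 1≤e)) , sparse-upper N≤ hi is)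
 , (A , N , λ n N≤ e lo hi → let (m , is) = cubic-exists N≤ hi in m , is , middle-lower N≤ lo hi is , middle N≤ lo hi is)
 -- This `K` forces the logarithmic ratio to be at least `l + l`, which absorbs the constants of the
 -- upper bound and provides the 10 required for the dense pieces.
 , (2 ^ (l + l) , A , N , λ n N≤ e lo hi → let (m , is) = dense-exists N≤ hi in
  m , is , Dense.lower N≤ lo hi is , Dense.upper N≤ lo hi is)
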